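{- Let $G$ be an s-bridgeless signed graph with negativeness $\epsilon_N=\epsilon_N(G)>0$, and let $|E|=|E(G)|$, $|V|=|V(G)|$. (1) In general, $$SCC(G)\le |E|+3|V|+z_1,\qquad z_1=\min\Big\{\tfrac{2}{3}|E|+\tfrac{4}{3}\epsilon_N-7,\ |V|+2\epsilon_N-8\Big\}.$$ (2) If $G$ is $2$-edge-connected and $\epsilon_N$ is even, then $$SCC(G)\le |E|+2|V|+z_2,\qquad z_2=\min\Big\{\tfrac{2}{3}|E|+\tfrac{1}{3}\epsilon_N-4,\ |V|+\epsilon_N-5\Big\}.$$
   Context: Graphs may have multiple edges and loops. A signed graph is a graph $G$ with a map $\sigma:E(G)\to\{1,-1\}$; an edge is negative if $\sigma(e)=-1$ and positive otherwise. $E_N(H)$ denotes the set of negative edges of a subgraph $H$. A circuit (a loop counts as a circuit of length 1) is balanced if it contains an even number of negative edges and unbalanced otherwise. A signed circuit is a subgraph that is either (i) a balanced circuit, (ii) a short barbell: the union of two unbalanced circuits meeting at a single vertex, or (iii) a long barbell: the union of two vertex-disjoint unbalanced circuits together with a path meeting the circuits only at its ends. The length of a signed circuit is its number of edges. A signed circuit cover of $G$ is a family of signed circuits of $G$ such that every edge of $G$ lies in at least one member; its length is the total length of its members. $SCC(G)$ is the minimum length of a signed circuit cover of $G$. $G$ is s-bridgeless if every edge lies in some signed circuit (equivalently, $G$ has a signed circuit cover). Switching at a vertex $u$ reverses the signs of all edges incident with $u$. The negativeness $\epsilon_N(G)$ is the minimum of $|E_N(G')|$ over all signed graphs $G'$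 obtained from $G$ by sequences of switchings. -}

module Defs where

open import Data.Nat using (ℕ; zero; suc; _+_; _*_; _≤_; _%_)
open import Data.Fin using (Fin; zero; suc; fromℕ; inject₁; _≟_)
open import Data.Bool using (Bool; true; false; _xor_; if_then_else_)
open import Data.Product using (Σ; ∃; _×_; _,_; proj₁; proj₂)
open import Data.Sum using (_⊎_)
open import Data.List using (List; []; _∷_; foldr; map)
open import Data.Nat.ListAction using (sum)
open import Data.List.Relation.Unary.Any using (Any)
open import Relation.Nullary using (¬_)
open import Relation.Nullary.Decidable using (⌊_⌋)
open import Relation.Binary.PropositionalEquality using (_≡_)
open import Function.Definitions using (Injective)

-- Signed graphs (multiple edges and loops allowed).
-- Vertices are Fin nV, edges are Fin nE; each edge has an (unordered)
-- pair of ends, given as an ordered pair; a loop has equal ends.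
-- neg e ≡ true  iff  σ(e) = -1.

record SignedGraph : Set where
  field
    nV   : ℕ
    nE   : ℕ
    ends : Fin nE → Fin nV × Fin nV
    neg  : Fin nE → Bool
open SignedGraph public

count : ∀ {n} → (Fin n → Bool) → ℕ
count {zero}  f = 0
count {suc n} f = (if f zero then 1 else 0) + count (λ i → f (suc i))

Joins : (G : SignedGraph) → Fin (nE G) → Fin (nV G) → Fin (nV G) → Set
Joins G e u w = (ends G e ≡ (u , w)) ⊎ (ends G e ≡ (w , u))

-- Circuits: distinct vertices v₀ … v_len and distinct edges e₀ … e_len,
-- e_i joining v_i and v_{i+1}, and e_len joining v_len and v₀.
-- (len = 0 : a loop; len = 1 : two parallel edges.)  Number of edges = suc len.

record Circuit (G : SignedGraph) : Set where
  field
    len    : ℕ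
    vs     : Fin (suc len) → Fin (nV G)
    es     : Fin (suc len) → Fin (nE G)
    vs-inj : Injective _≡_ _≡_ vs
    es-inj : Injective _≡_ _≡_ es
    step   : ∀ (i : Fin len) → Joins G (es (inject₁ i)) (vs (inject₁ i)) (vs (suc i))
    close  : Joins G (es (fromℕ len)) (vs (fromℕ len)) (vs zero)
open Circuit public

OnC : ∀ {G} → Circuit G → Fin (nV G) → Set
OnC C v = ∃ λ i → vs C i ≡ v

EdgeOfC : ∀ {G} → Circuit G → Fin (nE G) → Set
EdgeOfC C e = ∃ λ i → es C i ≡ e

negC : ∀ {G} → Circuit G → ℕ
negC {G} C = count (λ i → neg G (es C i))

Balanced : ∀ {G} → Circuit G → Set
Balanced C = negC C % 2 ≡ 0

Unbalanced : ∀ {G} → Circuit G → Set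
Unbalanced C = negC C % 2 ≡ 1

record Path (G : SignedGraph) : Set where
  field
    plen    : ℕ
    pv      : Fin (suc plen) → Fin (nV G)
    pe      : Fin plen → Fin (nE G)
    pv-inj  : Injective _≡_ _≡_ pv
    pe-inj  : Injective _≡_ _≡_ pe
    pstep   : ∀ (i : Fin plen) → Joins G (pe i) (pv (inject₁ i)) (pv (suc i))
open Path public

EdgeOfP : ∀ {G} → Path G → Fin (nE G) → Set
EdgeOfP P e = ∃ λ i → pe P i ≡ e

data SignedCircuit (G : SignedGraph) : Set where
  balanced : (C : Circuit G) → Balanced C → SignedCircuit G
  short    : (C₁ C₂ : Circuit G) → Unbalanced C₁ → Unbalanced C₂ →
             (Σ (Fin (nV G)) λ v → OnC C₁ v × OnC C₂ v ×
                (∀ w → OnC C₁ w → OnC C₂ w → w ≡ v)) →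
             (∀ i j → ¬ (es C₁ i ≡ es C₂ j)) →
             SignedCircuit G
  long     : (C₁ C₂ : Circuit G) (P : Path G) → Unbalanced C₁ → Unbalanced C₂ →
             (∀ v → OnC C₁ v → ¬ OnC C₂ v) →
             OnC C₁ (pv P zero) → OnC C₂ (pv P (fromℕ (plen P))) →
             (∀ i → OnC C₁ (pv P i) ⊎ OnC C₂ (pv P i) →
                (i ≡ zero) ⊎ (i ≡ fromℕ (plen P))) →
             SignedCircuit G

_∈SC_ : ∀ {G} → Fin (nE G) → SignedCircuit G → Set
e ∈SC balanced C _ = EdgeOfC C e
e ∈SC short C₁ C₂ _ _ _ _ = EdgeOfC C₁ e ⊎ EdgeOfC C₂ e
e ∈SC long C₁ C₂ P _ _ _ _ _ _ = EdgeOfC C₁ e ⊎ EdgeOfC C₂ e ⊎ EdgeOfP P e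

size : ∀ {G} → SignedCircuit G → ℕ
size (balanced C _) = suc (len C)
size (short C₁ C₂ _ _ _ _) = suc (len C₁) + suc (len C₂)
size (long C₁ C₂ P _ _ _ _ _ _) = suc (len C₁) + suc (len C₂) + plen P

record SCCover (G : SignedGraph) : Set where
  field
    members : List (SignedCircuit G)
    covers  : ∀ (e : Fin (nE G)) → Any (e ∈SC_) members
open SCCover public

coverLength : ∀ {G} → SCCover G → ℕ
coverLength c = sum (map size (members c))

SBridgeless : SignedGraph → Set
SBridgeless G = ∀ (e : Fin (nE G)) → Σ (SignedCircuit G) λ S → e ∈SC S

-- Switching and negativeness.
-- Switching at u multiplies σ(e) by τ(x)τ(y) for the ends x,y of e,
-- i.e. flips non-loop edges at u; a loop at u is flipped twice (unchanged).

isV : ∀ {n} → Fin n → Fin n → Bool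
isV u x = ⌊ u ≟ x ⌋

switch : (G : SignedGraph) → Fin (nV G) → (Fin (nE G) → Bool) → (Fin (nE G) → Bool)
switch G u σ e = σ e xor (isV u (proj₁ (ends G e)) xor isV u (proj₂ (ends G e)))

switches : (G : SignedGraph) → List (Fin (nV G)) → (Fin (nE G) → Bool)
switches G us = foldr (switch G) (neg G) us

IsNegativeness : SignedGraph → ℕ → Set
IsNegativeness G ε =
  (Σ (List (Fin (nV G))) λ us → count (switches G us) ≡ ε) ×
  (∀ (us : List (Fin (nV G))) → ε ≤ count (switches G us))

data Walk (G : SignedGraph) (P : Fin (nE G) → Set) : Fin (nV G) → Fin (nV G) → Set where
  here : ∀ {u} → Walk G P u u
  wstep : ∀ {u w x} (e : Fin (nE G)) → P e → Joins G e u w → Walk G P w x → Walk G P u x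

Connected : SignedGraph → Set
Connected G = ∀ u v → Walk G (λ _ → Fin (nE G)) u v

TwoEdgeConnected : SignedGraph → Set
TwoEdgeConnected G =
  Connected G × (∀ (e : Fin (nE G)) u v → Walk G (λ f → ¬ (f ≡ e)) u v)

{-# OPTIONS --safe #-}
-- Fix a switching-equivalent signature with ε negative edges. By minimality no cut has more negative than positive edges, so the ends
-- of a negative edge are connected by positive edges, and a bridge of the positive graph is crossed by at most one negative edge.
-- A closure argument in the style of Seymour's 6-flow theorem yields few positive edges J making the negative edges N an even set
-- N ⊕ J, and even sets K₁, K₂, K₃ of positive edges which together with J cover the bridgeless part of the positive graph; averaging
-- over the available choices bounds their total size. Even sets of positive edges split into balanced circuits. The even set N ⊕ J
-- splits into balanced circuits and unbalanced ones ("tokens") meeting pairwise in at most one vertex, because two circuits with two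
-- common vertices contain a balanced theta circuit. Tokens are joined in pairs to barbells by moving them along a spanning tree of
-- each component. If no edge of the component separates it, one token per tree edge suffices; with an odd number of negative edges
-- one of them is set aside and covered by a signed circuit of its own. Otherwise every separating edge must lie on the path of some
-- barbell, and up to two tokens cross each tree edge.

module Submission where

open import Defs
open import Data.Nat using (ℕ; zero; suc; _+_; _*_; _≤_; _<_; _%_; z≤n; s≤s; _≤?_)
open import Data.Nat as ℕ using ()
open import Data.Nat.Properties as ℕₚ using (≤-refl; ≤-trans; ≤-reflexive; +-mono-≤; +-comm; +-assoc; +-suc; m≤m+n; m≤n+m)
open import Data.Nat.Induction using (<-wellFounded)
open import Data.Nat.ListAction using (sum)
open import Data.Nat.ListAction.Properties using (sum-++)
open import Data.Nat.Solver using (module +-*-Solver)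
open import Induction.WellFounded using (Acc; acc)
open import Data.Fin using (Fin; zero; suc; fromℕ; inject₁; _≟_)
open import Data.Fin.Properties using (any?)
open import Data.Bool using (Bool; true; false; _xor_; _∧_; _∨_; not; if_then_else_) renaming (_≟_ to _≟ᵇ_; T to Bool-T)
open import Data.Bool.Properties using (xor-assoc; xor-comm; xor-same; xor-identityʳ; ∧-distribˡ-xor; ∧-distribʳ-xor; ∧-comm; ∧-zeroʳ; ∧-identityʳ; ∨-zeroʳ)
open import Data.Product using (Σ; ∃; _×_; _,_; proj₁; proj₂)
open import Data.Sum using (_⊎_; inj₁; inj₂; [_,_])
open import Data.Empty using (⊥; ⊥-elim)
open import Data.Unit using (⊤; tt)
open import Data.List using (List; []; _∷_; _++_; tabulate; map; length; filter; allFin)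
open import Data.List.Properties using (length-++; map-++)
open import Data.List.Membership.Propositional using (_∈_; _∉_)
open import Data.List.Membership.Propositional.Properties using (∈-lookup; ∈-tabulate⁺; ∈-tabulate⁻; ∈-++⁺ˡ; ∈-++⁺ʳ; ∈-++⁻; ∈-filter⁺; ∈-filter⁻; ∈-allFin)
open import Data.List.Relation.Unary.Any using (Any; here; there; index)
open import Data.List.Relation.Unary.Any.Properties using (lookup-index; ++⁺ˡ; ++⁺ʳ)
open import Data.List.Relation.Unary.All as All using (All; []; _∷_)
open import Data.List.Relation.Unary.All.Properties as Allₚ using (¬Any⇒All¬)
open import Data.List.Relation.Unary.AllPairs using (AllPairs; []; _∷_)
open import Data.List.Relation.Unary.Unique.Propositional using (Unique)
open import Data.List.Relation.Unary.Unique.Propositional.Properties as Uniqueₚ using ()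
open import Function using (_∘_; id; case_of_)
open import Function.Definitions using (Injective)
open import Relation.Nullary using (¬_; Dec; yes; no)
open import Relation.Binary.PropositionalEquality using (_≡_; _≢_; refl; sym; trans; cong; cong₂; subst; subst₂; module ≡-Reasoning)

-- One cover meets both terms of a minimum. With p positive edges, n vertices and u separating
-- edges, the base cover of cost c has to satisfy 3c + 3u ≤ 3p + 6n - 6 and 3c + 3u ≤ 5p + 3n - 3;
-- the right sides differ by 2p + 3 - 3n. If this is not negative, the closure construction, whose
-- surplus is charged to vertices, gives the first bound and hence the second. Otherwise averaging
-- alone gives 3c + 3u ≤ 7p, which lies below both. The obstacle in the joining is a separating
-- edge: no even set meets it, so each of its sides has to send a token across even if it has none
-- to spare. The tokens added for this are fundamental circuits with a tail. They may share edges
-- with other tokens, so two tokens are paired only if they are distinct circuits of the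
-- decomposition or come from different sides of a separating edge. The extra length is charged to
-- the negative edges, and the separating edges are charged to the room 3u, which exists because J
-- avoids them.

≢true⇒false : ∀ {b} → b ≢ true → b ≡ false
≢true⇒false {false} _ = refl
≢true⇒false {true} h = ⊥-elim (h refl)

≢false⇒true : ∀ {b} → b ≢ false → b ≡ true
≢false⇒true {true} _ = refl
≢false⇒true {false} h = ⊥-elim (h refl)

absurd : ∀ {ℓ} {X : Set ℓ} {b} → b ≡ true → b ≡ false → X
absurd refl ()

bool-cases : ∀ b → (b ≡ true) ⊎ (b ≡ false)
bool-cases true = inj₁ refl
bool-cases false = inj₂ refl

∧-left : ∀ {a b} → a ∧ b ≡ true → a ≡ true
∧-left {true} _ = refl

∧-right : ∀ {a b} → a ∧ b ≡ true → b ≡ true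
∧-right {true} h = h

∧-intro : ∀ {a b} → a ≡ true → b ≡ true → a ∧ b ≡ true
∧-intro refl refl = refl

∧-falseˡ : ∀ {a b} → a ≡ false → a ∧ b ≡ false
∧-falseˡ refl = refl

∧-falseʳ : ∀ {a b} → b ≡ false → a ∧ b ≡ false
∧-falseʳ {a} refl = ∧-zeroʳ a

∨-left : ∀ {a b} → a ≡ true → a ∨ b ≡ true
∨-left refl = refl

∨-right : ∀ {a b} → b ≡ true → a ∨ b ≡ true
∨-right {a} refl = ∨-zeroʳ a

∨-split : ∀ {a b} → a ∨ b ≡ true → (a ≡ true) ⊎ (b ≡ true)
∨-split {true} _ = inj₁ refl
∨-split {false} h = inj₂ h

∨-false : ∀ {a b} → a ∨ b ≡ false → (a ≡ false) × (b ≡ false)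
∨-false {false} h = refl , h

not-true : ∀ {a} → not a ≡ true → a ≡ false
not-true {false} _ = refl

not-intro : ∀ {a} → a ≡ false → not a ≡ true
not-intro refl = refl

xor-split : ∀ {a b} → a xor b ≡ true → (a ≡ true × b ≡ false) ⊎ (a ≡ false × b ≡ true)
xor-split {true} {false} _ = inj₁ (refl , refl)
xor-split {false} {true} _ = inj₂ (refl , refl)

xor-false : ∀ {a b} → a xor b ≡ false → a ≡ b
xor-false {true} {true} _ = refl
xor-false {false} {false} _ = refl

xor-trueˡ : ∀ {a b} → a ≡ true → b ≡ false → a xor b ≡ true
xor-trueˡ refl refl = refl

xor-trueʳ : ∀ {a b} → a ≡ false → b ≡ true → a xor b ≡ true
xor-trueʳ refl refl = refl

xor-≡ : ∀ {a b} → a ≡ b → a xor b ≡ false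
xor-≡ {a} refl = xor-same a

xor-flip : ∀ x y b → x xor b ≡ true → x xor y ≡ true → y ≡ b
xor-flip true false false _ _ = refl
xor-flip false true true _ _ = refl

xor-interchange : ∀ a b c d → (a xor b) xor (c xor d) ≡ (a xor c) xor (b xor d)
xor-interchange false b c d = trans (sym (xor-assoc b c d)) (trans (cong (_xor d) (xor-comm b c)) (xor-assoc c b d))
xor-interchange true false c d with c | d
... | true | true = refl
... | true | false = refl
... | false | true = refl
... | false | false = refl
xor-interchange true true c d with c | d
... | true | true = refl
... | true | false = refl
... | false | true = refl
... | false | false = refl

isV-refl : ∀ {n} (u : Fin n) → isV u u ≡ true
isV-refl u with u ≟ u
... | yes _ = refl
... | no h = ⊥-elim (h refl)

isV-true : ∀ {n} {u x : Fin n} → isV u x ≡ true → u ≡ x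
isV-true {u = u} {x} h with u ≟ x
... | yes p = p
isV-true () | no _

isV-false : ∀ {n} {u x : Fin n} → u ≢ x → isV u x ≡ false
isV-false {u = u} {x} h with u ≟ x
... | yes p = ⊥-elim (h p)
... | no _ = refl

isV-≢ : ∀ {n} {u x : Fin n} → isV u x ≡ false → u ≢ x
isV-≢ {u = u} h refl = absurd (isV-refl u) h

isV-sym : ∀ {n} (u x : Fin n) → isV u x ≡ isV x u
isV-sym u x with bool-cases (isV u x)
... | inj₁ p with isV-true p
...   | refl = refl
isV-sym u x | inj₂ p = trans p (sym (isV-false λ q → isV-≢ p (sym q)))

search : ∀ {n} (f : Fin n → Bool) → (∃ λ i → f i ≡ true) ⊎ (∀ i → f i ≡ false)
search f with any? (λ i → f i ≟ᵇ true)
... | yes p = inj₁ p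
... | no h = inj₂ λ i → ≢true⇒false λ q → h (i , q)

-- Parity sums, natural sums and counting over finite index sets; lists as subsets.

infixl 6 _⊕_
_⊕_ : ∀ {n} → (Fin n → Bool) → (Fin n → Bool) → Fin n → Bool
(f ⊕ g) i = f i xor g i

⨁ : ∀ {n} → (Fin n → Bool) → Bool
⨁ {zero} f = false
⨁ {suc n} f = f zero xor ⨁ (f ∘ suc)

⨁-cong : ∀ {n} {f g : Fin n → Bool} → (∀ i → f i ≡ g i) → ⨁ f ≡ ⨁ g
⨁-cong {zero} h = refl
⨁-cong {suc n} h = cong₂ _xor_ (h zero) (⨁-cong (h ∘ suc))

⨁-false : ∀ {n} {f : Fin n → Bool} → (∀ i → f i ≡ false) → ⨁ f ≡ false
⨁-false {zero} h = refl
⨁-false {suc n} h = cong₂ _xor_ (h zero) (⨁-false (h ∘ suc))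

⨁-⊕ : ∀ {n} (f g : Fin n → Bool) → ⨁ (f ⊕ g) ≡ ⨁ f xor ⨁ g
⨁-⊕ {zero} f g = refl
⨁-⊕ {suc n} f g = trans (cong ((f zero xor g zero) xor_) (⨁-⊕ (f ∘ suc) (g ∘ suc))) (xor-interchange (f zero) (g zero) _ _)

⨁-∧ : ∀ {n} b (f : Fin n → Bool) → ⨁ (λ i → b ∧ f i) ≡ b ∧ ⨁ f
⨁-∧ {zero} b f = sym (∧-zeroʳ b)
⨁-∧ {suc n} b f = trans (cong ((b ∧ f zero) xor_) (⨁-∧ b (f ∘ suc))) (sym (∧-distribˡ-xor b (f zero) _))

⨁-swap : ∀ {m n} (f : Fin m → Fin n → Bool) → ⨁ (λ i → ⨁ (f i)) ≡ ⨁ (λ j → ⨁ (λ i → f i j))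
⨁-swap {zero} {n} f = sym (⨁-false {n} {λ _ → false} λ _ → refl)
⨁-swap {suc m} f = trans (cong (⨁ (f zero) xor_) (⨁-swap (f ∘ suc))) (sym (⨁-⊕ (f zero) (λ j → ⨁ (λ i → f (suc i) j))))

⨁-at : ∀ {n} (u : Fin n) (f : Fin n → Bool) → ⨁ (λ i → isV u i ∧ f i) ≡ f u
⨁-at {suc n} zero f = trans (cong (f zero xor_) (⨁-false {f = λ i → isV zero (suc i) ∧ f (suc i)} λ i → ∧-falseˡ {b = f (suc i)} (isV-false {u = zero} {suc i} λ ()))) (xor-identityʳ (f zero))
⨁-at {suc n} (suc u) f = trans (cong₂ _xor_ (∧-falseˡ {b = f zero} (isV-false {u = suc u} {zero} λ ()))
    (⨁-cong {g = λ i → isV u i ∧ f (suc i)} λ i → cong (_∧ f (suc i)) (suc-isV i))) (⨁-at u (f ∘ suc))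
  where
    suc-isV : ∀ i → isV (suc u) (suc i) ≡ isV u i
    suc-isV i with u ≟ i
    ... | yes refl = refl
    ... | no h = refl

⨁-pick : ∀ {n} (A : Fin n → Bool) x → ⨁ (λ v → A v ∧ isV v x) ≡ A x
⨁-pick A x = trans (⨁-cong λ v → trans (∧-comm (A v) _) (cong (_∧ A v) (isV-sym v x))) (⨁-at x A)

⨁-true : ∀ {n} (f : Fin n → Bool) → ⨁ f ≡ true → ∃ λ i → f i ≡ true
⨁-true f h with search f
... | inj₁ p = p
... | inj₂ none = absurd h (⨁-false none)

-- If no other index were `true`, `f` would be the indicator of `e`, whose parity sum is `true`.
⨁-second : ∀ {n} (f : Fin n → Bool) {e} → ⨁ f ≡ false → f e ≡ true → ∃ λ e' → e' ≢ e × f e' ≡ true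
⨁-second f {e} h fe with search (λ i → f i ∧ not (isV e i))
... | inj₁ (e' , p) = e' , (λ { refl → absurd (isV-refl e) (not-true (∧-right p)) }) , ∧-left p
... | inj₂ q = absurd (trans (sym (⨁-cong {f = λ i → isV e i ∧ true} eq)) (⨁-at e (λ _ → true))) h
  where
    eq : ∀ i → isV e i ∧ true ≡ f i
    eq i with bool-cases (isV e i)
    ... | inj₁ p with isV-true p
    ...   | refl = trans (cong (_∧ true) p) (sym fe)
    eq i | inj₂ p = trans (cong (_∧ true) p) (sym (lem (f i) (q i)))
      where
        lem : ∀ b → b ∧ not (isV e i) ≡ false → b ≡ false
        lem b r = ≢true⇒false λ { refl → absurd (not-intro p) r }

bN : Bool → ℕ
bN b = if b then 1 else 0

bN≤1 : ∀ b → bN b ≤ 1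
bN≤1 true = ≤-refl
bN≤1 false = z≤n

sumF : ∀ {n} → (Fin n → ℕ) → ℕ
sumF {zero} f = 0
sumF {suc n} f = f zero + sumF (f ∘ suc)

sumF-cong : ∀ {n} {f g : Fin n → ℕ} → (∀ i → f i ≡ g i) → sumF f ≡ sumF g
sumF-cong {zero} h = refl
sumF-cong {suc n} h = cong₂ _+_ (h zero) (sumF-cong (h ∘ suc))

sumF-mono : ∀ {n} {f g : Fin n → ℕ} → (∀ i → f i ≤ g i) → sumF f ≤ sumF g
sumF-mono {zero} h = z≤n
sumF-mono {suc n} h = +-mono-≤ (h zero) (sumF-mono (h ∘ suc))

+-interchange : ∀ a b c d → (a + b) + (c + d) ≡ (a + c) + (b + d)
+-interchange = +-*-Solver.solve 4 (λ a b c d → (a :+ b) :+ (c :+ d) := (a :+ c) :+ (b :+ d)) refl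
  where open +-*-Solver

sumF-+ : ∀ {n} (f g : Fin n → ℕ) → sumF (λ i → f i + g i) ≡ sumF f + sumF g
sumF-+ {zero} f g = refl
sumF-+ {suc n} f g = trans (cong ((f zero + g zero) +_) (sumF-+ (f ∘ suc) (g ∘ suc))) (+-interchange (f zero) (g zero) _ _)

sumF-* : ∀ {n} k (f : Fin n → ℕ) → sumF (λ i → k * f i) ≡ k * sumF f
sumF-* {zero} k f = sym (ℕₚ.*-zeroʳ k)
sumF-* {suc n} k f = trans (cong ((k * f zero) +_) (sumF-* k (f ∘ suc))) (sym (ℕₚ.*-distribˡ-+ k (f zero) _))

sumF-zero : ∀ {n} → sumF {n} (λ _ → 0) ≡ 0
sumF-zero {zero} = refl
sumF-zero {suc n} = sumF-zero {n}

sumF-swap : ∀ {m n} (f : Fin m → Fin n → ℕ) → sumF (λ i → sumF (f i)) ≡ sumF (λ j → sumF (λ i → f i j))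
sumF-swap {zero} {n} f = sym (sumF-zero {n})
sumF-swap {suc m} f = trans (cong (sumF (f zero) +_) (sumF-swap (f ∘ suc))) (sym (sumF-+ (f zero) (λ j → sumF (λ i → f (suc i) j))))

sumF-∋ : ∀ {n} (f : Fin n → ℕ) i → f i ≤ sumF f
sumF-∋ f zero = m≤m+n _ _
sumF-∋ f (suc i) = ≤-trans (sumF-∋ (f ∘ suc) i) (m≤n+m _ _)

sumF-one : ∀ {n} → sumF {n} (λ _ → 1) ≡ n
sumF-one {zero} = refl
sumF-one {suc n} = cong suc sumF-one

count-sumF : ∀ {n} (f : Fin n → Bool) → count f ≡ sumF (bN ∘ f)
count-sumF {zero} f = refl
count-sumF {suc n} f = cong (bN (f zero) +_) (count-sumF (f ∘ suc))

sumF-at : ∀ {n} (u : Fin n) (f : Fin n → ℕ) → sumF (λ i → bN (isV u i) * f i) ≡ f u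
sumF-at {suc n} zero f = trans (cong₂ _+_ (ℕₚ.+-identityʳ _) (trans (sumF-cong λ i → cong (λ b → bN b * f (suc i)) (isV-false {u = zero} {suc i} λ ())) (sumF-zero {n}))) (ℕₚ.+-identityʳ _)
sumF-at {suc n} (suc u) f = trans (sumF-cong {f = λ i → bN (isV (suc u) (suc i)) * f (suc i)} eq) (sumF-at u (f ∘ suc))
  where
    eq : ∀ i → bN (isV (suc u) (suc i)) * f (suc i) ≡ bN (isV u i) * f (suc i)
    eq i with u ≟ i
    ... | yes refl = refl
    ... | no h = refl

count-mono : ∀ {n} {f g : Fin n → Bool} → (∀ i → f i ≡ true → g i ≡ true) → count f ≤ count g
count-mono {zero} h = z≤n
count-mono {suc n} {f} {g} h = +-mono-≤ (lem (f zero) (g zero) (h zero)) (count-mono (h ∘ suc))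
  where
    lem : ∀ a b → (a ≡ true → b ≡ true) → bN a ≤ bN b
    lem false b _ = z≤n
    lem true b k rewrite k refl = ≤-refl

count-cong : ∀ {n} {f g : Fin n → Bool} → (∀ i → f i ≡ g i) → count f ≡ count g
count-cong {zero} h = refl
count-cong {suc n} h = cong₂ _+_ (cong bN (h zero)) (count-cong (h ∘ suc))

count-false : ∀ {n} → count {n} (λ _ → false) ≡ 0
count-false {zero} = refl
count-false {suc n} = count-false {n}

count≤n : ∀ {n} (f : Fin n → Bool) → count f ≤ n
count≤n {zero} f = z≤n
count≤n {suc n} f = +-mono-≤ (bN≤1 (f zero)) (count≤n (f ∘ suc))

count-pos : ∀ {n} (f : Fin n → Bool) {i} → f i ≡ true → 1 ≤ count f
count-pos f {i} h = ≤-trans (≤-reflexive (sym (cong bN h))) (≤-trans (sumF-∋ (bN ∘ f) i) (≤-reflexive (sym (count-sumF f))))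

count-∨ : ∀ {n} (f g : Fin n → Bool) → count (λ i → f i ∨ g i) ≤ count f + count g
count-∨ {zero} f g = z≤n
count-∨ {suc n} f g = ≤-trans (+-mono-≤ (lem (f zero) (g zero)) (count-∨ (f ∘ suc) (g ∘ suc))) (≤-reflexive (+-interchange (bN (f zero)) _ _ _))
  where
    lem : ∀ a b → bN (a ∨ b) ≤ bN a + bN b
    lem true b = s≤s z≤n
    lem false b = ≤-refl

count-∨-disjoint : ∀ {n} (f g : Fin n → Bool) → (∀ i → f i ≡ true → g i ≡ false) → count (λ i → f i ∨ g i) ≡ count f + count g
count-∨-disjoint {zero} f g d = refl
count-∨-disjoint {suc n} f g d = trans (cong₂ _+_ (lem (f zero) (g zero) (d zero)) (count-∨-disjoint (f ∘ suc) (g ∘ suc) (d ∘ suc))) (+-interchange (bN (f zero)) _ _ _)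
  where
    lem : ∀ a b → (a ≡ true → b ≡ false) → bN (a ∨ b) ≡ bN a + bN b
    lem true b k rewrite k refl = refl
    lem false b k = refl

count-isV : ∀ {n} (u : Fin n) → count (isV u) ≡ 1
count-isV u = trans (count-sumF (isV u)) (trans (sumF-cong λ i → sym (ℕₚ.*-identityʳ (bN (isV u i)))) (sumF-at u (λ _ → 1)))

count-two : ∀ {n} (f : Fin n → Bool) {i j} → i ≢ j → f i ≡ true → f j ≡ true → 2 ≤ count f
count-two f {i} {j} i≢j fi fj = ≤-trans (≤-reflexive (sym (trans (count-∨-disjoint (isV i) (isV j) λ k p → isV-false λ q → i≢j (trans (isV-true p) (sym q))) (cong₂ _+_ (count-isV i) (count-isV j)))))
  (count-mono {f = λ k → isV i k ∨ isV j k} {f} λ k p → case ∨-split p of λ { (inj₁ q) → trans (cong f (sym (isV-true q))) fi ; (inj₂ q) → trans (cong f (sym (isV-true q))) fj })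

bN-parity : ∀ b k → (bN b + bN k) % 2 ≡ bN (b xor k)
bN-parity true true = refl
bN-parity true false = refl
bN-parity false true = refl
bN-parity false false = refl

count-%2 : ∀ {n} (f : Fin n → Bool) → count f % 2 ≡ bN (⨁ f)
count-%2 {zero} f = refl
count-%2 {suc n} f = trans (%-step (bN (f zero)) (count (f ∘ suc))) (trans (cong (λ k → (bN (f zero) + k) % 2) (count-%2 (f ∘ suc))) (bN-parity (f zero) _))
  where
    open import Data.Nat.DivMod using (%-distribˡ-+; m%n%n≡m%n)
    %-step : ∀ a k → (a + k) % 2 ≡ (a + k % 2) % 2
    %-step a k = trans (%-distribˡ-+ a k 2) (trans (cong (λ x → (a % 2 + x) % 2) (sym (m%n%n≡m%n k 2))) (sym (%-distribˡ-+ a (k % 2) 2)))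

-- Entries are added modulo 2, so repetitions cancel. This makes the boundary of a walk equal to its
-- two ends even if the walk repeats edges; `mem` below is plain membership.
χ : ∀ {n} → List (Fin n) → Fin n → Bool
χ [] e = false
χ (x ∷ l) e = isV x e xor χ l e

χ-∉ : ∀ {n} (l : List (Fin n)) {e} → e ∉ l → χ l e ≡ false
χ-∉ [] h = refl
χ-∉ (x ∷ l) h = cong₂ _xor_ (isV-false λ q → h (here (sym q))) (χ-∉ l (h ∘ there))

χ-∈ : ∀ {n} (l : List (Fin n)) {e} → χ l e ≡ true → e ∈ l
χ-∈ (x ∷ l) {e} h with bool-cases (isV x e)
... | inj₁ p = here (sym (isV-true p))
... | inj₂ p = there (χ-∈ l (trans (sym (cong (_xor χ l e) p)) h))

unique-head : ∀ {A : Set} {x : A} {l} → Unique (x ∷ l) → x ∉ l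
unique-head (p ∷ _) q = All.lookup p q refl

unique-tail : ∀ {A : Set} {x : A} {l} → Unique (x ∷ l) → Unique l
unique-tail (_ ∷ u) = u

unique-∷ : ∀ {A : Set} {x : A} {l} → x ∉ l → Unique l → Unique (x ∷ l)
unique-∷ h u = ¬Any⇒All¬ _ h ∷ u

unique-++ : ∀ {A : Set} {k l : List A} → Unique k → Unique l → (∀ {x} → x ∈ k → x ∈ l → ⊥) → Unique (k ++ l)
unique-++ uk ul d = Uniqueₚ.++⁺ uk ul λ p → d (proj₁ p) (proj₂ p)

unique-++ˡ : ∀ {A : Set} (k : List A) {l} → Unique (k ++ l) → Unique k
unique-++ˡ [] u = []
unique-++ˡ (x ∷ k) (p ∷ u) = Allₚ.++⁻ˡ k p ∷ unique-++ˡ k u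

unique-++ʳ : ∀ {A : Set} (k : List A) {l} → Unique (k ++ l) → Unique l
unique-++ʳ [] u = u
unique-++ʳ (x ∷ k) (p ∷ u) = unique-++ʳ k u

unique-++-disjoint : ∀ {A : Set} (k : List A) {l x} → Unique (k ++ l) → x ∈ k → x ∈ l → ⊥
unique-++-disjoint (x ∷ k) (p ∷ u) (here refl) q = All.lookup (Allₚ.++⁻ʳ k p) q refl
unique-++-disjoint (x ∷ k) (p ∷ u) (there h) q = unique-++-disjoint k u h q

χ-unique : ∀ {n} (l : List (Fin n)) {e} → Unique l → e ∈ l → χ l e ≡ true
χ-unique (x ∷ l) u (here refl) = xor-trueˡ (isV-refl x) (χ-∉ l (unique-head u))
χ-unique (x ∷ l) {e} u (there h) = xor-trueʳ (isV-false {u = x} {e} λ { refl → unique-head u h }) (χ-unique l (unique-tail u) h)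

χ-++ : ∀ {n} (k l : List (Fin n)) e → χ (k ++ l) e ≡ χ k e xor χ l e
χ-++ [] l e = refl
χ-++ (x ∷ k) l e = trans (cong (isV x e xor_) (χ-++ k l e)) (sym (xor-assoc (isV x e) _ _))

-- Splitting a circuit off an even set lowers its size by the length of the circuit. This gives both
-- the termination of the decompositions and their total length.
count-χ : ∀ {n} (S : Fin n → Bool) (l : List (Fin n)) → Unique l → (∀ e → e ∈ l → S e ≡ true) → count S ≡ length l + count (S ⊕ χ l)
count-χ S [] u h = count-cong λ i → sym (xor-identityʳ (S i))
count-χ S (x ∷ l) u h = trans (trans (count-cong eq) (trans (count-∨-disjoint (isV x) S' disj) (cong (_+ count S') (count-isV x))))
    (cong suc (trans (count-χ S' l (unique-tail u) in') (cong (length l +_) (count-cong λ i → xor-assoc (S i) (isV x i) (χ l i)))))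
  where
    S' = S ⊕ isV x
    disj : ∀ i → isV x i ≡ true → S' i ≡ false
    disj i p = xor-≡ (trans (h i (here (sym (isV-true p)))) (sym p))
    eq : ∀ i → S i ≡ isV x i ∨ S' i
    eq i with bool-cases (isV x i)
    ... | inj₁ p = trans (h i (here (sym (isV-true p)))) (sym (∨-left p))
    ... | inj₂ p rewrite p = sym (xor-identityʳ (S i))
    in' : ∀ e → e ∈ l → S' e ≡ true
    in' e q = xor-trueˡ (h e (there q)) (isV-false λ { refl → unique-head u q })

mem : ∀ {n} → List (Fin n) → Fin n → Bool
mem [] i = false
mem (x ∷ l) i = isV x i ∨ mem l i

mem-∈ : ∀ {n} (l : List (Fin n)) {i} → mem l i ≡ true → i ∈ l
mem-∈ (x ∷ l) h with ∨-split h
... | inj₁ p = here (sym (isV-true p))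
... | inj₂ p = there (mem-∈ l p)

∈-mem : ∀ {n} (l : List (Fin n)) {i} → i ∈ l → mem l i ≡ true
∈-mem (x ∷ l) (here refl) = ∨-left (isV-refl x)
∈-mem (x ∷ l) (there h) = ∨-right {isV x _} (∈-mem l h)

∉-mem : ∀ {n} (l : List (Fin n)) {i} → i ∉ l → mem l i ≡ false
∉-mem l h = ≢true⇒false λ p → h (mem-∈ l p)

mem-∉ : ∀ {n} (l : List (Fin n)) {i} → mem l i ≡ false → i ∉ l
mem-∉ l p h = absurd (∈-mem l h) p

_∈?ₗ_ : ∀ {n} (i : Fin n) (l : List (Fin n)) → (i ∈ l) ⊎ (i ∉ l)
i ∈?ₗ l with bool-cases (mem l i)
... | inj₁ p = inj₁ (mem-∈ l p)
... | inj₂ p = inj₂ (mem-∉ l p)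

count-mem : ∀ {n} (l : List (Fin n)) → count (mem l) ≤ length l
count-mem {n} [] = ≤-reflexive (count-false {n})
count-mem (x ∷ l) = ≤-trans (count-∨ (isV x) (mem l)) (+-mono-≤ (≤-reflexive (count-isV x)) (count-mem l))

count-mem-unique : ∀ {n} (l : List (Fin n)) → Unique l → count (mem l) ≡ length l
count-mem-unique {n} [] u = count-false {n}
count-mem-unique (x ∷ l) u = trans (count-∨-disjoint (isV x) (mem l) λ i p → ∉-mem l (subst (_∉ l) (isV-true p) (unique-head u)))
  (cong₂ _+_ (count-isV x) (count-mem-unique l (unique-tail u)))

unique-⊆-length : ∀ {n} (k l : List (Fin n)) → Unique k → (∀ {x} → x ∈ k → x ∈ l) → length k ≤ length l
unique-⊆-length k l u h = ≤-trans (≤-reflexive (sym (count-mem-unique k u))) (≤-trans (count-mono {f = mem k} {mem l} λ i p → ∈-mem l (h (mem-∈ k p))) (count-mem l))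

unique-length : ∀ {n} (l : List (Fin n)) → Unique l → length l ≤ n
unique-length l u = ≤-trans (≤-reflexive (sym (count-mem-unique l u))) (count≤n (mem l))

mult : ∀ {n} → List (Fin n) → Fin n → ℕ
mult [] i = 0
mult (x ∷ l) i = bN (isV x i) + mult l i

sum-mult : ∀ {n} (f : Fin n → ℕ) (l : List (Fin n)) → sum (map f l) ≡ sumF (λ i → mult l i * f i)
sum-mult {n} f [] = sym (sumF-zero {n})
sum-mult f (x ∷ l) = sym (trans (sumF-cong λ i → ℕₚ.*-distribʳ-+ (f i) (bN (isV x i)) (mult l i))
  (trans (sumF-+ (λ i → bN (isV x i) * f i) _) (cong₂ _+_ (sumF-at x f) (sym (sum-mult f l)))))

mult-∉ : ∀ {n} (l : List (Fin n)) {i} → i ∉ l → mult l i ≡ 0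
mult-∉ [] h = refl
mult-∉ (x ∷ l) h = cong₂ _+_ (cong bN (isV-false λ q → h (here (sym q)))) (mult-∉ l (h ∘ there))

mult-unique : ∀ {n} (l : List (Fin n)) i → Unique l → mult l i ≤ 1
mult-unique [] i u = z≤n
mult-unique (x ∷ l) i u with bool-cases (isV x i)
... | inj₁ p rewrite p = ≤-reflexive (cong suc (mult-∉ l (subst (_∉ l) (isV-true p) (unique-head u))))
... | inj₂ p rewrite p = mult-unique l i (unique-tail u)

sum-∈ : ∀ {A : Set} (f : A → ℕ) {l : List A} {x} → x ∈ l → f x ≤ sum (map f l)
sum-∈ f (here refl) = m≤m+n _ _
sum-∈ f {y ∷ l} (there h) = ≤-trans (sum-∈ f h) (m≤n+m _ (f y))

anyL : ∀ {n} (A : Fin n → Bool) (l : List (Fin n)) → (∃ λ x → x ∈ l × A x ≡ true) ⊎ (∀ {x} → x ∈ l → A x ≡ false)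
anyL A [] = inj₂ λ ()
anyL A (x ∷ l) with bool-cases (A x) | anyL A l
... | inj₁ p | _ = inj₁ (x , here refl , p)
... | inj₂ p | inj₁ (y , h , q) = inj₁ (y , there h , q)
... | inj₂ p | inj₂ h = inj₂ λ { (here refl) → p ; (there q) → h q }

count-strict : ∀ {n} (f g : Fin n → Bool) {i} → (∀ j → f j ≡ true → g j ≡ true) → f i ≡ false → g i ≡ true → count f < count g
count-strict f g {i} h fi gi = ≤-trans (≤-reflexive (sym (trans (count-∨-disjoint (isV i) f λ j p → subst (λ k → f k ≡ false) (isV-true p) fi) (cong (_+ count f) (count-isV i)))))
  (count-mono {f = λ j → isV i j ∨ f j} {g} λ j p → case ∨-split p of λ { (inj₁ q) → subst (λ k → g k ≡ true) (isV-true q) gi ; (inj₂ q) → h j q })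

ES' : SignedGraph → Set
ES' G = Fin (nE G) → Bool

-- Cuts, even edge sets, walks, rooted trees and components.

module Walks (G : SignedGraph) where

  V = Fin (nV G)
  E = Fin (nE G)
  VS = V → Bool
  ES = E → Bool

  src tgt : E → V
  src e = proj₁ (ends G e)
  tgt e = proj₂ (ends G e)

  cut : VS → ES
  cut A e = A (src e) xor A (tgt e)

  -- The degree of `v` in `S` modulo 2; a loop contributes nothing because `cut` vanishes on it.
  ∂ : ES → VS
  ∂ S v = ⨁ (λ e → S e ∧ cut (isV v) e)

  Even : ES → Set
  Even S = ∀ v → ∂ S v ≡ false

  In : ES → E → Set
  In S e = S e ≡ true

  ∂-cong : ∀ {S S' : ES} → (∀ e → S e ≡ S' e) → ∀ v → ∂ S v ≡ ∂ S' v
  ∂-cong h v = ⨁-cong λ e → cong (_∧ cut (isV v) e) (h e)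

  ∂-⊕ : ∀ (S S' : ES) v → ∂ (S ⊕ S') v ≡ ∂ S v xor ∂ S' v
  ∂-⊕ S S' v = trans (⨁-cong λ e → ∧-distribʳ-xor (cut (isV v) e) (S e) (S' e)) (⨁-⊕ (λ e → S e ∧ cut (isV v) e) (λ e → S' e ∧ cut (isV v) e))

  even-⊕ : ∀ {S S' : ES} → Even S → Even S' → Even (S ⊕ S')
  even-⊕ {S} {S'} h h' v = trans (∂-⊕ S S' v) (cong₂ _xor_ (h v) (h' v))

  even-cong : ∀ {S S' : ES} → (∀ e → S e ≡ S' e) → Even S → Even S'
  even-cong h k v = trans (sym (∂-cong h v)) (k v)

  even-∅ : Even (λ _ → false)
  even-∅ v = ⨁-false {nE G} {λ _ → false} λ _ → refl

  -- The handshake argument modulo 2: after exchanging the two sums, an edge with both ends in `A`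
  -- is counted twice and cancels.
  cut-sum : ∀ (A : VS) (S : ES) → ⨁ (λ v → A v ∧ ∂ S v) ≡ ⨁ (λ e → S e ∧ cut A e)
  cut-sum A S = begin
    ⨁ (λ v → A v ∧ ∂ S v) ≡⟨ ⨁-cong (λ v → sym (⨁-∧ (A v) (λ e → S e ∧ cut (isV v) e))) ⟩
    ⨁ (λ v → ⨁ (λ e → A v ∧ (S e ∧ cut (isV v) e))) ≡⟨ ⨁-swap (λ v e → A v ∧ (S e ∧ cut (isV v) e)) ⟩
    ⨁ (λ e → ⨁ (λ v → A v ∧ (S e ∧ cut (isV v) e))) ≡⟨ ⨁-cong (λ e → ⨁-cong (λ v → rearrange (A v) (S e) (cut (isV v) e))) ⟩
    ⨁ (λ e → ⨁ (λ v → S e ∧ (A v ∧ cut (isV v) e))) ≡⟨ ⨁-cong (λ e → ⨁-∧ (S e) (λ v → A v ∧ cut (isV v) e)) ⟩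
    ⨁ (λ e → S e ∧ ⨁ (λ v → A v ∧ cut (isV v) e)) ≡⟨ ⨁-cong (λ e → cong (S e ∧_) (inner e)) ⟩
    ⨁ (λ e → S e ∧ cut A e) ∎
    where
      open ≡-Reasoning
      rearrange : ∀ a s c → a ∧ (s ∧ c) ≡ s ∧ (a ∧ c)
      rearrange false s c = sym (∧-zeroʳ s)
      rearrange true s c = refl
      inner : ∀ e → ⨁ (λ v → A v ∧ cut (isV v) e) ≡ cut A e
      inner e = trans (⨁-cong λ v → ∧-distribˡ-xor (A v) (isV v (src e)) (isV v (tgt e)))
        (trans (⨁-⊕ (λ v → A v ∧ isV v (src e)) (λ v → A v ∧ isV v (tgt e))) (cong₂ _xor_ (⨁-pick A (src e)) (⨁-pick A (tgt e))))

  even-cut : ∀ {S : ES} → Even S → ∀ A → ⨁ (λ e → S e ∧ cut A e) ≡ false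
  even-cut {S} h A = trans (sym (cut-sum A S)) (⨁-false λ v → ∧-falseʳ {A v} (h v))

  even-second : ∀ {S : ES} → Even S → ∀ A {e} → S e ≡ true → cut A e ≡ true → ∃ λ e' → e' ≢ e × S e' ≡ true × cut A e' ≡ true
  even-second {S} h A {e} s c with ⨁-second (λ e → S e ∧ cut A e) (even-cut h A) (∧-intro s c)
  ... | e' , ne , p = e' , ne , ∧-left p , ∧-right p

  joins-self : ∀ e → Joins G e (src e) (tgt e)
  joins-self e = inj₁ refl

  joins-sym : ∀ {e u w} → Joins G e u w → Joins G e w u
  joins-sym (inj₁ p) = inj₂ p
  joins-sym (inj₂ p) = inj₁ p

  joins-cut : ∀ (A : VS) {e u w} → Joins G e u w → cut A e ≡ A u xor A w
  joins-cut A (inj₁ refl) = refl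
  joins-cut A {e} {u} {w} (inj₂ refl) = xor-comm (A w) (A u)

  joins-ends : ∀ {e u w a b} → Joins G e u w → Joins G e a b → (a ≡ u × b ≡ w) ⊎ (a ≡ w × b ≡ u)
  joins-ends (inj₁ refl) (inj₁ refl) = inj₁ (refl , refl)
  joins-ends (inj₁ refl) (inj₂ refl) = inj₂ (refl , refl)
  joins-ends (inj₂ refl) (inj₁ refl) = inj₂ (refl , refl)
  joins-ends (inj₂ refl) (inj₂ refl) = inj₁ (refl , refl)

  cut-orient : ∀ (A : VS) {e} → cut A e ≡ true → Σ V λ a → Σ V λ b → Joins G e a b × A a ≡ true × A b ≡ false
  cut-orient A {e} h with xor-split h
  ... | inj₁ (p , q) = src e , tgt e , joins-self e , p , q
  ... | inj₂ (p , q) = tgt e , src e , joins-sym (joins-self e) , q , p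

  par : ES → List E → Bool
  par w [] = false
  par w (x ∷ l) = w x xor par w l

  χ-par : ∀ (w : ES) l → ⨁ (λ e → χ l e ∧ w e) ≡ par w l
  χ-par w [] = ⨁-false {nE G} {λ _ → false} λ _ → refl
  χ-par w (x ∷ l) = trans (⨁-cong λ e → ∧-distribʳ-xor (w e) (isV x e) (χ l e))
    (trans (⨁-⊕ (λ e → isV x e ∧ w e) (λ e → χ l e ∧ w e)) (cong₂ _xor_ (⨁-at x w) (χ-par w l)))

  par-++ : ∀ w k l → par w (k ++ l) ≡ par w k xor par w l
  par-++ w [] l = refl
  par-++ w (x ∷ k) l = trans (cong (w x xor_) (par-++ w k l)) (sym (xor-assoc (w x) _ _))

  par-false : ∀ {w} l → (∀ e → e ∈ l → w e ≡ false) → par w l ≡ false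
  par-false [] h = refl
  par-false (x ∷ l) h = cong₂ _xor_ (h x (here refl)) (par-false l λ e p → h e (there p))

  par-cong : ∀ {w w'} l → (∀ e → e ∈ l → w e ≡ w' e) → par w l ≡ par w' l
  par-cong [] h = refl
  par-cong (x ∷ l) h = cong₂ _xor_ (h x (here refl)) (par-cong l λ e p → h e (there p))

  par-⊕ : ∀ w w' l → par (w ⊕ w') l ≡ par w l xor par w' l
  par-⊕ w w' [] = refl
  par-⊕ w w' (x ∷ l) = trans (cong ((w x xor w' x) xor_) (par-⊕ w w' l)) (xor-interchange (w x) (w' x) _ _)

  module _ {P : E → Set} where

    verts : ∀ {u v} → Walk G P u v → List V
    verts {u} here = u ∷ []
    verts {u} (wstep e p j w) = u ∷ verts w

    edges : ∀ {u v} → Walk G P u v → List E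
    edges here = []
    edges (wstep e p j w) = e ∷ edges w

    edges-P : ∀ {u v} (w : Walk G P u v) {e} → e ∈ edges w → P e
    edges-P (wstep e p j w) (here refl) = p
    edges-P (wstep e p j w) (there h) = edges-P w h

    start∈ : ∀ {u v} (w : Walk G P u v) → u ∈ verts w
    start∈ here = here refl
    start∈ (wstep e p j w) = here refl

    end∈ : ∀ {u v} (w : Walk G P u v) → v ∈ verts w
    end∈ here = here refl
    end∈ (wstep e p j w) = there (end∈ w)

    length-verts : ∀ {u v} (w : Walk G P u v) → length (verts w) ≡ suc (length (edges w))
    length-verts here = refl
    length-verts (wstep e p j w) = cong suc (length-verts w)

    infixr 5 _⟫_
    _⟫_ : ∀ {u v x} → Walk G P u v → Walk G P v x → Walk G P u x
    here ⟫ w' = w'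
    wstep e p j w ⟫ w' = wstep e p j (w ⟫ w')

    edges-⟫ : ∀ {u v x} (w : Walk G P u v) (w' : Walk G P v x) → edges (w ⟫ w') ≡ edges w ++ edges w'
    edges-⟫ here w' = refl
    edges-⟫ (wstep e p j w) w' = cong (e ∷_) (edges-⟫ w w')

    verts-⟫ : ∀ {u v x} (w : Walk G P u v) (w' : Walk G P v x) {z} → z ∈ verts (w ⟫ w') → z ∈ verts w ⊎ z ∈ verts w'
    verts-⟫ here w' h = inj₂ h
    verts-⟫ (wstep e p j w) w' (here q) = inj₁ (here q)
    verts-⟫ (wstep e p j w) w' (there h) with verts-⟫ w w' h
    ... | inj₁ q = inj₁ (there q)
    ... | inj₂ q = inj₂ q

    rev : ∀ {u v} → Walk G P u v → Walk G P v u
    rev here = here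
    rev (wstep e p j w) = rev w ⟫ wstep e p (joins-sym j) here

    rev-edges : ∀ {u v} (w : Walk G P u v) {e} → e ∈ edges (rev w) → e ∈ edges w
    rev-edges (wstep e p j w) h with ∈-++⁻ (edges (rev w)) (subst (_ ∈_) (edges-⟫ (rev w) _) h)
    ... | inj₁ q = there (rev-edges w q)
    ... | inj₂ (here q) = here q

    par-cut : ∀ (A : VS) {u v} (w : Walk G P u v) → par (cut A) (edges w) ≡ A u xor A v
    par-cut A {u} here = sym (xor-same (A u))
    par-cut A {u} {v} (wstep {w = x} e p j w) = trans (cong₂ _xor_ (joins-cut A j) (par-cut A w)) (cancel (A u) (A x) (A v))
      where
        cancel : ∀ a b c → (a xor b) xor (b xor c) ≡ a xor c
        cancel a b c = trans (xor-assoc a b _) (cong (a xor_) (trans (sym (xor-assoc b b c)) (cong (_xor c) (xor-same b))))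

    ∂-walk : ∀ {u v} (w : Walk G P u v) x → ∂ (χ (edges w)) x ≡ isV x u xor isV x v
    ∂-walk w x = trans (χ-par (cut (isV x)) (edges w)) (par-cut (isV x) w)

    edge-ends : ∀ {u v} (w : Walk G P u v) {e a b} → e ∈ edges w → Joins G e a b → a ∈ verts w × b ∈ verts w
    edge-ends (wstep e p j w) (here refl) k with joins-ends j k
    ... | inj₁ (refl , refl) = here refl , there (start∈ w)
    ... | inj₂ (refl , refl) = there (start∈ w) , here refl
    edge-ends (wstep e p j w) (there h) k = let (x , y) = edge-ends w h k in there x , there y

    unique-edges : ∀ {u v} (w : Walk G P u v) → Unique (verts w) → Unique (edges w)
    unique-edges here uq = []
    unique-edges (wstep e p j w) uq = unique-∷ (λ h → unique-head uq (proj₁ (edge-ends w h j))) (unique-edges w (unique-tail uq))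

    crossing : ∀ (A : VS) {u v} (w : Walk G P u v) → A u ≡ true → A v ≡ false →
      Σ E λ e → Σ V λ a → Σ V λ b → e ∈ edges w × Joins G e a b × A a ≡ true × A b ≡ false × a ∈ verts w
    crossing A here p q = absurd p q
    crossing A {u} (wstep {w = x} e pe j w) p q with bool-cases (A x)
    ... | inj₂ r = e , u , x , here refl , j , p , r , here refl
    ... | inj₁ r with crossing A w r q
    ...   | e' , a , b , h , k , s , t , i = e' , a , b , there h , k , s , t , there i

    -- Collects what is inherited when a walk is shortened, by erasing loops or by cutting at a
    -- vertex, so that such operations compose through `sub-trans`.
    record Sub {u v} (w : Walk G P u v) (x y : V) : Set where
      constructor sub
      field
        walk : Walk G P x y
        vs⊆ : ∀ {z} → z ∈ verts walk → z ∈ verts w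
        es⊆ : ∀ {e} → e ∈ edges walk → e ∈ edges w
        len≤ : length (edges walk) ≤ length (edges w)
        uniq : Unique (verts w) → Unique (verts walk)
    open Sub public

    sub-refl : ∀ {u v} (w : Walk G P u v) → Sub w u v
    sub-refl w = sub w id id ≤-refl id

    sub-trans : ∀ {u v x y a b} {w : Walk G P u v} (s : Sub w x y) → Sub (walk s) a b → Sub w a b
    sub-trans s t = sub (walk t) (vs⊆ s ∘ vs⊆ t) (es⊆ s ∘ es⊆ t) (≤-trans (len≤ t) (len≤ s)) (uniq t ∘ uniq s)

    sub-step : ∀ {u x v a b} {e p} {j : Joins G e u x} {w : Walk G P x v} → Sub w a b → Sub (wstep e p j w) a b
    sub-step s = sub (walk s) (there ∘ vs⊆ s) (there ∘ es⊆ s) (≤-trans (len≤ s) (ℕₚ.n≤1+n _)) (uniq s ∘ unique-tail)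

    suffix : ∀ {u v} (w : Walk G P u v) {x} → x ∈ verts w → Sub w x v
    suffix here (here refl) = sub-refl here
    suffix (wstep e p j w) (here refl) = sub-refl _
    suffix (wstep e p j w) (there h) = sub-step (suffix w h)

    extend : ∀ {u x v b} {e p} {j : Joins G e u x} {w : Walk G P x v} → Sub w x b → Sub (wstep e p j w) u b
    extend {e = e} {p} {j} s = sub (wstep e p j (walk s)) (λ { (here q) → here q ; (there q) → there (vs⊆ s q) })
      (λ { (here q) → here q ; (there q) → there (es⊆ s q) }) (s≤s (len≤ s))
      (λ uq → unique-∷ (unique-head uq ∘ vs⊆ s) (uniq s (unique-tail uq)))

    prefix : ∀ {u v} (w : Walk G P u v) {x} → x ∈ verts w → Sub w u x
    prefix here (here refl) = sub-refl here
    prefix (wstep e p j w) (here refl) = sub here (λ { (here q) → here q }) (λ ()) z≤n (λ _ → [] ∷ [])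
    prefix (wstep e p j w) (there h) = extend (prefix w h)

    erase-raw : ∀ {u v} (w : Walk G P u v) → Σ (Sub w u v) λ s → Unique (verts (walk s))
    erase-raw here = sub-refl here , [] ∷ []
    erase-raw {u} (wstep e p j w) with erase-raw w
    ... | s , uq with u ∈?ₗ verts (walk s)
    ...   | inj₁ h = let t = suffix (walk s) h in sub-step (sub-trans s t) , uniq t uq
    ...   | inj₂ h = sub (wstep e p j (walk s)) (λ { (here q) → here q ; (there q) → there (vs⊆ s q) })
              (λ { (here q) → here q ; (there q) → there (es⊆ s q) }) (s≤s (len≤ s)) (λ _ → unique-∷ h uq) , unique-∷ h uq

    abstract
      erase : ∀ {u v} (w : Walk G P u v) → Σ (Sub w u v) λ s → Unique (verts (walk s))
      erase = erase-raw

    -- The walk is cut at its last vertex in `A`; `trimBack` cuts at the first one. Applied in turn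
    -- they leave a path that meets two given sets only at its ends.
    trimFront-raw : ∀ (A : VS) {u v} (w : Walk G P u v) {x} → x ∈ verts w → A x ≡ true →
      Σ V λ a → Σ (Sub w a v) λ s → A a ≡ true × (∀ {z} → z ∈ verts (walk s) → A z ≡ true → z ≡ a)
    trimFront-raw A {u} here (here refl) h = u , sub-refl here , h , λ { (here q) _ → q }
    trimFront-raw A {u} (wstep e p j w) x∈ h with anyL A (verts w)
    ... | inj₁ (y , y∈ , q) with trimFront-raw A w y∈ q
    ...   | a , s , r , only = a , sub-step s , r , only
    trimFront-raw A {u} (wstep e p j w) (here refl) h | inj₂ k = u , sub-refl _ , h , λ { (here q) _ → q ; (there q) r → absurd r (k q) }
    trimFront-raw A {u} (wstep e p j w) (there x∈) h | inj₂ k = absurd h (k x∈)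

    abstract
      trimFront : ∀ (A : VS) {u v} (w : Walk G P u v) {x} → x ∈ verts w → A x ≡ true →
        Σ V λ a → Σ (Sub w a v) λ s → A a ≡ true × (∀ {z} → z ∈ verts (walk s) → A z ≡ true → z ≡ a)
      trimFront = trimFront-raw

    trimBack-raw : ∀ (B : VS) {u v} (w : Walk G P u v) {x} → x ∈ verts w → B x ≡ true →
      Σ V λ b → Σ (Sub w u b) λ s → B b ≡ true × (∀ {z} → z ∈ verts (walk s) → B z ≡ true → z ≡ b)
    trimBack-raw B {u} here (here refl) h = u , sub-refl here , h , λ { (here q) _ → q }
    trimBack-raw B {u} (wstep e p j w) x∈ h with bool-cases (B u)
    ... | inj₁ q = u , prefix (wstep e p j w) (here refl) , q , λ { (here r) _ → r }
    trimBack-raw B {u} (wstep e p j w) (here refl) h | inj₂ q = absurd h q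
    trimBack-raw B {u} (wstep e p j w) (there x∈) h | inj₂ q with trimBack-raw B w x∈ h
    ... | b , s , r , only = b , extend s , r , λ { (here refl) t → absurd t q ; (there t) → only t }

    abstract
      trimBack : ∀ (B : VS) {u v} (w : Walk G P u v) {x} → x ∈ verts w → B x ≡ true →
        Σ V λ b → Σ (Sub w u b) λ s → B b ≡ true × (∀ {z} → z ∈ verts (walk s) → B z ≡ true → z ≡ b)
      trimBack = trimBack-raw

  mapW : ∀ {P Q : E → Set} {u v} → (w : Walk G P u v) → (∀ {e} → e ∈ edges w → Q e) → Walk G Q u v
  mapW here h = here
  mapW (wstep e p j w) h = wstep e (h (here refl)) j (mapW w (h ∘ there))

  mapW-verts : ∀ {P Q : E → Set} {u v} (w : Walk G P u v) (h : ∀ {e} → e ∈ edges w → Q e) → verts (mapW {Q = Q} w h) ≡ verts w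
  mapW-verts here h = refl
  mapW-verts (wstep e p j w) h = cong (_ ∷_) (mapW-verts w (h ∘ there))

  mapW-edges : ∀ {P Q : E → Set} {u v} (w : Walk G P u v) (h : ∀ {e} → e ∈ edges w → Q e) → edges (mapW {Q = Q} w h) ≡ edges w
  mapW-edges here h = refl
  mapW-edges (wstep e p j w) h = cong (e ∷_) (mapW-edges w (h ∘ there))

  weaken : ∀ {P Q : E → Set} {u v} → (∀ {e} → P e → Q e) → Walk G P u v → Walk G Q u v
  weaken h w = mapW w (h ∘ edges-P w)

  -- A constructor `graft` singles out one edge together with the two rooted trees that it joins.
  -- The recursion that later moves tokens over the tree edges has exactly this shape.
  data RT (P : E → Set) : V → Set where
    leaf : ∀ v → RT P v
    graft : ∀ {v c} → RT P v → (e : E) → P e → Joins G e v c → RT P c → RT P v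

  module _ {P : E → Set} where

    tverts : ∀ {v} → RT P v → List V
    tverts (leaf v) = v ∷ []
    tverts (graft t e p j t') = tverts t ++ tverts t'

    tedges : ∀ {v} → RT P v → List E
    tedges (leaf v) = []
    tedges (graft t e p j t') = e ∷ tedges t ++ tedges t'

    tedges-P : ∀ {v} (t : RT P v) {e} → e ∈ tedges t → P e
    tedges-P (graft t e p j t') (here refl) = p
    tedges-P (graft t e p j t') (there h) with ∈-++⁻ (tedges t) h
    ... | inj₁ q = tedges-P t q
    ... | inj₂ q = tedges-P t' q

    length-tverts : ∀ {v} (t : RT P v) → length (tverts t) ≡ suc (length (tedges t))
    length-tverts (leaf v) = refl
    length-tverts (graft t e p j t') = trans (length-++ (tverts t)) (trans (cong₂ _+_ (length-tverts t) (length-tverts t'))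
      (trans (cong suc (+-suc _ _)) (cong (λ k → suc (suc k)) (sym (length-++ (tedges t))))))

    root∈ : ∀ {v} (t : RT P v) → v ∈ tverts t
    root∈ (leaf v) = here refl
    root∈ (graft t e p j t') = ∈-++⁺ˡ (root∈ t)

    toRoot : ∀ {v} (t : RT P v) {a} → a ∈ tverts t → Walk G (_∈ tedges t) a v
    toRoot (leaf v) (here refl) = here
    toRoot (graft t e p j t') h with ∈-++⁻ (tverts t) h
    ... | inj₁ q = weaken (there ∘ ∈-++⁺ˡ) (toRoot t q)
    ... | inj₂ q = weaken (there ∘ ∈-++⁺ʳ (tedges t)) (toRoot t' q) ⟫ wstep e (here refl) (joins-sym j) here

    tedge-ends : ∀ {v} (t : RT P v) {e a b} → e ∈ tedges t → Joins G e a b → a ∈ tverts t × b ∈ tverts t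
    tedge-ends (graft t e p j t') (here refl) k with joins-ends j k
    ... | inj₁ (refl , refl) = ∈-++⁺ˡ (root∈ t) , ∈-++⁺ʳ (tverts t) (root∈ t')
    ... | inj₂ (refl , refl) = ∈-++⁺ʳ (tverts t) (root∈ t') , ∈-++⁺ˡ (root∈ t)
    tedge-ends (graft t e p j t') (there h) k with ∈-++⁻ (tedges t) h
    ... | inj₁ q = let (x , y) = tedge-ends t q k in ∈-++⁺ˡ x , ∈-++⁺ˡ y
    ... | inj₂ q = let (x , y) = tedge-ends t' q k in ∈-++⁺ʳ (tverts t) x , ∈-++⁺ʳ (tverts t) y

    unique-tedges : ∀ {v} (t : RT P v) → Unique (tverts t) → Unique (tedges t)
    unique-tedges (leaf v) u = []
    unique-tedges (graft t e p j t') u = unique-∷ (λ h → case ∈-++⁻ (tedges t) h of λ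
        { (inj₁ q) → disj (proj₂ (tedge-ends t q j)) (root∈ t') ; (inj₂ q) → disj (root∈ t) (proj₁ (tedge-ends t' q j)) })
        (unique-++ (unique-tedges t (unique-++ˡ _ u)) (unique-tedges t' (unique-++ʳ (tverts t) u))
          λ {x} p q → disj (proj₁ (tedge-ends t p (joins-self x))) (proj₁ (tedge-ends t' q (joins-self x))))
      where
        disj : ∀ {x} → x ∈ tverts t → x ∈ tverts t' → ⊥
        disj = unique-++-disjoint (tverts t) u

    record Insert {v} (t : RT P v) (c : V) : Set where
      field
        tree : RT P v
        fwd : ∀ {x} → x ∈ tverts tree → x ≡ c ⊎ x ∈ tverts t
        bwd : ∀ {x} → x ∈ tverts t → x ∈ tverts tree
        new : c ∈ tverts tree
        uniqt : c ∉ tverts t → Unique (tverts t) → Unique (tverts tree)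
        grown : length (tverts tree) ≡ suc (length (tverts t))
    open Insert

    insert : ∀ {v} (t : RT P v) {a c e} → a ∈ tverts t → P e → Joins G e a c → Insert t c
    insert (leaf v) {c = c} {e} (here refl) p j = record
      { tree = graft (leaf v) e p j (leaf c)
      ; fwd = λ { (here q) → inj₂ (here q) ; (there (here q)) → inj₁ q }
      ; bwd = λ { (here q) → here q }
      ; new = there (here refl)
      ; uniqt = λ h _ → unique-∷ (λ { (here refl) → h (here refl) }) ([] ∷ [])
      ; grown = refl }
    insert (graft t e' p' j' t') {a} h p j with ∈-++⁻ (tverts t) h
    ... | inj₁ q = let I = insert t q p j in record
      { tree = graft (tree I) e' p' j' t'
      ; fwd = λ r → case ∈-++⁻ (tverts (tree I)) r of λ { (inj₁ s) → case fwd I s of λ { (inj₁ z) → inj₁ z ; (inj₂ z) → inj₂ (∈-++⁺ˡ z) } ; (inj₂ s) → inj₂ (∈-++⁺ʳ (tverts t) s) }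
      ; bwd = λ r → case ∈-++⁻ (tverts t) r of λ { (inj₁ s) → ∈-++⁺ˡ (bwd I s) ; (inj₂ s) → ∈-++⁺ʳ (tverts (tree I)) s }
      ; new = ∈-++⁺ˡ (new I)
      ; uniqt = λ n u → unique-++ (uniqt I (n ∘ ∈-++⁺ˡ) (unique-++ˡ _ u)) (unique-++ʳ (tverts t) u)
          λ r s → case fwd I r of λ { (inj₁ refl) → n (∈-++⁺ʳ (tverts t) s) ; (inj₂ z) → unique-++-disjoint (tverts t) u z s }
      ; grown = trans (length-++ (tverts (tree I))) (trans (cong (_+ length (tverts t')) (grown I)) (cong suc (sym (length-++ (tverts t))))) }
    ... | inj₂ q = let I = insert t' q p j in record
      { tree = graft t e' p' j' (tree I)
      ; fwd = λ r → case ∈-++⁻ (tverts t) r of λ { (inj₁ s) → inj₂ (∈-++⁺ˡ s) ; (inj₂ s) → case fwd I s of λ { (inj₁ z) → inj₁ z ; (inj₂ z) → inj₂ (∈-++⁺ʳ (tverts t) z) } }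
      ; bwd = λ r → case ∈-++⁻ (tverts t) r of λ { (inj₁ s) → ∈-++⁺ˡ s ; (inj₂ s) → ∈-++⁺ʳ (tverts t) (bwd I s) }
      ; new = ∈-++⁺ʳ (tverts t) (new I)
      ; uniqt = λ n u → unique-++ (unique-++ˡ _ u) (uniqt I (n ∘ ∈-++⁺ʳ (tverts t)) (unique-++ʳ (tverts t) u))
          λ r s → case fwd I s of λ { (inj₁ refl) → n (∈-++⁺ˡ r) ; (inj₂ z) → unique-++-disjoint (tverts t) u r z }
      ; grown = trans (length-++ (tverts t)) (trans (cong (length (tverts t) +_) (grown I)) (trans (+-suc _ _) (cong suc (sym (length-++ (tverts t)))))) }

  record Reach (S : ES) (u : V) : Set where
    field
      tree : RT (In S) u
      uniq : Unique (tverts tree)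
      closed : ∀ {e a b} → S e ≡ true → Joins G e a b → a ∈ tverts tree → b ∈ tverts tree
    set : VS
    set = mem (tverts tree)

    set-root : set u ≡ true
    set-root = ∈-mem (tverts tree) (root∈ tree)

    set-step : ∀ {e a b} → S e ≡ true → Joins G e a b → set a ≡ true → set b ≡ true
    set-step s j h = ∈-mem (tverts tree) (closed s j (mem-∈ (tverts tree) h))

    set-uncut : ∀ {e} → S e ≡ true → cut set e ≡ false
    set-uncut {e} s = ≢true⇒false λ h → let (a , b , j , p , q) = cut-orient set h in absurd (set-step s j p) q

    fromSet : ∀ {x} → set x ≡ true → Walk G (In S) x u
    fromSet h = weaken (tedges-P tree) (toRoot tree (mem-∈ (tverts tree) h))

  reach-raw : ∀ S u → Reach S u
  reach-raw S u = grow (nV G) (leaf u) ([] ∷ []) (m≤m+n (nV G) 1)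
    where
      advance : ∀ k (t : RT (In S) u) → Unique (tverts t) → nV G ≤ k + length (tverts t) → ∀ {e a c} → S e ≡ true → Joins G e a c → a ∈ tverts t → c ∉ tverts t → Reach S u
      grow : ∀ k (t : RT (In S) u) → Unique (tverts t) → nV G ≤ k + length (tverts t) → Reach S u
      grow k t uq h with search (λ e → S e ∧ cut (mem (tverts t)) e)
      ... | inj₂ none = record { tree = t ; uniq = uq ; closed = λ {e} {a} {b} s j a∈ → mem-∈ (tverts t) (≢false⇒true λ q →
              absurd (∧-intro s (trans (joins-cut (mem (tverts t)) j) (xor-trueˡ (∈-mem (tverts t) a∈) q))) (none e)) }
      ... | inj₁ (e , p) with cut-orient (mem (tverts t)) {e} (∧-right p)
      ...   | a , c , j , a∈ , c∉ = advance k t uq h (∧-left p) j (mem-∈ (tverts t) a∈) (mem-∉ (tverts t) c∉)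
      -- The fuel `k` bounds the number of vertices still missing. Once it is used up, the tree has
      -- all vertices, and a new one would make a repetition-free list longer than `nV G`.
      advance zero t uq h s j a∈ c∉ = ⊥-elim (ℕₚ.<-irrefl refl (≤-trans (s≤s h) (unique-length _ (unique-∷ c∉ uq))))
      advance (suc k) t uq h s j a∈ c∉ = let I = insert t a∈ s j in
        grow k (Insert.tree I) (Insert.uniqt I c∉ uq) (≤-trans h (≤-reflexive (trans (sym (+-suc k _)) (cong (k +_) (sym (Insert.grown I))))))

  abstract
    reach : ∀ S u → Reach S u
    reach = reach-raw

  reach-walk : ∀ {S u} (R : Reach S u) {x} → Walk G (In S) u x → Reach.set R x ≡ true
  reach-walk R w = go w (Reach.set-root R)
    where
      go : ∀ {a b} → Walk G (In _) a b → Reach.set R a ≡ true → Reach.set R b ≡ true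
      go here h = h
      go (wstep e p j w) h = go w (Reach.set-step R p j h)

-- Circuits as closed paths, and barbells built from two circuits and a walk.

module Cycles (G : SignedGraph) where
  open Walks G

  -- A simple path closed by one further edge `ce`. The trivial path gives a loop; `ce∉` matters for
  -- a path with one edge, where it excludes going back along the same edge.
  record Cyc : Set where
    field
      {ca cb} : V
      cpath : Walk G (λ _ → ⊤) ca cb
      cuniq : Unique (verts cpath)
      ce : E
      cj : Joins G ce cb ca
      ce∉ : ce ∉ edges cpath
    cverts : List V
    cverts = verts cpath
    cedges : List E
    cedges = ce ∷ edges cpath
  open Cyc public

  clen : Cyc → ℕ
  clen C = length (cedges C)

  clen-verts : ∀ C → length (cverts C) ≡ clen C
  clen-verts C = length-verts (cpath C)

  cedges-unique : ∀ C → Unique (cedges C)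
  cedges-unique C = unique-∷ (ce∉ C) (unique-edges (cpath C) (cuniq C))

  cedge-ends : ∀ C {e a b} → e ∈ cedges C → Joins G e a b → a ∈ cverts C × b ∈ cverts C
  cedge-ends C (here refl) k with joins-ends (cj C) k
  ... | inj₁ (refl , refl) = end∈ (cpath C) , start∈ (cpath C)
  ... | inj₂ (refl , refl) = start∈ (cpath C) , end∈ (cpath C)
  cedge-ends C (there h) k = edge-ends (cpath C) h k

  par-cut-cyc : ∀ (A : VS) C → par (cut A) (cedges C) ≡ false
  par-cut-cyc A C = trans (cong₂ _xor_ (joins-cut A (cj C)) (par-cut A (cpath C))) (cancel (A (cb C)) (A (ca C)))
    where
      cancel : ∀ a b → (a xor b) xor (b xor a) ≡ false
      cancel a b = xor-≡ (xor-comm a b)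

  even-cyc : ∀ C → Even (χ (cedges C))
  even-cyc C x = trans (χ-par (cut (isV x)) (cedges C)) (par-cut-cyc (isV x) C)

  cyc-inside : ∀ (A : VS) C → (∀ {e} → e ∈ cedges C → cut A e ≡ false) → ∀ {x y} → x ∈ cverts C → y ∈ cverts C → A x ≡ A y
  cyc-inside A C h x∈ y∈ = trans (toStart (cpath C) (h ∘ there) x∈) (sym (toStart (cpath C) (h ∘ there) y∈))
    where
      toStart : ∀ {u v x} (w : Walk G (λ _ → ⊤) u v) → (∀ {e} → e ∈ edges w → cut A e ≡ false) → x ∈ verts w → A x ≡ A u
      toStart here k (here refl) = refl
      toStart (wstep e p j w) k (here refl) = refl
      toStart (wstep e p j w) k (there q) = trans (toStart w (k ∘ there) q) (sym (xor-false (trans (sym (joins-cut A j)) (k (here refl)))))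

  module _ {P : E → Set} where

    vsW : ∀ {u v} (w : Walk G P u v) → Fin (suc (length (edges w))) → V
    vsW {u} w zero = u
    vsW (wstep e p j w) (suc i) = vsW w i

    -- A `Circuit` enumerates its closing edge last, whereas `cedges` lists it first.
    esC : ∀ {u v} (w : Walk G P u v) → E → Fin (suc (length (edges w))) → E
    esC here c zero = c
    esC (wstep e p j w) c zero = e
    esC (wstep e p j w) c (suc i) = esC w c i

    esW : ∀ {u v} (w : Walk G P u v) → Fin (length (edges w)) → E
    esW (wstep e p j w) zero = e
    esW (wstep e p j w) (suc i) = esW w i

    vsW-∈ : ∀ {u v} (w : Walk G P u v) i → vsW w i ∈ verts w
    vsW-∈ w zero = start∈ w
    vsW-∈ (wstep e p j w) (suc i) = there (vsW-∈ w i)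

    ∈-vsW : ∀ {u v} (w : Walk G P u v) {x} → x ∈ verts w → ∃ λ i → vsW w i ≡ x
    ∈-vsW here (here refl) = zero , refl
    ∈-vsW (wstep e p j w) (here refl) = zero , refl
    ∈-vsW (wstep e p j w) (there h) = let (i , q) = ∈-vsW w h in suc i , q

    vsW-inj : ∀ {u v} (w : Walk G P u v) → Unique (verts w) → Injective _≡_ _≡_ (vsW w)
    vsW-inj here uq {zero} {zero} h = refl
    vsW-inj (wstep e p j w) uq {zero} {zero} h = refl
    vsW-inj (wstep e p j w) uq {zero} {suc i} h = ⊥-elim (unique-head uq (subst (_∈ verts w) (sym h) (vsW-∈ w i)))
    vsW-inj (wstep e p j w) uq {suc i} {zero} h = ⊥-elim (unique-head uq (subst (_∈ verts w) h (vsW-∈ w i)))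
    vsW-inj (wstep e p j w) uq {suc i} {suc k} h = cong suc (vsW-inj w (unique-tail uq) h)

    vsW-end : ∀ {u v} (w : Walk G P u v) → vsW w (fromℕ (length (edges w))) ≡ v
    vsW-end here = refl
    vsW-end (wstep e p j w) = vsW-end w

    esW-∈ : ∀ {u v} (w : Walk G P u v) i → esW w i ∈ edges w
    esW-∈ (wstep e p j w) zero = here refl
    esW-∈ (wstep e p j w) (suc i) = there (esW-∈ w i)

    ∈-esW : ∀ {u v} (w : Walk G P u v) {x} → x ∈ edges w → ∃ λ i → esW w i ≡ x
    ∈-esW (wstep e p j w) (here refl) = zero , refl
    ∈-esW (wstep e p j w) (there h) = let (i , q) = ∈-esW w h in suc i , q

    esW-inj : ∀ {u v} (w : Walk G P u v) → Unique (edges w) → Injective _≡_ _≡_ (esW w)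
    esW-inj (wstep e p j w) uq {zero} {zero} h = refl
    esW-inj (wstep e p j w) uq {zero} {suc i} h = ⊥-elim (unique-head uq (subst (_∈ edges w) (sym h) (esW-∈ w i)))
    esW-inj (wstep e p j w) uq {suc i} {zero} h = ⊥-elim (unique-head uq (subst (_∈ edges w) h (esW-∈ w i)))
    esW-inj (wstep e p j w) uq {suc i} {suc k} h = cong suc (esW-inj w (unique-tail uq) h)

    esW-joins : ∀ {u v} (w : Walk G P u v) i → Joins G (esW w i) (vsW w (inject₁ i)) (vsW w (suc i))
    esW-joins (wstep e p j w) zero = j
    esW-joins (wstep e p j w) (suc i) = esW-joins w i

    esC-∈ : ∀ {u v} (w : Walk G P u v) c i → esC w c i ∈ c ∷ edges w
    esC-∈ here c zero = here refl
    esC-∈ (wstep e p j w) c zero = there (here refl)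
    esC-∈ (wstep e p j w) c (suc i) with esC-∈ w c i
    ... | here q = here q
    ... | there q = there (there q)

    ∈-esC : ∀ {u v} (w : Walk G P u v) c {x} → x ∈ c ∷ edges w → ∃ λ i → esC w c i ≡ x
    ∈-esC here c (here refl) = zero , refl
    ∈-esC (wstep e p j w) c (here refl) = let (i , q) = ∈-esC w c (here refl) in suc i , q
    ∈-esC (wstep e p j w) c (there (here refl)) = zero , refl
    ∈-esC (wstep e p j w) c (there (there h)) = let (i , q) = ∈-esC w c (there h) in suc i , q

    esC-inj : ∀ {u v} (w : Walk G P u v) c → Unique (c ∷ edges w) → Injective _≡_ _≡_ (esC w c)
    esC-inj here c uq {zero} {zero} h = refl
    esC-inj (wstep e p j w) c uq {zero} {zero} h = refl
    esC-inj (wstep e p j w) c uq {zero} {suc i} h = ⊥-elim (first w c uq (subst (_∈ c ∷ edges w) (sym h) (esC-∈ w c i)))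
      where
        first : ∀ {x v} (w : Walk G P x v) c → Unique (c ∷ e ∷ edges w) → e ∉ c ∷ edges w
        first w c uq (here refl) = unique-head uq (here refl)
        first w c uq (there h) = unique-head (unique-tail uq) h
    esC-inj (wstep e p j w) c uq {suc i} {zero} h = sym (esC-inj (wstep e p j w) c uq {zero} {suc i} (sym h))
    esC-inj (wstep e p j w) c uq {suc i} {suc k} h = cong suc (esC-inj w c (unique-∷ (unique-head uq ∘ there) (unique-tail (unique-tail uq))) h)

    esC-joins : ∀ {u v} (w : Walk G P u v) c (i : Fin (length (edges w))) → Joins G (esC w c (inject₁ i)) (vsW w (inject₁ i)) (vsW w (suc i))
    esC-joins (wstep e p j w) c zero = j
    esC-joins (wstep e p j w) c (suc i) = esC-joins w c i

    esC-close : ∀ {u v x} (w : Walk G P u v) c → Joins G c v x → Joins G (esC w c (fromℕ (length (edges w)))) (vsW w (fromℕ (length (edges w)))) x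
    esC-close here c k = k
    esC-close (wstep e p j w) c k = esC-close w c k

    ⨁-esC : ∀ (f : ES) {u v} (w : Walk G P u v) c → ⨁ (λ i → f (esC w c i)) ≡ par f (c ∷ edges w)
    ⨁-esC f here c = refl
    ⨁-esC f (wstep e p j w) c = trans (cong (f e xor_) (⨁-esC f w c)) (trans (sym (xor-assoc (f e) (f c) _))
      (trans (cong (_xor par f (edges w)) (xor-comm (f e) (f c))) (xor-assoc (f c) (f e) _)))

  toCircuit : Cyc → Circuit G
  toCircuit C = record
    { len = length (edges (cpath C)) ; vs = vsW (cpath C) ; es = esC (cpath C) (ce C)
    ; vs-inj = vsW-inj (cpath C) (cuniq C) ; es-inj = esC-inj (cpath C) (ce C) (cedges-unique C)
    ; step = esC-joins (cpath C) (ce C) ; close = esC-close (cpath C) (ce C) (cj C) }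

  onC-∈ : ∀ C {v} → OnC (toCircuit C) v → v ∈ cverts C
  onC-∈ C (i , refl) = vsW-∈ (cpath C) i

  ∈-onC : ∀ C {v} → v ∈ cverts C → OnC (toCircuit C) v
  ∈-onC C = ∈-vsW (cpath C)

  ∈-edgeOfC : ∀ C {e} → e ∈ cedges C → EdgeOfC (toCircuit C) e
  ∈-edgeOfC C = ∈-esC (cpath C) (ce C)

  negC-par : ∀ C → negC (toCircuit C) % 2 ≡ bN (par (neg G) (cedges C))
  negC-par C = trans (count-%2 (λ i → neg G (esC (cpath C) (ce C) i))) (cong bN (⨁-esC (neg G) (cpath C) (ce C)))

  toPath : ∀ {P u v} (w : Walk G P u v) → Unique (verts w) → Path G
  toPath w uq = record { plen = length (edges w) ; pv = vsW w ; pe = esW w ; pv-inj = vsW-inj w uq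
    ; pe-inj = esW-inj w (unique-edges w uq) ; pstep = esW-joins w }

  EdgeDisjoint : Cyc → Cyc → Set
  EdgeDisjoint C C' = ∀ {e} → e ∈ cedges C → e ∈ cedges C' → ⊥

  MeetOnce : Cyc → Cyc → Set
  MeetOnce C C' = ∀ {x y} → x ∈ cverts C → x ∈ cverts C' → y ∈ cverts C → y ∈ cverts C' → x ≡ y

  record Compat (C C' : Cyc) : Set where
    constructor compat
    field
      disjoint : EdgeDisjoint C C'
      once : MeetOnce C C'
  open Compat public

  compat-sym : ∀ {C C'} → Compat C C' → Compat C' C
  compat-sym (compat d o) = compat (λ p q → d q p) λ p q r s → o q p s r

  compat-disjoint : ∀ {C C'} → (∀ {x} → x ∈ cverts C → x ∈ cverts C' → ⊥) → Compat C C'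
  compat-disjoint {C} {C'} h = compat (λ {e} p q → h (proj₁ (cedge-ends C p (joins-self e))) (proj₁ (cedge-ends C' q (joins-self e)))) λ p q _ _ → ⊥-elim (h p q)

  balancedSC : ∀ C → par (neg G) (cedges C) ≡ false → SignedCircuit G
  balancedSC C h = balanced (toCircuit C) (trans (negC-par C) (cong bN h))

  -- Two estimates of the size: by the lengths of the circuits and of the walk, and by vertices,
  -- since a barbell of either form has exactly one edge more than it has vertices. The field
  -- `crosses` is the reason why barbells can cover separating edges.
  record Barbell {P s t} (C C' : Cyc) (w : Walk G P s t) : Set where
    field
      sc : SignedCircuit G
      cov : ∀ {e} → e ∈ cedges C ⊎ e ∈ cedges C' → e ∈SC sc
      size≤ : size sc ≤ clen C + clen C' + length (edges w)
      size≤verts : ∀ (L : List V) → (∀ {x} → x ∈ cverts C ⊎ x ∈ cverts C' ⊎ x ∈ verts w → x ∈ L) → size sc ≤ suc (length L)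
      crosses : ∀ (A : VS) → (∀ {x} → x ∈ cverts C → A x ≡ true) → (∀ {x} → x ∈ cverts C' → A x ≡ false) → ∃ λ e → cut A e ≡ true × e ∈SC sc

  barbell : ∀ {P s t} C C' (w : Walk G P s t) → Compat C C' → par (neg G) (cedges C) ≡ true → par (neg G) (cedges C') ≡ true →
    s ∈ cverts C → t ∈ cverts C' → Barbell C C' w
  barbell {P} {s} {t} C C' w cp u u' s∈ t∈ with anyL (mem (cverts C')) (cverts C)
  ... | inj₁ (v , v∈ , v∈m) = record
      { sc = short (toCircuit C) (toCircuit C') (ub C u) (ub C' u')
          (v , ∈-onC C v∈ , ∈-onC C' v∈' , λ x p q → once cp (onC-∈ C p) (onC-∈ C' q) v∈ v∈')
          λ i j q → disjoint cp (esC-∈ (cpath C) (ce C) i) (subst (_∈ cedges C') (sym q) (esC-∈ (cpath C') (ce C') j))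
      ; cov = λ { (inj₁ p) → inj₁ (∈-edgeOfC C p) ; (inj₂ p) → inj₂ (∈-edgeOfC C' p) }
      ; size≤ = m≤m+n _ _
      ; size≤verts = λ L h → ≤-trans (≤-reflexive (cong₂ _+_ (lenC C) (lenC C'))) (≤-trans (count-two-sets L h) (≤-trans (ℕₚ.+-monoˡ-≤ 1 (count-mem L)) (≤-reflexive (+-comm _ 1))))
      ; crosses = λ A p q → absurd (p v∈) (q v∈') }
    where
      ub : ∀ C → par (neg G) (cedges C) ≡ true → Unbalanced (toCircuit C)
      ub C h = trans (negC-par C) (cong bN h)
      v∈' = mem-∈ (cverts C') v∈m
      lenC : ∀ C → clen C ≡ count (mem (cverts C))
      lenC C = trans (sym (clen-verts C)) (sym (count-mem-unique (cverts C) (cuniq C)))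
      count-two-sets : ∀ L → (∀ {x} → x ∈ cverts C ⊎ x ∈ cverts C' ⊎ x ∈ verts w → x ∈ L) → count (mem (cverts C)) + count (mem (cverts C')) ≤ count (mem L) + 1
      count-two-sets L h = subst₂ _≤_ (trans (sumF-+ (bN ∘ mem (cverts C)) (bN ∘ mem (cverts C'))) (sym (cong₂ _+_ (count-sumF (mem (cverts C))) (count-sumF (mem (cverts C'))))))
          (trans (sumF-+ (bN ∘ mem L) (bN ∘ isV v)) (cong₂ _+_ (sym (count-sumF (mem L))) (trans (sym (count-sumF (isV v))) (count-isV v)))) (sumF-mono pt)
        where
          pt : ∀ x → bN (mem (cverts C) x) + bN (mem (cverts C') x) ≤ bN (mem L x) + bN (isV v x)
          pt x with bool-cases (mem (cverts C) x) | bool-cases (mem (cverts C') x)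
          ... | inj₂ p | inj₂ q rewrite p | q = z≤n
          ... | inj₁ p | inj₂ q rewrite p | q | ∈-mem L (h (inj₁ (mem-∈ (cverts C) p))) = s≤s z≤n
          ... | inj₂ p | inj₁ q rewrite p | q | ∈-mem L (h (inj₂ (inj₁ (mem-∈ (cverts C') q)))) = s≤s z≤n
          ... | inj₁ p | inj₁ q with once cp (mem-∈ (cverts C) p) (mem-∈ (cverts C') q) v∈ v∈'
          ...   | refl rewrite p | q | ∈-mem L (h (inj₁ (mem-∈ (cverts C) p))) | isV-refl x = ≤-refl
  ... | inj₂ apart with erase w
  ...   | s₀ , uq₀ with trimFront (mem (cverts C)) (walk s₀) (start∈ (walk s₀)) (∈-mem (cverts C) s∈)
  ...     | a , s₁ , a∈ , only-a with trimBack (mem (cverts C')) (walk s₁) (end∈ (walk s₁)) (∈-mem (cverts C') t∈)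
  ...       | b , s₂ , b∈ , only-b = record
      { sc = long (toCircuit C) (toCircuit C') (toPath r ur) (ub C u) (ub C' u')
          (λ x p q → absurd (∈-mem (cverts C') (onC-∈ C' q)) (apart (onC-∈ C p)))
          (∈-onC C (mem-∈ (cverts C) a∈)) (subst (OnC (toCircuit C')) (sym (vsW-end r)) (∈-onC C' (mem-∈ (cverts C') b∈)))
          (λ { i (inj₁ p) → inj₁ (vsW-inj r ur (a-only (vsW-∈ r i) (onC-∈ C p)))
             ; i (inj₂ p) → inj₂ (vsW-inj r ur (trans (only-b (vsW-∈ r i) (∈-mem (cverts C') (onC-∈ C' p))) (sym (vsW-end r)))) })
      ; cov = λ { (inj₁ p) → inj₁ (∈-edgeOfC C p) ; (inj₂ p) → inj₂ (inj₁ (∈-edgeOfC C' p)) }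
      ; size≤ = ℕₚ.+-monoʳ-≤ (clen C + clen C') (≤-trans (len≤ s₂) (≤-trans (len≤ s₁) (len≤ s₀)))
      ; size≤verts = λ L h → ℕₚ.≤-pred (≤-trans (≤-reflexive (trans (sym (+-suc (clen C + clen C') (length (edges r)))) (cong₂ _+_ (cong₂ _+_ (lenC C) (lenC C')) lenR))) (≤-trans (count-three-sets L h) (≤-trans (ℕₚ.+-monoˡ-≤ 2 (count-mem L)) (≤-reflexive (+-comm _ 2)))))
      ; crosses = λ A p q → let (e , _ , _ , e∈ , j , x , y , _) = crossing A r (p (mem-∈ (cverts C) a∈)) (q (mem-∈ (cverts C') b∈)) in
          e , trans (joins-cut A j) (xor-trueˡ x y) , inj₂ (inj₂ (∈-esW r e∈)) }
    where
      ub : ∀ C → par (neg G) (cedges C) ≡ true → Unbalanced (toCircuit C)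
      ub C h = trans (negC-par C) (cong bN h)
      lenC : ∀ C → clen C ≡ count (mem (cverts C))
      lenC C = trans (sym (clen-verts C)) (sym (count-mem-unique (cverts C) (cuniq C)))
      r = walk s₂
      ur = uniq s₂ (uniq s₁ uq₀)
      a-only : ∀ {x} → x ∈ verts r → x ∈ cverts C → x ≡ a
      a-only p q = only-a (vs⊆ s₂ p) (∈-mem (cverts C) q)
      lenR : suc (length (edges r)) ≡ count (mem (verts r))
      lenR = trans (sym (length-verts r)) (sym (count-mem-unique (verts r) ur))
      -- The excess 2 pays for the ends `a` and `b` of the path, the only vertices that lie on two
      -- of the three parts.
      count-three-sets : ∀ L → (∀ {x} → x ∈ cverts C ⊎ x ∈ cverts C' ⊎ x ∈ verts w → x ∈ L) → count (mem (cverts C)) + count (mem (cverts C')) + count (mem (verts r)) ≤ count (mem L) + 2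
      count-three-sets L h = subst₂ _≤_ (trans (sumF-+ (λ x → m₁ x + m₂ x) m₃) (trans (cong (_+ sumF m₃) (sumF-+ m₁ m₂)) (sym (cong₂ _+_ (cong₂ _+_ (count-sumF (mem (cverts C))) (count-sumF (mem (cverts C')))) (count-sumF (mem (verts r)))))))
          (trans (sumF-+ (bN ∘ mem L) (λ x → bN (isV a x) + bN (isV b x))) (cong₂ _+_ (sym (count-sumF (mem L))) (trans (sumF-+ (bN ∘ isV a) (bN ∘ isV b)) (cong₂ _+_ (one a) (one b))))) (sumF-mono pt)
        where
          m₁ m₂ m₃ : V → ℕ
          m₁ = bN ∘ mem (cverts C)
          m₂ = bN ∘ mem (cverts C')
          m₃ = bN ∘ mem (verts r)
          one : ∀ v → sumF (bN ∘ isV v) ≡ 1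
          one v = trans (sym (count-sumF (isV v))) (count-isV v)
          pt : ∀ x → m₁ x + m₂ x + m₃ x ≤ bN (mem L x) + (bN (isV a x) + bN (isV b x))
          pt x with bool-cases (mem (cverts C) x) | bool-cases (mem (cverts C') x) | bool-cases (mem (verts r) x)
          ... | inj₂ p | inj₂ q | inj₂ z rewrite p | q | z = z≤n
          ... | inj₂ p | inj₂ q | inj₁ z rewrite p | q | z | ∈-mem L (h (inj₂ (inj₂ (vs⊆ s₀ (vs⊆ s₁ (vs⊆ s₂ (mem-∈ (verts r) z))))))) = s≤s z≤n
          ... | inj₁ p | inj₁ q | _ = absurd q (apart (mem-∈ (cverts C) p))
          ... | inj₁ p | inj₂ q | inj₂ z rewrite p | q | z | ∈-mem L (h (inj₁ (mem-∈ (cverts C) p))) = s≤s z≤n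
          ... | inj₂ p | inj₁ q | inj₂ z rewrite p | q | z | ∈-mem L (h (inj₂ (inj₁ (mem-∈ (cverts C') q)))) = s≤s z≤n
          ... | inj₁ p | inj₂ q | inj₁ z with a-only (mem-∈ (verts r) z) (mem-∈ (cverts C) p)
          ...   | refl rewrite p | q | z | ∈-mem L (h (inj₁ (mem-∈ (cverts C) p))) | isV-refl x = s≤s (s≤s z≤n)
          pt x | inj₂ p | inj₁ q | inj₁ z with only-b (mem-∈ (verts r) z) q
          ...   | refl rewrite p | q | z | ∈-mem L (h (inj₂ (inj₁ (mem-∈ (cverts C') q)))) | isV-refl x = s≤s (≤-trans (s≤s z≤n) (m≤n+m 1 _))

-- Decomposition of even sets into balanced circuits and compatible unbalanced ones.

module Decompose (G : SignedGraph) where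
  open Walks G
  open Cycles G

  Free : E → Set
  Free _ = ⊤

  ⊕χ-in : ∀ {S : ES} l {e} → (∀ {e} → e ∈ l → S e ≡ true) → (S ⊕ χ l) e ≡ true → S e ≡ true
  ⊕χ-in {S} l {e} h k with bool-cases (χ l e)
  ... | inj₁ p = h (χ-∈ l p)
  ... | inj₂ p = trans (sym (xor-identityʳ (S e))) (trans (cong (S e xor_) (sym p)) k)

  ⊕χ-split : ∀ {S : ES} l {e} → S e ≡ true → (S ⊕ χ l) e ≡ true ⊎ e ∈ l
  ⊕χ-split l {e} h with bool-cases (χ l e)
  ... | inj₁ p = inj₂ (χ-∈ l p)
  ... | inj₂ p = inj₁ (xor-trueˡ h p)

  ⊕χ-out : ∀ {S : ES} l {e} → Unique l → (∀ {e} → e ∈ l → S e ≡ true) → (S ⊕ χ l) e ≡ true → e ∉ l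
  ⊕χ-out l uq h k q = absurd k (xor-≡ (trans (h q) (sym (χ-unique l uq q))))

  delete : ES → E → ES
  delete S e e' = S e' ∧ not (isV e e')

  delete-⊆ : ∀ {S e e'} → delete S e e' ≡ true → S e' ≡ true
  delete-⊆ = ∧-left

  delete-≢ : ∀ {S e e'} → delete S e e' ≡ true → e' ≢ e
  delete-≢ {S} {e} {e'} h refl = absurd (isV-refl e) (not-true (∧-right {S e} h))

  delete-in : ∀ {S e e'} → S e' ≡ true → e' ≢ e → delete S e e' ≡ true
  delete-in h n = ∧-intro h (not-intro (isV-false (n ∘ sym)))

  closeWalk : ∀ {S : ES} {e u v} → Joins G e u v → S e ≡ true → Walk G (In (delete S e)) v u → Σ Cyc λ C → (∀ {e'} → e' ∈ cedges C → S e' ≡ true) × e ∈ cedges C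
  closeWalk {S} {e} {u} {v} j s w = C , (λ { (here refl) → s ; (there h) → delete-⊆ {S} (edges-P w (in-w h)) }) , here refl
    where
      er = erase w
      p = weaken {Q = Free} (λ _ → tt) (walk (proj₁ er))
      in-w : ∀ {e'} → e' ∈ edges p → e' ∈ edges w
      in-w h = es⊆ (proj₁ er) (subst (_ ∈_) (mapW-edges (walk (proj₁ er)) _) h)
      C : Cyc
      C = record { cpath = p ; cuniq = subst Unique (sym (mapW-verts (walk (proj₁ er)) _)) (proj₂ er) ; ce = e ; cj = j
                 ; ce∉ = λ h → delete-≢ {S} (edges-P w (in-w h)) refl }

  -- By parity the edge e of an even set cannot be its only edge leaving the component of one end of e in the rest.
  evenWalk : ∀ {S : ES} → Even S → ∀ {e u v} → S e ≡ true → Joins G e u v → Walk G (In (delete S e)) v u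
  evenWalk {S} ev {e} {u} {v} s j with bool-cases (Reach.set R v)
    where R = reach (delete S e) u
  ... | inj₁ p = Reach.fromSet (reach (delete S e) u) p
  ... | inj₂ p = let R = reach (delete S e) u
                     (e' , ne , s' , c') = even-second ev (Reach.set R) s (trans (joins-cut (Reach.set R) j) (xor-trueˡ (Reach.set-root R) p))
                 in absurd c' (Reach.set-uncut R (delete-in {S} s' ne))

  findCyc : ∀ {S : ES} → Even S → ∀ {e} → S e ≡ true → Σ Cyc λ C → (∀ {e'} → e' ∈ cedges C → S e' ≡ true) × e ∈ cedges C
  findCyc ev {e} s = closeWalk (joins-self e) s (evenWalk ev s (joins-self e))

  parL : ES → List Cyc → Bool
  parL w [] = false
  parL w (C ∷ cs) = par w (cedges C) xor parL w cs

  ⨁-remove : ∀ (S : ES) l w → ⨁ (λ e → S e ∧ w e) ≡ par w l xor ⨁ (λ e → (S ⊕ χ l) e ∧ w e)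
  ⨁-remove S l w = trans (⨁-cong λ e → trans (cong (_∧ w e) (pt (S e) (χ l e))) (∧-distribʳ-xor (w e) (χ l e) (S e xor χ l e)))
    (trans (⨁-⊕ (λ e → χ l e ∧ w e) (λ e → (S ⊕ χ l) e ∧ w e)) (cong (_xor ⨁ (λ e → (S ⊕ χ l) e ∧ w e)) (χ-par w l)))
    where
      pt : ∀ s c → s ≡ c xor (s xor c)
      pt true true = refl
      pt true false = refl
      pt false true = refl
      pt false false = refl

  -- The field `parity` holds for every weight `w`. With the signs of one component as the weight,
  -- it later decides whether the number of unbalanced circuits there is even.
  record Decomp (S : ES) : Set where
    field
      cs : List Cyc
      inS : ∀ {C} → C ∈ cs → ∀ {e} → e ∈ cedges C → S e ≡ true
      cover : ∀ {e} → S e ≡ true → Σ Cyc λ C → C ∈ cs × e ∈ cedges C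
      total : sum (map clen cs) ≡ count S
      disj : AllPairs EdgeDisjoint cs
      parity : ∀ w → ⨁ (λ e → S e ∧ w e) ≡ parL w cs

  decompose-raw : ∀ S → Even S → Decomp S
  decompose-raw S ev = go S ev (<-wellFounded (count S))
    where
      go : ∀ S → Even S → Acc _<_ (count S) → Decomp S
      go S ev (acc rs) with search S
      ... | inj₂ none = record { cs = [] ; inS = λ () ; cover = λ {e} s → absurd s (none e)
              ; total = sym (trans (count-cong none) (count-false {nE G})) ; disj = []
              ; parity = λ w → ⨁-false λ e → ∧-falseˡ (none e) }
      ... | inj₁ (e₀ , s₀) = record
              { cs = C ∷ cs D
              ; inS = λ { (here refl) → C⊆ ; (there h) p → ⊕χ-in (cedges C) C⊆ (inS D h p) }
              ; cover = λ s → case ⊕χ-split {S} (cedges C) s of λ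
                  { (inj₁ p) → let (C' , h , q) = cover D p in C' , there h , q ; (inj₂ p) → C , here refl , p }
              ; total = trans (cong (clen C +_) (total D)) (sym eq)
              ; disj = All.tabulate (λ {C'} h {e} p q → ⊕χ-out {S} (cedges C) (cedges-unique C) C⊆ (inS D h q) p) ∷ disj D
              ; parity = λ w → trans (⨁-remove S (cedges C) w) (cong (par w (cedges C) xor_) (parity D w)) }
        where
          open Decomp
          C = proj₁ (findCyc ev s₀)
          C⊆ : ∀ {e} → e ∈ cedges C → S e ≡ true
          C⊆ = proj₁ (proj₂ (findCyc ev s₀))
          eq : count S ≡ clen C + count (S ⊕ χ (cedges C))
          eq = count-χ S (cedges C) (cedges-unique C) λ e → C⊆
          D = go (S ⊕ χ (cedges C)) (even-⊕ {S} ev (even-cyc C)) (rs (≤-trans (s≤s (m≤n+m _ _)) (≤-reflexive (sym eq))))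

  abstract
    decompose : ∀ S → Even S → Decomp S
    decompose = decompose-raw

  record Split {P u v} (w : Walk G P u v) (x : V) : Set where
    field
      fst : Sub w u x
      snd : Sub w x v
      eqn : edges w ≡ edges (walk fst) ++ edges (walk snd)
      vsplit : ∀ {z} → z ∈ verts w → z ∈ verts (walk fst) ⊎ z ∈ verts (walk snd)
      meet : Unique (verts w) → ∀ {z} → z ∈ verts (walk fst) → z ∈ verts (walk snd) → z ≡ x

  splitW : ∀ {P u v} (w : Walk G P u v) {x} → x ∈ verts w → Split w x
  splitW here (here refl) = record { fst = sub-refl here ; snd = sub-refl here ; eqn = refl ; vsplit = inj₁ ; meet = λ { _ (here q) _ → q } }
  splitW w@(wstep e p j w') (here refl) = record { fst = prefix w (here refl) ; snd = sub-refl w ; eqn = refl ; vsplit = inj₂ ; meet = λ { _ (here q) _ → q } }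
  splitW (wstep e p j w) (there h) = record
    { fst = extend (fst S) ; snd = sub-step (snd S) ; eqn = cong (e ∷_) (eqn S)
    ; vsplit = λ { (here q) → inj₁ (here q) ; (there q) → case vsplit S q of λ { (inj₁ r) → inj₁ (there r) ; (inj₂ r) → inj₂ r } }
    ; meet = λ { uq (here refl) q → ⊥-elim (unique-head uq (vs⊆ (snd S) q)) ; uq (there r) q → meet S (unique-tail uq) r q } }
    where
      open Split
      S = splitW w h

  unique-⟫ : ∀ {P : E → Set} {u v x} (w : Walk G P u v) (w' : Walk G P v x) → Unique (verts w) → Unique (verts w') →
    (∀ {z} → z ∈ verts w → z ∈ verts w' → z ≡ v) → Unique (verts (w ⟫ w'))
  unique-⟫ here w' uq uq' h = uq'
  unique-⟫ (wstep e p j w) w' uq uq' h = unique-∷ (λ q → case verts-⟫ w w' q of λ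
      { (inj₁ r) → unique-head uq r ; (inj₂ r) → unique-head uq (subst (_∈ verts w) (sym (h (here refl) r)) (end∈ w)) })
    (unique-⟫ w w' (unique-tail uq) uq' (h ∘ there))

  rev-verts : ∀ {P : E → Set} {u v} (w : Walk G P u v) {z} → z ∈ verts (rev w) → z ∈ verts w
  rev-verts here h = h
  rev-verts (wstep e p j w) h with verts-⟫ (rev w) (wstep e p (joins-sym j) here) h
  ... | inj₁ q = there (rev-verts w q)
  ... | inj₂ (here q) = there (subst (_∈ verts w) (sym q) (start∈ w))
  ... | inj₂ (there (here q)) = here q

  unique-rev : ∀ {P : E → Set} {u v} (w : Walk G P u v) → Unique (verts w) → Unique (verts (rev w))
  unique-rev here uq = uq
  unique-rev (wstep {u = u} {w = x} e p j w) uq = unique-⟫ (rev w) _ (unique-rev w (unique-tail uq))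
    (unique-∷ (λ { (here refl) → unique-head uq (start∈ w) }) ([] ∷ []))
    λ { q (here r) → r ; q (there (here refl)) → ⊥-elim (unique-head uq (rev-verts w q)) }

  par-rev : ∀ {P : E → Set} σ {u v} (w : Walk G P u v) → par σ (edges (rev w)) ≡ par σ (edges w)
  par-rev σ here = refl
  par-rev σ (wstep e p j w) = trans (cong (par σ) (edges-⟫ (rev w) _)) (trans (par-++ σ (edges (rev w)) (e ∷ []))
    (trans (cong₂ _xor_ (par-rev σ w) (xor-identityʳ (σ e))) (xor-comm (par σ (edges w)) (σ e))))

  record Arcs (σ : ES) (C : Cyc) (q x : V) : Set where
    field
      A₁ A₂ : Walk G Free q x
      u₁ : Unique (verts A₁)
      u₂ : Unique (verts A₂)
      v₁ : ∀ {z} → z ∈ verts A₁ → z ∈ cverts C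
      v₂ : ∀ {z} → z ∈ verts A₂ → z ∈ cverts C
      e₁ : ∀ {e} → e ∈ edges A₁ → e ∈ cedges C
      e₂ : ∀ {e} → e ∈ edges A₂ → e ∈ cedges C
      sumpar : par σ (edges A₁) xor par σ (edges A₂) ≡ par σ (cedges C)

  private
    shuffle : ∀ a b₁ b₂ c → b₁ xor (b₂ xor (c xor a)) ≡ c xor (a xor (b₁ xor b₂))
    shuffle true true true true = refl
    shuffle true true true false = refl
    shuffle true true false true = refl
    shuffle true true false false = refl
    shuffle true false true true = refl
    shuffle true false true false = refl
    shuffle true false false true = refl
    shuffle true false false false = refl
    shuffle false true true true = refl
    shuffle false true true false = refl
    shuffle false true false true = refl
    shuffle false true false false = refl
    shuffle false false true true = refl
    shuffle false false true false = refl
    shuffle false false false true = refl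
    shuffle false false false false = refl

    shuffle' : ∀ a₁ a₂ b c → a₂ xor (a₁ xor (c xor b)) ≡ c xor ((a₁ xor a₂) xor b)
    shuffle' true a₂ b c = helper a₂ b c
      where
        helper : ∀ a₂ b c → a₂ xor (true xor (c xor b)) ≡ c xor ((true xor a₂) xor b)
        helper true true true = refl
        helper true true false = refl
        helper true false true = refl
        helper true false false = refl
        helper false true true = refl
        helper false true false = refl
        helper false false true = refl
        helper false false false = refl
    shuffle' false true true true = refl
    shuffle' false true true false = refl
    shuffle' false true false true = refl
    shuffle' false true false false = refl
    shuffle' false false true true = refl
    shuffle' false false true false = refl
    shuffle' false false false true = refl
    shuffle' false false false false = refl

  arcs : ∀ σ C {q x} → x ∈ cverts C → q ∈ cverts C → q ≢ x → Arcs σ C q x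
  arcs σ C {q} {x} x∈ q∈ q≢x with splitW (cpath C) x∈
  ... | s with Split.vsplit s q∈
  ...   | inj₂ q∈b = record
      { A₁ = rev b₁ ; A₂ = b₂ ⟫ wstep (ce C) tt (cj C) a
      ; u₁ = unique-rev b₁ (uniq (fst t) ub)
      ; u₂ = unique-⟫ b₂ _ (uniq (snd t) ub) (unique-∷ cb∉a ua) λ { p (here r) → r ; p (there r) → ⊥-elim (apart p r) }
      ; v₁ = λ p → vs⊆ (snd s) (vs⊆ (fst t) (rev-verts b₁ p))
      ; v₂ = λ p → case verts-⟫ b₂ (wstep (ce C) tt (cj C) a) p of λ
          { (inj₁ r) → vs⊆ (snd s) (vs⊆ (snd t) r) ; (inj₂ (here r)) → subst (_∈ cverts C) (sym r) (end∈ (cpath C)) ; (inj₂ (there r)) → vs⊆ (fst s) r }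
      ; e₁ = λ p → there (es⊆ (snd s) (es⊆ (fst t) (rev-edges b₁ p)))
      ; e₂ = λ p → case ∈-++⁻ (edges b₂) (subst (_ ∈_) (edges-⟫ b₂ _) p) of λ
          { (inj₁ r) → there (es⊆ (snd s) (es⊆ (snd t) r)) ; (inj₂ (here r)) → here r ; (inj₂ (there r)) → there (es⊆ (fst s) r) }
      ; sumpar = begin
          par σ (edges (rev b₁)) xor par σ (edges (b₂ ⟫ wstep (ce C) tt (cj C) a))
            ≡⟨ cong₂ _xor_ (par-rev σ b₁) (trans (cong (par σ) (edges-⟫ b₂ _)) (par-++ σ (edges b₂) _)) ⟩
          par σ (edges b₁) xor (par σ (edges b₂) xor (σ (ce C) xor par σ (edges a))) ≡⟨ shuffle (par σ (edges a)) (par σ (edges b₁)) (par σ (edges b₂)) (σ (ce C)) ⟩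
          σ (ce C) xor (par σ (edges a) xor (par σ (edges b₁) xor par σ (edges b₂)))
            ≡⟨ cong (σ (ce C) xor_) (sym (trans (cong (par σ) (eqn s)) (trans (par-++ σ (edges a) _) (cong (par σ (edges a) xor_) (trans (cong (par σ) (eqn t)) (par-++ σ (edges b₁) _)))))) ⟩
          par σ (cedges C) ∎ }
    where
      open ≡-Reasoning
      open Split
      a = walk (fst s)
      b = walk (snd s)
      t = splitW b q∈b
      b₁ = walk (fst t)
      b₂ = walk (snd t)
      ua = uniq (fst s) (cuniq C)
      ub = uniq (snd s) (cuniq C)
      apart : ∀ {z} → z ∈ verts b₂ → z ∈ verts a → ⊥
      apart p r with meet s (cuniq C) r (vs⊆ (snd t) p)
      ... | refl = q≢x (sym (meet t ub (start∈ b₁) p))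
      cb∉a : cb C ∉ verts a
      cb∉a r = apart (end∈ b₂) r
  ...   | inj₁ q∈a = record
      { A₁ = a₂ ; A₂ = rev a₁ ⟫ wstep (ce C) tt (joins-sym (cj C)) (rev b)
      ; u₁ = uniq (snd t) ua
      ; u₂ = unique-⟫ (rev a₁) _ (unique-rev a₁ (uniq (fst t) ua)) (unique-∷ (λ r → apart (start∈ a₁) (rev-verts b r)) (unique-rev b ub))
          λ { p (here r) → r ; p (there r) → ⊥-elim (apart (rev-verts a₁ p) (rev-verts b r)) }
      ; v₁ = λ p → vs⊆ (fst s) (vs⊆ (snd t) p)
      ; v₂ = λ p → case verts-⟫ (rev a₁) (wstep (ce C) tt (joins-sym (cj C)) (rev b)) p of λ
          { (inj₁ r) → vs⊆ (fst s) (vs⊆ (fst t) (rev-verts a₁ r)) ; (inj₂ (here r)) → subst (_∈ cverts C) (sym r) (start∈ (cpath C))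
          ; (inj₂ (there r)) → vs⊆ (snd s) (rev-verts b r) }
      ; e₁ = λ p → there (es⊆ (fst s) (es⊆ (snd t) p))
      ; e₂ = λ p → case ∈-++⁻ (edges (rev a₁)) (subst (_ ∈_) (edges-⟫ (rev a₁) _) p) of λ
          { (inj₁ r) → there (es⊆ (fst s) (es⊆ (fst t) (rev-edges a₁ r))) ; (inj₂ (here r)) → here r ; (inj₂ (there r)) → there (es⊆ (snd s) (rev-edges b r)) }
      ; sumpar = begin
          par σ (edges a₂) xor par σ (edges (rev a₁ ⟫ wstep (ce C) tt (joins-sym (cj C)) (rev b)))
            ≡⟨ cong (par σ (edges a₂) xor_) (trans (cong (par σ) (edges-⟫ (rev a₁) _)) (trans (par-++ σ (edges (rev a₁)) _) (cong₂ _xor_ (par-rev σ a₁) (cong (σ (ce C) xor_) (par-rev σ b))))) ⟩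
          par σ (edges a₂) xor (par σ (edges a₁) xor (σ (ce C) xor par σ (edges b))) ≡⟨ shuffle' (par σ (edges a₁)) (par σ (edges a₂)) (par σ (edges b)) (σ (ce C)) ⟩
          σ (ce C) xor ((par σ (edges a₁) xor par σ (edges a₂)) xor par σ (edges b))
            ≡⟨ cong (σ (ce C) xor_) (sym (trans (cong (par σ) (eqn s)) (trans (par-++ σ (edges a) _) (cong (_xor par σ (edges b)) (trans (cong (par σ) (eqn t)) (par-++ σ (edges a₁) _)))))) ⟩
          par σ (cedges C) ∎ }
    where
      open ≡-Reasoning
      open Split
      a = walk (fst s)
      b = walk (snd s)
      t = splitW a q∈a
      a₁ = walk (fst t)
      a₂ = walk (snd t)
      ua = uniq (fst s) (cuniq C)
      ub = uniq (snd s) (cuniq C)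
      apart : ∀ {z} → z ∈ verts a₁ → z ∈ verts b → ⊥
      apart p r with meet s (cuniq C) (vs⊆ (fst t) p) r
      ... | refl = q≢x (sym (meet t ua p (end∈ a₂)))

  -- A theta graph contains a balanced circuit: two of its three paths have equal sign.
  theta-raw : ∀ σ C C' → EdgeDisjoint C C' → ∀ {x y} → x ≢ y → x ∈ cverts C → x ∈ cverts C' → y ∈ cverts C → y ∈ cverts C' →
    par σ (cedges C) ≡ true → Σ Cyc λ B → par σ (cedges B) ≡ false × (∀ {e} → e ∈ cedges B → e ∈ cedges C ⊎ e ∈ cedges C')
  theta-raw σ C C' dj {x} {y} x≢y x∈ x∈' y∈ y∈' odd
    -- The ear: a path of `C'` that starts at `x` and is cut at its next vertex on `C`. It exists
    -- because the path ends at `y`, which lies on `C` and differs from `x`.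
    with trimBack (λ z → mem (cverts C) z ∧ not (isV x z)) (walk path) (end∈ (walk path)) (∧-intro (∈-mem (cverts C) y∈) (not-intro (isV-false x≢y)))
    where
      s = splitW (cpath C') x∈'
      t = splitW (cpath C') y∈'
      xy = rev (walk (Split.fst s)) ⟫ walk (Split.fst t)
      path = proj₁ (erase xy)
  ... | b , ear , b∈ , only = shut (walk ear) (uniq ear (proj₂ (erase xy))) (es⊆C' ∘ es⊆ ear)
      λ {z} p q → case bool-cases (isV x z) of λ { (inj₁ r) → inj₁ (sym (isV-true r)) ; (inj₂ r) → inj₂ (only p (∧-intro (∈-mem (cverts C) q) (not-intro r))) }
    where
      s = splitW (cpath C') x∈'
      t = splitW (cpath C') y∈'
      xy = rev (walk (Split.fst s)) ⟫ walk (Split.fst t)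
      b≢x : b ≢ x
      b≢x refl = absurd (isV-refl b) (not-true (∧-right {mem (cverts C) b} b∈))
      es⊆C' : ∀ {e} → e ∈ edges (walk (proj₁ (erase xy))) → e ∈ cedges C'
      es⊆C' p with ∈-++⁻ (edges (rev (walk (Split.fst s)))) (subst (_ ∈_) (edges-⟫ (rev (walk (Split.fst s))) _) (es⊆ (proj₁ (erase xy)) p))
      ... | inj₁ r = there (es⊆ (Split.fst s) (rev-edges (walk (Split.fst s)) r))
      ... | inj₂ r = there (es⊆ (Split.fst t) r)
      arc : Arcs σ C b x
      arc = arcs σ C x∈ (mem-∈ (cverts C) (∧-left b∈)) b≢x
      pick : ∀ e w a₁ a₂ → a₁ xor a₂ ≡ true → (e xor (w xor a₁) ≡ false) ⊎ (e xor (w xor a₂) ≡ false)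
      pick true true true false h = inj₂ refl
      pick true true false true h = inj₁ refl
      pick true false true false h = inj₁ refl
      pick true false false true h = inj₂ refl
      pick false true true false h = inj₁ refl
      pick false true false true h = inj₂ refl
      pick false false true false h = inj₂ refl
      pick false false false true h = inj₁ refl
      shut : (w : Walk G Free x b) → Unique (verts w) → (∀ {e} → e ∈ edges w → e ∈ cedges C') → (∀ {z} → z ∈ verts w → z ∈ cverts C → z ≡ x ⊎ z ≡ b) →
        Σ Cyc λ B → par σ (cedges B) ≡ false × (∀ {e} → e ∈ cedges B → e ∈ cedges C ⊎ e ∈ cedges C')
      shut here _ _ _ = ⊥-elim (b≢x refl)
      shut (wstep e p j w) uq inC' ends∈ = case pick (σ e) (par σ (edges w)) _ _ (trans (Arcs.sumpar arc) odd) of λ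
          { (inj₁ h) → cyc (Arcs.A₁ arc) (Arcs.u₁ arc) (Arcs.v₁ arc) (Arcs.e₁ arc) , trans (parity (Arcs.A₁ arc)) h , λ {e'} → inB (Arcs.A₁ arc) (Arcs.e₁ arc) {e'}
          ; (inj₂ h) → cyc (Arcs.A₂ arc) (Arcs.u₂ arc) (Arcs.v₂ arc) (Arcs.e₂ arc) , trans (parity (Arcs.A₂ arc)) h , λ {e'} → inB (Arcs.A₂ arc) (Arcs.e₂ arc) {e'} }
        where
          parity : ∀ (A : Walk G Free b x) → par σ (e ∷ edges (w ⟫ A)) ≡ σ e xor (par σ (edges w) xor par σ (edges A))
          parity A = cong (σ e xor_) (trans (cong (par σ) (edges-⟫ w A)) (par-++ σ (edges w) (edges A)))
          cyc : (A : Walk G Free b x) → Unique (verts A) → (∀ {z} → z ∈ verts A → z ∈ cverts C) → (∀ {e} → e ∈ edges A → e ∈ cedges C) → Cyc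
          cyc A uA vA eA = record
            { cpath = w ⟫ A
            ; cuniq = unique-⟫ w A (unique-tail uq) uA λ p q → case ends∈ (there p) (vA q) of λ
                { (inj₁ refl) → ⊥-elim (unique-head uq p) ; (inj₂ r) → r }
            ; ce = e ; cj = j
            ; ce∉ = λ h → case ∈-++⁻ (edges w) (subst (_ ∈_) (edges-⟫ w A) h) of λ
                { (inj₁ r) → unique-head (unique-edges (wstep e p j w) uq) r ; (inj₂ r) → dj (eA r) (inC' (here refl)) } }
          inB : (A : Walk G Free b x) → (∀ {e} → e ∈ edges A → e ∈ cedges C) → ∀ {e'} → e' ∈ e ∷ edges (w ⟫ A) → e' ∈ cedges C ⊎ e' ∈ cedges C'
          inB A eA (here refl) = inj₂ (inC' (here refl))
          inB A eA (there h) with ∈-++⁻ (edges w) (subst (_ ∈_) (edges-⟫ w A) h)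
          ... | inj₁ r = inj₂ (inC' (there r))
          ... | inj₂ r = inj₁ (eA r)

  abstract
    theta : ∀ σ C C' → EdgeDisjoint C C' → ∀ {x y} → x ≢ y → x ∈ cverts C → x ∈ cverts C' → y ∈ cverts C → y ∈ cverts C' →
      par σ (cedges C) ≡ true → Σ Cyc λ B → par σ (cedges B) ≡ false × (∀ {e} → e ∈ cedges B → e ∈ cedges C ⊎ e ∈ cedges C')
    theta = theta-raw

  meetOnce? : ∀ C C' → MeetOnce C C' ⊎ Σ V λ x → Σ V λ y → x ≢ y × (x ∈ cverts C × x ∈ cverts C') × (y ∈ cverts C × y ∈ cverts C')
  meetOnce? C C' with search common
    where
      common : VS
      common x = mem (cverts C) x ∧ mem (cverts C') x
  ... | inj₂ none = inj₁ λ p q _ _ → absurd (∧-intro (∈-mem (cverts C) p) (∈-mem (cverts C') q)) (none _)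
  ... | inj₁ (x , xc) with search (λ y → (mem (cverts C) y ∧ mem (cverts C') y) ∧ not (isV x y))
  ...   | inj₁ (y , yc) = inj₂ (x , y , (λ { refl → absurd (isV-refl x) (not-true (∧-right {mem (cverts C) x ∧ mem (cverts C') x} yc)) }) ,
            both x xc , both y (∧-left yc))
    where
      both : ∀ z → mem (cverts C) z ∧ mem (cverts C') z ≡ true → z ∈ cverts C × z ∈ cverts C'
      both z h = mem-∈ (cverts C) (∧-left h) , mem-∈ (cverts C') (∧-right {mem (cverts C) z} h)
  ...   | inj₂ none = inj₁ λ p q r s → trans (same p q) (sym (same r s))
    where
      same : ∀ {z} → z ∈ cverts C → z ∈ cverts C' → z ≡ x
      same {z} p q with bool-cases (isV x z)
      ... | inj₁ h = sym (isV-true h)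
      ... | inj₂ h = absurd (∧-intro (∧-intro (∈-mem (cverts C) p) (∈-mem (cverts C') q)) (not-intro h)) (none z)

  Bad : Cyc → Cyc → Set
  Bad C C' = EdgeDisjoint C C' × Σ V λ x → Σ V λ y → x ≢ y × (x ∈ cverts C × x ∈ cverts C') × (y ∈ cverts C × y ∈ cverts C')

  allCompat? : ∀ l → AllPairs EdgeDisjoint l → AllPairs Compat l ⊎ Σ Cyc λ C → Σ Cyc λ C' → C ∈ l × C' ∈ l × Bad C C'
  allCompat? [] [] = inj₁ []
  allCompat? (C ∷ l) (d ∷ ds) with allCompat? l ds
  ... | inj₂ (B , B' , p , q , b) = inj₂ (B , B' , there p , there q , b)
  ... | inj₁ ok with one l d
    where
      one : ∀ l → All (EdgeDisjoint C) l → All (Compat C) l ⊎ Σ Cyc λ C' → C' ∈ l × Bad C C'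
      one [] [] = inj₁ []
      one (C' ∷ l) (d ∷ ds) with meetOnce? C C' | one l ds
      ... | inj₂ b | _ = inj₂ (C' , here refl , d , b)
      ... | inj₁ m | inj₁ a = inj₁ (compat d m ∷ a)
      ... | inj₁ m | inj₂ (B , p , b) = inj₂ (B , there p , b)
  ...   | inj₁ a = inj₁ (a ∷ ok)
  ...   | inj₂ (B , p , b) = inj₂ (C , B , here refl , there p , b)

  record Parts (σ : ES) (cs : List Cyc) : Set where
    field
      bs ds : List Cyc
      bal : ∀ {C} → C ∈ bs → par σ (cedges C) ≡ false
      unb : ∀ {C} → C ∈ ds → par σ (cedges C) ≡ true
      fromB : ∀ {C} → C ∈ bs → C ∈ cs
      fromD : ∀ {C} → C ∈ ds → C ∈ cs
      to : ∀ {C} → C ∈ cs → C ∈ bs ⊎ C ∈ ds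
      total : sum (map clen bs) + sum (map clen ds) ≡ sum (map clen cs)
      disj : AllPairs EdgeDisjoint cs → AllPairs EdgeDisjoint ds
      parity : ∀ w → parL w bs xor parL w ds ≡ parL w cs

  partition-raw : ∀ σ cs → Parts σ cs
  partition-raw σ [] = record { bs = [] ; ds = [] ; bal = λ () ; unb = λ () ; fromB = λ () ; fromD = λ () ; to = λ () ; total = refl ; disj = λ _ → [] ; parity = λ _ → refl }
  partition-raw σ (C ∷ cs) with bool-cases (par σ (cedges C)) | partition-raw σ cs
  ... | inj₂ h | p = record
      { bs = C ∷ bs ; ds = ds ; bal = λ { (here refl) → h ; (there q) → bal q } ; unb = unb
      ; fromB = λ { (here q) → here q ; (there q) → there (fromB q) } ; fromD = there ∘ fromD
      ; to = λ { (here q) → inj₁ (here q) ; (there q) → case to q of λ { (inj₁ r) → inj₁ (there r) ; (inj₂ r) → inj₂ r } }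
      ; total = trans (+-assoc (clen C) _ _) (cong (clen C +_) total) ; disj = λ { (_ ∷ a) → disj a }
      ; parity = λ w → trans (xor-assoc (par w (cedges C)) _ _) (cong (par w (cedges C) xor_) (parity w)) }
    where open Parts p
  ... | inj₁ h | p = record
      { bs = bs ; ds = C ∷ ds ; bal = bal ; unb = λ { (here refl) → h ; (there q) → unb q }
      ; fromB = there ∘ fromB ; fromD = λ { (here q) → here q ; (there q) → there (fromD q) }
      ; to = λ { (here q) → inj₂ (here q) ; (there q) → case to q of λ { (inj₁ r) → inj₁ r ; (inj₂ r) → inj₂ (there r) } }
      ; total = trans (trans (sym (+-assoc (sum (map clen bs)) (clen C) _)) (trans (cong (_+ sum (map clen ds)) (+-comm (sum (map clen bs)) (clen C))) (+-assoc (clen C) _ _))) (cong (clen C +_) total)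
      ; disj = λ { (a ∷ b) → All.tabulate (λ q → All.lookup a (fromD q)) ∷ disj b }
      ; parity = λ w → trans (move (parL w bs) (par w (cedges C)) (parL w ds)) (cong (par w (cedges C) xor_) (parity w)) }
    where
      open Parts p
      move : ∀ a b c → a xor (b xor c) ≡ b xor (a xor c)
      move a b c = trans (sym (xor-assoc a b c)) (trans (cong (_xor c) (xor-comm a b)) (xor-assoc b a c))

  abstract
    partition : ∀ σ cs → Parts σ cs
    partition = partition-raw

  -- Here `bs` are the balanced circuits and `ds` the unbalanced ones; `compats` is what allows any
  -- two of the latter to be the circuits of a barbell.
  record Tokens (σ S : ES) : Set where
    field
      bs ds : List Cyc
      bal : ∀ {C} → C ∈ bs → par σ (cedges C) ≡ false
      unb : ∀ {C} → C ∈ ds → par σ (cedges C) ≡ true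
      inS : ∀ {C} → C ∈ bs ⊎ C ∈ ds → ∀ {e} → e ∈ cedges C → S e ≡ true
      cover : ∀ {e} → S e ≡ true → Σ Cyc λ C → (C ∈ bs ⊎ C ∈ ds) × e ∈ cedges C
      total : sum (map clen bs) + sum (map clen ds) ≡ count S
      compats : AllPairs Compat ds
      parity : ∀ w → ⨁ (λ e → S e ∧ w e) ≡ parL w bs xor parL w ds

  addBalanced : ∀ {σ S} B → par σ (cedges B) ≡ false → (∀ {e} → e ∈ cedges B → S e ≡ true) → Tokens σ (S ⊕ χ (cedges B)) → Tokens σ S
  addBalanced {σ} {S} B balB B⊆ t = record
    { bs = B ∷ Tokens.bs t ; ds = Tokens.ds t ; bal = λ { (here refl) → balB ; (there q) → Tokens.bal t q } ; unb = Tokens.unb t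
    ; inS = λ { (inj₁ (here refl)) → B⊆ ; (inj₁ (there q)) r → ⊕χ-in (cedges B) B⊆ (Tokens.inS t (inj₁ q) r)
              ; (inj₂ q) r → ⊕χ-in (cedges B) B⊆ (Tokens.inS t (inj₂ q) r) }
    ; cover = λ s → case ⊕χ-split {S} (cedges B) s of λ
        { (inj₁ q) → case Tokens.cover t q of λ { (C , inj₁ r , z) → C , inj₁ (there r) , z ; (C , inj₂ r , z) → C , inj₂ r , z }
        ; (inj₂ q) → B , inj₁ (here refl) , q }
    ; total = trans (+-assoc (clen B) _ _) (trans (cong (clen B +_) (Tokens.total t)) (sym (count-χ S (cedges B) (cedges-unique B) λ e → B⊆)))
    ; compats = Tokens.compats t
    ; parity = λ w → trans (⨁-remove S (cedges B) w) (trans (cong (par w (cedges B) xor_) (Tokens.parity t w)) (sym (xor-assoc (par w (cedges B)) _ _))) }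

  tokensOrBalanced : ∀ σ S → Even S → Tokens σ S ⊎ Σ Cyc λ B → par σ (cedges B) ≡ false × (∀ {e} → e ∈ cedges B → S e ≡ true)
  tokensOrBalanced σ S ev = cases (allCompat? (Parts.ds p) (Parts.disj p (Decomp.disj D)))
    where
      D = decompose S ev
      p = partition σ (Decomp.cs D)
      cases : AllPairs Compat (Parts.ds p) ⊎ (Σ Cyc λ C → Σ Cyc λ C' → C ∈ Parts.ds p × C' ∈ Parts.ds p × Bad C C') → _
      cases (inj₁ ok) = inj₁ record
        { bs = Parts.bs p ; ds = Parts.ds p ; bal = Parts.bal p ; unb = Parts.unb p
        ; inS = λ { (inj₁ q) → Decomp.inS D (Parts.fromB p q) ; (inj₂ q) → Decomp.inS D (Parts.fromD p q) }
        ; cover = λ s → let (C , q , r) = Decomp.cover D s in C , Parts.to p q , r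
        ; total = trans (Parts.total p) (Decomp.total D) ; compats = ok
        ; parity = λ w → trans (Decomp.parity D w) (sym (Parts.parity p w)) }
      cases (inj₂ (C , C' , C∈ , C'∈ , dj , x , y , x≢y , (x∈ , x∈') , (y∈ , y∈'))) =
        found (theta σ C C' dj x≢y x∈ x∈' y∈ y∈' (Parts.unb p C∈))
        where
          found : (Σ Cyc λ B → par σ (cedges B) ≡ false × (∀ {e} → e ∈ cedges B → e ∈ cedges C ⊎ e ∈ cedges C')) → _
          found (B , balB , B⊆) = inj₂ (B , balB , λ {e} q → case B⊆ q of λ
            { (inj₁ r) → Decomp.inS D (Parts.fromD p C∈) r ; (inj₂ r) → Decomp.inS D (Parts.fromD p C'∈) r })

  -- Unbalanced circuits that meet twice are not repaired in place. A balanced circuit in their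
  -- union is split off, and the rest, a smaller even set, is decomposed anew.
  tokens-raw : ∀ σ S → Even S → Tokens σ S
  tokens-raw σ S ev = go S ev (<-wellFounded (count S))
    where
      go : ∀ S → Even S → Acc _<_ (count S) → Tokens σ S
      go S ev (acc rs) with tokensOrBalanced σ S ev
      ... | inj₁ t = t
      ... | inj₂ (B , balB , B⊆) = addBalanced B balB B⊆ (go (S ⊕ χ (cedges B)) (even-⊕ {S} ev (even-cyc B))
              (rs (≤-trans (s≤s (m≤n+m _ _)) (≤-reflexive (sym (count-χ S (cedges B) (cedges-unique B) λ e → B⊆))))))

  abstract
    tokens : ∀ σ S → Even S → Tokens σ S
    tokens = tokens-raw

-- Linking two vertices of a connected bridgeless graph by an even set.

module Link (G : SignedGraph) where
  open Walks G
  open Decompose G using (delete; delete-⊆; delete-≢; delete-in)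

  infixl 7 _↾_
  -- Testing one end of an edge is enough, because `A` is always a union of components of `S`.
  _↾_ : ES → VS → ES
  (S ↾ A) e = S e ∧ A (src e)

  ∂-↾ : ∀ {S : ES} {A : VS} → (∀ {e} → S e ≡ true → cut A e ≡ false) → ∀ v → ∂ (S ↾ A) v ≡ A v ∧ ∂ S v
  ∂-↾ {S} {A} h v = trans (⨁-cong pt) (⨁-∧ (A v) (λ e → S e ∧ cut (isV v) e))
    where
      pt : ∀ e → (S e ∧ A (src e)) ∧ cut (isV v) e ≡ A v ∧ (S e ∧ cut (isV v) e)
      pt e with bool-cases (S e) | bool-cases (cut (isV v) e)
      ... | inj₂ p | _ = outS (S e) (A (src e)) (cut (isV v) e) (A v) p
        where
          outS : ∀ s a c x → s ≡ false → (s ∧ a) ∧ c ≡ x ∧ (s ∧ c)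
          outS s a c x refl = sym (∧-zeroʳ x)
      ... | inj₁ p | inj₂ q = outC (S e) (A (src e)) (cut (isV v) e) (A v) q
        where
          outC : ∀ s a c x → c ≡ false → (s ∧ a) ∧ c ≡ x ∧ (s ∧ c)
          outC s a c x refl = trans (∧-zeroʳ (s ∧ a)) (sym (trans (cong (x ∧_) (∧-zeroʳ s)) (∧-zeroʳ x)))
      ... | inj₁ p | inj₁ q = both (S e) (A (src e)) (cut (isV v) e) (A v) p q same
        where
          both : ∀ s a c x → s ≡ true → c ≡ true → a ≡ x → (s ∧ a) ∧ c ≡ x ∧ (s ∧ c)
          both s a c x refl refl refl = refl
          same : A (src e) ≡ A v
          same with xor-split q
          ... | inj₁ (r , _) = cong A (sym (isV-true r))
          ... | inj₂ (_ , r) = trans (xor-false (h p)) (cong A (sym (isV-true r)))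

  edge-distinct : ∀ {P : E → Set} {u v} (w : Walk G P u v) → Unique (verts w) → ∀ {e a b} → e ∈ edges w → Joins G e a b → a ≢ b
  edge-distinct (wstep e p j w) uq (here refl) k refl with joins-ends j k
  ... | inj₁ (refl , q) = unique-head uq (subst (_∈ verts w) (sym q) (start∈ w))
  ... | inj₂ (q , refl) = unique-head uq (subst (_∈ verts w) (sym q) (start∈ w))
  edge-distinct (wstep e p j w) uq (there h) k = edge-distinct w (unique-tail uq) h k

  in-reach : ∀ {S : ES} {u} (R : Reach S u) {x} → Reach.set R x ≡ true → Walk G (In (S ↾ Reach.set R)) x u
  in-reach {S} R h = weaken (λ {e} p → ∧-intro (tedges-P tree p) (∈-mem (tverts tree) (proj₁ (tedge-ends tree p (joins-self e))))) (toRoot tree (mem-∈ (tverts tree) h))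
    where open Reach R

  reach-⊆ : ∀ {S : ES} {u} (R : Reach S u) (B : VS) → B u ≡ true → (∀ {e} → S e ≡ true → cut B e ≡ false) → ∀ {x} → Reach.set R x ≡ true → B x ≡ true
  reach-⊆ R B bu h {x} p with bool-cases (B x)
  ... | inj₁ q = q
  ... | inj₂ q = let w = rev (Reach.fromSet R p) ; (e , _ , _ , e∈ , j , s , t , _) = crossing B w bu q in
        absurd (trans (joins-cut B j) (xor-trueˡ s t)) (h (edges-P w e∈))

  module _ (EB : ES) (around : ∀ {e u v} → EB e ≡ true → Joins G e u v → Walk G (In (delete EB e)) v u) where

    -- K connects y to v; rerouting K through an ear of the circuit that closes e connects y to the other end of e.
    linkStep : ∀ {y v v'} (K : ES) → Even K → (∀ {e} → K e ≡ true → EB e ≡ true) → Walk G (In K) y v → ∀ {e} → EB e ≡ true → Joins G e v v' →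
      Σ ES λ K' → Even K' × (∀ {e} → K' e ≡ true → EB e ≡ true) × Walk G (In K') y v'
    linkStep {y} {v} {v'} K ev K⊆ yv {e} eB j with bool-cases (Reach.set (reach K y) v')
    ... | inj₁ h = K , ev , K⊆ , rev (Reach.fromSet (reach K y) h)
    ... | inj₂ v'∉ = result (bool-cases (Reach.set R₁ v))
      where
        R = reach K y
        A = Reach.set R
        v∈ : A v ≡ true
        v∈ = reach-walk R yv
        K₀ = K ↾ A
        back = erase (around eB j)
        -- The way back around `e` is stopped at its first vertex `z` in the component `A` of `y`.
        -- Thus `Q`, the edge `e` followed by this part, is an ear from `v` to `z` that shares no
        -- edge with `K₀`.
        tr = trimBack A (walk (proj₁ back)) (end∈ (walk (proj₁ back))) v∈
        z = proj₁ tr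
        qs = proj₁ (proj₂ tr)
        q = walk qs
        uq = uniq qs (proj₂ back)
        z∈ : A z ≡ true
        z∈ = proj₁ (proj₂ (proj₂ tr))
        z-only : ∀ {x} → x ∈ verts q → A x ≡ true → x ≡ z
        z-only = proj₂ (proj₂ (proj₂ tr))
        q-del : ∀ {g} → g ∈ edges q → delete EB e g ≡ true
        q-del h = edges-P q h
        Q = e ∷ edges q
        uQ : Unique Q
        uQ = unique-∷ (λ h → delete-≢ {EB} (q-del h) refl) (unique-edges q uq)
        K₀-ends : ∀ {g a b} → K₀ g ≡ true → Joins G g a b → A a ≡ true × A b ≡ true
        K₀-ends {g} {a} {b} h k with joins-ends (joins-self g) k
        ... | inj₁ (refl , refl) = ∧-right {K g} h , Reach.set-step R (∧-left h) (joins-self g) (∧-right {K g} h)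
        ... | inj₂ (refl , refl) = Reach.set-step R (∧-left h) (joins-self g) (∧-right {K g} h) , ∧-right {K g} h
        Q-K₀ : ∀ {g} → K₀ g ≡ true → g ∉ Q
        Q-K₀ h (here refl) = absurd (proj₂ (K₀-ends h j)) v'∉
        Q-K₀ {g} h (there k) = let (a∈ , b∈) = edge-ends q k (joins-self g) ; (a , b) = K₀-ends h (joins-self g) in
          edge-distinct q uq k (joins-self g) (trans (z-only a∈ a) (sym (z-only b∈ b)))
        χQ-K₀ : ∀ {g} → K₀ g ≡ true → χ Q g ≡ false
        χQ-K₀ h = χ-∉ Q (Q-K₀ h)
        e∉K₀ : K₀ e ≡ false
        e∉K₀ = ≢true⇒false λ h → Q-K₀ h (here refl)
        ∂Q : ∀ x → ∂ (χ Q) x ≡ isV x v xor isV x z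
        ∂Q x = trans (cong (λ l → ∂ (χ (e ∷ l)) x) (sym (mapW-edges q _))) (∂-walk (wstep {P = In EB} e eB j (weaken (delete-⊆ {EB}) q)) x)
        vz = in-reach R v∈ ⟫ rev (in-reach R z∈)
        p = walk (proj₁ (erase vz))
        up = proj₂ (erase vz)
        p-K₀ : ∀ {g} → g ∈ edges p → K₀ g ≡ true
        p-K₀ = edges-P p
        χp-K₀ : ∀ {g} → χ (edges p) g ≡ true → K₀ g ≡ true
        χp-K₀ h = p-K₀ (χ-∈ (edges p) h)
        -- Without the path `p` from `v` to `z`, the set has the same boundary as the ear, so that
        -- `K₁ ⊕ χ Q` is even again.
        K₁ = K₀ ⊕ χ (edges p)
        K₁-K₀ : ∀ {g} → K₁ g ≡ true → K₀ g ≡ true × χ (edges p) g ≡ false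
        K₁-K₀ {g} h with xor-split {K₀ g} h
        ... | inj₁ (a , b) = a , b
        ... | inj₂ (a , b) = absurd (χp-K₀ b) a
        e∉p : χ (edges p) e ≡ false
        e∉p = ≢true⇒false λ h → absurd (χp-K₀ h) e∉K₀
        e∈Q : χ Q e ≡ true
        e∈Q = χ-unique Q uQ (here refl)
        R₁ = reach K₁ y
        ∂K₁ : ∀ x → ∂ K₁ x ≡ isV x v xor isV x z
        ∂K₁ x = trans (∂-⊕ K₀ (χ (edges p)) x) (trans (cong₂ _xor_ (trans (∂-↾ (Reach.set-uncut R) x) (∧-falseʳ {A x} (ev x))) (∂-walk p x)) refl)
        Q⊆ : ∀ {g} → χ Q g ≡ true → EB g ≡ true
        Q⊆ h with χ-∈ Q h
        ... | here refl = eB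
        ... | there k = delete-⊆ {EB} (q-del k)
        result : (Reach.set R₁ v ≡ true) ⊎ (Reach.set R₁ v ≡ false) → Σ ES λ K' → Even K' × (∀ {e} → K' e ≡ true → EB e ≡ true) × Walk G (In K') y v'
        result (inj₁ h) = K₁ ⊕ χ Q
          , (λ x → trans (∂-⊕ K₁ (χ Q) x) (trans (cong₂ _xor_ (∂K₁ x) (∂Q x)) (xor-same (isV x v xor isV x z))))
          , (λ {g} k → case xor-split {K₁ g} k of λ { (inj₁ (a , _)) → K⊆ (∧-left (proj₁ (K₁-K₀ a))) ; (inj₂ (_ , b)) → Q⊆ b })
          , weaken (λ {g} k → xor-trueˡ k (χQ-K₀ (proj₁ (K₁-K₀ k)))) (rev (Reach.fromSet R₁ h))
            ⟫ wstep e (xor-trueʳ (cong₂ _xor_ e∉K₀ e∉p) e∈Q) j here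
        -- Removing `p` has cut `y` off from `v`. Then `p` is put back, and only the component `O`
        -- of `y` is kept from the rest of `K₁`. The walk from `y` to `v` in `K₀` leaves `O` by an
        -- edge of `p`, so from there `v` is reached along `p`.
        result (inj₂ h) = K₂ , even₂ , K₂⊆ ,
            weaken O⊆ (rev (in-reach R₁ o∈)) ⟫ (mapW back-p (λ k → p⊆ (p-K₀ (es⊆ (prefix p o∈p) (rev-edges (walk (prefix p o∈p)) k)) , χ-unique (edges p) (unique-edges p up) (es⊆ (prefix p o∈p) (rev-edges (walk (prefix p o∈p)) k)))) ⟫ wstep e e∈K₂ j here)
          where
            O = Reach.set R₁
            K₂ = (K₁ ↾ O) ⊕ (χ (edges p) ⊕ χ Q)
            -- The component `O` meets the boundary of `K₁` evenly, and `v` is not in `O`.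
            z∉ : O z ≡ false
            z∉ = trans (sym (trans (⨁-cong λ x → trans (cong (O x ∧_) (∂K₁ x)) (∧-distribˡ-xor (O x) (isV x v) (isV x z)))
                  (trans (⨁-⊕ (λ x → O x ∧ isV x v) (λ x → O x ∧ isV x z)) (trans (cong₂ _xor_ (⨁-pick O v) (⨁-pick O z)) (cong (_xor O z) h)))))
              (trans (cut-sum O K₁) (⨁-false λ g → uncut g))
              where
                uncut : ∀ g → K₁ g ∧ cut O g ≡ false
                uncut g with bool-cases (K₁ g)
                ... | inj₁ k = ∧-falseʳ {K₁ g} (Reach.set-uncut R₁ k)
                ... | inj₂ k = ∧-falseˡ k
            off : ∀ x → O x ∧ (isV x v xor isV x z) ≡ false
            off x with bool-cases (O x)
            ... | inj₂ k = ∧-falseˡ k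
            ... | inj₁ k = ∧-falseʳ {O x} (cong₂ _xor_ (isV-false {u = x} {v} λ q → absurd (trans (sym (cong O q)) k) h) (isV-false {u = x} {z} λ q → absurd (trans (sym (cong O q)) k) z∉))
            even₂ : Even K₂
            even₂ x = trans (∂-⊕ (K₁ ↾ O) (χ (edges p) ⊕ χ Q) x) (cong₂ _xor_
              (trans (∂-↾ (Reach.set-uncut R₁) x) (trans (cong (O x ∧_) (∂K₁ x)) (off x)))
              (trans (∂-⊕ (χ (edges p)) (χ Q) x) (trans (cong₂ _xor_ (∂-walk p x) (∂Q x)) (xor-same (isV x v xor isV x z)))))
            K₂⊆ : ∀ {g} → K₂ g ≡ true → EB g ≡ true
            K₂⊆ {g} k = case xor-split {(K₁ ↾ O) g} k of λ
              { (inj₁ (a , _)) → K⊆ (∧-left (proj₁ (K₁-K₀ (∧-left a))))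
              ; (inj₂ (_ , b)) → case xor-split {χ (edges p) g} b of λ { (inj₁ (c , _)) → K⊆ (∧-left (χp-K₀ c)) ; (inj₂ (_ , c)) → Q⊆ c } }
            O⊆ : ∀ {g} → (K₁ ↾ O) g ≡ true → K₂ g ≡ true
            O⊆ {g} k = let (a , b) = K₁-K₀ (∧-left k) in xor-trueˡ k (cong₂ _xor_ b (χQ-K₀ a))
            p⊆ : ∀ {g} → K₀ g ≡ true × χ (edges p) g ≡ true → K₂ g ≡ true
            p⊆ {g} (a , b) = xor-trueʳ {(K₁ ↾ O) g} (∧-falseˡ (xor-≡ (trans a (sym b)))) (xor-trueˡ b (χQ-K₀ a))
            e∈K₂ : K₂ e ≡ true
            e∈K₂ = xor-trueʳ {(K₁ ↾ O) e} (∧-falseˡ (cong₂ _xor_ e∉K₀ e∉p)) (xor-trueʳ e∉p e∈Q)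
            cr = crossing O (rev (in-reach R v∈)) (Reach.set-root R₁) h
            g₀ = proj₁ cr
            o = proj₁ (proj₂ cr)
            o' = proj₁ (proj₂ (proj₂ cr))
            g₀∈ = proj₁ (proj₂ (proj₂ (proj₂ cr)))
            g₀j = proj₁ (proj₂ (proj₂ (proj₂ (proj₂ cr))))
            o∈ = proj₁ (proj₂ (proj₂ (proj₂ (proj₂ (proj₂ cr)))))
            o'∉ = proj₁ (proj₂ (proj₂ (proj₂ (proj₂ (proj₂ (proj₂ cr))))))
            g₀∈p : g₀ ∈ edges p
            g₀∈p = χ-∈ (edges p) (trans (sym (xor-false {K₀ g₀} (≢true⇒false λ k → absurd (Reach.set-step R₁ k g₀j o∈) o'∉))) (edges-P (rev (in-reach R v∈)) g₀∈))
            o∈p : o ∈ verts p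
            o∈p = proj₁ (edge-ends p g₀∈p g₀j)
            back-p = rev (walk (prefix p o∈p))

    -- An even set with `y` and `v` in one component stands for two edge-disjoint paths between
    -- them. It is carried along a walk from `y` to `v`, one edge at a time, starting from the empty
    -- set.
    link-raw : ∀ {y v} → Walk G (In EB) y v → Σ ES λ K → Even K × (∀ {e} → K e ≡ true → EB e ≡ true) × Walk G (In K) y v
    link-raw {y} w = go (λ _ → false) even-∅ (λ ()) here w
      where
        go : ∀ {u v} (K : ES) → Even K → (∀ {e} → K e ≡ true → EB e ≡ true) → Walk G (In K) y u → Walk G (In EB) u v →
          Σ ES λ K → Even K × (∀ {e} → K e ≡ true → EB e ≡ true) × Walk G (In K) y v
        go K ev K⊆ yu here = K , ev , K⊆ , yu
        go K ev K⊆ yu (wstep e p j w) = let (K' , ev' , K'⊆ , yu') = linkStep K ev K⊆ yu p j in go K' ev' K'⊆ yu' w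

    abstract
      link : ∀ {y v} → Walk G (In EB) y v → Σ ES λ K → Even K × (∀ {e} → K e ≡ true → EB e ≡ true) × Walk G (In K) y v
      link = link-raw

-- Pieces outside a vertex set, relative even sets and the closure data.

module Flow (G : SignedGraph) (E₀ : ES' G) where
  open Walks G
  open Decompose G using (delete; delete-⊆; delete-≢; delete-in)
  open Link G

  within : VS → ES
  within B e = E₀ e ∧ (B (src e) ∧ B (tgt e))

  within-joins : ∀ {B : VS} {e a b} → E₀ e ≡ true → Joins G e a b → B a ≡ true → B b ≡ true → within B e ≡ true
  within-joins {B} s (inj₁ refl) p q = ∧-intro s (∧-intro p q)
  within-joins {B} s (inj₂ refl) p q = ∧-intro s (∧-intro q p)

  within-ends : ∀ {B : VS} {e a b} → within B e ≡ true → Joins G e a b → B a ≡ true × B b ≡ true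
  within-ends {B} {e} h (inj₁ refl) = ∧-left (∧-right {E₀ e} h) , ∧-right {B (src e)} (∧-right {E₀ e} h)
  within-ends {B} {e} h (inj₂ refl) = ∧-right {B (src e)} (∧-right {E₀ e} h) , ∧-left (∧-right {E₀ e} h)

  within-uncut : ∀ {B : VS} {e} → within B e ≡ true → cut B e ≡ false
  within-uncut {B} {e} h = let (p , q) = within-ends {B} {e} h (joins-self e) in xor-≡ (trans p (sym q))

  -- The boundary edges of a piece that do not lead to `A`; a closure step attaches a piece by edges
  -- that do.
  Ext : VS → VS → E → Set
  Ext A B e = Σ V λ u → Σ V λ w → E₀ e ≡ true × Joins G e u w × B u ≡ true × B w ≡ false × A w ≡ false

  record Piece (A : VS) : Set where
    field
      B : VS
      b₀ : V
      b₀∈ : B b₀ ≡ true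
      apart : ∀ {v} → B v ≡ true → A v ≡ false
      ext≤1 : ∀ {e e'} → Ext A B e → Ext A B e' → e ≡ e'
      conn : ∀ {a b} → B a ≡ true → B b ≡ true → Walk G (In (within B)) a b
      around : ∀ {e u v} → within B e ≡ true → Joins G e u v → Walk G (In (delete (within B) e)) v u

  -- A descent to a leaf of the bridge tree outside `A`: first to a component of the current set,
  -- then across a bridge `e` to a side without the external edge. As there is at most one such
  -- edge, a side exists whose only external edge is `e`.
  piece-raw : ∀ (A : VS) {v} → A v ≡ false → Piece A
  piece-raw A {v} v∉ = shrink (not ∘ A) v (not-intro v∉) not-true (λ { (_ , w , _ , _ , _ , p , q) _ → absurd (not-intro q) p }) (<-wellFounded _)
    where
      shrink : ∀ (B : VS) b → B b ≡ true → (∀ {v} → B v ≡ true → A v ≡ false) → (∀ {e e'} → Ext A B e → Ext A B e' → e ≡ e') → Acc _<_ (count B) → Piece A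
      shrink B b b∈ apart ext≤1 (acc rs) = cases (search λ v → B v ∧ not (Reach.set R v))
        where
          EB = within B
          R = reach EB b
          R⊆B : ∀ {x} → Reach.set R x ≡ true → B x ≡ true
          R⊆B = reach-⊆ R B b∈ (within-uncut {B})
          cases : (∃ λ v → B v ∧ not (Reach.set R v) ≡ true) ⊎ (∀ v → B v ∧ not (Reach.set R v) ≡ false) → Piece A
          cases (inj₁ (v , h)) = shrink (Reach.set R) b (Reach.set-root R) (apart ∘ R⊆B) (λ p q → ext≤1 (lift p) (lift q))
              (rs (count-strict (Reach.set R) B (λ _ → R⊆B) (not-true (∧-right {B v} h)) (∧-left h)))
            where
              lift : ∀ {e} → Ext A (Reach.set R) e → Ext A B e
              lift (u , w , s , j , u∈ , w∉ , w∉A) = u , w , s , j , R⊆B u∈ , ≢true⇒false (λ w∈ → absurd (Reach.set-step R (within-joins {B} s j (R⊆B u∈) w∈) j u∈) w∉) , w∉A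
          cases (inj₂ all) = bridges (search λ e → EB e ∧ not (Reach.set (reach (delete EB e) (src e)) (tgt e)))
            where
              inR : ∀ {v} → B v ≡ true → Reach.set R v ≡ true
              inR {v} h = ≢false⇒true λ q → absurd (∧-intro h (not-intro q)) (all v)
              bridges : (∃ λ e → EB e ∧ not (Reach.set (reach (delete EB e) (src e)) (tgt e)) ≡ true) ⊎ (∀ e → EB e ∧ not (Reach.set (reach (delete EB e) (src e)) (tgt e)) ≡ false) → Piece A
              bridges (inj₂ none) = record { B = B ; b₀ = b ; b₀∈ = b∈ ; apart = apart ; ext≤1 = ext≤1
                ; conn = λ p q → Reach.fromSet R (inR p) ⟫ rev (Reach.fromSet R (inR q)) ; around = around }
                where
                  back : ∀ {e} → EB e ≡ true → Walk G (In (delete EB e)) (tgt e) (src e)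
                  back {e} h = Reach.fromSet (reach (delete EB e) (src e)) (≢false⇒true λ q → absurd (∧-intro h (not-intro q)) (none e))
                  around : ∀ {e u v} → EB e ≡ true → Joins G e u v → Walk G (In (delete EB e)) v u
                  around h (inj₁ refl) = back h
                  around h (inj₂ refl) = rev (back h)
              bridges (inj₁ (e , h)) = sides (search extS)
                where
                  e∈ : EB e ≡ true
                  e∈ = ∧-left h
                  RS = reach (delete EB e) (src e)
                  S = Reach.set RS
                  tgt∉ : S (tgt e) ≡ false
                  tgt∉ = not-true (∧-right {EB e} h)
                  S⊆B : ∀ {x} → S x ≡ true → B x ≡ true
                  S⊆B = reach-⊆ RS B (proj₁ (within-ends {B} e∈ (joins-self e))) (λ k → within-uncut {B} (delete-⊆ {EB} k))
                  only-e : ∀ {g u w} → E₀ g ≡ true → Joins G g u w → B u ≡ true → B w ≡ true → S u ≡ true → S w ≡ false → g ≡ e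
                  only-e {g} s j u∈ w∈ p q with g ≟ e
                  ... | yes r = r
                  ... | no r = absurd (Reach.set-step RS (delete-in {EB} (within-joins {B} s j u∈ w∈) r) j p) q
                  outside : VS
                  outside v = not (B v) ∧ not (A v)
                  extS : ES
                  extS g = E₀ g ∧ ((S (src g) ∧ outside (tgt g)) ∨ (S (tgt g) ∧ outside (src g)))
                  extS-intro : ∀ {g u w} → E₀ g ≡ true → Joins G g u w → S u ≡ true → B w ≡ false → A w ≡ false → extS g ≡ true
                  extS-intro s (inj₁ refl) p q r = ∧-intro s (∨-left (∧-intro p (∧-intro (not-intro q) (not-intro r))))
                  extS-intro {g} s (inj₂ refl) p q r = ∧-intro s (∨-right {S (src g) ∧ _} (∧-intro p (∧-intro (not-intro q) (not-intro r))))
                  extS-elim : ∀ {g} → extS g ≡ true → Σ V λ u → Σ V λ w → E₀ g ≡ true × Joins G g u w × S u ≡ true × B w ≡ false × A w ≡ false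
                  extS-elim {g} h with ∨-split {S (src g) ∧ outside (tgt g)} (∧-right {E₀ g} h)
                  ... | inj₁ q = src g , tgt g , ∧-left h , joins-self g , ∧-left q , not-true (∧-left (∧-right {S (src g)} q)) , not-true (∧-right {not (B (tgt g))} (∧-right {S (src g)} q))
                  ... | inj₂ q = tgt g , src g , ∧-left h , joins-sym (joins-self g) , ∧-left q , not-true (∧-left (∧-right {S (tgt g)} q)) , not-true (∧-right {not (B (src g))} (∧-right {S (tgt g)} q))
                  sides : (∃ λ g → extS g ≡ true) ⊎ (∀ g → extS g ≡ false) → Piece A
                  sides (inj₂ none) = shrink S (src e) (Reach.set-root RS) (apart ∘ S⊆B) (λ p q → trans (is-e p) (sym (is-e q)))
                      (rs (count-strict S B (λ _ → S⊆B) tgt∉ (proj₂ (within-ends {B} e∈ (joins-self e)))))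
                    where
                      is-e : ∀ {g} → Ext A S g → g ≡ e
                      is-e {g} (u , w , s , j , u∈ , w∉ , w∉A) with bool-cases (B w)
                      ... | inj₁ w∈B = only-e s j (S⊆B u∈) w∈B u∈ w∉
                      ... | inj₂ w∉B = absurd (extS-intro s j u∈ w∉B w∉A) (none g)
                  sides (inj₁ (g , gh)) = shrink B' (tgt e) (∧-intro (proj₂ (within-ends {B} e∈ (joins-self e))) (not-intro tgt∉)) (apart ∘ ∧-left)
                      (λ p q → trans (is-e p) (sym (is-e q)))
                      (rs (count-strict B' B (λ _ → ∧-left) (∧-falseʳ {B (src e)} (cong not (Reach.set-root RS))) (proj₁ (within-ends {B} e∈ (joins-self e)))))
                    where
                      B' : VS
                      B' v = B v ∧ not (S v)
                      is-e : ∀ {g'} → Ext A B' g' → g' ≡ e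
                      is-e {g'} (u , w , s , j , u∈ , w∉ , w∉A) with bool-cases (B w)
                      ... | inj₁ w∈B = only-e s (joins-sym j) w∈B (∧-left u∈) (≢false⇒true λ k → absurd (∧-intro w∈B (not-intro k)) w∉) (not-true (∧-right {B u} u∈))
                      ... | inj₂ w∉B with extS-elim gh
                      ...   | u' , w' , s' , j' , u'∈ , w'∉ , w'∉A with ext≤1 (u , w , s , j , ∧-left u∈ , w∉B , w∉A) (u' , w' , s' , j' , S⊆B u'∈ , w'∉ , w'∉A)
                      ...     | refl with joins-ends j j'
                      ...       | inj₁ (refl , _) = absurd u'∈ (not-true (∧-right {B u} u∈))
                      ...       | inj₂ (refl , _) = absurd (S⊆B u'∈) w∉B

  abstract
    piece : ∀ (A : VS) {v} → A v ≡ false → Piece A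
    piece = piece-raw

  -- No bridge remains after contracting `A`. The condition passes to larger sets, since it concerns
  -- fewer `B`.
  Thick : VS → Set
  Thick A = ∀ (B : VS) {b} → B b ≡ true → (∀ {v} → B v ≡ true → A v ≡ false) →
    Σ E λ e → Σ E λ e' → e ≢ e' × (E₀ e ≡ true × cut B e ≡ true) × (E₀ e' ≡ true × cut B e' ≡ true)

  -- An even set of the graph obtained by contracting A.
  Rel : VS → ES → Set
  Rel A f = ∀ v → A v ≡ false → ∂ f v ≡ false

  rel-⊕ : ∀ {A f g} → Rel A f → Rel A g → Rel A (f ⊕ g)
  rel-⊕ {A} {f} {g} p q v h = trans (∂-⊕ f g v) (cong₂ _xor_ (p v h) (q v h))

  scale : Bool → ES → ES
  scale c f e = c ∧ f e

  rel-scale : ∀ {A f} c → Rel A f → Rel A (scale c f)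
  rel-scale true p = p
  rel-scale false p v h = even-∅ v

  -- Corrections are confined to `Y` and to the part of `C` in the tree. Therefore chords, and edges
  -- of `C` outside the tree, keep the values that were prescribed for them.
  Reserve : (T C Y : ES) → ES → Set
  Reserve T C Y g = ∀ {e} → g e ≡ true → Y e ≡ true ⊎ (C e ≡ true × T e ≡ true)

  -- Seymour's closure argument: Y is covered by two relative even sets supported on Y and on the tree part of C,
  -- for every prescribed pair f₁, f₂ of values.
  record Growth (A : VS) : Set where
    field
      T C Y : ES
      T⊆ : ∀ {e} → T e ≡ true → C e ≡ true ⊎ Y e ≡ true
      C⊆ : ∀ {e} → C e ≡ true → E₀ e ≡ true
      Y⊆ : ∀ {e} → Y e ≡ true → E₀ e ≡ true
      CY : ∀ {e} → C e ≡ true → Y e ≡ false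
      C-even : Even C
      C-avoids : ∀ {e a b} → C e ≡ true → Joins G e a b → A a ≡ false
      Y-leaves : ∀ {e a b} → Y e ≡ true → Joins G e a b → A a ≡ true → A b ≡ false
      -- A closure step enlarges `A` by m + 1 vertices, adds at most two edges to `Y` and at most m
      -- tree edges to `C`, and 5 · 2 + 11m ≤ 11(m + 1). Twice these weights, 10 and 22, are what
      -- `denseWeight` needs on `Y` and on the tree part of `C` beyond the unit 12.
      bound : 5 * count Y + 11 * count (λ e → C e ∧ T e) + 11 * count A ≤ 11 * nV G
      toA : ∀ v → Σ V λ a → A a ≡ true × Walk G (In T) v a
      -- Arbitrary starting values are needed for the induction, which calls the hypothesis with an
      -- altered `f₁`, and for the sparse base cover, which prescribes an even set containing all
      -- chords.
      flow : ∀ f₁ f₂ → Rel A f₁ → Rel A f₂ → (∀ {e} → f₁ e ≡ true → E₀ e ≡ true) → (∀ {e} → f₂ e ≡ true → E₀ e ≡ true) →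
        Σ ES λ g₁ → Σ ES λ g₂ → Rel A (f₁ ⊕ g₁) × Rel A (f₂ ⊕ g₂) × Reserve T C Y g₁ × Reserve T C Y g₂ ×
          (∀ {e} → Y e ≡ true → (f₁ ⊕ g₁) e ∨ (f₂ ⊕ g₂) e ≡ true)

  -- Passing from `A'` back to the smaller `A`, the vertices in between have to become even. Each
  -- odd one is joined to `A` by its path in `N`, and `fix` is the sum of these paths.
  module Lift {A A' : VS} {N : List E} (path : ∀ {v} → A' v ∧ not (A v) ≡ true → Σ V λ a → A a ≡ true × Walk G (_∈ N) v a) where

    route : V → List E
    route v with bool-cases (A' v ∧ not (A v))
    ... | inj₁ h = edges (proj₂ (proj₂ (path h)))
    ... | inj₂ _ = []

    route-∂ : ∀ v x → A x ≡ false → A' v ∧ not (A v) ≡ true → ∂ (χ (route v)) x ≡ isV x v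
    route-∂ v x x∉ h with bool-cases (A' v ∧ not (A v))
    ... | inj₂ k = absurd h k
    ... | inj₁ k = let (a , a∈ , w) = path k in trans (∂-walk w x) (trans (cong (isV x v xor_) (isV-false {u = x} {a} λ { refl → absurd a∈ x∉ })) (xor-identityʳ _))

    route-N : ∀ v {e} → χ (route v) e ≡ true → e ∈ N
    route-N v h with bool-cases (A' v ∧ not (A v))
    ... | inj₁ k = edges-P (proj₂ (proj₂ (path k))) (χ-∈ (edges (proj₂ (proj₂ (path k)))) h)

    coef : ES → V → Bool
    coef f v = (A' v ∧ not (A v)) ∧ ∂ f v

    fix : ES → ES
    fix f e = ⨁ (λ v → coef f v ∧ χ (route v) e)

    fix-N : ∀ f {e} → fix f e ≡ true → e ∈ N
    fix-N f {e} h = let (v , p) = ⨁-true (λ v → coef f v ∧ χ (route v) e) h in route-N v (∧-right {coef f v} p)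

    ∂-fix : ∀ f x → A x ≡ false → ∂ (fix f) x ≡ coef f x
    ∂-fix f x x∉ = trans (⨁-cong λ e → trans (∧-comm (fix f e) (cut (isV x) e)) (sym (⨁-∧ (cut (isV x) e) (λ v → coef f v ∧ χ (route v) e))))
      (trans (⨁-swap (λ e v → cut (isV x) e ∧ (coef f v ∧ χ (route v) e)))
      (trans (⨁-cong pt) (⨁-at x (coef f))))
      where
        rearrange : ∀ c k r → c ∧ (k ∧ r) ≡ k ∧ (r ∧ c)
        rearrange c false r = ∧-zeroʳ c
        rearrange c true r = ∧-comm c r
        pt : ∀ v → ⨁ (λ e → cut (isV x) e ∧ (coef f v ∧ χ (route v) e)) ≡ isV x v ∧ coef f v
        pt v = trans (⨁-cong λ e → rearrange (cut (isV x) e) (coef f v) (χ (route v) e)) (trans (⨁-∧ (coef f v) (λ e → χ (route v) e ∧ cut (isV x) e)) (final (bool-cases (coef f v))))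
          where
            final : (coef f v ≡ true) ⊎ (coef f v ≡ false) → coef f v ∧ ∂ (χ (route v)) x ≡ isV x v ∧ coef f v
            final (inj₁ h) = trans (cong (coef f v ∧_) (route-∂ v x x∉ (∧-left h))) (∧-comm (coef f v) (isV x v))
            final (inj₂ h) rewrite h = sym (∧-zeroʳ (isV x v))

    rel-fix : ∀ {f} → (∀ v → A' v ≡ false → ∂ f v ≡ false) → Rel A (f ⊕ fix f)
    rel-fix {f} h x x∉ = trans (∂-⊕ f (fix f) x) (trans (cong (∂ f x xor_) (∂-fix f x x∉)) (fin (bool-cases (A' x))))
      where
        fin : (A' x ≡ true) ⊎ (A' x ≡ false) → ∂ f x xor coef f x ≡ false
        fin (inj₁ p) rewrite p | x∉ = xor-same (∂ f x)
        fin (inj₂ p) rewrite p = trans (xor-identityʳ (∂ f x)) (h x p)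

-- The two closure steps and the induction on the vertices outside `A`.

module Grow (G : SignedGraph) (E₀ : ES' G) where
  open Walks G
  open Link G
  open Flow G E₀

  Rec : VS → Set
  Rec A = ∀ A' → (∀ v → A v ≡ true → A' v ≡ true) → ∀ {v} → A v ≡ false → A' v ≡ true → Growth A'

  ends-of : ∀ {D : VS} {e a b u w} → Joins G e a b → Joins G e u w → D a ≡ true → D b ≡ true → D u ≡ true × D w ≡ true
  ends-of j k p q with joins-ends j k
  ... | inj₁ (refl , refl) = p , q
  ... | inj₂ (refl , refl) = q , p

  -- The piece hangs on `A` by two edges. A component `D` of an even set linking `y₁` to `y₂` goes
  -- into `C`, its vertices `W` into `A`, and `x₁`, `x₂` into `Y`. The spanning tree of `D` together
  -- with `x₁` leads `W` back to `A`; with `x₂` it carries the relative cycle `Γ`.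
  module StepTwo {A : VS} (P : Piece A) {x₁ x₂ : E} {y₁ a₁ y₂ a₂ : V} (x₁≢x₂ : x₁ ≢ x₂)
    (E₁ : E₀ x₁ ≡ true) (E₂ : E₀ x₂ ≡ true) (j₁ : Joins G x₁ y₁ a₁) (j₂ : Joins G x₂ y₂ a₂)
    (y₁∈ : Piece.B P y₁ ≡ true) (y₂∈ : Piece.B P y₂ ≡ true) (a₁∈ : A a₁ ≡ true) (a₂∈ : A a₂ ≡ true) (rec : Rec A) where
    open Piece P

    linked : Σ ES λ K → Even K × (∀ {e} → K e ≡ true → within B e ≡ true) × Walk G (In K) y₁ y₂
    linked = link (within B) around (conn y₁∈ y₂∈)

    K : ES
    K = proj₁ linked
    K⊆ : ∀ {e} → K e ≡ true → within B e ≡ true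
    K⊆ = proj₁ (proj₂ (proj₂ linked))
    R : Reach K y₁
    R = reach K y₁
    W : VS
    W = Reach.set R
    tv : List V
    tv = tverts (Reach.tree R)
    te : List E
    te = tedges (Reach.tree R)

    W⊆B : ∀ {v} → W v ≡ true → B v ≡ true
    W⊆B = reach-⊆ R B y₁∈ (λ k → within-uncut {B} (K⊆ k))
    W-A : ∀ {v} → W v ≡ true → A v ≡ false
    W-A h = apart (W⊆B h)
    y₂∈W : W y₂ ≡ true
    y₂∈W = reach-walk R (proj₂ (proj₂ (proj₂ linked)))

    A' : VS
    A' v = A v ∨ W v
    A⊆ : ∀ v → A v ≡ true → A' v ≡ true
    A⊆ v = ∨-left
    W⊆ : ∀ {v} → W v ≡ true → A' v ≡ true
    W⊆ {v} h = ∨-right {A v} h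
    drop' : ∀ {v} → A' v ≡ false → A v ≡ false
    drop' h = proj₁ (∨-false h)

    I : Growth A'
    I = rec A' A⊆ (apart y₁∈) (W⊆ (Reach.set-root R))
    module I = Growth I

    D : ES
    D = K ↾ W
    D-ends : ∀ {e a b} → D e ≡ true → Joins G e a b → W a ≡ true × W b ≡ true
    D-ends {e} h k = ends-of {W} (joins-self e) k (∧-right {K e} h) (Reach.set-step R (∧-left h) (joins-self e) (∧-right {K e} h))
    D-even : Even D
    D-even v = trans (∂-↾ (Reach.set-uncut R) v) (∧-falseʳ {W v} (proj₁ (proj₂ linked) v))

    te-D : ∀ {e} → e ∈ te → D e ≡ true
    te-D {e} h = ∧-intro (tedges-P (Reach.tree R) h) (∈-mem tv (proj₁ (tedge-ends (Reach.tree R) h (joins-self e))))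

    N : List E
    N = x₁ ∷ te
    M : List E
    M = x₂ ∷ N
    M-in : ∀ {e a b} → e ∈ M → Joins G e a b → A' a ≡ true × A' b ≡ true
    M-in (here refl) k = ends-of {A'} j₂ k (W⊆ y₂∈W) (∨-left a₂∈)
    M-in (there (here refl)) k = ends-of {A'} j₁ k (W⊆ (Reach.set-root R)) (∨-left a₁∈)
    M-in (there (there h)) k = let (p , q) = D-ends (te-D h) k in W⊆ p , W⊆ q
    C'-M : ∀ {e} → I.C e ≡ true → e ∉ M
    C'-M {e} h k = absurd (proj₁ (M-in k (joins-self e))) (I.C-avoids h (joins-self e))
    Y'-M : ∀ {e} → I.Y e ≡ true → e ∉ M
    Y'-M {e} h k = let (p , q) = M-in k (joins-self e) in absurd q (I.Y-leaves h (joins-self e) p)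
    C'-D : ∀ {e} → I.C e ≡ true → D e ≡ true → ⊥
    C'-D {e} h k = absurd (W⊆ (proj₁ (D-ends k (joins-self e)))) (I.C-avoids h (joins-self e))
    Y'-D : ∀ {e} → I.Y e ≡ true → D e ≡ true → ⊥
    Y'-D {e} h k = let (p , q) = D-ends k (joins-self e) in absurd (W⊆ q) (I.Y-leaves h (joins-self e) (W⊆ p))

    T C Y : ES
    T e = I.T e ∨ mem N e
    C = I.C ⊕ D
    Y e = I.Y e ∨ (isV x₁ e ∨ isV x₂ e)

    C-split : ∀ {e} → C e ≡ true → I.C e ≡ true ⊎ D e ≡ true
    C-split {e} h = case xor-split {I.C e} h of λ { (inj₁ (p , _)) → inj₁ p ; (inj₂ (_ , p)) → inj₂ p }
    C-left : ∀ {e} → I.C e ≡ true → C e ≡ true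
    C-left h = xor-trueˡ h (≢true⇒false (C'-D h))
    C-right : ∀ {e} → D e ≡ true → C e ≡ true
    C-right h = xor-trueʳ (≢true⇒false λ k → C'-D k h) h
    Y-split : ∀ {e} → Y e ≡ true → I.Y e ≡ true ⊎ e ≡ x₁ ⊎ e ≡ x₂
    Y-split {e} h = case ∨-split {I.Y e} h of λ { (inj₁ p) → inj₁ p ; (inj₂ q) → case ∨-split {isV x₁ e} q of λ
      { (inj₁ p) → inj₂ (inj₁ (sym (isV-true p))) ; (inj₂ p) → inj₂ (inj₂ (sym (isV-true p))) } }
    Y-x₁ : Y x₁ ≡ true
    Y-x₁ = ∨-right {I.Y x₁} (∨-left (isV-refl x₁))
    Y-x₂ : Y x₂ ≡ true
    Y-x₂ = ∨-right {I.Y x₂} (∨-right {isV x₁ x₂} (isV-refl x₂))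
    x₁-D : D x₁ ≡ true → ⊥
    x₁-D h = absurd a₁∈ (W-A (proj₂ (D-ends h j₁)))
    x₂-D : D x₂ ≡ true → ⊥
    x₂-D h = absurd a₂∈ (W-A (proj₂ (D-ends h j₂)))

    path : ∀ {v} → A' v ∧ not (A v) ≡ true → Σ V λ a → A a ≡ true × Walk G (_∈ N) v a
    path {v} h with ∨-split {A v} (∧-left h)
    ... | inj₁ p = absurd p (not-true (∧-right {A' v} h))
    ... | inj₂ p = a₁ , a₁∈ , weaken there (toRoot (Reach.tree R) (mem-∈ tv p)) ⟫ wstep x₁ (here refl) j₁ here

    module L = Lift {A} {A'} {N} path

    -- The closed walk a₁ y₁ … y₂ a₂ through the tree part of D is the cycle used to repair the values on x₁ and x₂.
    inner : Walk G (_∈ te) y₁ y₂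
    inner = rev (toRoot (Reach.tree R) (mem-∈ tv y₂∈W))
    Γl : List E
    Γl = x₁ ∷ (edges inner ++ x₂ ∷ [])
    Γ : ES
    Γ = χ Γl
    Γ-rel : Rel A Γ
    Γ-rel v v∉ = trans (cong (λ l → ∂ (χ l) v) (sym eqn)) (trans (∂-walk loop v) (cong₂ _xor_
        (isV-false {u = v} {a₁} λ { refl → absurd a₁∈ v∉ }) (isV-false {u = v} {a₂} λ { refl → absurd a₂∈ v∉ })))
      where
        inner' : Walk G (λ _ → ⊤) y₁ y₂
        inner' = weaken (λ _ → tt) inner
        loop : Walk G (λ _ → ⊤) a₁ a₂
        loop = wstep x₁ tt (joins-sym j₁) (inner' ⟫ wstep x₂ tt j₂ here)
        eqn : edges loop ≡ Γl
        eqn = cong (x₁ ∷_) (trans (edges-⟫ inner' _) (cong (_++ x₂ ∷ []) (mapW-edges inner _)))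
    Γ-M : ∀ {e} → Γ e ≡ true → e ∈ M
    Γ-M h with χ-∈ Γl h
    ... | here refl = there (here refl)
    ... | there k with ∈-++⁻ (edges inner) k
    ...   | inj₁ q = there (there (edges-P inner q))
    ...   | inj₂ (here q) = here q
    x₁∉te : x₁ ∉ te
    x₁∉te h = x₁-D (te-D h)
    x₂∉te : x₂ ∉ te
    x₂∉te h = x₂-D (te-D h)
    Γ-x₁ : Γ x₁ ≡ true
    Γ-x₁ = xor-trueˡ (isV-refl x₁) (χ-∉ (edges inner ++ x₂ ∷ []) λ h → case ∈-++⁻ (edges inner) h of λ
      { (inj₁ q) → x₁∉te (edges-P inner q) ; (inj₂ (here q)) → x₁≢x₂ q })
    Γ-x₂ : Γ x₂ ≡ true
    Γ-x₂ = xor-trueʳ (isV-false x₁≢x₂) (trans (χ-++ (edges inner) (x₂ ∷ []) x₂)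
      (xor-trueʳ (χ-∉ (edges inner) λ q → x₂∉te (edges-P inner q)) (trans (xor-identityʳ _) (isV-refl x₂))))

    -- Each of the two edges excludes exactly one of the four choices of `s` and `t`, so at least
    -- two choices are left.
    free : ∀ a b c d → Σ Bool λ s → Σ Bool λ t → (a xor s) ∨ (b xor t) ≡ true × (c xor s) ∨ (d xor t) ≡ true
    free false false false false = true , true , refl , refl
    free false false false true = true , true , refl , refl
    free false false true false = true , true , refl , refl
    free false false true true = true , false , refl , refl
    free false true false false = true , true , refl , refl
    free false true false true = true , true , refl , refl
    free false true true false = true , true , refl , refl
    free false true true true = true , false , refl , refl
    free true false false false = true , true , refl , refl
    free true false false true = true , true , refl , refl
    free true false true false = true , true , refl , refl
    free true false true true = false , true , refl , refl
    free true true false false = true , false , refl , refl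
    free true true false true = true , false , refl , refl
    free true true true false = false , true , refl , refl
    free true true true true = false , true , refl , refl

    reserve-I : ∀ {g} → Reserve I.T I.C I.Y g → Reserve T C Y g
    reserve-I r h = case r h of λ { (inj₁ p) → inj₁ (∨-left p) ; (inj₂ (p , q)) → inj₂ (C-left p , ∨-left q) }
    reserve-M : ∀ {e} → e ∈ M → Y e ≡ true ⊎ (C e ≡ true × T e ≡ true)
    reserve-M (here refl) = inj₁ Y-x₂
    reserve-M (there (here refl)) = inj₁ Y-x₁
    reserve-M {e} (there (there h)) = inj₂ (C-right (te-D h) , ∨-right {I.T e} (∈-mem N (there h)))

    -- First `fix` restores evenness on `W`, then `Γ` is added if `c` holds. Both change edges of
    -- `M` only, so the values that the recursion reached on its own `Y` survive.
    module Adjust (f g : ES) (c : Bool) where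
      h : ES
      h = (f ⊕ g) ⊕ L.fix (f ⊕ g)
      g' : ES
      g' = (g ⊕ L.fix (f ⊕ g)) ⊕ scale c Γ
      regroup : ∀ e → (f ⊕ g') e ≡ (h ⊕ scale c Γ) e
      regroup e = trans (sym (xor-assoc (f e) (g e xor L.fix (f ⊕ g) e) _)) (cong (_xor scale c Γ e) (sym (xor-assoc (f e) (g e) _)))
      rel : Rel A' (f ⊕ g) → Rel A (f ⊕ g')
      rel r v v∉ = trans (∂-cong regroup v) (rel-⊕ {A} {h} {scale c Γ} (L.rel-fix r) (rel-scale {A} {Γ} c Γ-rel) v v∉)
      reserve : Reserve I.T I.C I.Y g → Reserve T C Y g'
      reserve r {e} k with xor-split {(g ⊕ L.fix (f ⊕ g)) e} k
      ... | inj₂ (_ , q) = reserve-M (Γ-M (∧-right {c} q))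
      ... | inj₁ (p , _) with xor-split {g e} p
      ...   | inj₁ (q , _) = reserve-I r q
      ...   | inj₂ (_ , q) = reserve-M (there (L.fix-N (f ⊕ g) q))
      keep : ∀ {e} → e ∉ M → (f ⊕ g') e ≡ (f ⊕ g) e
      keep {e} n = trans (regroup e) (trans (cong₂ _xor_ (trans (cong ((f ⊕ g) e xor_) (≢true⇒false λ k → n (there (L.fix-N (f ⊕ g) k)))) (xor-identityʳ ((f ⊕ g) e)))
        (∧-falseʳ {c} (≢true⇒false λ k → n (Γ-M k)))) (xor-identityʳ ((f ⊕ g) e)))
      at : ∀ {e} → Γ e ≡ true → (f ⊕ g') e ≡ h e xor c
      at {e} k = trans (regroup e) (cong (h e xor_) (trans (cong (c ∧_) k) (∧-identityʳ c)))

    growth : Growth A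
    growth = record
      { T = T ; C = C ; Y = Y
      ; T⊆ = λ {e} h → case ∨-split {I.T e} h of λ
          { (inj₁ p) → case I.T⊆ p of λ { (inj₁ q) → inj₁ (C-left q) ; (inj₂ q) → inj₂ (∨-left q) }
          ; (inj₂ p) → case mem-∈ N p of λ { (here refl) → inj₂ Y-x₁ ; (there q) → inj₁ (C-right (te-D q)) } }
      ; C⊆ = λ h → case C-split h of λ { (inj₁ p) → I.C⊆ p ; (inj₂ p) → ∧-left (K⊆ (∧-left p)) }
      ; Y⊆ = λ h → case Y-split h of λ { (inj₁ p) → I.Y⊆ p ; (inj₂ (inj₁ refl)) → E₁ ; (inj₂ (inj₂ refl)) → E₂ }
      ; CY = λ h → ≢true⇒false λ k → CY-disjoint (C-split h) (Y-split k)
      ; C-even = even-⊕ {I.C} I.C-even D-even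
      ; C-avoids = λ {_} {a} h k → case C-split h of λ { (inj₁ p) → drop' (I.C-avoids p k) ; (inj₂ p) → W-A (proj₁ (D-ends p k)) }
      ; Y-leaves = λ {e} {a} {b} h k p → case Y-split h of λ
          { (inj₁ q) → drop' (I.Y-leaves q k (A⊆ a p))
          ; (inj₂ (inj₁ refl)) → one-end k j₁ (apart y₁∈) p ; (inj₂ (inj₂ refl)) → one-end k j₂ (apart y₂∈) p }
      ; bound = bound
      ; toA = toA
      ; flow = flow }
      where
        CY-disjoint : ∀ {e} → I.C e ≡ true ⊎ D e ≡ true → I.Y e ≡ true ⊎ e ≡ x₁ ⊎ e ≡ x₂ → ⊥
        CY-disjoint (inj₁ p) (inj₁ q) = absurd q (I.CY p)
        CY-disjoint (inj₁ p) (inj₂ (inj₁ refl)) = C'-M p (there (here refl))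
        CY-disjoint (inj₁ p) (inj₂ (inj₂ refl)) = C'-M p (here refl)
        CY-disjoint (inj₂ p) (inj₁ q) = Y'-D q p
        CY-disjoint (inj₂ p) (inj₂ (inj₁ refl)) = x₁-D p
        CY-disjoint (inj₂ p) (inj₂ (inj₂ refl)) = x₂-D p
        one-end : ∀ {e a b y c} → Joins G e a b → Joins G e y c → A y ≡ false → A a ≡ true → A b ≡ false
        one-end k j y∉ p with joins-ends j k
        ... | inj₁ (refl , refl) = absurd p y∉
        ... | inj₂ (refl , refl) = y∉
        bound : 5 * count Y + 11 * count (λ e → C e ∧ T e) + 11 * count A ≤ 11 * nV G
        bound = ≤-trans (+-mono-≤ (+-mono-≤ (ℕₚ.*-monoʳ-≤ 5 cY) (ℕₚ.*-monoʳ-≤ 11 cCT)) ≤-refl)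
            (≤-trans (arith (count I.Y) (count (λ e → I.C e ∧ I.T e)) (length te) (count A)) (≤-trans (ℕₚ.+-monoʳ-≤ (5 * count I.Y + 11 * count (λ e → I.C e ∧ I.T e)) (ℕₚ.*-monoʳ-≤ 11 (≤-reflexive (sym cA)))) I.bound))
          where
            cY : count Y ≤ count I.Y + 2
            cY = ≤-trans (count-∨ I.Y (λ e → isV x₁ e ∨ isV x₂ e)) (ℕₚ.+-monoʳ-≤ (count I.Y) (≤-trans (count-∨ (isV x₁) (isV x₂)) (≤-reflexive (cong₂ _+_ (count-isV x₁) (count-isV x₂)))))
            cCT : count (λ e → C e ∧ T e) ≤ count (λ e → I.C e ∧ I.T e) + length te
            cCT = ≤-trans (count-mono {g = λ e → (I.C e ∧ I.T e) ∨ mem te e} pt) (≤-trans (count-∨ (λ e → I.C e ∧ I.T e) (mem te)) (ℕₚ.+-monoʳ-≤ (count (λ e → I.C e ∧ I.T e)) (count-mem te)))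
              where
                pt : ∀ e → C e ∧ T e ≡ true → (I.C e ∧ I.T e) ∨ mem te e ≡ true
                pt e h with C-split {e} (∧-left h) | ∨-split {I.T e} (∧-right {C e} h)
                ... | inj₁ p | inj₁ q = ∨-left (∧-intro p q)
                ... | inj₁ p | inj₂ q = ⊥-elim (C'-M p (there (mem-∈ N q)))
                ... | inj₂ p | inj₁ q = case I.T⊆ q of λ { (inj₁ r) → ⊥-elim (C'-D r p) ; (inj₂ r) → ⊥-elim (Y'-D r p) }
                ... | inj₂ p | inj₂ q with mem-∈ N q
                ...   | here refl = ⊥-elim (x₁-D p)
                ...   | there r = ∨-right {I.C e ∧ I.T e} (∈-mem te r)
            cA : count A' ≡ count A + suc (length te)
            cA = trans (count-∨-disjoint A W λ v p → ≢true⇒false λ q → absurd p (W-A q))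
              (cong (count A +_) (trans (count-mem-unique tv (Reach.uniq R)) (length-tverts (Reach.tree R))))
            arith : ∀ y c t a → 5 * (y + 2) + 11 * (c + t) + 11 * a ≤ 5 * y + 11 * c + 11 * (a + suc t)
            arith y c t a = ≤-trans (m≤m+n _ 1) (≤-reflexive (solve 4 (λ y c t a → con 5 :* (y :+ con 2) :+ con 11 :* (c :+ t) :+ con 11 :* a :+ con 1 := con 5 :* y :+ con 11 :* c :+ con 11 :* (a :+ (con 1 :+ t))) refl y c t a))
              where open +-*-Solver
        toA : ∀ v → Σ V λ a → A a ≡ true × Walk G (In T) v a
        toA v with I.toA v
        ... | a , a∈ , w with bool-cases (A a)
        ...   | inj₁ p = a , p , weaken ∨-left w
        ...   | inj₂ p = let (b , b∈ , w') = path {a} (∧-intro a∈ (not-intro p)) in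
                  b , b∈ , weaken ∨-left w ⟫ weaken (λ {e} q → ∨-right {I.T e} (∈-mem N q)) w'
        flow : ∀ f₁ f₂ → Rel A f₁ → Rel A f₂ → (∀ {e} → f₁ e ≡ true → E₀ e ≡ true) → (∀ {e} → f₂ e ≡ true → E₀ e ≡ true) →
          Σ ES λ g₁ → Σ ES λ g₂ → Rel A (f₁ ⊕ g₁) × Rel A (f₂ ⊕ g₂) × Reserve T C Y g₁ × Reserve T C Y g₂ ×
            (∀ {e} → Y e ≡ true → (f₁ ⊕ g₁) e ∨ (f₂ ⊕ g₂) e ≡ true)
        flow f₁ f₂ r₁ r₂ s₁ s₂ = from (I.flow f₁ f₂ (λ v h → r₁ v (drop' h)) (λ v h → r₂ v (drop' h)) s₁ s₂)
          where
            from : (Σ ES λ g₁ → Σ ES λ g₂ → Rel A' (f₁ ⊕ g₁) × Rel A' (f₂ ⊕ g₂) × Reserve I.T I.C I.Y g₁ × Reserve I.T I.C I.Y g₂ ×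
              (∀ {e} → I.Y e ≡ true → (f₁ ⊕ g₁) e ∨ (f₂ ⊕ g₂) e ≡ true)) → _
            from (g₁ , g₂ , q₁ , q₂ , t₁ , t₂ , nz) = adjust (free (h₁ x₁) (h₂ x₁) (h₁ x₂) (h₂ x₂))
              where
                h₁ h₂ : ES
                h₁ = Adjust.h f₁ g₁ true
                h₂ = Adjust.h f₂ g₂ true
                adjust : (Σ Bool λ s → Σ Bool λ t → (h₁ x₁ xor s) ∨ (h₂ x₁ xor t) ≡ true × (h₁ x₂ xor s) ∨ (h₂ x₂ xor t) ≡ true) → _
                adjust (c₁ , c₂ , p , q) = A₁.g' , A₂.g' , A₁.rel q₁ , A₂.rel q₂ , (λ {e} → A₁.reserve t₁ {e}) , (λ {e} → A₂.reserve t₂ {e}) , λ {e} k → cover {e} (Y-split k)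
                  where
                    module A₁ = Adjust f₁ g₁ c₁
                    module A₂ = Adjust f₂ g₂ c₂
                    cover : ∀ {e} → I.Y e ≡ true ⊎ e ≡ x₁ ⊎ e ≡ x₂ → (f₁ ⊕ A₁.g') e ∨ (f₂ ⊕ A₂.g') e ≡ true
                    cover (inj₁ k) = trans (cong₂ _∨_ (A₁.keep (Y'-M k)) (A₂.keep (Y'-M k))) (nz k)
                    cover (inj₂ (inj₁ refl)) = trans (cong₂ _∨_ (A₁.at Γ-x₁) (A₂.at Γ-x₁)) p
                    cover (inj₂ (inj₂ refl)) = trans (cong₂ _∨_ (A₁.at Γ-x₂) (A₂.at Γ-x₂)) q

  -- Here `x` is the only edge from the piece to `A`, and `t` is the only other boundary edge. Just
  -- `y` moves into `A`. The edge `t` is taken care of around the recursive call, and `x` then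
  -- follows by conservation across `B`.
  module StepOne {A : VS} (P : Piece A) {x t : E} {y a : V} (x≢t : x ≢ t)
    (Ex : E₀ x ≡ true) (jx : Joins G x y a) (y∈ : Piece.B P y ≡ true) (a∈ : A a ≡ true)
    (Et : Flow.Ext G E₀ A (Piece.B P) t) (only : ∀ {e} → E₀ e ≡ true → cut (Piece.B P) e ≡ true → e ≡ x ⊎ e ≡ t) (rec : Rec A) where
    open Piece P

    p q : V
    p = proj₁ Et
    q = proj₁ (proj₂ Et)
    E₀t : E₀ t ≡ true
    E₀t = proj₁ (proj₂ (proj₂ Et))
    jt : Joins G t p q
    jt = proj₁ (proj₂ (proj₂ (proj₂ Et)))
    p∈ : B p ≡ true
    p∈ = proj₁ (proj₂ (proj₂ (proj₂ (proj₂ Et))))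
    q∉B : B q ≡ false
    q∉B = proj₁ (proj₂ (proj₂ (proj₂ (proj₂ (proj₂ Et)))))
    q∉A : A q ≡ false
    q∉A = proj₂ (proj₂ (proj₂ (proj₂ (proj₂ (proj₂ Et)))))
    cut-t : cut B t ≡ true
    cut-t = trans (joins-cut B jt) (xor-trueˡ p∈ q∉B)

    A' : VS
    A' v = A v ∨ isV y v
    A⊆ : ∀ v → A v ≡ true → A' v ≡ true
    A⊆ v = ∨-left
    y∈A' : A' y ≡ true
    y∈A' = ∨-right {A y} (isV-refl y)
    drop' : ∀ {v} → A' v ≡ false → A v ≡ false
    drop' h = proj₁ (∨-false h)

    I : Growth A'
    I = rec A' A⊆ (apart y∈) y∈A'
    module I = Growth I

    C-x : I.C x ≡ true → ⊥
    C-x h = absurd y∈A' (I.C-avoids h jx)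
    -- `C` avoids `x`, whose end `y` lies in `A'`, and an even set within `E₀` cannot cross the
    -- boundary of `B` by `t` alone.
    C-t : I.C t ≡ true → ⊥
    C-t h = case even-second {I.C} I.C-even B h cut-t of λ { (e , e≢t , Ce , ce) → case only (I.C⊆ Ce) ce of λ
      { (inj₁ refl) → C-x Ce ; (inj₂ r) → e≢t r } }
    Y-x : I.Y x ≡ true → ⊥
    Y-x h = absurd (∨-left a∈) (I.Y-leaves h jx y∈A')

    T Y : ES
    T e = I.T e ∨ isV x e
    Y e = I.Y e ∨ (isV x e ∨ isV t e)

    Y-split : ∀ {e} → Y e ≡ true → I.Y e ≡ true ⊎ e ≡ x ⊎ e ≡ t
    Y-split {e} h = case ∨-split {I.Y e} h of λ { (inj₁ p) → inj₁ p ; (inj₂ q) → case ∨-split {isV x e} q of λ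
      { (inj₁ p) → inj₂ (inj₁ (sym (isV-true p))) ; (inj₂ p) → inj₂ (inj₂ (sym (isV-true p))) } }
    Y-at-x : Y x ≡ true
    Y-at-x = ∨-right {I.Y x} (∨-left (isV-refl x))
    Y-at-t : Y t ≡ true
    Y-at-t = ∨-right {I.Y t} (∨-right {isV x t} (isV-refl t))

    path : ∀ {v} → A' v ∧ not (A v) ≡ true → Σ V λ b → A b ≡ true × Walk G (_∈ (x ∷ [])) v b
    path {v} h with ∨-split {A v} (∧-left h)
    ... | inj₁ k = absurd k (not-true (∧-right {A' v} h))
    ... | inj₂ k with isV-true k
    ...   | refl = a , a∈ , wstep x (here refl) jx here

    module L = Lift {A} {A'} {x ∷ []} path

    reserve-I : ∀ {g} → Reserve I.T I.C I.Y g → Reserve T I.C Y g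
    reserve-I r h = case r h of λ { (inj₁ p) → inj₁ (∨-left p) ; (inj₂ (p , q)) → inj₂ (p , ∨-left q) }

    Good : ES → ES → ES → ES → Set
    Good f₁ f₂ g₁ g₂ = Rel A' (f₁ ⊕ g₁) × Rel A' (f₂ ⊕ g₂) × Reserve T I.C Y g₁ × Reserve T I.C Y g₂ ×
      (∀ {e} → I.Y e ≡ true ⊎ e ≡ t → (f₁ ⊕ g₁) e ∨ (f₂ ⊕ g₂) e ≡ true)

    onE₀ : ∀ {f g} → (∀ {e} → f e ≡ true → E₀ e ≡ true) → Reserve T I.C Y g → ∀ {e} → (f ⊕ g) e ≡ true → E₀ e ≡ true
    onE₀ {f} {g} s r {e} h with xor-split {f e} h
    ... | inj₁ (p , _) = s p
    ... | inj₂ (_ , p) with r p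
    ...   | inj₂ (c , _) = I.C⊆ c
    ...   | inj₁ k with Y-split k
    ...     | inj₁ i = I.Y⊆ i
    ...     | inj₂ (inj₁ refl) = Ex
    ...     | inj₂ (inj₂ refl) = E₀t

    -- Relative even sets are conserved across B, whose only boundary edges are x and t.
    same-xt : ∀ {f} → Rel A f → (∀ {e} → f e ≡ true → E₀ e ≡ true) → f t ≡ true → f x ≡ true
    same-xt {f} r s h with ⨁-second (λ e → f e ∧ cut B e) (trans (sym (cut-sum B f)) (⨁-false zeros)) (∧-intro h cut-t)
      where
        zeros : ∀ v → B v ∧ ∂ f v ≡ false
        zeros v with bool-cases (B v)
        ... | inj₁ k = ∧-falseʳ {B v} (r v (apart k))
        ... | inj₂ k = ∧-falseˡ k
    ... | e , e≢t , k with only (s (∧-left k)) (∧-right {f e} k)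
    ...   | inj₁ refl = ∧-left k
    ...   | inj₂ r' = ⊥-elim (e≢t r')

    finish : ∀ f₁ f₂ → (∀ {e} → f₁ e ≡ true → E₀ e ≡ true) → (∀ {e} → f₂ e ≡ true → E₀ e ≡ true) → ∀ g₁ g₂ → Good f₁ f₂ g₁ g₂ →
      Σ ES λ g₁ → Σ ES λ g₂ → Rel A (f₁ ⊕ g₁) × Rel A (f₂ ⊕ g₂) × Reserve T I.C Y g₁ × Reserve T I.C Y g₂ ×
        (∀ {e} → Y e ≡ true → (f₁ ⊕ g₁) e ∨ (f₂ ⊕ g₂) e ≡ true)
    finish f₁ f₂ s₁ s₂ g₁ g₂ (q₁ , q₂ , t₁ , t₂ , nz) = M₁.g' , M₂.g' , M₁.rel q₁ , M₂.rel q₂ , (λ {e} → M₁.reserve t₁ {e}) , (λ {e} → M₂.reserve t₂ {e}) , λ k → cover (Y-split k)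
      where
        module M (f g : ES) where
          g' : ES
          g' = g ⊕ L.fix (f ⊕ g)
          regroup : ∀ e → (f ⊕ g') e ≡ ((f ⊕ g) ⊕ L.fix (f ⊕ g)) e
          regroup e = sym (xor-assoc (f e) (g e) _)
          rel : Rel A' (f ⊕ g) → Rel A (f ⊕ g')
          rel r v v∉ = trans (∂-cong regroup v) (L.rel-fix r v v∉)
          reserve : Reserve T I.C Y g → Reserve T I.C Y g'
          reserve r {e} k with xor-split {g e} k
          ... | inj₁ (p , _) = r p
          ... | inj₂ (_ , p) with L.fix-N (f ⊕ g) p
          ...   | here refl = inj₁ Y-at-x
          keep : ∀ {e} → e ≢ x → (f ⊕ g') e ≡ (f ⊕ g) e
          keep {e} n = trans (regroup e) (trans (cong ((f ⊕ g) e xor_) (≢true⇒false λ k → case L.fix-N (f ⊕ g) k of λ { (here r) → n r })) (xor-identityʳ ((f ⊕ g) e)))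
        module M₁ = M f₁ g₁
        module M₂ = M f₂ g₂
        at-t : (f₁ ⊕ M₁.g') t ∨ (f₂ ⊕ M₂.g') t ≡ true
        at-t = trans (cong₂ _∨_ (M₁.keep (x≢t ∘ sym)) (M₂.keep (x≢t ∘ sym))) (nz (inj₂ refl))
        cover : ∀ {e} → I.Y e ≡ true ⊎ e ≡ x ⊎ e ≡ t → (f₁ ⊕ M₁.g') e ∨ (f₂ ⊕ M₂.g') e ≡ true
        cover (inj₁ k) = trans (cong₂ _∨_ (M₁.keep (λ { refl → Y-x k })) (M₂.keep (λ { refl → Y-x k }))) (nz (inj₁ k))
        cover (inj₂ (inj₂ refl)) = at-t
        cover (inj₂ (inj₁ refl)) with ∨-split {(f₁ ⊕ M₁.g') t} at-t
        ... | inj₁ h = ∨-left (same-xt (M₁.rel q₁) (onE₀ {f₁} {M₁.g'} s₁ (λ {e} → M₁.reserve t₁ {e})) h)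
        ... | inj₂ h = ∨-right {(f₁ ⊕ M₁.g') x} (same-xt (M₂.rel q₂) (onE₀ {f₂} {M₂.g'} s₂ (λ {e} → M₂.reserve t₂ {e})) h)

    -- Unless the recursion puts `t` into its own `Y`, its corrections cannot touch `t`. So `f₁` is
    -- altered beforehand: a relative cycle through `t`, closed along the tree, makes its value at
    -- `t` true, and this value stays.
    prepare : ∀ f₁ f₂ → Rel A' f₁ → Rel A' f₂ → (∀ {e} → f₁ e ≡ true → E₀ e ≡ true) → (∀ {e} → f₂ e ≡ true → E₀ e ≡ true) → Σ ES λ g₁ → Σ ES λ g₂ → Good f₁ f₂ g₁ g₂
    prepare f₁ f₂ r₁ r₂ s₁ s₂ with bool-cases (I.Y t)
    ... | inj₁ Yt = let (g₁ , g₂ , q₁ , q₂ , t₁ , t₂ , nz) = I.flow f₁ f₂ r₁ r₂ s₁ s₂ in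
        g₁ , g₂ , q₁ , q₂ , (λ {e} → reserve-I t₁ {e}) , (λ {e} → reserve-I t₂ {e}) , λ { (inj₁ k) → nz k ; (inj₂ refl) → nz Yt }
    ... | inj₂ ¬Yt = repaired (I.flow (f₁ ⊕ scale c Γ) f₂ (rel-⊕ {A'} {f₁} r₁ (rel-scale {A'} {Γ} c Γ-rel)) r₂ sΓ s₂)
      where
        c : Bool
        c = not (f₁ t)
        wp : Σ V λ b → A' b ≡ true × Walk G (In I.T) p b
        wp = I.toA p
        wq : Σ V λ b → A' b ≡ true × Walk G (In I.T) q b
        wq = I.toA q
        loop : Walk G (λ e → e ≡ t ⊎ I.T e ≡ true) (proj₁ wp) (proj₁ wq)
        loop = weaken inj₂ (rev (proj₂ (proj₂ wp))) ⟫ wstep t (inj₁ refl) jt (weaken inj₂ (proj₂ (proj₂ wq)))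
        Γ : ES
        Γ = χ (edges loop)
        Γ-rel : Rel A' Γ
        Γ-rel v v∉ = trans (∂-walk loop v) (cong₂ _xor_ (isV-false λ r → absurd (proj₁ (proj₂ wp)) (subst (λ z → A' z ≡ false) r v∉))
          (isV-false λ r → absurd (proj₁ (proj₂ wq)) (subst (λ z → A' z ≡ false) r v∉)))
        ¬Tt : I.T t ≡ true → ⊥
        ¬Tt h = case I.T⊆ h of λ { (inj₁ k) → C-t k ; (inj₂ k) → absurd k ¬Yt }
        Γ-t : Γ t ≡ true
        Γ-t = trans (cong (λ l → χ l t) (edges-⟫ (weaken inj₂ (rev (proj₂ (proj₂ wp)))) _)) (trans (χ-++ (edges (weaken {Q = λ e → e ≡ t ⊎ I.T e ≡ true} inj₂ (rev (proj₂ (proj₂ wp))))) _ t)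
          (xor-trueʳ (off (rev (proj₂ (proj₂ wp)))) (xor-trueˡ (isV-refl t) (off (proj₂ (proj₂ wq))))))
          where
            off : ∀ {u v} (w : Walk G (In I.T) u v) → χ (edges (weaken {Q = λ e → e ≡ t ⊎ I.T e ≡ true} inj₂ w)) t ≡ false
            off w = χ-∉ (edges (weaken {Q = λ e → e ≡ t ⊎ I.T e ≡ true} inj₂ w)) λ h → ¬Tt (edges-P w (subst (t ∈_) (mapW-edges w _) h))
        Γ-T : ∀ {e} → Γ e ≡ true → e ≡ t ⊎ I.T e ≡ true
        Γ-T h = edges-P loop (χ-∈ (edges loop) h)
        T-E₀ : ∀ {e} → I.T e ≡ true → E₀ e ≡ true
        T-E₀ h = case I.T⊆ h of λ { (inj₁ k) → I.C⊆ k ; (inj₂ k) → I.Y⊆ k }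
        sΓ : ∀ {e} → (f₁ ⊕ scale c Γ) e ≡ true → E₀ e ≡ true
        sΓ {e} h = case xor-split {f₁ e} h of λ { (inj₁ (k , _)) → s₁ k ; (inj₂ (_ , k)) → case Γ-T (∧-right {c} k) of λ
          { (inj₁ refl) → E₀t ; (inj₂ i) → T-E₀ i } }
        f₁t : (f₁ ⊕ scale c Γ) t ≡ true
        f₁t = trans (cong (λ b → f₁ t xor (not (f₁ t) ∧ b)) Γ-t) (lem (f₁ t))
          where
            lem : ∀ b → b xor (not b ∧ true) ≡ true
            lem true = refl
            lem false = refl
        not-t : ∀ {g} → Reserve I.T I.C I.Y g → g t ≡ false
        not-t r = ≢true⇒false λ h → case r h of λ { (inj₁ k) → absurd k ¬Yt ; (inj₂ (k , _)) → C-t k }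
        repaired : (Σ ES λ g₁ → Σ ES λ g₂ → Rel A' ((f₁ ⊕ scale c Γ) ⊕ g₁) × Rel A' (f₂ ⊕ g₂) × Reserve I.T I.C I.Y g₁ × Reserve I.T I.C I.Y g₂ ×
          (∀ {e} → I.Y e ≡ true → ((f₁ ⊕ scale c Γ) ⊕ g₁) e ∨ (f₂ ⊕ g₂) e ≡ true)) → Σ ES λ g₁ → Σ ES λ g₂ → Good f₁ f₂ g₁ g₂
        repaired (g₁ , g₂ , q₁ , q₂ , t₁ , t₂ , nz) = scale c Γ ⊕ g₁ , g₂
          , (λ v h → trans (∂-cong (λ e → sym (xor-assoc (f₁ e) (scale c Γ e) (g₁ e))) v) (q₁ v h)) , q₂
          , (λ {e} h → case xor-split {scale c Γ e} h of λ
              { (inj₁ (k , _)) → case Γ-T (∧-right {c} k) of λ { (inj₁ refl) → inj₁ Y-at-t ; (inj₂ i) → case I.T⊆ i of λ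
                  { (inj₁ m) → inj₂ (m , ∨-left i) ; (inj₂ m) → inj₁ (∨-left m) } }
              ; (inj₂ (_ , k)) → reserve-I t₁ k })
          , (λ {e} → reserve-I t₂ {e})
          , λ { {e} (inj₁ k) → trans (cong (_∨ (f₂ ⊕ g₂) e) (sym (xor-assoc (f₁ e) (scale c Γ e) (g₁ e)))) (nz k)
              ; (inj₂ refl) → ∨-left (trans (sym (xor-assoc (f₁ t) (scale c Γ t) (g₁ t))) (trans (cong ((f₁ ⊕ scale c Γ) t xor_) (not-t {g₁} t₁)) (trans (xor-identityʳ _) f₁t))) }

    growth : Growth A
    growth = record
      { T = T ; C = I.C ; Y = Y
      ; T⊆ = λ {e} h → case ∨-split {I.T e} h of λ
          { (inj₁ k) → case I.T⊆ k of λ { (inj₁ i) → inj₁ i ; (inj₂ i) → inj₂ (∨-left i) }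
          ; (inj₂ k) → inj₂ (subst (λ z → Y z ≡ true) (isV-true k) Y-at-x) }
      ; C⊆ = I.C⊆
      ; Y⊆ = λ h → case Y-split h of λ { (inj₁ k) → I.Y⊆ k ; (inj₂ (inj₁ refl)) → Ex ; (inj₂ (inj₂ refl)) → E₀t }
      ; CY = λ h → ≢true⇒false λ k → case Y-split k of λ
          { (inj₁ i) → absurd i (I.CY h) ; (inj₂ (inj₁ refl)) → C-x h ; (inj₂ (inj₂ refl)) → C-t h }
      ; C-even = I.C-even
      ; C-avoids = λ h k → drop' (I.C-avoids h k)
      ; Y-leaves = λ {e} {u} {w} h k u∈ → case Y-split h of λ
          { (inj₁ i) → drop' (I.Y-leaves i k (A⊆ u u∈))
          ; (inj₂ (inj₁ refl)) → case joins-ends jx k of λ { (inj₁ (refl , _)) → absurd u∈ (apart y∈) ; (inj₂ (_ , refl)) → apart y∈ }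
          ; (inj₂ (inj₂ refl)) → case joins-ends jt k of λ { (inj₁ (refl , refl)) → q∉A ; (inj₂ (refl , refl)) → apart p∈ } }
      ; bound = bound
      ; toA = toA
      ; flow = λ f₁ f₂ r₁ r₂ s₁ s₂ → let (g₁ , g₂ , ok) = prepare f₁ f₂ (λ v h → r₁ v (drop' h)) (λ v h → r₂ v (drop' h)) s₁ s₂ in finish f₁ f₂ s₁ s₂ g₁ g₂ ok }
      where
        bound : 5 * count Y + 11 * count (λ e → I.C e ∧ T e) + 11 * count A ≤ 11 * nV G
        bound = ≤-trans (+-mono-≤ (+-mono-≤ (ℕₚ.*-monoʳ-≤ 5 cY) (ℕₚ.*-monoʳ-≤ 11 cCT)) ≤-refl)
            (≤-trans (arith (count I.Y) (count (λ e → I.C e ∧ I.T e)) (count A)) (≤-trans (ℕₚ.+-monoʳ-≤ (5 * count I.Y + 11 * count (λ e → I.C e ∧ I.T e)) (ℕₚ.*-monoʳ-≤ 11 (≤-reflexive (sym cA)))) I.bound))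
          where
            cY : count Y ≤ count I.Y + 2
            cY = ≤-trans (count-∨ I.Y (λ e → isV x e ∨ isV t e)) (ℕₚ.+-monoʳ-≤ (count I.Y) (≤-trans (count-∨ (isV x) (isV t)) (≤-reflexive (cong₂ _+_ (count-isV x) (count-isV t)))))
            cCT : count (λ e → I.C e ∧ T e) ≤ count (λ e → I.C e ∧ I.T e)
            cCT = count-mono {g = λ e → I.C e ∧ I.T e} λ e h → case ∨-split {I.T e} (∧-right {I.C e} h) of λ
              { (inj₁ k) → ∧-intro (∧-left h) k ; (inj₂ k) → ⊥-elim (C-x (subst (λ z → I.C z ≡ true) (sym (isV-true k)) (∧-left h))) }
            cA : count A' ≡ count A + 1
            cA = trans (count-∨-disjoint A (isV y) λ v h → ≢true⇒false λ k → absurd h (subst (λ z → A z ≡ false) (isV-true k) (apart y∈))) (cong (count A +_) (count-isV y))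
            arith : ∀ y c a → 5 * (y + 2) + 11 * c + 11 * a ≤ 5 * y + 11 * c + 11 * (a + 1)
            arith y c a = ≤-trans (m≤m+n _ 1) (≤-reflexive (solve 3 (λ y c a → con 5 :* (y :+ con 2) :+ con 11 :* c :+ con 11 :* a :+ con 1 := con 5 :* y :+ con 11 :* c :+ con 11 :* (a :+ con 1)) refl y c a))
              where open +-*-Solver
        toA : ∀ v → Σ V λ a → A a ≡ true × Walk G (In T) v a
        toA v with I.toA v
        ... | b , b∈ , w with bool-cases (A b)
        ...   | inj₁ k = b , k , weaken ∨-left w
        ...   | inj₂ k = let (b' , b'∈ , w') = path {b} (∧-intro b∈ (not-intro k)) in
                  b' , b'∈ , weaken ∨-left w ⟫ weaken (λ {e} i → ∨-right {I.T e} (case i of λ { (here refl) → isV-refl x })) w'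

  module _ {A : VS} (P : Piece A) where
    open Piece P

    toRootEdge : ES
    toRootEdge e = E₀ e ∧ ((B (src e) ∧ A (tgt e)) ∨ (B (tgt e) ∧ A (src e)))

    toRoot-elim : ∀ {e} → toRootEdge e ≡ true → Σ V λ y → Σ V λ a → E₀ e ≡ true × Joins G e y a × B y ≡ true × A a ≡ true
    toRoot-elim {e} h with ∨-split {B (src e) ∧ A (tgt e)} (∧-right {E₀ e} h)
    ... | inj₁ k = src e , tgt e , ∧-left h , joins-self e , ∧-left k , ∧-right {B (src e)} k
    ... | inj₂ k = tgt e , src e , ∧-left h , joins-sym (joins-self e) , ∧-left k , ∧-right {B (tgt e)} k

    boundary : ∀ {e} → E₀ e ≡ true → cut B e ≡ true → toRootEdge e ≡ true ⊎ Ext A B e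
    boundary {e} s c with cut-orient B {e} c
    ... | u , w , j , u∈ , w∉ with bool-cases (A w)
    ...   | inj₂ w∉A = inj₂ (u , w , s , j , u∈ , w∉ , w∉A)
    ...   | inj₁ w∈A with j
    ...     | inj₁ refl = inj₁ (∧-intro s (∨-left (∧-intro u∈ w∈A)))
    ...     | inj₂ refl = inj₁ (∧-intro s (∨-right {B (src e) ∧ A (tgt e)} (∧-intro u∈ w∈A)))

  -- A piece has two boundary edges by thickness but at most one external edge, so some edge leads
  -- to `A`. A second edge to `A` permits `StepTwo`; if there is none, the boundary is this edge and
  -- one external edge, as `StepOne` requires.
  grow-raw : ∀ A → Thick A → Acc _<_ (count (not ∘ A)) → Growth A
  grow-raw A thick (acc rs) = cases (search (not ∘ A))
    where
      rec : Rec A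
      rec A' A⊆ {v} v∉ v∈ = grow-raw A' (λ B b∈ apart → thick B b∈ λ h → ≢true⇒false λ k → absurd (A⊆ _ k) (apart h))
        (rs (count-strict (not ∘ A') (not ∘ A) (λ u h → not-intro (≢true⇒false λ k → absurd (A⊆ u k) (not-true h))) (cong not v∈) (not-intro v∉)))
      cases : (∃ λ v → not (A v) ≡ true) ⊎ (∀ v → not (A v) ≡ false) → Growth A
      cases (inj₂ all) = record { T = λ _ → false ; C = λ _ → false ; Y = λ _ → false ; T⊆ = λ () ; C⊆ = λ () ; Y⊆ = λ () ; CY = λ () ; C-even = even-∅
        ; C-avoids = λ () ; Y-leaves = λ ()
        ; bound = ≤-trans (≤-reflexive (cong₂ (λ i k → 5 * i + 11 * k + 11 * count A) (count-false {nE G}) (count-false {nE G}))) (ℕₚ.*-monoʳ-≤ 11 (count≤n A))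
        ; toA = λ v → v , full v , here
        ; flow = λ f₁ f₂ _ _ _ _ → (λ _ → false) , (λ _ → false) , (λ v h → absurd (full v) h) , (λ v h → absurd (full v) h) , (λ ()) , (λ ()) , λ () }
        where
          full : ∀ v → A v ≡ true
          full v = ≢false⇒true λ h → absurd (not-intro h) (all v)
      cases (inj₁ (v , v∉)) = first (search (toRootEdge P))
        where
          P : Piece A
          P = piece A (not-true v∉)
          open Piece P
          first : (∃ λ e → toRootEdge P e ≡ true) ⊎ (∀ e → toRootEdge P e ≡ false) → Growth A
          first (inj₂ none) = let (e , e' , e≢e' , (s , c) , (s' , c')) = thick B b₀∈ apart in
            ⊥-elim (case boundary P s c of λ { (inj₁ k) → absurd k (none e) ; (inj₂ k) → case boundary P s' c' of λ
              { (inj₁ k') → absurd k' (none e') ; (inj₂ k') → e≢e' (ext≤1 k k') } })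
          first (inj₁ (x , hx)) = second (search λ e → toRootEdge P e ∧ not (isV x e))
            where
              ex = toRoot-elim P hx
              second : (∃ λ e → toRootEdge P e ∧ not (isV x e) ≡ true) ⊎ (∀ e → toRootEdge P e ∧ not (isV x e) ≡ false) → Growth A
              second (inj₁ (x' , h)) with ex | toRoot-elim P (∧-left h)
              ... | y , a , s , j , y∈ , a∈ | y' , a' , s' , j' , y'∈ , a'∈ =
                    StepTwo.growth P {x} {x'} (λ { refl → absurd (isV-refl x) (not-true (∧-right {toRootEdge P x} h)) }) s s' j j' y∈ y'∈ a∈ a'∈ rec
              second (inj₂ none) with ex | thick B b₀∈ apart
              ... | y , a , s , j , y∈ , a∈ | e , e' , e≢e' , (se , ce) , (se' , ce') = third (is-x se ce) (is-x se' ce')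
                where
                  is-x : ∀ {g} → E₀ g ≡ true → cut B g ≡ true → g ≡ x ⊎ Ext A B g
                  is-x {g} sg cg with boundary P sg cg
                  ... | inj₂ k = inj₂ k
                  ... | inj₁ k with x ≟ g
                  ...   | yes r = inj₁ (sym r)
                  ...   | no r = absurd (∧-intro k (not-intro (isV-false r))) (none g)
                  withExt : ∀ {t} → t ≢ x → Ext A B t → Growth A
                  withExt {t} t≢x k = StepOne.growth P {x} {t} (t≢x ∘ sym) s j y∈ a∈ k
                    (λ sg cg → case is-x sg cg of λ { (inj₁ r) → inj₁ r ; (inj₂ k') → inj₂ (ext≤1 k' k) }) rec
                  third : e ≡ x ⊎ Ext A B e → e' ≡ x ⊎ Ext A B e' → Growth A
                  third (inj₁ r) (inj₁ r') = ⊥-elim (e≢e' (trans r (sym r')))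
                  third (inj₁ r) (inj₂ k) = withExt (λ r' → e≢e' (trans r (sym r'))) k
                  third (inj₂ k) (inj₁ r) = withExt (λ r' → e≢e' (trans r' (sym r))) k
                  third (inj₂ k) (inj₂ k') = ⊥-elim (e≢e' (ext≤1 k k'))

  abstract
    grow : ∀ A → Thick A → Growth A
    grow A thick = grow-raw A thick (<-wellFounded _)

-- A switching-equivalent signature with fewest negative edges, and its positive graph.

module Signature (G : SignedGraph) where
  open Walks G
  open Cycles G
  open Decompose G

  record MinSig (ε : ℕ) : Set where
    field
      σ : ES
      τ : VS
      σ-def : ∀ e → σ e ≡ neg G e xor cut τ e
      σ-count : count σ ≡ ε
      σ-min : ∀ A → count (λ e → σ e ∧ cut A e) ≤ count (λ e → not (σ e) ∧ cut A e)

  -- Switching adds a cut modulo 2. A vertex switched twice cancels, which is why `χ us` and not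
  -- membership describes the effect of the list.
  switches-cut : ∀ us e → switches G us e ≡ neg G e xor cut (χ us) e
  switches-cut [] e = sym (xor-identityʳ (neg G e))
  switches-cut (u ∷ us) e = trans (cong (_xor cut (isV u) e) (switches-cut us e)) (trans (xor-assoc (neg G e) _ _)
    (cong (neg G e xor_) (trans (xor-comm (cut (χ us) e) (cut (isV u) e)) (xor-interchange (isV u (src e)) (isV u (tgt e)) (χ us (src e)) (χ us (tgt e))))))

  members-of : VS → List V
  members-of A = filter (λ v → A v ≟ᵇ true) (allFin (nV G))

  χ-members : ∀ A v → χ (members-of A) v ≡ A v
  χ-members A v with bool-cases (A v)
  ... | inj₁ h = trans (χ-unique (members-of A) (Uniqueₚ.filter⁺ (λ v → A v ≟ᵇ true) (Uniqueₚ.allFin⁺ (nV G))) (∈-filter⁺ (λ v → A v ≟ᵇ true) (∈-allFin v) h)) (sym h)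
  ... | inj₂ h = trans (χ-∉ (members-of A) λ q → absurd (proj₂ (∈-filter⁻ (λ v → A v ≟ᵇ true) {xs = allFin (nV G)} q)) h) (sym h)

  minSig : ∀ {ε} → IsNegativeness G ε → MinSig ε
  minSig {ε} ((us , eq) , least) = record
    { σ = switches G us ; τ = χ us ; σ-def = switches-cut us ; σ-count = eq ; σ-min = minimal }
    where
      minimal : ∀ A → count (λ e → switches G us e ∧ cut A e) ≤ count (λ e → not (switches G us e) ∧ cut A e)
      -- Switching along `A` exchanges the signs on the cut. The negative edges off the cut occur on
      -- both sides of the comparison and cancel.
      minimal A = ℕₚ.+-cancelʳ-≤ (count (λ e → switches G us e ∧ not (cut A e))) _ _
        (≤-trans (≤-reflexive (trans (sym (add inside)) (trans eq' refl))) (≤-trans less (≤-reflexive (add outside))))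
        where
          s : ES
          s = switches G us
          add : ∀ {f g h : ES} → (∀ e → bN (f e) ≡ bN (g e) + bN (h e)) → count f ≡ count g + count h
          add {f} {g} {h} pt = trans (count-sumF f) (trans (sumF-cong pt) (trans (sumF-+ (bN ∘ g) (bN ∘ h)) (sym (cong₂ _+_ (count-sumF g) (count-sumF h)))))
          inside : ∀ e → bN (s e) ≡ bN (s e ∧ cut A e) + bN (s e ∧ not (cut A e))
          inside e with s e | cut A e
          ... | true | true = refl
          ... | true | false = refl
          ... | false | _ = refl
          outside : ∀ e → bN (s e xor cut A e) ≡ bN (not (s e) ∧ cut A e) + bN (s e ∧ not (cut A e))
          outside e with s e | cut A e
          ... | true | true = refl
          ... | true | false = refl
          ... | false | true = refl
          ... | false | false = refl
          eq' : count s ≡ ε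
          eq' = eq
          switched : ∀ e → switches G (members-of A ++ us) e ≡ s e xor cut A e
          switched e = trans (switches-cut (members-of A ++ us) e) (trans (cong (neg G e xor_) (trans (cong₂ _xor_ (χ-++ (members-of A) us (src e)) (χ-++ (members-of A) us (tgt e)))
            (trans (xor-interchange (χ (members-of A) (src e)) _ _ _) (trans (cong₂ _xor_ (cong₂ _xor_ (χ-members A (src e)) (χ-members A (tgt e))) refl) (xor-comm (cut A e) (cut (χ us) e))))))
            (trans (sym (xor-assoc (neg G e) _ _)) (cong (_xor cut A e) (sym (switches-cut us e)))))
          less : ε ≤ count (λ e → s e xor cut A e)
          less = ≤-trans (least (members-of A ++ us)) (≤-reflexive (count-cong switched))

  module Minimal {ε : ℕ} (M : MinSig ε) where
    open MinSig M public

    -- The two signatures differ by a cut, and a circuit meets a cut evenly; hence balance may be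
    -- tested with either.
    par-σ : ∀ C → par σ (cedges C) ≡ par (neg G) (cedges C)
    par-σ C = trans (par-cong (cedges C) (λ e _ → σ-def e)) (trans (par-⊕ (neg G) (cut τ) (cedges C)) (trans (cong (par (neg G) (cedges C) xor_) (par-cut-cyc τ C)) (xor-identityʳ _)))

    pos : ES
    pos e = not (σ e)

    neg-pos : ∀ {e} → σ e ≡ true → pos e ≡ true → ⊥
    neg-pos p q = absurd p (not-true q)

    -- By minimality a cut without positive edges contains no negative ones either.
    neg-connected : ∀ {e} → σ e ≡ true → Walk G (In pos) (tgt e) (src e)
    neg-connected {e} h with bool-cases (Reach.set (reach pos (src e)) (tgt e))
    ... | inj₁ p = Reach.fromSet (reach pos (src e)) p
    ... | inj₂ p = ⊥-elim (ℕₚ.<-irrefl refl (≤-trans (count-pos (λ e → σ e ∧ cut A e) (∧-intro h (xor-trueˡ (Reach.set-root (reach pos (src e))) p)))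
        (≤-trans (σ-min A) (≤-reflexive (trans (count-cong none) (count-false {nE G}))))))
      where
        A : VS
        A = Reach.set (reach pos (src e))
        none : ∀ e' → pos e' ∧ cut A e' ≡ false
        none e' with bool-cases (pos e')
        ... | inj₁ q = ∧-falseʳ {pos e'} (Reach.set-uncut (reach pos (src e)) q)
        ... | inj₂ q = ∧-falseˡ q

    one-neg : ∀ {A t} → (∀ {e} → pos e ≡ true → cut A e ≡ true → e ≡ t) → ∀ {e e'} → σ e ≡ true → cut A e ≡ true → σ e' ≡ true → cut A e' ≡ true → e ≡ e'
    one-neg {A} {t} only {e} {e'} s c s' c' with e ≟ e'
    ... | yes r = r
    ... | no r = ⊥-elim (ℕₚ.<-irrefl refl (≤-trans (count-two (λ e → σ e ∧ cut A e) r (∧-intro s c) (∧-intro s' c'))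
        (≤-trans (σ-min A) (≤-trans (count-mono {g = isV t} λ e h → subst (λ z → isV t z ≡ true) (sym (only (∧-left h) (∧-right {pos e} h))) (isV-refl t)) (≤-reflexive (count-isV t))))))

    -- The positive edges that are not bridges of the positive graph: the ends remain connected
    -- after deletion.
    E₀ : ES
    E₀ e = pos e ∧ Reach.set (reach (delete pos e) (src e)) (tgt e)

    E₀-pos : ∀ {e} → E₀ e ≡ true → pos e ≡ true
    E₀-pos = ∧-left

    cyc-E₀ : ∀ C → (∀ {e} → e ∈ cedges C → pos e ≡ true) → ∀ {e} → e ∈ cedges C → E₀ e ≡ true
    cyc-E₀ C C⊆ {e} h = ∧-intro (C⊆ h) (reach-walk (reach (delete pos e) (src e))
        (rev (weaken (λ {e'} k → delete-in {pos} (C⊆ (χ-∈ (cedges C) (delete-⊆ {χ (cedges C)} k))) (delete-≢ {χ (cedges C)} k))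
          (evenWalk (even-cyc C) (χ-unique (cedges C) (cedges-unique C) h) (joins-self e)))))

    E₀-cyc : ∀ {e} → E₀ e ≡ true → Σ Cyc λ C → e ∈ cedges C × (∀ {e'} → e' ∈ cedges C → E₀ e' ≡ true)
    E₀-cyc {e} h = let (C , C⊆ , e∈) = closeWalk {pos} (joins-self e) (∧-left h) (Reach.fromSet (reach (delete pos e) (src e)) (∧-right {pos e} h)) in
      C , e∈ , cyc-E₀ C C⊆

    E₀-second : ∀ {A e} → E₀ e ≡ true → cut A e ≡ true → ∃ λ e' → e' ≢ e × E₀ e' ≡ true × cut A e' ≡ true
    E₀-second {A} {e} h c = let (C , e∈ , C⊆) = E₀-cyc h ; (e' , ne , k , c') = even-second {χ (cedges C)} (even-cyc C) A (χ-unique (cedges C) (cedges-unique C) e∈) c in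
      e' , ne , C⊆ (χ-∈ (cedges C) k) , c'

    bridge : ∀ {e} → pos e ≡ true → E₀ e ≡ false → Σ VS λ A → cut A e ≡ true × (∀ {e'} → pos e' ≡ true → cut A e' ≡ true → e' ≡ e)
    bridge {e} p h = A , xor-trueˡ (Reach.set-root R) (≢true⇒false λ q → absurd (∧-intro p q) h) , λ {e'} p' c' → only p' c'
      where
        R : Reach (delete pos e) (src e)
        R = reach (delete pos e) (src e)
        A : VS
        A = Reach.set R
        only : ∀ {e'} → pos e' ≡ true → cut A e' ≡ true → e' ≡ e
        only {e'} p' c' with e' ≟ e
        ... | yes r = r
        ... | no r = absurd c' (Reach.set-uncut R (delete-in {pos} p' r))

    open import Data.Fin using (toℕ)
    open import Data.Fin.Properties using (toℕ-injective)

    comp : ∀ v → Reach E₀ v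
    comp v = reach E₀ v

    earlier : V → VS
    earlier v u = Reach.set (comp v) u ∧ (toℕ u ℕ.<ᵇ toℕ v)

    -- The vertex of least index in each component of `E₀`. The closure argument starts from these
    -- vertices, so that their number is subtracted from the number of vertices in its bound.
    isRoot : VS
    isRoot v with search (earlier v)
    ... | inj₁ _ = false
    ... | inj₂ _ = true

    root-least : ∀ {v u} → isRoot v ≡ true → Walk G (In E₀) v u → toℕ v ≤ toℕ u
    root-least {v} {u} h w with search (earlier v)
    root-least {v} {u} () w | inj₁ _
    ... | inj₂ none = ℕₚ.≮⇒≥ λ lt → absurd (∧-intro (reach-walk (comp v) w) (T⇒≡ (ℕₚ.<⇒<ᵇ lt))) (none u)
      where
        T⇒≡ : ∀ {b} → Bool-T b → b ≡ true
        T⇒≡ {true} _ = refl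

    root-unique : ∀ {u v} → isRoot u ≡ true → isRoot v ≡ true → Walk G (In E₀) u v → u ≡ v
    root-unique p q w = toℕ-injective (ℕₚ.≤-antisym (root-least p w) (root-least q (rev w)))

    findRoot : ∀ v → Σ V λ r → isRoot r ≡ true × Walk G (In E₀) v r
    findRoot v = go v (<-wellFounded (toℕ v))
      where
        rooted : ∀ {v} → (∀ u → earlier v u ≡ false) → isRoot v ≡ true
        rooted {v} none with search (earlier v)
        ... | inj₁ (u , p) = absurd p (none u)
        ... | inj₂ _ = refl
        go : ∀ v → Acc _<_ (toℕ v) → Σ V λ r → isRoot r ≡ true × Walk G (In E₀) v r
        go v (acc rs) with search (earlier v)
        ... | inj₂ none = v , rooted none , here
        ... | inj₁ (u , p) = let (r , q , w) = go u (rs (ℕₚ.<ᵇ⇒< (toℕ u) (toℕ v) (≡⇒T (∧-right {Reach.set (comp v) u} p)))) in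
                r , q , rev (Reach.fromSet (comp v) (∧-left p)) ⟫ w
          where
            ≡⇒T : ∀ {b} → b ≡ true → Bool-T b
            ≡⇒T refl = tt

    open Flow G E₀
    open Grow G E₀

    -- A walk in `E₀` from `B` to its root leaves `B`, and the edge by which it leaves lies on a
    -- circuit of `E₀`, which crosses again.
    thick : Thick isRoot
    thick B {b} b∈ apart with findRoot b
    ... | r , q , w with crossing B w b∈ (≢true⇒false λ h → absurd q (apart h))
    ...   | e , _ , _ , e∈ , j , x , y , _ with trans (joins-cut B j) (xor-trueˡ x y)
    ...     | c = let (e' , ne , s' , c') = E₀-second {B} (edges-P w e∈) c in e , e' , ne ∘ sym , (edges-P w e∈ , c) , (s' , c')

    abstract
      growth : Growth isRoot
      growth = grow isRoot thick

    -- In a component of `E₀` only the root could be odd, and the number of odd vertices in a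
    -- component is even.
    rel-even : ∀ {f} → (∀ {e} → f e ≡ true → E₀ e ≡ true) → Rel isRoot f → Even f
    rel-even {f} f⊆ r v with bool-cases (isRoot v)
    ... | inj₂ h = r v h
    ... | inj₁ h = trans (trans (sym (⨁-at v (∂ f))) (⨁-cong pt)) (trans (cut-sum A f) (⨁-false uncut))
      where
        A : VS
        A = Reach.set (comp v)
        pt : ∀ u → isV v u ∧ ∂ f u ≡ A u ∧ ∂ f u
        pt u with bool-cases (isV v u) | bool-cases (A u) | bool-cases (isRoot u)
        ... | inj₁ p | inj₁ q | _ = cong (_∧ ∂ f u) (trans p (sym q))
        ... | inj₁ p | inj₂ q | _ = absurd (subst (λ z → A z ≡ true) (isV-true p) (Reach.set-root (comp v))) q
        ... | inj₂ p | inj₂ q | _ = cong (_∧ ∂ f u) (trans p (sym q))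
        ... | inj₂ p | inj₁ q | inj₁ z = ⊥-elim (isV-≢ p (root-unique h z (rev (Reach.fromSet (comp v) q))))
        ... | inj₂ p | inj₁ q | inj₂ z = trans (∧-falseʳ {isV v u} (r u z)) (sym (∧-falseʳ {A u} (r u z)))
        uncut : ∀ e → f e ∧ cut A e ≡ false
        uncut e with bool-cases (f e)
        ... | inj₁ p = ∧-falseʳ {f e} (Reach.set-uncut (comp v) (f⊆ p))
        ... | inj₂ p = ∧-falseˡ p

-- The interface between the choice of the signature with its closure data and everything that
-- follows; the switching itself is needed only to show that `par-σ` holds.
record Setup (G : SignedGraph) (ε : ℕ) : Set where
  open Walks G
  open Cycles G
  field
    σ : ES
    σ-count : count σ ≡ ε
    par-σ : ∀ C → par σ (cedges C) ≡ par (neg G) (cedges C)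
  pos : ES
  pos e = not (σ e)
  neg-pos : ∀ {e} → σ e ≡ true → pos e ≡ true → ⊥
  neg-pos p q = absurd p (not-true q)
  field
    neg-connected : ∀ {e} → σ e ≡ true → Walk G (In pos) (tgt e) (src e)
    one-neg : ∀ {A t} → (∀ {e} → pos e ≡ true → cut A e ≡ true → e ≡ t) → ∀ {e e'} → σ e ≡ true → cut A e ≡ true → σ e' ≡ true → cut A e' ≡ true → e ≡ e'
    E₀ : ES
    E₀-pos : ∀ {e} → E₀ e ≡ true → pos e ≡ true
    E₀-second : ∀ {A e} → E₀ e ≡ true → cut A e ≡ true → ∃ λ e' → e' ≢ e × E₀ e' ≡ true × cut A e' ≡ true
    bridge : ∀ {e} → pos e ≡ true → E₀ e ≡ false → Σ VS λ A → cut A e ≡ true × (∀ {e'} → pos e' ≡ true → cut A e' ≡ true → e' ≡ e)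
    isRoot : VS
    root-unique : ∀ {u v} → isRoot u ≡ true → isRoot v ≡ true → Walk G (In E₀) u v → u ≡ v
    findRoot : ∀ v → Σ V λ r → isRoot r ≡ true × Walk G (In E₀) v r
    growth : Flow.Growth G E₀ isRoot
    rel-even : ∀ {f} → (∀ {e} → f e ≡ true → E₀ e ≡ true) → Flow.Rel G E₀ isRoot f → Even f

setup : ∀ G {ε} → IsNegativeness G ε → Setup G ε
setup G h = record
  { σ = σ ; σ-count = σ-count ; par-σ = par-σ ; neg-connected = neg-connected ; one-neg = λ {A} {t} → one-neg {A} {t}
  ; E₀ = E₀ ; E₀-pos = E₀-pos ; E₀-second = λ {A} → E₀-second {A} ; bridge = bridge ; isRoot = isRoot ; root-unique = root-unique
  ; findRoot = findRoot ; growth = growth ; rel-even = rel-even }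
  where
    open Signature G
    open Minimal (minSig h)

-- Averaging over finitely many choices, and the weights per edge.

leastIndex : ∀ {n} (f : Fin (suc n) → ℕ) → ∃ λ i → ∀ j → f i ≤ f j
leastIndex {zero} f = zero , λ { zero → ≤-refl }
leastIndex {suc n} f with leastIndex (f ∘ suc)
... | i , h with f zero ≤? f (suc i)
...   | yes p = zero , λ { zero → ≤-refl ; (suc j) → ≤-trans p (h j) }
...   | no p = suc i , λ { zero → ℕₚ.<⇒≤ (ℕₚ.≰⇒> p) ; (suc j) → h j }

sumF-const : ∀ {n} c → sumF {n} (λ _ → c) ≡ n * c
sumF-const {zero} c = refl
sumF-const {suc n} c = cong (c +_) (sumF-const {n} c)

average-raw : ∀ {n} (f : Fin (suc n) → ℕ) → ∃ λ i → suc n * f i ≤ sumF f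
average-raw {n} f = let (i , h) = leastIndex f in i , ≤-trans (≤-reflexive (sym (sumF-const {suc n} (f i)))) (sumF-mono h)

abstract
  average : ∀ {n} (f : Fin (suc n) → ℕ) → ∃ λ i → suc n * f i ≤ sumF f
  average = average-raw

-- How many of the four sums j, j + a, j + b, j + a + b contain a given edge: two if a or b contains
-- it, otherwise all or none.
spread : Bool → Bool → Bool → ℕ
spread j a b = if a ∨ b then 2 else 4 * bN j

spread-table : ∀ j a b → bN (j xor false) + (bN (j xor a) + (bN (j xor b) + (bN (j xor (a xor b)) + 0))) ≤ spread j a b
spread-table true true true = ≤-refl
spread-table true true false = ≤-refl
spread-table true false true = ≤-refl
spread-table true false false = ≤-refl
spread-table false true true = ≤-refl
spread-table false true false = ≤-refl
spread-table false false true = ≤-refl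
spread-table false false false = ≤-refl

sumF-scale : ∀ {n} k (f : Fin n → Bool) → sumF (λ e → k * bN (f e)) ≡ k * count f
sumF-scale k f = trans (sumF-* k (bN ∘ f)) (cong (k *_) (sym (count-sumF f)))

-- Twelve times the averaged cost at one edge: the join is the best of four (3 · 4), the pair is the
-- best of three (4 · 3), while `C` is used as it is and a separator counts once.
denseWeight : Bool → Bool → Bool → Bool → Bool → ℕ
denseWeight j c a b u = 3 * spread j a b + 12 * bN c + 4 * (4 * bN (a ∨ b)) + 12 * bN u

denseWeight-C : ∀ j a b → denseWeight j true a b false ≤ 34
denseWeight-C true true true = ≤-refl
denseWeight-C true true false = ≤-refl
denseWeight-C true false true = ≤-refl
denseWeight-C true false false = m≤m+n 24 10
denseWeight-C false true true = ≤-refl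
denseWeight-C false true false = ≤-refl
denseWeight-C false false true = ≤-refl
denseWeight-C false false false = m≤m+n 12 22

abstract
  dense-total : ∀ {n} (J C a b U P Y CT : Fin n → Bool) {j k} →
    (∀ e → denseWeight (J e) (C e) (a e) (b e) (U e) ≤ 12 * bN (P e) + (10 * bN (Y e) + 22 * bN (CT e))) →
    4 * j ≤ sumF (λ e → spread (J e) (a e) (b e)) → 3 * k ≤ sumF (λ e → 4 * bN (a e ∨ b e)) →
    12 * (j + count C + k) + 12 * count U ≤ 12 * count P + (10 * count Y + 22 * count CT)
  dense-total {n} J C a b U P Y CT {j} {k} pt p q = ≤-trans (ℕₚ.+-monoˡ-≤ (12 * count U) (≤-trans (≤-reflexive (regroup j (count C) k))
      (+-mono-≤ (ℕₚ.+-monoˡ-≤ (12 * count C) (ℕₚ.*-monoʳ-≤ 3 p)) (ℕₚ.*-monoʳ-≤ 4 q))))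
    (≤-trans (≤-reflexive (sym wsum)) (≤-trans (sumF-mono pt) (≤-reflexive rsum)))
    where
      regroup : ∀ j c k → 12 * (j + c + k) ≡ 3 * (4 * j) + 12 * c + 4 * (3 * k)
      regroup j c k = trans (ℕₚ.*-distribˡ-+ 12 (j + c) k) (cong₂ _+_ (trans (ℕₚ.*-distribˡ-+ 12 j c) (cong (_+ 12 * c) (ℕₚ.*-assoc 3 4 j))) (ℕₚ.*-assoc 4 3 k))
      s t : Fin n → ℕ
      s e = spread (J e) (a e) (b e)
      t e = 4 * bN (a e ∨ b e)
      wsum : sumF (λ e → denseWeight (J e) (C e) (a e) (b e) (U e)) ≡ 3 * sumF s + 12 * count C + 4 * sumF t + 12 * count U
      wsum = trans (sumF-+ (λ e → 3 * s e + 12 * bN (C e) + 4 * t e) (λ e → 12 * bN (U e)))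
        (cong₂ _+_ (trans (sumF-+ (λ e → 3 * s e + 12 * bN (C e)) (λ e → 4 * t e))
          (cong₂ _+_ (trans (sumF-+ (λ e → 3 * s e) (λ e → 12 * bN (C e))) (cong₂ _+_ (sumF-* 3 s) (sumF-scale 12 C))) (sumF-* 4 t))) (sumF-scale 12 U))
      rsum : sumF (λ e → 12 * bN (P e) + (10 * bN (Y e) + 22 * bN (CT e))) ≡ 12 * count P + (10 * count Y + 22 * count CT)
      rsum = trans (sumF-+ (λ e → 12 * bN (P e)) (λ e → 10 * bN (Y e) + 22 * bN (CT e))) (cong₂ _+_ (sumF-scale 12 P)
          (trans (sumF-+ (λ e → 10 * bN (Y e)) (λ e → 22 * bN (CT e))) (cong₂ _+_ (sumF-scale 10 Y) (sumF-scale 22 CT))))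

-- Twenty-four times the averaged cost at one edge: the join is the best of eight (3 · 8), the first
-- even set the best of four (6 · 4) and the pair the best of three (8 · 3).
sparseWeight : Bool → Bool → Bool → Bool → Bool → ℕ
sparseWeight j c a b u = 3 * (spread j a b + spread (j xor c) a b) + 6 * spread c a b + 8 * (4 * bN (a ∨ b)) + 24 * bN u

abstract
  sparse-total : ∀ {n} (J C a b U P : Fin n → Bool) {j c k} →
    (∀ e → sparseWeight (J e) (C e) (a e) (b e) (U e) ≤ 56 * bN (P e)) →
    8 * j ≤ sumF (λ e → spread (J e) (a e) (b e) + spread (J e xor C e) (a e) (b e)) → 4 * c ≤ sumF (λ e → spread (C e) (a e) (b e)) →
    3 * k ≤ sumF (λ e → 4 * bN (a e ∨ b e)) →
    24 * (j + c + k) + 24 * count U ≤ 56 * count P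
  sparse-total {n} J C a b U P {j} {c} {k} pt p q r = ≤-trans (ℕₚ.+-monoˡ-≤ (24 * count U) (≤-trans (≤-reflexive (regroup j c k))
      (+-mono-≤ (+-mono-≤ (ℕₚ.*-monoʳ-≤ 3 p) (ℕₚ.*-monoʳ-≤ 6 q)) (ℕₚ.*-monoʳ-≤ 8 r))))
    (≤-trans (≤-reflexive (sym wsum)) (≤-trans (sumF-mono pt) (≤-reflexive (sumF-scale 56 P))))
    where
      regroup : ∀ j c k → 24 * (j + c + k) ≡ 3 * (8 * j) + 6 * (4 * c) + 8 * (3 * k)
      regroup j c k = trans (ℕₚ.*-distribˡ-+ 24 (j + c) k) (cong₂ _+_ (trans (ℕₚ.*-distribˡ-+ 24 j c) (cong₂ _+_ (ℕₚ.*-assoc 3 8 j) (ℕₚ.*-assoc 6 4 c))) (ℕₚ.*-assoc 8 3 k))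
      s₁ s₂ t : Fin n → ℕ
      s₁ e = spread (J e) (a e) (b e) + spread (J e xor C e) (a e) (b e)
      s₂ e = spread (C e) (a e) (b e)
      t e = 4 * bN (a e ∨ b e)
      wsum : sumF (λ e → sparseWeight (J e) (C e) (a e) (b e) (U e)) ≡ 3 * sumF s₁ + 6 * sumF s₂ + 8 * sumF t + 24 * count U
      wsum = trans (sumF-+ (λ e → 3 * s₁ e + 6 * s₂ e + 8 * t e) (λ e → 24 * bN (U e)))
        (cong₂ _+_ (trans (sumF-+ (λ e → 3 * s₁ e + 6 * s₂ e) (λ e → 8 * t e))
          (cong₂ _+_ (trans (sumF-+ (λ e → 3 * s₁ e) (λ e → 6 * s₂ e)) (cong₂ _+_ (sumF-* 3 s₁) (sumF-* 6 s₂))) (sumF-* 8 t))) (sumF-scale 24 U))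

  -- Four times the claim asks for 24v - 24 beyond 12p. The doubled closure bound gives 22v - 22a
  -- with a ≥ 1, and v ≥ 1 yields the missing 2v - 2.
  dense-bound : ∀ c u p y t a v → 12 * c + 12 * u ≤ 12 * p + (10 * y + 22 * t) → 5 * y + 11 * t + 11 * a ≤ 11 * v → 1 ≤ a → 1 ≤ v →
    3 * c + 3 * u + 6 ≤ 3 * p + 6 * v
  dense-bound c u p y t a v h k a≥1 v≥1 = ℕₚ.*-cancelˡ-≤ 4 (≤-trans (≤-reflexive e₁) (≤-trans (ℕₚ.+-monoˡ-≤ 24 h) (≤-trans (≤-reflexive (+-assoc (12 * p) (10 * y + 22 * t) 24))
      (≤-trans (ℕₚ.+-monoʳ-≤ (12 * p) (≤-trans (≤-reflexive (sym (+-assoc (10 * y + 22 * t) 22 2))) (+-mono-≤ (≤-trans (ℕₚ.+-monoʳ-≤ (10 * y + 22 * t) (ℕₚ.*-monoʳ-≤ 22 a≥1)) (≤-trans (≤-reflexive e₂) (ℕₚ.*-monoʳ-≤ 2 k))) (ℕₚ.*-monoʳ-≤ 2 v≥1)))) (≤-reflexive e₃)))))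
    where
      e₁ : 4 * (3 * c + 3 * u + 6) ≡ 12 * c + 12 * u + 24
      e₁ = trans (ℕₚ.*-distribˡ-+ 4 (3 * c + 3 * u) 6) (cong (_+ 24) (trans (ℕₚ.*-distribˡ-+ 4 (3 * c) (3 * u)) (cong₂ _+_ (sym (ℕₚ.*-assoc 4 3 c)) (sym (ℕₚ.*-assoc 4 3 u)))))
      e₂ : 10 * y + 22 * t + 22 * a ≡ 2 * (5 * y + 11 * t + 11 * a)
      e₂ = sym (trans (ℕₚ.*-distribˡ-+ 2 (5 * y + 11 * t) (11 * a)) (cong₂ _+_ (trans (ℕₚ.*-distribˡ-+ 2 (5 * y) (11 * t)) (cong₂ _+_ (sym (ℕₚ.*-assoc 2 5 y)) (sym (ℕₚ.*-assoc 2 11 t)))) (sym (ℕₚ.*-assoc 2 11 a))))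
      e₃ : 12 * p + (2 * (11 * v) + 2 * v) ≡ 4 * (3 * p + 6 * v)
      e₃ = trans (cong (12 * p +_) (trans (cong (_+ 2 * v) (sym (ℕₚ.*-assoc 2 11 v))) (sym (ℕₚ.*-distribʳ-+ v 22 2)))) (trans (cong₂ _+_ (ℕₚ.*-assoc 4 3 p) (ℕₚ.*-assoc 4 6 v)) (sym (ℕₚ.*-distribˡ-+ 4 (3 * p) (6 * v))))

  sparse-cancel : ∀ c u p → 24 * c + 24 * u ≤ 56 * p → 3 * c + 3 * u ≤ 7 * p
  sparse-cancel c u p h = ℕₚ.*-cancelˡ-≤ 8 (≤-trans (≤-reflexive (trans (ℕₚ.*-distribˡ-+ 8 (3 * c) (3 * u)) (cong₂ _+_ (sym (ℕₚ.*-assoc 8 3 c)) (sym (ℕₚ.*-assoc 8 3 u))))) (≤-trans h (≤-reflexive (ℕₚ.*-assoc 8 7 p))))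

  dense-second : ∀ c p v → c + 6 ≤ 3 * p + 6 * v → 3 * v ≤ 2 * p + 3 → c + 3 ≤ 5 * p + 3 * v
  dense-second c p v h k = ℕₚ.+-cancelʳ-≤ 3 _ _ (≤-trans (≤-reflexive (+-assoc c 3 3)) (≤-trans h (≤-trans (≤-reflexive (e₁ p v)) (≤-trans (ℕₚ.+-monoʳ-≤ (3 * p + 3 * v) k) (≤-reflexive (e₂ p v))))))
    where
      open +-*-Solver
      e₁ : ∀ p v → 3 * p + 6 * v ≡ 3 * p + 3 * v + 3 * v
      e₁ = solve 2 (λ p v → con 3 :* p :+ con 6 :* v := con 3 :* p :+ con 3 :* v :+ con 3 :* v) refl
      e₂ : ∀ p v → 3 * p + 3 * v + (2 * p + 3) ≡ 5 * p + 3 * v + 3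
      e₂ = solve 2 (λ p v → con 3 :* p :+ con 3 :* v :+ (con 2 :* p :+ con 3) := con 5 :* p :+ con 3 :* v :+ con 3) refl

  sparse-both : ∀ c p v → c ≤ 7 * p → 2 * p + 3 ≤ 3 * v → c + 6 ≤ 3 * p + 6 * v × c + 3 ≤ 5 * p + 3 * v
  sparse-both c p v h k = ≤-trans (ℕₚ.+-monoˡ-≤ 6 h) (≤-trans (≤-reflexive (e₁ p)) (≤-trans (ℕₚ.+-monoʳ-≤ (3 * p) (ℕₚ.*-monoʳ-≤ 2 k)) (≤-reflexive (cong (3 * p +_) (sym (ℕₚ.*-assoc 2 3 v)))))) ,
      ≤-trans (ℕₚ.+-monoˡ-≤ 3 h) (≤-trans (≤-reflexive (e₂ p)) (ℕₚ.+-monoʳ-≤ (5 * p) k))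
    where
      open +-*-Solver
      e₁ : ∀ p → 7 * p + 6 ≡ 3 * p + 2 * (2 * p + 3)
      e₁ = solve 1 (λ p → con 7 :* p :+ con 6 := con 3 :* p :+ con 2 :* (con 2 :* p :+ con 3)) refl
      e₂ : ∀ p → 7 * p + 3 ≡ 5 * p + (2 * p + 3)
      e₂ = solve 1 (λ p → con 7 :* p :+ con 3 := con 5 :* p :+ (con 2 :* p :+ con 3)) refl

-- The base cover: a join of the negative edges and three even sets of positive edges.

module Base (G : SignedGraph) {ε : ℕ} (S : Setup G ε) where
  open Walks G
  open Decompose G
  open Setup S
  open Flow G E₀
  open Growth growth

  -- A join for the odd vertices of `X`: the sum modulo 2 of one walk in `S` for each edge of `X`.
  join-raw : ∀ (X S : ES) → (∀ e → X e ≡ true → Walk G (In S) (src e) (tgt e)) → Σ ES λ J → (∀ v → ∂ J v ≡ ∂ X v) × (∀ {e} → J e ≡ true → S e ≡ true)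
  join-raw X S w = J , ∂J , λ {e} h → let (f , p) = ⨁-true (λ f → X f ∧ χ (route f) e) h in route-S f (∧-right {X f} p)
    where
      route : E → List E
      route f with bool-cases (X f)
      ... | inj₁ h = edges (w f h)
      ... | inj₂ _ = []
      route-S : ∀ f {e} → χ (route f) e ≡ true → S e ≡ true
      route-S f h with bool-cases (X f)
      ... | inj₁ k = edges-P (w f k) (χ-∈ (edges (w f k)) h)
      route-∂ : ∀ f v → X f ∧ ∂ (χ (route f)) v ≡ X f ∧ cut (isV v) f
      route-∂ f v with bool-cases (X f)
      ... | inj₁ k = cong (X f ∧_) (∂-walk (w f k) v)
      ... | inj₂ k = trans (∧-falseˡ k) (sym (∧-falseˡ k))
      J : ES
      J e = ⨁ (λ f → X f ∧ χ (route f) e)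
      rearrange : ∀ c k r → c ∧ (k ∧ r) ≡ k ∧ (r ∧ c)
      rearrange c false r = ∧-zeroʳ c
      rearrange c true r = ∧-comm c r
      ∂J : ∀ v → ∂ J v ≡ ∂ X v
      ∂J v = trans (⨁-cong λ e → trans (∧-comm (J e) (cut (isV v) e)) (sym (⨁-∧ (cut (isV v) e) (λ f → X f ∧ χ (route f) e))))
        (trans (⨁-swap (λ e f → cut (isV v) e ∧ (X f ∧ χ (route f) e)))
        (⨁-cong λ f → trans (⨁-cong λ e → rearrange (cut (isV v) e) (X f) (χ (route f) e)) (trans (⨁-∧ (X f) (λ e → χ (route f) e ∧ cut (isV v) e)) (route-∂ f v))))

  abstract
    join : ∀ (X S : ES) → (∀ e → X e ≡ true → Walk G (In S) (src e) (tgt e)) → Σ ES λ J → (∀ v → ∂ J v ≡ ∂ X v) × (∀ {e} → J e ≡ true → S e ≡ true)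
    join = join-raw

  T-E₀ : ∀ {e} → T e ≡ true → E₀ e ≡ true
  T-E₀ h = case T⊆ h of λ { (inj₁ p) → C⊆ p ; (inj₂ p) → Y⊆ p }

  -- `T` spans every component of `E₀`; with the positive bridges added it connects whatever
  -- positive edges connect. Joins are taken in `TB` and thus meet no chord.
  chord bridges TB : ES
  chord e = E₀ e ∧ (not (C e) ∧ not (Y e))
  bridges e = pos e ∧ not (E₀ e)
  TB e = T e ∨ bridges e

  T-walk : ∀ {e} → E₀ e ≡ true → Walk G (In T) (src e) (tgt e)
  T-walk {e} h = meet (toA (src e)) (toA (tgt e))
    where
      meet : (Σ V λ a → isRoot a ≡ true × Walk G (In T) (src e) a) → (Σ V λ a → isRoot a ≡ true × Walk G (In T) (tgt e) a) → Walk G (In T) (src e) (tgt e)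
      meet (a , p , w) (b , q , w') = w ⟫ subst (λ z → Walk G (In T) z (tgt e)) (sym (root-unique p q (rev (weaken T-E₀ w) ⟫ wstep e h (joins-self e) (weaken T-E₀ w')))) (rev w')

  TB-walk : ∀ {e} → pos e ≡ true → Walk G (In TB) (src e) (tgt e)
  TB-walk {e} h with bool-cases (E₀ e)
  ... | inj₁ p = weaken ∨-left (T-walk p)
  ... | inj₂ p = wstep e (∨-right {T e} (∧-intro h (not-intro p))) (joins-self e) here

  TB-lift : ∀ {u v} → Walk G (In pos) u v → Walk G (In TB) u v
  TB-lift here = here
  TB-lift (wstep e p (inj₁ refl) w) = TB-walk p ⟫ TB-lift w
  TB-lift (wstep e p (inj₂ refl) w) = rev (TB-walk p) ⟫ TB-lift w

  chord-out : ∀ {e} → chord e ≡ true → C e ≡ false × Y e ≡ false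
  chord-out {e} h = not-true (∧-left (∧-right {E₀ e} h)) , not-true (∧-right {not (C e)} (∧-right {E₀ e} h))

  reserve-chord : ∀ {g e} → Reserve T C Y g → chord e ≡ true → g e ≡ false
  reserve-chord r h = ≢true⇒false λ k → case r k of λ { (inj₁ p) → absurd p (proj₂ (chord-out h)) ; (inj₂ (p , _)) → absurd p (proj₁ (chord-out h)) }

  T-chord : ∀ {e} → chord e ≡ true → T e ≡ false
  T-chord h = ≢true⇒false λ k → case T⊆ k of λ { (inj₁ p) → absurd p (proj₁ (chord-out h)) ; (inj₂ p) → absurd p (proj₂ (chord-out h)) }

  -- `U` will be the set of separating edges. The term `3 * count U` is room that the cover leaves
  -- because `J` cannot contain them; it is spent when barbells run along them.
  record BaseCover (N U : ES) : Set where
    field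
      J K₁ K₂ K₃ : ES
      J⊆ : ∀ {e} → J e ≡ true → pos e ≡ true
      J-even : Even (N ⊕ J)
      even₁ : Even K₁
      even₂ : Even K₂
      even₃ : Even K₃
      in₁ : ∀ {e} → K₁ e ≡ true → E₀ e ≡ true
      in₂ : ∀ {e} → K₂ e ≡ true → E₀ e ≡ true
      in₃ : ∀ {e} → K₃ e ≡ true → E₀ e ≡ true
      cover : ∀ {e} → E₀ e ≡ true → J e ∨ (K₁ e ∨ (K₂ e ∨ K₃ e)) ≡ true
    cost : ℕ
    cost = count J + count K₁ + (count K₂ + count K₃)
    field
      bound₁ : 3 * cost + 3 * count U + 6 ≤ 3 * count pos + 6 * nV G
      bound₂ : 3 * cost + 3 * count U + 3 ≤ 5 * count pos + 3 * nV G

  sum-options : ∀ {n} (F : Fin n → ES) (h : E → ℕ) → (∀ e → sumF (λ i → bN (F i e)) ≤ h e) → sumF (λ i → count (F i)) ≤ sumF h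
  sum-options F h k = ≤-trans (≤-reflexive (trans (sumF-cong λ i → count-sumF (F i)) (sumF-swap (λ i e → bN (F i e))))) (sumF-mono k)

  pairOf : ES → ES → Fin 3 → ES × ES
  pairOf g₁ g₂ zero = g₁ , g₂
  pairOf g₁ g₂ (suc zero) = g₁ , g₁ ⊕ g₂
  pairOf g₁ g₂ (suc (suc zero)) = g₂ , g₁ ⊕ g₂

  pair-cover : ∀ g₁ g₂ i {e} → g₁ e ∨ g₂ e ≡ true → proj₁ (pairOf g₁ g₂ i) e ∨ proj₂ (pairOf g₁ g₂ i) e ≡ true
  pair-cover g₁ g₂ zero h = h
  pair-cover g₁ g₂ (suc zero) {e} h with g₁ e | g₂ e
  ... | true | _ = refl
  ... | false | true = refl
  pair-cover g₁ g₂ (suc (suc zero)) {e} h with g₁ e | g₂ e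
  ... | true | true = refl
  ... | true | false = refl
  ... | false | true = refl

  pair-prop : ∀ {Q : ES → Set} g₁ g₂ i → Q g₁ → Q g₂ → Q (g₁ ⊕ g₂) → Q (proj₁ (pairOf g₁ g₂ i)) × Q (proj₂ (pairOf g₁ g₂ i))
  pair-prop g₁ g₂ zero a b c = a , b
  pair-prop g₁ g₂ (suc zero) a b c = a , c
  pair-prop g₁ g₂ (suc (suc zero)) a b c = b , c

  -- Any two of `g₁`, `g₂` and their sum cover the union of the first two. An edge of the union lies
  -- in exactly two of the three sets, hence occurs four times over the three pairs.
  bestPair-raw : ∀ g₁ g₂ → ∃ λ i → 3 * (count (proj₁ (pairOf g₁ g₂ i)) + count (proj₂ (pairOf g₁ g₂ i))) ≤ sumF (λ e → 4 * bN (g₁ e ∨ g₂ e))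
  bestPair-raw g₁ g₂ = let (i , h) = average f in i , ≤-trans h sumf
    where
      f : Fin 3 → ℕ
      f i = count (proj₁ (pairOf g₁ g₂ i)) + count (proj₂ (pairOf g₁ g₂ i))
      F : Fin 6 → ES
      F zero = g₁
      F (suc zero) = g₂
      F (suc (suc zero)) = g₁
      F (suc (suc (suc zero))) = g₁ ⊕ g₂
      F (suc (suc (suc (suc zero)))) = g₂
      F (suc (suc (suc (suc (suc zero))))) = g₁ ⊕ g₂
      table : ∀ a b → bN a + (bN b + (bN a + (bN (a xor b) + (bN b + (bN (a xor b) + 0))))) ≤ 4 * bN (a ∨ b)
      table true true = ≤-refl
      table true false = ≤-refl
      table false true = ≤-refl
      table false false = ≤-refl
      regroup : ∀ a b c → a + b + (a + c + (b + c + 0)) ≡ a + (b + (a + (c + (b + (c + 0)))))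
      regroup = solve 3 (λ a b c → a :+ b :+ (a :+ c :+ (b :+ c :+ con 0)) := a :+ (b :+ (a :+ (c :+ (b :+ (c :+ con 0)))))) refl
        where open +-*-Solver
      sumf : sumF f ≤ sumF (λ e → 4 * bN (g₁ e ∨ g₂ e))
      sumf = ≤-trans (≤-reflexive (regroup (count g₁) (count g₂) (count (g₁ ⊕ g₂)))) (sum-options F _ λ e → table (g₁ e) (g₂ e))

  abstract
    bestPair : ∀ g₁ g₂ → ∃ λ i → 3 * (count (proj₁ (pairOf g₁ g₂ i)) + count (proj₂ (pairOf g₁ g₂ i))) ≤ sumF (λ e → 4 * bN (g₁ e ∨ g₂ e))
    bestPair = bestPair-raw

  comb₄ : ES → ES → Fin 4 → ES
  comb₄ g₁ g₂ zero e = false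
  comb₄ g₁ g₂ (suc zero) e = g₁ e
  comb₄ g₁ g₂ (suc (suc zero)) e = g₂ e
  comb₄ g₁ g₂ (suc (suc (suc zero))) e = g₁ e xor g₂ e

  comb-prop : ∀ {Q : ES → Set} g₁ g₂ i → Q (λ _ → false) → Q g₁ → Q g₂ → Q (g₁ ⊕ g₂) → Q (comb₄ g₁ g₂ i)
  comb-prop g₁ g₂ zero z a b c = z
  comb-prop g₁ g₂ (suc zero) z a b c = a
  comb-prop g₁ g₂ (suc (suc zero)) z a b c = b
  comb-prop g₁ g₂ (suc (suc (suc zero))) z a b c = c

  best₄-raw : ∀ S g₁ g₂ → ∃ λ i → 4 * count (S ⊕ comb₄ g₁ g₂ i) ≤ sumF (λ e → spread (S e) (g₁ e) (g₂ e))
  best₄-raw S g₁ g₂ = let (i , h) = average (λ i → count (S ⊕ comb₄ g₁ g₂ i)) in i ,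
    ≤-trans h (sum-options (λ i → S ⊕ comb₄ g₁ g₂ i) _ λ e → spread-table (S e) (g₁ e) (g₂ e))

  abstract
    best₄ : ∀ S g₁ g₂ → ∃ λ i → 4 * count (S ⊕ comb₄ g₁ g₂ i) ≤ sumF (λ e → spread (S e) (g₁ e) (g₂ e))
    best₄ = best₄-raw

  with-C : ES → Fin 2 → ES
  with-C S zero = S
  with-C S (suc zero) = S ⊕ C

  best₈-raw : ∀ S g₁ g₂ → ∃ λ k → ∃ λ i → 8 * count (with-C S k ⊕ comb₄ g₁ g₂ i) ≤ sumF (λ e → spread (S e) (g₁ e) (g₂ e) + spread (S e xor C e) (g₁ e) (g₂ e))
  best₈-raw S g₁ g₂ with average (λ k → count (with-C S k ⊕ comb₄ g₁ g₂ (proj₁ (best₄ (with-C S k) g₁ g₂))))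
  ... | k , h = k , proj₁ (best₄ (with-C S k) g₁ g₂) , ≤-trans (≤-reflexive (trans (ℕₚ.*-assoc 4 2 c) refl)) (≤-trans (ℕₚ.*-monoʳ-≤ 4 h)
      (≤-trans (≤-reflexive (dist a b)) (≤-trans (+-mono-≤ (proj₂ (best₄ S g₁ g₂)) (proj₂ (best₄ (S ⊕ C) g₁ g₂))) (≤-reflexive (sym (sumF-+ (λ e → spread (S e) (g₁ e) (g₂ e)) (λ e → spread (S e xor C e) (g₁ e) (g₂ e))))))))
    where
      a b c : ℕ
      a = count (S ⊕ comb₄ g₁ g₂ (proj₁ (best₄ S g₁ g₂)))
      b = count ((S ⊕ C) ⊕ comb₄ g₁ g₂ (proj₁ (best₄ (S ⊕ C) g₁ g₂)))
      c = count (with-C S k ⊕ comb₄ g₁ g₂ (proj₁ (best₄ (with-C S k) g₁ g₂)))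
      dist : ∀ a b → 4 * (a + (b + 0)) ≡ 4 * a + 4 * b
      dist = solve 2 (λ a b → con 4 :* (a :+ (b :+ con 0)) := con 4 :* a :+ con 4 :* b) refl
        where open +-*-Solver

  abstract
    best₈ : ∀ S g₁ g₂ → ∃ λ k → ∃ λ i → 8 * count (with-C S k ⊕ comb₄ g₁ g₂ i) ≤ sumF (λ e → spread (S e) (g₁ e) (g₂ e) + spread (S e xor C e) (g₁ e) (g₂ e))
    best₈ = best₈-raw

  module _ (N U : ES) (N⊆ : ∀ {e} → N e ≡ true → σ e ≡ true) (U⊆ : ∀ {e} → U e ≡ true → pos e ≡ true)
    (U-cut : ∀ {e} → U e ≡ true → Σ VS λ A → cut A e ≡ true × (∀ {e'} → cut A e' ≡ true → e' ≡ e)) (v₀ : V) where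

    N-pos : ∀ {e} → pos e ≡ true → N e ≡ false
    N-pos h = ≢true⇒false λ k → neg-pos (N⊆ k) h

    U-E₀ : ∀ {e} → U e ≡ true → E₀ e ≡ false
    U-E₀ h = ≢true⇒false λ k → let (A , c , only) = U-cut h ; (e' , ne , _ , c') = E₀-second {A} k c in ne (only c')

    -- An even set cannot meet a cut that consists of a single edge.
    U-join : ∀ {J} → Even (N ⊕ J) → ∀ {e} → U e ≡ true → J e ≡ false
    U-join {J} ev h = ≢true⇒false λ k → let (A , c , only) = U-cut h ; (e' , ne , _ , c') = even-second {N ⊕ J} ev A (xor-trueʳ (N-pos (U⊆ h)) k) c in ne (only c')

    base-walk : ∀ e → (N ⊕ chord) e ≡ true → Walk G (In TB) (src e) (tgt e)
    base-walk e h with xor-split {N e} h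
    ... | inj₁ (p , _) = rev (TB-lift (neg-connected (N⊆ p)))
    ... | inj₂ (_ , p) = weaken ∨-left (T-walk (∧-left p))

    J₀ : Σ ES λ J → (∀ v → ∂ J v ≡ ∂ (N ⊕ chord) v) × (∀ {e} → J e ≡ true → TB e ≡ true)
    J₀ = join (N ⊕ chord) TB base-walk

    BaseJoin : ES → Set
    BaseJoin J = Even (N ⊕ J) × (∀ {e} → chord e ≡ true → J e ≡ true) × (∀ {e} → J e ≡ true → pos e ≡ true) ×
      (∀ {e} → C e ≡ true → T e ≡ false → J e ≡ false)

    -- All chords are put into the join, and the parity is then corrected inside `TB`. The
    -- correction meets neither the chords nor the edges of `C` outside the tree, so the former stay
    -- and the latter stay out.
    baseJoin-raw : Σ ES BaseJoin
    baseJoin-raw = Jr , even , chord∈ , inPos , offC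
      where
        Jr : ES
        Jr = chord ⊕ proj₁ J₀
        even : Even (N ⊕ Jr)
        even = even-cong (λ e → xor-assoc (N e) (chord e) (proj₁ J₀ e)) λ v → trans (∂-⊕ (N ⊕ chord) (proj₁ J₀) v) (trans (cong (∂ (N ⊕ chord) v xor_) (proj₁ (proj₂ J₀) v)) (xor-same (∂ (N ⊕ chord) v)))
        TB-chord : ∀ {e} → chord e ≡ true → TB e ≡ false
        TB-chord {e} h = ≢true⇒false λ k → case ∨-split {T e} k of λ { (inj₁ p) → absurd p (T-chord h) ; (inj₂ p) → absurd (∧-left h) (not-true (∧-right {pos e} p)) }
        chord∈ : ∀ {e} → chord e ≡ true → Jr e ≡ true
        chord∈ h = xor-trueˡ h (≢true⇒false λ k → absurd (proj₂ (proj₂ J₀) k) (TB-chord h))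
        split : ∀ {e} → Jr e ≡ true → chord e ≡ true ⊎ TB e ≡ true
        split {e} h = case xor-split {chord e} h of λ { (inj₁ (p , _)) → inj₁ p ; (inj₂ (_ , p)) → inj₂ (proj₂ (proj₂ J₀) p) }
        inPos : ∀ {e} → Jr e ≡ true → pos e ≡ true
        inPos {e} h = case split h of λ { (inj₁ p) → E₀-pos (∧-left p) ; (inj₂ p) → case ∨-split {T e} p of λ
          { (inj₁ q) → E₀-pos (T-E₀ q) ; (inj₂ q) → ∧-left q } }
        offC : ∀ {e} → C e ≡ true → T e ≡ false → Jr e ≡ false
        offC {e} c t = ≢true⇒false λ h → case split h of λ { (inj₁ p) → absurd c (proj₁ (chord-out p)) ; (inj₂ p) → case ∨-split {T e} p of λ
          { (inj₁ q) → absurd q t ; (inj₂ q) → absurd (C⊆ c) (not-true (∧-right {pos e} q)) } }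

    abstract
      baseJoin : Σ ES BaseJoin
      baseJoin = baseJoin-raw

    Jb : ES
    Jb = proj₁ baseJoin
    Jb-even : Even (N ⊕ Jb)
    Jb-even = proj₁ (proj₂ baseJoin)
    Jb-chord : ∀ {e} → chord e ≡ true → Jb e ≡ true
    Jb-chord = proj₁ (proj₂ (proj₂ baseJoin))
    Jb-pos : ∀ {e} → Jb e ≡ true → pos e ≡ true
    Jb-pos = proj₁ (proj₂ (proj₂ (proj₂ baseJoin)))
    Jb-C : ∀ {e} → C e ≡ true → T e ≡ false → Jb e ≡ false
    Jb-C = proj₂ (proj₂ (proj₂ (proj₂ baseJoin)))

    module Assemble (g₁ g₂ : ES) (ev₁ : Even g₁) (ev₂ : Even g₂) (s₁ : ∀ {e} → g₁ e ≡ true → E₀ e ≡ true) (s₂ : ∀ {e} → g₂ e ≡ true → E₀ e ≡ true) where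

      Inside : ES → Set
      Inside g = Even g × (∀ {e} → g e ≡ true → E₀ e ≡ true)

      in⊕ : Inside (g₁ ⊕ g₂)
      in⊕ = even-⊕ {g₁} ev₁ ev₂ , λ {e} h → case xor-split {g₁ e} h of λ { (inj₁ (p , _)) → s₁ p ; (inj₂ (_ , p)) → s₂ p }

      in-comb : ∀ i → Inside (comb₄ g₁ g₂ i)
      in-comb i = comb-prop {Inside} g₁ g₂ i (even-∅ , λ ()) (ev₁ , s₁) (ev₂ , s₂) in⊕

      in-pair : ∀ i → Inside (proj₁ (pairOf g₁ g₂ i)) × Inside (proj₂ (pairOf g₁ g₂ i))
      in-pair i = pair-prop {Inside} g₁ g₂ i (ev₁ , s₁) (ev₂ , s₂) in⊕

      join-shift : ∀ {S} → Inside S → Even (N ⊕ Jb) × (∀ {e} → Jb e ≡ true → pos e ≡ true) → Even (N ⊕ (Jb ⊕ S)) × (∀ {e} → (Jb ⊕ S) e ≡ true → pos e ≡ true)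
      join-shift {S} (ev , s) (p , q) = even-cong (λ e → xor-assoc (N e) (Jb e) (S e)) (even-⊕ {N ⊕ Jb} p ev) ,
        λ {e} h → case xor-split {Jb e} h of λ { (inj₁ (k , _)) → q k ; (inj₂ (_ , k)) → E₀-pos (s k) }

    no-U : ∀ {e} → U e ≡ true → (g₁ g₂ : ES) → (∀ {e} → g₁ e ≡ true → E₀ e ≡ true) → (∀ {e} → g₂ e ≡ true → E₀ e ≡ true) → g₁ e ≡ false × g₂ e ≡ false
    no-U u g₁ g₂ s₁ s₂ = ≢true⇒false (λ k → absurd (s₁ k) (U-E₀ u)) , ≢true⇒false (λ k → absurd (s₂ k) (U-E₀ u))

    -- The join covers the chords, `C` itself serves as the first even set, and the pair covers `Y`.
    -- Averaging affects only `Y` and the tree part of `C`, so any other edge is paid at most once;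
    -- the surplus 10 and 22 on those two sets is what `Growth.bound` pays for.
    dense : Σ ES λ J → Σ ES λ K₂ → Σ ES λ K₃ → Even (N ⊕ J) × (∀ {e} → J e ≡ true → pos e ≡ true) ×
      (Even K₂ × (∀ {e} → K₂ e ≡ true → E₀ e ≡ true)) × (Even K₃ × (∀ {e} → K₃ e ≡ true → E₀ e ≡ true)) ×
      (∀ {e} → E₀ e ≡ true → J e ∨ (C e ∨ (K₂ e ∨ K₃ e)) ≡ true) ×
      12 * (count J + count C + (count K₂ + count K₃)) + 12 * count U ≤ 12 * count pos + (10 * count Y + 22 * count (λ e → C e ∧ T e))
    dense with flow (λ _ → false) (λ _ → false) (λ v _ → even-∅ v) (λ v _ → even-∅ v) (λ ()) (λ ())
    ... | g₁ , g₂ , r₁ , r₂ , t₁ , t₂ , nz = Jb ⊕ comb₄ g₁ g₂ i , proj₁ (pairOf g₁ g₂ k) , proj₂ (pairOf g₁ g₂ k)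
        , proj₁ shifted , proj₂ shifted , proj₁ (A.in-pair k) , proj₂ (A.in-pair k) , cov
        , estimate
      where
        in-E₀ : ∀ {g} → Reserve T C Y g → ∀ {e} → g e ≡ true → E₀ e ≡ true
        in-E₀ r h = case r h of λ { (inj₁ p) → Y⊆ p ; (inj₂ (p , _)) → C⊆ p }
        s₁ : ∀ {e} → g₁ e ≡ true → E₀ e ≡ true
        s₁ = in-E₀ {g₁} t₁
        s₂ : ∀ {e} → g₂ e ≡ true → E₀ e ≡ true
        s₂ = in-E₀ {g₂} t₂
        module A = Assemble g₁ g₂ (rel-even s₁ r₁) (rel-even s₂ r₂) s₁ s₂
        i : Fin 4
        i = proj₁ (best₄ Jb g₁ g₂)
        k : Fin 3
        k = proj₁ (bestPair g₁ g₂)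
        shifted = A.join-shift (A.in-comb i) (Jb-even , Jb-pos)
        cov : ∀ {e} → E₀ e ≡ true → (Jb ⊕ comb₄ g₁ g₂ i) e ∨ (C e ∨ (proj₁ (pairOf g₁ g₂ k) e ∨ proj₂ (pairOf g₁ g₂ k) e)) ≡ true
        cov {e} h with bool-cases (C e) | bool-cases (Y e)
        ... | inj₁ c | _ = ∨-right {(Jb ⊕ comb₄ g₁ g₂ i) e} (∨-left c)
        ... | inj₂ _ | inj₁ y = ∨-right {(Jb ⊕ comb₄ g₁ g₂ i) e} (∨-right {C e} (pair-cover g₁ g₂ k {e} (nz y)))
        ... | inj₂ c | inj₂ y = ∨-left (trans (cong₂ _xor_ (Jb-chord ch) (still i)) refl)
          where
            ch : chord e ≡ true
            ch = ∧-intro h (∧-intro (not-intro c) (not-intro y))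
            z₁ : g₁ e ≡ false
            z₁ = reserve-chord {g₁} t₁ ch
            z₂ : g₂ e ≡ false
            z₂ = reserve-chord {g₂} t₂ ch
            still : ∀ i → comb₄ g₁ g₂ i e ≡ false
            still zero = refl
            still (suc zero) = z₁
            still (suc (suc zero)) = z₂
            still (suc (suc (suc zero))) = cong₂ _xor_ z₁ z₂
        pt : ∀ e → denseWeight (Jb e) (C e) (g₁ e) (g₂ e) (U e) ≤ 12 * bN (pos e) + (10 * bN (Y e) + 22 * bN (C e ∧ T e))
        pt e with bool-cases (U e)
        ... | inj₁ u = tab (Jb e) (C e) (g₁ e) (g₂ e) (U e) (pos e) (U-join {Jb} Jb-even u) (≢true⇒false λ c → absurd (C⊆ c) (U-E₀ u)) (proj₁ (no-U u g₁ g₂ s₁ s₂)) (proj₂ (no-U u g₁ g₂ s₁ s₂)) (U⊆ u)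
          where
            tab : ∀ j c a b u p {y} → j ≡ false → c ≡ false → a ≡ false → b ≡ false → p ≡ true → denseWeight j c a b u ≤ 12 * bN p + y
            tab _ _ _ _ true _ refl refl refl refl refl = m≤m+n 12 _
            tab _ _ _ _ false _ refl refl refl refl refl = z≤n
        ... | inj₂ u with bool-cases (C e) | bool-cases (Y e) | bool-cases (T e)
        ...   | inj₁ c | _ | inj₁ t = tab (Jb e) (C e) (g₁ e) (g₂ e) (U e) (pos e) (T e) {bN (Y e)} u c t (E₀-pos (C⊆ c))
          where
            tab : ∀ j c a b u p t {y} → u ≡ false → c ≡ true → t ≡ true → p ≡ true → denseWeight j c a b u ≤ 12 * bN p + (10 * y + 22 * bN (c ∧ t))
            tab j c a b u p t {y} refl refl refl refl = ≤-trans (denseWeight-C j a b) (ℕₚ.+-monoʳ-≤ 12 (m≤n+m 22 (10 * y)))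
        ...   | inj₁ c | _ | inj₂ t = tab (Jb e) (C e) (g₁ e) (g₂ e) (U e) (pos e) u c (Jb-C c t) (noT {g₁} t₁) (noT {g₂} t₂) (E₀-pos (C⊆ c))
          where
            noT : ∀ {g} → Reserve T C Y g → g e ≡ false
            noT r = ≢true⇒false λ h → case r h of λ { (inj₁ y) → absurd y (CY c) ; (inj₂ (_ , q)) → absurd q t }
            tab : ∀ j c a b u p {y} → u ≡ false → c ≡ true → j ≡ false → a ≡ false → b ≡ false → p ≡ true → denseWeight j c a b u ≤ 12 * bN p + y
            tab _ _ _ _ _ _ refl refl refl refl refl refl = m≤m+n 12 _
        ...   | inj₂ c | inj₁ y | _ = tab (Jb e) (C e) (g₁ e) (g₂ e) (U e) (pos e) (Y e) u c y (nz y) (E₀-pos (Y⊆ y))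
          where
            tab : ∀ j c a b u p y {x} → u ≡ false → c ≡ false → y ≡ true → a ∨ b ≡ true → p ≡ true → denseWeight j c a b u ≤ 12 * bN p + (10 * bN y + x)
            tab j _ true b _ _ _ refl refl refl h refl = m≤m+n 22 _
            tab j _ false true _ _ _ refl refl refl h refl = m≤m+n 22 _
        ...   | inj₂ c | inj₂ y | _ = tab (Jb e) (C e) (g₁ e) (g₂ e) (U e) (pos e) u c (out {g₁} t₁) (out {g₂} t₂) Jb-pos
          where
            out : ∀ {g} → Reserve T C Y g → g e ≡ false
            out r = ≢true⇒false λ h → case r h of λ { (inj₁ q) → absurd q y ; (inj₂ (q , _)) → absurd q c }
            tab : ∀ j c a b u p {x} → u ≡ false → c ≡ false → a ≡ false → b ≡ false → (j ≡ true → p ≡ true) → denseWeight j c a b u ≤ 12 * bN p + x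
            tab true _ _ _ _ _ refl refl refl refl h rewrite h refl = m≤m+n 12 _
            tab false _ _ _ _ _ refl refl refl refl h = z≤n
        estimate = dense-total Jb C g₁ g₂ U pos Y (λ e → C e ∧ T e) {count (Jb ⊕ comb₄ g₁ g₂ i)} {count (proj₁ (pairOf g₁ g₂ k)) + count (proj₂ (pairOf g₁ g₂ k))} pt (proj₂ (best₄ Jb g₁ g₂)) (proj₂ (bestPair g₁ g₂))

    Chosen : (J K₁ K₂ K₃ : ES) → Set
    Chosen J K₁ K₂ K₃ = Even (N ⊕ J) × (∀ {e} → J e ≡ true → pos e ≡ true) × (Even K₁ × (∀ {e} → K₁ e ≡ true → E₀ e ≡ true)) ×
      (Even K₂ × (∀ {e} → K₂ e ≡ true → E₀ e ≡ true)) × (Even K₃ × (∀ {e} → K₃ e ≡ true → E₀ e ≡ true)) ×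
      (∀ {e} → E₀ e ≡ true → J e ∨ (K₁ e ∨ (K₂ e ∨ K₃ e)) ≡ true)

    -- The chords are completed by tree edges to an even set `Q`, which is prescribed as `f₁`. Then
    -- `a` and `b` cover all of `E₀` except edges of `C`. With the join also averaged over adding
    -- `C`, an edge of `a` or `b` costs 1/2 + 1/2 + 4/3 = 7/3, and all other edges cost less.
    sparse : Σ ES λ J → Σ ES λ K₁ → Σ ES λ K₂ → Σ ES λ K₃ → Chosen J K₁ K₂ K₃ ×
      24 * (count J + count K₁ + (count K₂ + count K₃)) + 24 * count U ≤ 56 * count pos
    sparse = build (join chord T λ e h → T-walk (∧-left h))
      where
        build : (Σ ES λ J → (∀ v → ∂ J v ≡ ∂ chord v) × (∀ {e} → J e ≡ true → T e ≡ true)) → _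
        build (Jc , ∂Jc , Jc⊆) = build' (flow Q (λ _ → false) (λ v _ → Q-even v) (λ v _ → even-∅ v) Q⊆ (λ ()))
          where
            Q : ES
            Q = chord ⊕ Jc
            Q-even : Even Q
            Q-even v = trans (∂-⊕ chord Jc v) (trans (cong (∂ chord v xor_) (∂Jc v)) (xor-same (∂ chord v)))
            Q⊆ : ∀ {e} → Q e ≡ true → E₀ e ≡ true
            Q⊆ {e} h = case xor-split {chord e} h of λ { (inj₁ (p , _)) → ∧-left p ; (inj₂ (_ , p)) → T-E₀ (Jc⊆ p) }
            Q-chord : ∀ {e} → chord e ≡ true → Q e ≡ true
            Q-chord h = xor-trueˡ h (≢true⇒false λ k → absurd (Jc⊆ k) (T-chord h))
            build' : (Σ ES λ g₁ → Σ ES λ g₂ → Rel isRoot (Q ⊕ g₁) × Rel isRoot ((λ _ → false) ⊕ g₂) × Reserve T C Y g₁ × Reserve T C Y g₂ ×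
              (∀ {e} → Y e ≡ true → (Q ⊕ g₁) e ∨ g₂ e ≡ true)) → _
            build' (g₁ , g₂ , r₁ , r₂ , t₁ , t₂ , nz) = with-C Jb k ⊕ comb₄ a b i , C ⊕ comb₄ a b l , proj₁ (pairOf a b m) , proj₂ (pairOf a b m)
                , (proj₁ shifted , (λ {e} → proj₂ shifted {e}) , K₁-in , proj₁ (A.in-pair m) , proj₂ (A.in-pair m) , λ {e} → cov {e})
                , sparse-total Jb C a b U pos {count (with-C Jb k ⊕ comb₄ a b i)} {count (C ⊕ comb₄ a b l)} {count (proj₁ (pairOf a b m)) + count (proj₂ (pairOf a b m))}
                    pt (proj₂ (proj₂ (best₈ Jb a b))) (proj₂ (best₄ C a b)) (proj₂ (bestPair a b))
              where
                a b : ES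
                a = Q ⊕ g₁
                b = g₂
                in-E₀ : ∀ {g} → Reserve T C Y g → ∀ {e} → g e ≡ true → E₀ e ≡ true
                in-E₀ r h = case r h of λ { (inj₁ p) → Y⊆ p ; (inj₂ (p , _)) → C⊆ p }
                a⊆ : ∀ {e} → a e ≡ true → E₀ e ≡ true
                a⊆ {e} h = case xor-split {Q e} h of λ { (inj₁ (p , _)) → Q⊆ p ; (inj₂ (_ , p)) → in-E₀ {g₁} t₁ p }
                b⊆ : ∀ {e} → b e ≡ true → E₀ e ≡ true
                b⊆ = in-E₀ {g₂} t₂
                module A = Assemble a b (rel-even a⊆ r₁) (rel-even b⊆ r₂) a⊆ b⊆
                i : Fin 4
                i = proj₁ (proj₂ (best₈ Jb a b))
                k : Fin 2
                k = proj₁ (best₈ Jb a b)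
                l : Fin 4
                l = proj₁ (best₄ C a b)
                m : Fin 3
                m = proj₁ (bestPair a b)
                JC : ∀ k → Even (N ⊕ with-C Jb k) × (∀ {e} → with-C Jb k e ≡ true → pos e ≡ true)
                JC zero = Jb-even , Jb-pos
                JC (suc zero) = even-cong (λ e → xor-assoc (N e) (Jb e) (C e)) (even-⊕ {N ⊕ Jb} Jb-even C-even) ,
                  λ {e} h → case xor-split {Jb e} h of λ { (inj₁ (p , _)) → Jb-pos p ; (inj₂ (_ , p)) → E₀-pos (C⊆ p) }
                shifted : Even (N ⊕ (with-C Jb k ⊕ comb₄ a b i)) × (∀ {e} → (with-C Jb k ⊕ comb₄ a b i) e ≡ true → pos e ≡ true)
                shifted = even-cong (λ e → xor-assoc (N e) (with-C Jb k e) (comb₄ a b i e)) (even-⊕ {N ⊕ with-C Jb k} (proj₁ (JC k)) (proj₁ (A.in-comb i))) ,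
                  λ {e} h → case xor-split {with-C Jb k e} h of λ { (inj₁ (p , _)) → proj₂ (JC k) p ; (inj₂ (_ , p)) → E₀-pos (proj₂ (A.in-comb i) p) }
                K₁-in : Even (C ⊕ comb₄ a b l) × (∀ {e} → (C ⊕ comb₄ a b l) e ≡ true → E₀ e ≡ true)
                K₁-in = even-⊕ {C} C-even (proj₁ (A.in-comb l)) ,
                  λ {e} h → case xor-split {C e} h of λ { (inj₁ (p , _)) → C⊆ p ; (inj₂ (_ , p)) → proj₂ (A.in-comb l) p }
                a-or-C : ∀ {e} → E₀ e ≡ true → (a e ∨ b e ≡ true) ⊎ (a e ≡ false × b e ≡ false × C e ≡ true)
                a-or-C {e} h with bool-cases (a e ∨ b e)
                ... | inj₁ p = inj₁ p
                ... | inj₂ p with bool-cases (C e) | bool-cases (Y e)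
                ...   | inj₁ c | _ = inj₂ (proj₁ (∨-false p) , proj₂ (∨-false {a e} p) , c)
                ...   | inj₂ c | inj₁ y = absurd (nz y) p
                ...   | inj₂ c | inj₂ y = absurd (∨-left (xor-trueˡ (Q-chord ch) (reserve-chord {g₁} t₁ ch))) p
                  where
                    ch : chord e ≡ true
                    ch = ∧-intro h (∧-intro (not-intro c) (not-intro y))
                cov : ∀ {e} → E₀ e ≡ true → (with-C Jb k ⊕ comb₄ a b i) e ∨ ((C ⊕ comb₄ a b l) e ∨ (proj₁ (pairOf a b m) e ∨ proj₂ (pairOf a b m) e)) ≡ true
                cov {e} h with a-or-C h
                ... | inj₁ p = ∨-right {(with-C Jb k ⊕ comb₄ a b i) e} (∨-right {(C ⊕ comb₄ a b l) e} (pair-cover a b m {e} p))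
                ... | inj₂ (p , q , c) = ∨-right {(with-C Jb k ⊕ comb₄ a b i) e} (∨-left (xor-trueˡ c (still l)))
                  where
                    still : ∀ i → comb₄ a b i e ≡ false
                    still zero = refl
                    still (suc zero) = p
                    still (suc (suc zero)) = q
                    still (suc (suc (suc zero))) = cong₂ _xor_ p q
                tabE : ∀ j c a b u p → u ≡ false → p ≡ true → (a ∨ b ≡ true) ⊎ (a ≡ false × b ≡ false × c ≡ true) → sparseWeight j c a b u ≤ 56 * bN p
                tabE j c true b _ _ refl refl (inj₁ _) = ≤-refl
                tabE j c false true _ _ refl refl (inj₁ _) = ≤-refl
                tabE true _ _ _ _ _ refl refl (inj₂ (refl , refl , refl)) = m≤m+n 36 20
                tabE false _ _ _ _ _ refl refl (inj₂ (refl , refl , refl)) = m≤m+n 36 20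
                tabO : ∀ j c a b u p → c ≡ false → a ≡ false → b ≡ false → (j ≡ true → p ≡ true × u ≡ false) → (u ≡ true → p ≡ true) → sparseWeight j c a b u ≤ 56 * bN p
                tabO true _ _ _ u p refl refl refl h h' with h refl
                ... | refl , refl = m≤m+n 24 32
                tabO false _ _ _ true p refl refl refl h h' rewrite h' refl = m≤m+n 24 32
                tabO false _ _ _ false p refl refl refl h h' = z≤n
                pt : ∀ e → sparseWeight (Jb e) (C e) (a e) (b e) (U e) ≤ 56 * bN (pos e)
                pt e with bool-cases (E₀ e)
                ... | inj₁ h = tabE (Jb e) (C e) (a e) (b e) (U e) (pos e) (≢true⇒false λ u → absurd h (U-E₀ u)) (E₀-pos h) (a-or-C h)
                ... | inj₂ h = tabO (Jb e) (C e) (a e) (b e) (U e) (pos e) (≢true⇒false λ c → absurd (C⊆ c) h) (≢true⇒false λ c → absurd (a⊆ c) h) (≢true⇒false λ c → absurd (b⊆ c) h)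
                    (λ j → Jb-pos j , ≢true⇒false λ u → absurd j (U-join {Jb} Jb-even u)) U⊆

    pack : ∀ {J K₁ K₂ K₃} → Chosen J K₁ K₂ K₃ → 3 * (count J + count K₁ + (count K₂ + count K₃)) + 3 * count U + 6 ≤ 3 * count pos + 6 * nV G →
      3 * (count J + count K₁ + (count K₂ + count K₃)) + 3 * count U + 3 ≤ 5 * count pos + 3 * nV G → BaseCover N U
    pack {J} {K₁} {K₂} {K₃} (ev , J⊆ , (e₁ , i₁) , (e₂ , i₂) , (e₃ , i₃) , cov) b₁ b₂ = record
      { J = J ; K₁ = K₁ ; K₂ = K₂ ; K₃ = K₃ ; J⊆ = J⊆ ; J-even = ev ; even₁ = e₁ ; even₂ = e₂ ; even₃ = e₃ ; in₁ = i₁ ; in₂ = i₂ ; in₃ = i₃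
      ; cover = cov ; bound₁ = b₁ ; bound₂ = b₂ }

    baseCover-raw : BaseCover N U
    baseCover-raw with 3 * nV G ≤? 2 * count pos + 3
    ... | yes p = from dense
      where
        some-root : 1 ≤ count isRoot
        some-root = count-pos isRoot (proj₁ (proj₂ (findRoot v₀)))
        from : (Σ ES λ J → Σ ES λ K₂ → Σ ES λ K₃ → _) → BaseCover N U
        from (J , K₂ , K₃ , ev , J⊆ , k₂ , k₃ , cov , h) = pack (ev , J⊆ , (C-even , C⊆) , k₂ , k₃ , cov) b₁ (dense-second _ (count pos) (nV G) b₁ p)
          where
            b₁ : 3 * (count J + count C + (count K₂ + count K₃)) + 3 * count U + 6 ≤ 3 * count pos + 6 * nV G
            b₁ = dense-bound (count J + count C + (count K₂ + count K₃)) (count U) (count pos) (count Y) (count (λ e → C e ∧ T e)) (count isRoot) (nV G)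
              h bound some-root (≤-trans some-root (count≤n isRoot))
    ... | no p = from sparse
      where
        from : (Σ ES λ J → Σ ES λ K₁ → Σ ES λ K₂ → Σ ES λ K₃ → _) → BaseCover N U
        from (J , K₁ , K₂ , K₃ , ok , h) = let b = sparse-both (3 * c + 3 * count U) (count pos) (nV G) (sparse-cancel c (count U) (count pos) h) (ℕₚ.<⇒≤ (ℕₚ.≰⇒> p)) in
            pack ok (proj₁ b) (proj₂ b)
          where
            c : ℕ
            c = count J + count K₁ + (count K₂ + count K₃)

    abstract
      baseCover : BaseCover N U
      baseCover = baseCover-raw

-- Edges that separate their component.

module Separators (G : SignedGraph) where
  open Walks G
  open Cycles G
  open Decompose G using (delete; delete-≢; delete-in)

  -- A separating edge is kept together with a set that it alone leaves. All later statements about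
  -- its sides compare the values of `A` at two vertices.
  record Only (A : VS) (u : E) : Set where
    constructor mkOnly
    field
      cuts : cut A u ≡ true
      sole : ∀ {e} → cut A e ≡ true → e ≡ u
  open Only public

  only-same : ∀ {A u e a b} → Only A u → e ≢ u → Joins G e a b → A a ≡ A b
  only-same {A} {u} o ne j = xor-false (trans (sym (joins-cut A j)) (≢true⇒false λ h → ne (sole o h)))

  only-≢ : ∀ {A u a b} → Only A u → Joins G u a b → A a ≢ A b
  only-≢ {A} o j q = absurd (cuts o) (trans (joins-cut A j) (xor-≡ q))

  only-cyc : ∀ {A u} C → Only A u → ∀ {x y} → x ∈ cverts C → y ∈ cverts C → A x ≡ A y
  only-cyc {A} {u} C o = cyc-inside A C λ {e} h → ≢true⇒false λ k →
    let (e' , ne , _ , k') = even-second {χ (cedges C)} (even-cyc C) A (χ-unique (cedges C) (cedges-unique C) h) k in ne (trans (sole o k') (sym (sole o k)))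

  only-walk : ∀ {P : E → Set} {A u a b} → Only A u → (w : Walk G P a b) → u ∉ edges w → A a ≡ A b
  only-walk o here h = refl
  only-walk o (wstep e p j w) h = trans (only-same o (λ q → h (here (sym q))) j) (only-walk o w (h ∘ there))

  separator? : ∀ e → (Σ VS λ A → Only A e) ⊎ (∀ {A} → Only A e → ⊥)
  separator? e with bool-cases (Reach.set (reach (delete (λ _ → true) e) (src e)) (tgt e))
  ... | inj₁ p = inj₂ λ {A} o → only-≢ o (joins-self e) (sym (only-walk o w λ h → delete-≢ {λ _ → true} (edges-P w h) refl))
    where
      w : Walk G (In (delete (λ _ → true) e)) (tgt e) (src e)
      w = Reach.fromSet (reach (delete (λ _ → true) e) (src e)) p
  ... | inj₂ p = inj₁ (Reach.set R , mkOnly (xor-trueˡ (Reach.set-root R) p) sole')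
    where
      R : Reach (delete (λ _ → true) e) (src e)
      R = reach (delete (λ _ → true) e) (src e)
      sole' : ∀ {e'} → cut (Reach.set R) e' ≡ true → e' ≡ e
      sole' {e'} c with e' ≟ e
      ... | yes q = q
      ... | no q = absurd c (Reach.set-uncut R (delete-in {λ _ → true} refl q))

-- Tokens, their pairing to barbells, and the merging of partial results.

module Joining (G : SignedGraph) {n : ℕ} (D : Fin n → Cycles.Cyc G)
  (odd : ∀ i → Walks.par G (neg G) (Cycles.cedges (D i)) ≡ true) (compatible : ∀ {i j} → i ≢ j → Cycles.Compat G (D i) (D j)) where
  open Walks G
  open Cycles G
  open Decompose G using (Free)
  open Separators G

  -- An unbalanced circuit with the trail along which it has been moved to `v`; `tcost` bounds its
  -- share in the barbell that it will form with another token at `v`.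
  record Tok (v : V) : Set where
    field
      cyc : Cyc
      isOdd : par (neg G) (cedges cyc) ≡ true
      {start} : V
      base∈ : start ∈ cverts cyc
      trail : Walk G Free start v
    tcost : ℕ
    tcost = clen cyc + length (edges trail)
  open Tok public

  Covers : List (SignedCircuit G) → E → Set
  Covers em e = Any (e ∈SC_) em

  length-rev : ∀ {P : E → Set} {u v} (w : Walk G P u v) → length (edges (rev w)) ≡ length (edges w)
  length-rev here = refl
  length-rev (wstep e p j w) = trans (cong length (edges-⟫ (rev w) _)) (trans (length-++ (edges (rev w))) (trans (+-comm _ 1) (cong suc (length-rev w))))

  record Pairing {v} (a b : Tok v) : Set where
    field
      sc : SignedCircuit G
      pcov : ∀ {e} → e ∈ cedges (cyc a) ⊎ e ∈ cedges (cyc b) → e ∈SC sc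
      psize : size sc ≤ tcost a + tcost b
      psep : ∀ {A u} → Only A u → A (start a) ≢ A (start b) → u ∈SC sc

  pairing-raw : ∀ {v} (a b : Tok v) → Compat (cyc a) (cyc b) → Pairing a b
  pairing-raw a b cp = record { sc = sc ; pcov = cov ; psize = ≤-trans size≤ (≤-reflexive eq) ; psep = sep }
    where
      w : Walk G Free (start a) (start b)
      w = trail a ⟫ rev (trail b)
      open Barbell (barbell (cyc a) (cyc b) w cp (isOdd a) (isOdd b) (base∈ a) (base∈ b))
      eq : clen (cyc a) + clen (cyc b) + length (edges w) ≡ tcost a + tcost b
      eq = trans (cong (clen (cyc a) + clen (cyc b) +_) (trans (cong length (edges-⟫ (trail a) (rev (trail b)))) (trans (length-++ (edges (trail a))) (cong (length (edges (trail a)) +_) (length-rev (trail b))))))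
        (+-interchange (clen (cyc a)) (clen (cyc b)) _ _)
      sep : ∀ {A u} → Only A u → A (start a) ≢ A (start b) → u ∈SC sc
      sep {A} {u} o ne with bool-cases (A (start a)) | bool-cases (A (start b))
      ... | inj₁ p | inj₁ q = ⊥-elim (ne (trans p (sym q)))
      ... | inj₂ p | inj₂ q = ⊥-elim (ne (trans p (sym q)))
      ... | inj₁ p | inj₂ q = let (e , c , e∈) = crosses A (λ x∈ → trans (only-cyc (cyc a) o x∈ (base∈ a)) p) (λ x∈ → trans (only-cyc (cyc b) o x∈ (base∈ b)) q) in
          subst (_∈SC sc) (sole o c) e∈
      ... | inj₂ p | inj₁ q = let (e , c , e∈) = crosses (not ∘ A) (λ x∈ → not-intro (trans (only-cyc (cyc a) o x∈ (base∈ a)) p)) (λ x∈ → cong not (trans (only-cyc (cyc b) o x∈ (base∈ b)) q)) in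
          subst (_∈SC sc) (sole o (trans (sym (flip e)) c)) e∈
        where
          flip : ∀ e → cut (not ∘ A) e ≡ cut A e
          flip e with A (src e) | A (tgt e)
          ... | true | true = refl
          ... | true | false = refl
          ... | false | true = refl
          ... | false | false = refl

  abstract
    pairing : ∀ {v} (a b : Tok v) → Compat (cyc a) (cyc b) → Pairing a b
    pairing = pairing-raw

  tokenCost : List (Fin n) → ℕ
  tokenCost I = sum (map (clen ∘ D) I)

  -- State of the joining process at v after exhausting the tokens I and the tree edges Es: the signed circuits emitted so far
  -- and k tokens waiting at v. A separator u among the Es is covered already, or will be once its waiting token meets a later one.
  record Res (cap : ℕ) (v : V) (I : List (Fin n)) (Es : List E) (k x : ℕ) : Set where
    field
      em : List (SignedCircuit G)
      g : Fin k → Tok v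
      -- Each tree edge is crossed by at most `cap` of the counted tokens; `x` records the excess
      -- caused by tokens that were added to the given ones.
      cost : sum (map size em) + sumF (λ j → tcost (g j)) ≤ tokenCost I + cap * length Es + x
      cov : ∀ {i} → i ∈ I → (∀ e → e ∈ cedges (D i) → Covers em e) ⊎ Σ (Fin k) λ j → cyc (g j) ≡ D i
      obl : ∀ {A u} → Only A u → u ∈ Es → Covers em u ⊎ Σ (Fin k) λ j → A (start (g j)) ≢ A v
      loc : ∀ {A u} → Only A u → u ∉ Es → ∀ j → A (start (g j)) ≡ A v
  open Res public

  -- This secures compatibility at the next meeting. A token is either one of the given circuits,
  -- compatible with all the others, or it comes from beyond a separator and is vertex-disjoint from
  -- what lies on this side.
  Orig : ∀ {cap v I Es k x} → Res cap v I Es k x → Set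
  Orig {v = v} {I} {Es} {k} r = ∀ (j : Fin k) → (Σ (Fin n) λ i → i ∈ I × cyc (g r j) ≡ D i) ⊎ (Σ VS λ A → Σ E λ u → Only A u × u ∈ Es × A (start (g r j)) ≢ A v)

  Disjoint : {X : Set} → List X → List X → Set
  Disjoint k l = ∀ {x} → x ∈ k → x ∈ l → ⊥

  apart-compat : ∀ {v} (a b : Tok v) {A u} → Only A u → A (start a) ≢ A (start b) → Compat (cyc a) (cyc b)
  apart-compat a b o ne = compat-disjoint λ p q → ne (trans (only-cyc (cyc a) o (base∈ a) p) (only-cyc (cyc b) o q (base∈ b)))

  cross-compat : ∀ {cap v I₁ I₂ Es₁ Es₂ k₁ k₂ x₁ x₂} (r₁ : Res cap v I₁ Es₁ k₁ x₁) (r₂ : Res cap v I₂ Es₂ k₂ x₂) → Orig r₁ → Orig r₂ →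
    Disjoint I₁ I₂ → Disjoint Es₁ Es₂ → ∀ j₁ j₂ → Compat (cyc (g r₁ j₁)) (cyc (g r₂ j₂))
  cross-compat r₁ r₂ o₁ o₂ dI dE j₁ j₂ with o₁ j₁ | o₂ j₂
  ... | inj₂ (A , u , o , u∈ , ne) | _ = apart-compat (g r₁ j₁) (g r₂ j₂) o λ q → ne (trans q (loc r₂ o (λ h → dE u∈ h) j₂))
  ... | inj₁ _ | inj₂ (A , u , o , u∈ , ne) = apart-compat (g r₁ j₁) (g r₂ j₂) o λ q → ne (trans (sym q) (loc r₁ o (λ h → dE h u∈) j₁))
  ... | inj₁ (i₁ , p₁ , q₁) | inj₁ (i₂ , p₂ , q₂) = subst₂ Compat (sym q₁) (sym q₂) (compatible λ { refl → dI p₁ p₂ })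

  -- The pairs in `ps` become barbells and the tokens in `rest` keep waiting; `fate₁` and `fate₂`
  -- ensure that no token is lost. A pair covers a pending separator because, by `loc`, the partner
  -- waits on the other side of it.
  module Combine {cap : ℕ} {v : V} {I₁ I₂ : List (Fin n)} {Es₁ Es₂ : List E} {k₁ k₂ x₁ x₂ : ℕ} (r₁ : Res cap v I₁ Es₁ k₁ x₁) (r₂ : Res cap v I₂ Es₂ k₂ x₂)
    (cp : ∀ j₁ j₂ → Compat (cyc (g r₁ j₁)) (cyc (g r₂ j₂))) (dE : Disjoint Es₁ Es₂)
    (ps : List (Fin k₁ × Fin k₂)) {k : ℕ} (rest : Fin k → Fin k₁ ⊎ Fin k₂)
    (fate₁ : ∀ j → (Σ (Fin k₂) λ j' → (j , j') ∈ ps) ⊎ (Σ (Fin k) λ l → rest l ≡ inj₁ j))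
    (fate₂ : ∀ j → (Σ (Fin k₁) λ j' → (j' , j) ∈ ps) ⊎ (Σ (Fin k) λ l → rest l ≡ inj₂ j)) where

    pick : Fin k₁ ⊎ Fin k₂ → Tok v
    pick (inj₁ j) = g r₁ j
    pick (inj₂ j) = g r₂ j

    pairs : List (Fin k₁ × Fin k₂) → List (SignedCircuit G)
    pairs = map λ (a , b) → Pairing.sc (pairing (g r₁ a) (g r₂ b) (cp a b))

    pairsCost : List (Fin k₁ × Fin k₂) → ℕ
    pairsCost = sum ∘ map λ (a , b) → tcost (g r₁ a) + tcost (g r₂ b)

    pairs-size : ∀ l → sum (map size (pairs l)) ≤ pairsCost l
    pairs-size [] = z≤n
    pairs-size ((a , b) ∷ l) = +-mono-≤ (Pairing.psize (pairing (g r₁ a) (g r₂ b) (cp a b))) (pairs-size l)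

    in-pairs : ∀ {a b e} l → (a , b) ∈ l → e ∈SC Pairing.sc (pairing (g r₁ a) (g r₂ b) (cp a b)) → Covers (pairs l) e
    in-pairs (_ ∷ l) (here refl) h = here h
    in-pairs (_ ∷ l) (there q) h = there (in-pairs l q h)

    em' : List (SignedCircuit G)
    em' = pairs ps ++ (em r₁ ++ em r₂)

    combine : pairsCost ps + sumF (λ l → tcost (pick (rest l))) ≤ sumF (λ j → tcost (g r₁ j)) + sumF (λ j → tcost (g r₂ j)) →
      Res cap v (I₁ ++ I₂) (Es₁ ++ Es₂) k (x₁ + x₂)
    combine h = record
      { em = em' ; g = pick ∘ rest ; cost = cost'
      ; cov = λ {i} i∈ → case ∈-++⁻ I₁ i∈ of λ
          { (inj₁ p) → case cov r₁ p of λ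
              { (inj₁ c) → inj₁ λ e e∈ → ++⁺ʳ (pairs ps) (++⁺ˡ (c e e∈))
              ; (inj₂ (j , q)) → case fate₁ j of λ
                  { (inj₁ (j' , m)) → inj₁ λ e e∈ → ++⁺ˡ (in-pairs ps m (Pairing.pcov (pairing (g r₁ j) (g r₂ j') (cp j j')) (inj₁ (subst (λ C → e ∈ cedges C) (sym q) e∈))))
                  ; (inj₂ (l , m)) → inj₂ (l , trans (cong (cyc ∘ pick) m) q) } }
          ; (inj₂ p) → case cov r₂ p of λ
              { (inj₁ c) → inj₁ λ e e∈ → ++⁺ʳ (pairs ps) (++⁺ʳ (em r₁) (c e e∈))
              ; (inj₂ (j , q)) → case fate₂ j of λ
                  { (inj₁ (j' , m)) → inj₁ λ e e∈ → ++⁺ˡ (in-pairs ps m (Pairing.pcov (pairing (g r₁ j') (g r₂ j) (cp j' j)) (inj₂ (subst (λ C → e ∈ cedges C) (sym q) e∈))))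
                  ; (inj₂ (l , m)) → inj₂ (l , trans (cong (cyc ∘ pick) m) q) } } }
      ; obl = λ {A} {u} o u∈ → case ∈-++⁻ Es₁ u∈ of λ
          { (inj₁ p) → case obl r₁ o p of λ
              { (inj₁ c) → inj₁ (++⁺ʳ (pairs ps) (++⁺ˡ c))
              ; (inj₂ (j , q)) → case fate₁ j of λ
                  { (inj₁ (j' , m)) → inj₁ (++⁺ˡ (in-pairs ps m (Pairing.psep (pairing (g r₁ j) (g r₂ j') (cp j j')) o λ z → q (trans z (loc r₂ o (dE p) j')))))
                  ; (inj₂ (l , m)) → inj₂ (l , λ z → q (trans (cong (λ s → A (start (pick s))) (sym m)) z)) } }
          ; (inj₂ p) → case obl r₂ o p of λ
              { (inj₁ c) → inj₁ (++⁺ʳ (pairs ps) (++⁺ʳ (em r₁) c))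
              ; (inj₂ (j , q)) → case fate₂ j of λ
                  { (inj₁ (j' , m)) → inj₁ (++⁺ˡ (in-pairs ps m (Pairing.psep (pairing (g r₁ j') (g r₂ j) (cp j' j)) o λ z → q (trans (sym z) (loc r₁ o (λ k → dE k p) j')))))
                  ; (inj₂ (l , m)) → inj₂ (l , λ z → q (trans (cong (λ s → A (start (pick s))) (sym m)) z)) } } }
      ; loc = λ {A} o u∉ l → loc' {A} o u∉ (rest l) }
      where
        loc' : ∀ {A u} → Only A u → u ∉ Es₁ ++ Es₂ → ∀ s → A (start (pick s)) ≡ A v
        loc' o u∉ (inj₁ j) = loc r₁ o (u∉ ∘ ∈-++⁺ˡ) j
        loc' o u∉ (inj₂ j) = loc r₂ o (u∉ ∘ ∈-++⁺ʳ Es₁) j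
        cost' : sum (map size em') + sumF (λ l → tcost (pick (rest l))) ≤ tokenCost (I₁ ++ I₂) + cap * length (Es₁ ++ Es₂) + (x₁ + x₂)
        cost' = ≤-trans (≤-reflexive (cong (_+ q) e₁)) (≤-trans (ℕₚ.+-monoˡ-≤ q (ℕₚ.+-monoˡ-≤ (s₁ + s₂) (pairs-size ps))) (≤-trans (≤-reflexive (e₂ (pairsCost ps) (s₁ + s₂) q))
            (≤-trans (ℕₚ.+-monoˡ-≤ (s₁ + s₂) h) (≤-trans (≤-reflexive (e₃ t₁ t₂ s₁ s₂)) (≤-trans (+-mono-≤ (cost r₁) (cost r₂)) (≤-reflexive e₄))))))
          where
            open +-*-Solver
            q s₁ s₂ t₁ t₂ : ℕ
            q = sumF (λ l → tcost (pick (rest l)))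
            s₁ = sum (map size (em r₁))
            s₂ = sum (map size (em r₂))
            t₁ = sumF (λ j → tcost (g r₁ j))
            t₂ = sumF (λ j → tcost (g r₂ j))
            e₁ : sum (map size em') ≡ sum (map size (pairs ps)) + (s₁ + s₂)
            e₁ = trans (cong sum (map-++ size (pairs ps) _)) (trans (sum-++ (map size (pairs ps)) _) (cong (sum (map size (pairs ps)) +_) (trans (cong sum (map-++ size (em r₁) _)) (sum-++ (map size (em r₁)) _))))
            e₂ : ∀ a b c → a + b + c ≡ a + c + b
            e₂ = solve 3 (λ a b c → a :+ b :+ c := a :+ c :+ b) refl
            e₃ : ∀ t₁ t₂ s₁ s₂ → t₁ + t₂ + (s₁ + s₂) ≡ s₁ + t₁ + (s₂ + t₂)
            e₃ = solve 4 (λ t₁ t₂ s₁ s₂ → t₁ :+ t₂ :+ (s₁ :+ s₂) := s₁ :+ t₁ :+ (s₂ :+ t₂)) refl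
            e₅ : ∀ a b c l m x y → a + c * l + x + (b + c * m + y) ≡ a + b + c * (l + m) + (x + y)
            e₅ = solve 7 (λ a b c l m x y → a :+ c :* l :+ x :+ (b :+ c :* m :+ y) := a :+ b :+ c :* (l :+ m) :+ (x :+ y)) refl
            e₄ : tokenCost I₁ + cap * length Es₁ + x₁ + (tokenCost I₂ + cap * length Es₂ + x₂) ≡ tokenCost (I₁ ++ I₂) + cap * length (Es₁ ++ Es₂) + (x₁ + x₂)
            e₄ = trans (e₅ (tokenCost I₁) (tokenCost I₂) cap (length Es₁) (length Es₂) x₁ x₂)
              (cong (_+ (x₁ + x₂)) (cong₂ _+_ (sym (trans (cong sum (map-++ (clen ∘ D) I₁ I₂)) (sum-++ (map (clen ∘ D) I₁) _))) (cong (cap *_) (sym (length-++ Es₁)))))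

    orig : ∀ h → Orig r₁ → Orig r₂ → Orig (combine h)
    orig h o₁ o₂ l = from (rest l)
      where
        from : ∀ s → (Σ (Fin n) λ i → i ∈ I₁ ++ I₂ × cyc (pick s) ≡ D i) ⊎ (Σ VS λ A → Σ E λ u → Only A u × u ∈ Es₁ ++ Es₂ × A (start (pick s)) ≢ A v)
        from (inj₁ j) = case o₁ j of λ { (inj₁ (i , p , q)) → inj₁ (i , ∈-++⁺ˡ p , q) ; (inj₂ (A , u , o , p , q)) → inj₂ (A , u , o , ∈-++⁺ˡ p , q) }
        from (inj₂ j) = case o₂ j of λ { (inj₁ (i , p , q)) → inj₁ (i , ∈-++⁺ʳ I₁ p , q) ; (inj₂ (A , u , o , p , q)) → inj₂ (A , u , o , ∈-++⁺ʳ Es₁ p , q) }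

  Full : (cap : ℕ) (v : V) (I : List (Fin n)) (Es : List E) (k x : ℕ) → Set
  Full cap v I Es k x = Σ (Res cap v I Es k x) Orig

  -- The leading digits in the names below count the tokens waiting on the two sides. Pairs are
  -- formed between the sides and never within one, where compatibility is not known; `merge-22`
  -- therefore pairs one token of each side and leaves one of each.
  module Merge {cap : ℕ} {v : V} {I₁ I₂ : List (Fin n)} {Es₁ Es₂ : List E} (dI : Disjoint I₁ I₂) (dE : Disjoint Es₁ Es₂) where

    private
      two : ∀ {X : Set} → X → X → Fin 2 → X
      two a b zero = a
      two a b (suc zero) = b

      via : ∀ {k₁ k₂ x₁ x₂ k} (r₁ : Full cap v I₁ Es₁ k₁ x₁) (r₂ : Full cap v I₂ Es₂ k₂ x₂) (ps : List (Fin k₁ × Fin k₂)) (rest : Fin k → Fin k₁ ⊎ Fin k₂) →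
        (∀ j → (Σ (Fin k₂) λ j' → (j , j') ∈ ps) ⊎ (Σ (Fin k) λ l → rest l ≡ inj₁ j)) →
        (∀ j → (Σ (Fin k₁) λ j' → (j' , j) ∈ ps) ⊎ (Σ (Fin k) λ l → rest l ≡ inj₂ j)) →
        (∀ (f₁ : Fin k₁ → ℕ) (f₂ : Fin k₂ → ℕ) → sum (map (λ (a , b) → f₁ a + f₂ b) ps) + sumF (λ l → [ f₁ , f₂ ] (rest l)) ≤ sumF f₁ + sumF f₂) →
        Full cap v (I₁ ++ I₂) (Es₁ ++ Es₂) k (x₁ + x₂)
      via {k = k} (r₁ , o₁) (r₂ , o₂) ps rest f₁ f₂ h = C.combine ok , C.orig ok o₁ o₂
        where
          module C = Combine r₁ r₂ (cross-compat r₁ r₂ o₁ o₂ dI dE) dE ps rest f₁ f₂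
          split : ∀ s → tcost (C.pick s) ≡ [ (λ j → tcost (g r₁ j)) , (λ j → tcost (g r₂ j)) ] s
          split (inj₁ j) = refl
          split (inj₂ j) = refl
          ok : C.pairsCost ps + sumF (λ l → tcost (C.pick (rest l))) ≤ sumF (λ j → tcost (g r₁ j)) + sumF (λ j → tcost (g r₂ j))
          ok = ≤-trans (≤-reflexive (cong (C.pairsCost ps +_) (sumF-cong {f = λ l → tcost (C.pick (rest l))} λ l → split (rest l)))) (h (λ j → tcost (g r₁ j)) (λ j → tcost (g r₂ j)))

    merge-0k : ∀ {k x₁ x₂} → Full cap v I₁ Es₁ 0 x₁ → Full cap v I₂ Es₂ k x₂ → Full cap v (I₁ ++ I₂) (Es₁ ++ Es₂) k (x₁ + x₂)
    merge-0k r₁ r₂ = via r₁ r₂ [] inj₂ (λ ()) (λ j → inj₂ (j , refl)) (λ f₁ f₂ → ≤-refl)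

    merge-k0 : ∀ {k x₁ x₂} → Full cap v I₁ Es₁ k x₁ → Full cap v I₂ Es₂ 0 x₂ → Full cap v (I₁ ++ I₂) (Es₁ ++ Es₂) k (x₁ + x₂)
    merge-k0 r₁ r₂ = via r₁ r₂ [] inj₁ (λ j → inj₂ (j , refl)) (λ ()) (λ f₁ f₂ → m≤m+n _ _)

    merge-11-0 : ∀ {x₁ x₂} → Full cap v I₁ Es₁ 1 x₁ → Full cap v I₂ Es₂ 1 x₂ → Full cap v (I₁ ++ I₂) (Es₁ ++ Es₂) 0 (x₁ + x₂)
    merge-11-0 r₁ r₂ = via r₁ r₂ ((zero , zero) ∷ []) (λ ()) (λ { zero → inj₁ (zero , here refl) }) (λ { zero → inj₁ (zero , here refl) })
      (λ f₁ f₂ → ≤-reflexive (solve 2 (λ a b → (a :+ b :+ con 0) :+ con 0 := (a :+ con 0) :+ (b :+ con 0)) refl (f₁ zero) (f₂ zero)))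
      where open +-*-Solver

    merge-11-2 : ∀ {x₁ x₂} → Full cap v I₁ Es₁ 1 x₁ → Full cap v I₂ Es₂ 1 x₂ → Full cap v (I₁ ++ I₂) (Es₁ ++ Es₂) 2 (x₁ + x₂)
    merge-11-2 r₁ r₂ = via r₁ r₂ [] (two (inj₁ zero) (inj₂ zero)) (λ { zero → inj₂ (zero , refl) }) (λ { zero → inj₂ (suc zero , refl) })
      (λ f₁ f₂ → ≤-reflexive (solve 2 (λ a b → a :+ (b :+ con 0) := (a :+ con 0) :+ (b :+ con 0)) refl (f₁ zero) (f₂ zero)))
      where open +-*-Solver

    merge-12 : ∀ {x₁ x₂} → Full cap v I₁ Es₁ 1 x₁ → Full cap v I₂ Es₂ 2 x₂ → Full cap v (I₁ ++ I₂) (Es₁ ++ Es₂) 1 (x₁ + x₂)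
    merge-12 r₁ r₂ = via r₁ r₂ ((zero , zero) ∷ []) (λ _ → inj₂ (suc zero)) (λ { zero → inj₁ (zero , here refl) })
      (λ { zero → inj₁ (zero , here refl) ; (suc zero) → inj₂ (zero , refl) })
      (λ f₁ f₂ → ≤-reflexive (solve 3 (λ a b c → (a :+ b :+ con 0) :+ (c :+ con 0) := (a :+ con 0) :+ (b :+ (c :+ con 0))) refl (f₁ zero) (f₂ zero) (f₂ (suc zero))))
      where open +-*-Solver

    merge-21 : ∀ {x₁ x₂} → Full cap v I₁ Es₁ 2 x₁ → Full cap v I₂ Es₂ 1 x₂ → Full cap v (I₁ ++ I₂) (Es₁ ++ Es₂) 1 (x₁ + x₂)
    merge-21 r₁ r₂ = via r₁ r₂ ((zero , zero) ∷ []) (λ _ → inj₁ (suc zero)) (λ { zero → inj₁ (zero , here refl) ; (suc zero) → inj₂ (zero , refl) })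
      (λ { zero → inj₁ (zero , here refl) })
      (λ f₁ f₂ → ≤-reflexive (solve 3 (λ a b c → (a :+ c :+ con 0) :+ (b :+ con 0) := (a :+ (b :+ con 0)) :+ (c :+ con 0)) refl (f₁ zero) (f₁ (suc zero)) (f₂ zero)))
      where open +-*-Solver

    merge-22 : ∀ {x₁ x₂} → Full cap v I₁ Es₁ 2 x₁ → Full cap v I₂ Es₂ 2 x₂ → Full cap v (I₁ ++ I₂) (Es₁ ++ Es₂) 2 (x₁ + x₂)
    merge-22 r₁ r₂ = via r₁ r₂ ((zero , zero) ∷ []) (two (inj₁ (suc zero)) (inj₂ (suc zero)))
      (λ { zero → inj₁ (zero , here refl) ; (suc zero) → inj₂ (zero , refl) }) (λ { zero → inj₁ (zero , here refl) ; (suc zero) → inj₂ (suc zero , refl) })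
      (λ f₁ f₂ → ≤-reflexive (solve 4 (λ a b c d → (a :+ c :+ con 0) :+ (b :+ (d :+ con 0)) := (a :+ (b :+ con 0)) :+ (c :+ (d :+ con 0))) refl (f₁ zero) (f₁ (suc zero)) (f₂ zero) (f₂ (suc zero))))
      where open +-*-Solver

  emptyRes : ∀ cap v → Full cap v [] [] 0 0
  emptyRes cap v = record { em = [] ; g = λ () ; cost = z≤n ; cov = λ () ; obl = λ _ () ; loc = λ _ _ () } , λ ()

  singleRes : ∀ cap i → Full cap (ca (D i)) (i ∷ []) [] 1 0
  singleRes cap i = record
    { em = [] ; g = λ _ → tok ; cost = ≤-reflexive (single-cost (clen (D i)) cap)
    ; cov = λ { (here refl) → inj₂ (zero , refl) } ; obl = λ _ () ; loc = λ _ _ _ → refl } , λ _ → inj₁ (i , here refl , refl)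
    where
      open +-*-Solver
      single-cost : ∀ a c → (a + 0) + 0 ≡ (a + 0) + c * 0 + 0
      single-cost = solve 2 (λ a c → (a :+ con 0) :+ con 0 := (a :+ con 0) :+ c :* con 0 :+ con 0) refl
      tok : Tok (ca (D i))
      tok = record { cyc = D i ; isOdd = odd i ; base∈ = ca∈ ; trail = here }
        where
          ca∈ : ca (D i) ∈ cverts (D i)
          ca∈ = Walks.start∈ G (cpath (D i))

  push : ∀ {v c e} → Joins G e v c → Tok c → Tok v
  push {e = e} j t = record { cyc = cyc t ; isOdd = isOdd t ; base∈ = Tok.base∈ t ; trail = trail t ⟫ wstep e tt (joins-sym j) here }

  push-cost : ∀ {v c e} (j : Joins G e v c) t → tcost (push j t) ≡ tcost t + 1
  push-cost {e = e} j t = trans (cong (clen (cyc t) +_) (trans (cong length (edges-⟫ (trail t) _)) (length-++ (edges (trail t))))) (sym (+-assoc (clen (cyc t)) _ 1))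

  -- All waiting tokens cross `e`, whence `k ≤ cap`. If `e` is a separator, `need` provides at least
  -- one of them, and this token is the witness that `e` will be covered at a later pairing.
  move : ∀ {cap v c I Es k x e} → Res cap c I Es k x → Joins G e v c → e ∉ Es → k ≤ cap → (∀ {A} → Only A e → 1 ≤ k) → Res cap v I (e ∷ Es) k x
  move {cap} {v} {c} {I} {Es} {k} {x} {e} r j e∉ k≤ need = record
    { em = em r ; g = push j ∘ g r ; cost = cost' ; cov = cov r
    ; obl = λ { {A} o (here refl) → inj₂ (first (need o) , λ q → only-≢ o j (trans (sym q) (loc r o e∉ _)))
              ; {A} o (there h) → case obl r o h of λ { (inj₁ p) → inj₁ p ; (inj₂ (l , q)) → inj₂ (l , λ z → q (trans z (only-same o (λ { refl → e∉ h }) j))) } }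
    ; loc = λ o u∉ l → trans (loc r o (u∉ ∘ there) l) (sym (only-same o (λ q → u∉ (here (sym q))) j)) }
    where
      first : ∀ {k} → 1 ≤ k → Fin k
      first (s≤s _) = zero
      cost' : sum (map size (em r)) + sumF (λ l → tcost (push j (g r l))) ≤ tokenCost I + cap * length (e ∷ Es) + x
      cost' = ≤-trans (≤-reflexive (trans (cong (sum (map size (em r)) +_) (trans (sumF-cong λ l → push-cost j (g r l)) (trans (sumF-+ (λ l → tcost (g r l)) (λ _ → 1)) (cong (sumF (λ l → tcost (g r l)) +_) (sumF-one {k}))))) (sym (+-assoc (sum (map size (em r))) _ k))))
        (≤-trans (+-mono-≤ (cost r) k≤) (≤-reflexive (e₁ (tokenCost I) cap (length Es) x)))
        where
          open +-*-Solver
          e₁ : ∀ a c l x → a + c * l + x + c ≡ a + c * (1 + l) + x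
          e₁ = solve 4 (λ a c l x → a :+ c :* l :+ x :+ c := a :+ c :* (con 1 :+ l) :+ x) refl

  move-orig : ∀ {cap v c I Es k x e} (r : Res cap c I Es k x) (j : Joins G e v c) (e∉ : e ∉ Es) (k≤ : k ≤ cap) (need : ∀ {A} → Only A e → 1 ≤ k) →
    Orig r → Orig (move r j e∉ k≤ need)
  move-orig r j e∉ k≤ need o l = case o l of λ { (inj₁ p) → inj₁ p ; (inj₂ (A , u , on , h , q)) → inj₂ (A , u , on , there h , λ z → q (trans z (only-same on (λ { refl → e∉ h }) j))) }

  -- Beyond a separator every waiting token is recognised by the side it comes from.
  cross-orig : ∀ {cap v c I Es k x e} (r : Res cap c I Es k x) (j : Joins G e v c) (e∉ : e ∉ Es) (k≤ : k ≤ cap) (need : ∀ {A} → Only A e → 1 ≤ k) →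
    ∀ {A} → Only A e → Orig (move r j e∉ k≤ need)
  cross-orig r j e∉ k≤ need {A} on l = inj₂ (A , _ , on , here refl , λ q → only-≢ on j (trans (sym q) (loc r on e∉ l)))

-- Alternatives for the number of waiting tokens, with and without separators below.

module Run (G : SignedGraph) {ε : ℕ} (S : Setup G ε) {n : ℕ} (D : Fin n → Cycles.Cyc G)
  (odd : ∀ i → Walks.par G (neg G) (Cycles.cedges (D i)) ≡ true) (compatible : ∀ {i j} → i ≢ j → Cycles.Compat G (D i) (D j)) where
  open Walks G
  open Cycles G
  open Decompose G using (Free; delete; delete-⊆; delete-≢; delete-in; rev-verts)
  open Setup S
  open Separators G
  open Joining G D odd compatible

  Tree : V → Set
  Tree = RT (In pos)

  tree-walk-verts : ∀ {v} (t : Tree v) {a b} (w : Walk G (_∈ tedges t) a b) → a ∈ tverts t → ∀ {x} → x ∈ verts w → x ∈ tverts t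
  tree-walk-verts t here a∈ (here refl) = a∈
  tree-walk-verts t (wstep e p j w) a∈ (here refl) = a∈
  tree-walk-verts t (wstep e p j w) a∈ (there h) = tree-walk-verts t w (proj₂ (tedge-ends t p j)) h

  par-one : ∀ {w : ES} l {f} → Unique l → f ∈ l → w f ≡ true → (∀ {e} → e ∈ l → w e ≡ true → e ≡ f) → par w l ≡ true
  par-one {w} (x ∷ l) u (here refl) wf only = xor-trueˡ wf (par-false l λ e e∈ → ≢true⇒false λ h → unique-head u (subst (_∈ l) (only (there e∈) h) e∈))
  par-one {w} (x ∷ l) u (there h) wf only = xor-trueʳ (≢true⇒false λ k → unique-head u (subst (_∈ l) (sym (only (here refl) k)) h)) (par-one l (unique-tail u) h wf (only ∘ there))

  record Lollipop {c} (t : Tree c) : Set where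
    field
      tok : Tok c
      tokShort : tcost tok ≤ suc (length (tedges t))
      inTree : ∀ {e} → e ∈ edges (trail tok) → e ∈ tedges t

  -- The fundamental circuit of `f` and the tail to the root share one vertex and lie in the vertex
  -- set of the tree, so together they have at most as many edges as the tree has vertices.
  lollipop-raw : ∀ {c} (t : Tree c) {f} → σ f ≡ true → src f ∈ tverts t → tgt f ∈ tverts t → Lollipop t
  lollipop-raw {c} t {f} σf s∈ t∈ = record { tok = tok ; tokShort = tokShort ; inTree = λ h → edges-P q (subst (_ ∈_) (mapW-edges q _) h) }
    where
      loop : Walk G (_∈ tedges t) (tgt f) (src f)
      loop = toRoot t t∈ ⟫ rev (toRoot t s∈)
      er = erase loop
      p : Walk G (_∈ tedges t) (tgt f) (src f)
      p = Walks.walk (proj₁ er)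
      C : Cyc
      C = record { cpath = weaken (λ _ → tt) p ; cuniq = subst Unique (sym (mapW-verts p _)) (proj₂ er) ; ce = f ; cj = joins-self f
                 ; ce∉ = λ h → neg-pos σf (tedges-P t (edges-P p (subst (f ∈_) (mapW-edges p _) h))) }
      cverts⊆ : ∀ {x} → x ∈ cverts C → x ∈ tverts t
      cverts⊆ h = tree-walk-verts t p t∈ (subst (_ ∈_) (mapW-verts p _) h)
      oddC : par (neg G) (cedges C) ≡ true
      oddC = trans (sym (par-σ C)) (par-one (cedges C) (cedges-unique C) (here refl) σf λ
        { (here q) _ → q ; {e} (there h) k → ⊥-elim (neg-pos k (tedges-P t (edges-P p (subst (e ∈_) (mapW-edges p _) h)))) })
      down = erase (toRoot t t∈)
      tr = trimFront (mem (cverts C)) (Walks.walk (proj₁ down)) (start∈ (Walks.walk (proj₁ down))) (∈-mem (cverts C) (start∈ (cpath C)))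
      a : V
      a = proj₁ tr
      q : Walk G (_∈ tedges t) a c
      q = Walks.walk (proj₁ (proj₂ tr))
      uq : Unique (verts q)
      uq = uniq (proj₁ (proj₂ tr)) (proj₂ down)
      a∈ : mem (cverts C) a ≡ true
      a∈ = proj₁ (proj₂ (proj₂ tr))
      a-only : ∀ {z} → z ∈ verts q → mem (cverts C) z ≡ true → z ≡ a
      a-only = proj₂ (proj₂ (proj₂ tr))
      tok : Tok c
      tok = record { cyc = C ; isOdd = oddC ; base∈ = mem-∈ (cverts C) a∈ ; trail = weaken (λ _ → tt) q }
      pt : ∀ x → bN (mem (cverts C) x) + bN (mem (verts q) x) ≤ bN (mem (tverts t) x) + bN (isV a x)
      pt x = tab (mem (cverts C) x) (mem (verts q) x) (mem (tverts t) x) (isV a x) (λ h → ∈-mem (tverts t) (cverts⊆ (mem-∈ (cverts C) h)))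
          (λ h → ∈-mem (tverts t) (tree-walk-verts t q (cverts⊆ (mem-∈ (cverts C) a∈)) (mem-∈ (verts q) h)))
          (λ h k → subst (λ z → isV a z ≡ true) (sym (a-only (mem-∈ (verts q) k) h)) (isV-refl a))
        where
          tab : ∀ m k l i → (m ≡ true → l ≡ true) → (k ≡ true → l ≡ true) → (m ≡ true → k ≡ true → i ≡ true) → bN m + bN k ≤ bN l + bN i
          tab true true l i h₁ h₂ h₃ rewrite h₁ refl | h₃ refl refl = ≤-refl
          tab true false l i h₁ h₂ h₃ rewrite h₁ refl = s≤s z≤n
          tab false true l i h₁ h₂ h₃ rewrite h₂ refl = s≤s z≤n
          tab false false l i h₁ h₂ h₃ = z≤n
      counts : count (mem (cverts C)) + count (mem (verts q)) ≤ count (mem (tverts t)) + 1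
      counts = subst₂ _≤_ (trans (sumF-+ (bN ∘ mem (cverts C)) (bN ∘ mem (verts q))) (sym (cong₂ _+_ (count-sumF (mem (cverts C))) (count-sumF (mem (verts q))))))
        (trans (sumF-+ (bN ∘ mem (tverts t)) (bN ∘ isV a)) (cong₂ _+_ (sym (count-sumF (mem (tverts t)))) (trans (sym (count-sumF (isV a))) (count-isV a)))) (sumF-mono pt)
      tokShort : tcost tok ≤ suc (length (tedges t))
      tokShort = ℕₚ.+-cancelʳ-≤ 1 _ _ (≤-trans (≤-reflexive eq) (≤-trans counts (ℕₚ.+-monoˡ-≤ 1 (≤-trans (count-mem (tverts t)) (≤-reflexive (length-tverts t))))))
        where
          eq : tcost tok + 1 ≡ count (mem (cverts C)) + count (mem (verts q))
          eq = trans (+-assoc (clen C) _ 1) (cong₂ _+_ (trans (sym (clen-verts C)) (sym (count-mem-unique (cverts C) (cuniq C))))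
            (trans (+-comm _ 1) (trans (cong suc (cong length (mapW-edges q _))) (trans (sym (length-verts q)) (sym (count-mem-unique (verts q) uq))))))

  abstract
    lollipop : ∀ {c} (t : Tree c) {f} → σ f ≡ true → src f ∈ tverts t → tgt f ∈ tverts t → Lollipop t
    lollipop = lollipop-raw

  oddLen : {X : Set} → List X → Bool
  oddLen [] = false
  oddLen (x ∷ l) = not (oddLen l)

  oddLen-++ : ∀ {X : Set} (k l : List X) → oddLen (k ++ l) ≡ oddLen k xor oddLen l
  oddLen-++ [] l = refl
  oddLen-++ (x ∷ k) l = trans (cong not (oddLen-++ k l)) (lem (oddLen k) (oddLen l))
    where
      lem : ∀ a b → not (a xor b) ≡ not a xor b
      lem true true = refl
      lem true false = refl
      lem false true = refl
      lem false false = refl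

  NoSep : List E → Set
  NoSep Es = ∀ {A u} → Only A u → u ∈ Es → ⊥

  raise : ∀ {c c' v I Es k x} → c ≤ c' → Full c v I Es k x → Full c' v I Es k x
  raise {I = I} {Es} {x = x} h (r , o) = record { em = em r ; g = g r ; cov = cov r ; obl = obl r ; loc = loc r
    ; cost = ≤-trans (cost r) (ℕₚ.+-monoˡ-≤ x (ℕₚ.+-monoʳ-≤ (tokenCost I) (ℕₚ.*-monoˡ-≤ (length Es) h))) } , o

  -- An even number of tokens may be paired off with one crossing per edge, or leave two waiting
  -- with two crossings. The case `none` is apart, because without tokens none can be left waiting.
  data Plain (v : V) (I : List (Fin n)) (Es : List E) : Set where
    none : I ≡ [] → Full 0 v I Es 0 0 → Plain v I Es
    oddP : oddLen I ≡ true → Full 1 v I Es 1 0 → Plain v I Es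
    evenP : oddLen I ≡ false → Full 1 v I Es 0 0 → Full 2 v I Es 2 0 → Plain v I Es

  -- Both one and two waiting tokens are possible, with extra costs a and b.
  record Flex (v : V) (I : List (Fin n)) (Es : List E) (m : ℕ) : Set where
    field
      a b : ℕ
      one : Full 2 v I Es 1 a
      two : Full 2 v I Es 2 b
      extra : a + b + 1 ≤ 2 * m
  open Flex public

  1≤2 : 1 ≤ 2
  1≤2 = s≤s z≤n

  module MergeTrees {v : V} {I₁ I₂ : List (Fin n)} {Es₁ Es₂ : List E} (dI : Disjoint I₁ I₂) (dE : Disjoint Es₁ Es₂) where
    module M {cap : ℕ} = Merge {cap} {v} {I₁} {I₂} {Es₁} {Es₂} dI dE

    par++ : ∀ {p q} → oddLen I₁ ≡ p → oddLen I₂ ≡ q → oddLen (I₁ ++ I₂) ≡ p xor q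
    par++ h k = trans (oddLen-++ I₁ I₂) (cong₂ _xor_ h k)

    nil++ : ∀ {q} → I₁ ≡ [] → oddLen I₂ ≡ q → oddLen (I₁ ++ I₂) ≡ q
    nil++ h k = trans (oddLen-++ I₁ I₂) (trans (cong (λ l → oddLen l xor oddLen I₂) h) k)

    ++nil : ∀ {q} → oddLen I₁ ≡ q → I₂ ≡ [] → oddLen (I₁ ++ I₂) ≡ q
    ++nil k h = trans (oddLen-++ I₁ I₂) (trans (cong (λ l → oddLen I₁ xor oddLen l) h) (trans (xor-identityʳ _) k))

    plain-plain : Plain v I₁ Es₁ → Plain v I₂ Es₂ → Plain v (I₁ ++ I₂) (Es₁ ++ Es₂)
    plain-plain (none p r) (none q s) = none (cong₂ _++_ p q) (M.merge-0k r s)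
    plain-plain (none p r) (oddP q s) = oddP (nil++ p q) (M.merge-0k (raise z≤n r) s)
    plain-plain (none p r) (evenP q s s') = evenP (nil++ p q) (M.merge-0k (raise z≤n r) s) (M.merge-0k (raise z≤n r) s')
    plain-plain (oddP p r) (none q s) = oddP (++nil p q) (M.merge-k0 r (raise z≤n s))
    plain-plain (oddP p r) (oddP q s) = evenP (par++ p q) (M.merge-11-0 r s) (M.merge-11-2 (raise 1≤2 r) (raise 1≤2 s))
    plain-plain (oddP p r) (evenP q s s') = oddP (par++ p q) (M.merge-k0 r s)
    plain-plain (evenP p r r') (none q s) = evenP (++nil p q) (M.merge-k0 r (raise z≤n s)) (M.merge-k0 r' (raise z≤n s))
    plain-plain (evenP p r r') (oddP q s) = oddP (par++ p q) (M.merge-0k r s)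
    plain-plain (evenP p r r') (evenP q s s') = evenP (par++ p q) (M.merge-0k r s) (M.merge-22 r' s')

    -- An odd plain part turns one waiting token into two and two into one, so it only exchanges the
    -- two alternatives; in the other cases they are kept. The sum of the extras does not change.
    plain-flex : ∀ {m₁ m₂} → Plain v I₁ Es₁ → Flex v I₂ Es₂ m₂ → Flex v (I₁ ++ I₂) (Es₁ ++ Es₂) (m₁ + m₂)
    plain-flex {m₁} {m₂} P F = from P
      where
        up : ∀ {x} → x ≤ 2 * m₂ → x ≤ 2 * (m₁ + m₂)
        up h = ≤-trans h (ℕₚ.*-monoʳ-≤ 2 (m≤n+m m₂ m₁))
        swap : b F + a F + 1 ≤ 2 * m₂
        swap = ≤-trans (≤-reflexive (cong (_+ 1) (+-comm (b F) (a F)))) (extra F)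
        from : Plain v I₁ Es₁ → Flex v (I₁ ++ I₂) (Es₁ ++ Es₂) (m₁ + m₂)
        from (none _ r) = record { a = a F ; b = b F ; one = M.merge-0k (raise z≤n r) (one F) ; two = M.merge-0k (raise z≤n r) (two F) ; extra = up (extra F) }
        from (oddP _ r) = record { a = b F ; b = a F ; one = M.merge-12 (raise 1≤2 r) (two F) ; two = M.merge-11-2 (raise 1≤2 r) (one F) ; extra = up swap }
        from (evenP _ _ r) = record { a = a F ; b = b F ; one = M.merge-21 r (one F) ; two = M.merge-22 r (two F) ; extra = up (extra F) }

    flex-plain : ∀ {m₁ m₂} → Flex v I₁ Es₁ m₁ → Plain v I₂ Es₂ → Flex v (I₁ ++ I₂) (Es₁ ++ Es₂) (m₁ + m₂)
    flex-plain {m₁} {m₂} F P = from P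
      where
        up : ∀ {x y} → x ≤ 2 * m₁ → y ≡ x → y ≤ 2 * (m₁ + m₂)
        up h refl = ≤-trans h (ℕₚ.*-monoʳ-≤ 2 (m≤m+n m₁ m₂))
        z : ∀ a b → (a + 0) + (b + 0) + 1 ≡ a + b + 1
        z = solve 2 (λ a b → (a :+ con 0) :+ (b :+ con 0) :+ con 1 := a :+ b :+ con 1) refl
          where open +-*-Solver
        z' : ∀ a b → (b + 0) + (a + 0) + 1 ≡ a + b + 1
        z' = solve 2 (λ a b → (b :+ con 0) :+ (a :+ con 0) :+ con 1 := a :+ b :+ con 1) refl
          where open +-*-Solver
        from : Plain v I₂ Es₂ → Flex v (I₁ ++ I₂) (Es₁ ++ Es₂) (m₁ + m₂)
        from (none _ r) = record { a = a F + 0 ; b = b F + 0 ; one = M.merge-k0 (one F) (raise z≤n r) ; two = M.merge-k0 (two F) (raise z≤n r) ; extra = up (extra F) (z (a F) (b F)) }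
        from (oddP _ r) = record { a = b F + 0 ; b = a F + 0 ; one = M.merge-21 (two F) (raise 1≤2 r) ; two = M.merge-11-2 (one F) (raise 1≤2 r) ; extra = up (extra F) (z' (a F) (b F)) }
        from (evenP _ _ r) = record { a = a F + 0 ; b = b F + 0 ; one = M.merge-12 (one F) r ; two = M.merge-22 (two F) r ; extra = up (extra F) (z (a F) (b F)) }

    -- The first side fixes its cheaper alternative and combines it with both alternatives of the
    -- second side. The extra of that choice is paid twice, and twice the smaller of two numbers is
    -- at most their sum.
    flex-flex : ∀ {m₁ m₂} → Flex v I₁ Es₁ m₁ → Flex v I₂ Es₂ m₂ → Flex v (I₁ ++ I₂) (Es₁ ++ Es₂) (m₁ + m₂)
    flex-flex {m₁} {m₂} F F' with a F ≤? b F
    ... | yes p = record { a = a F + b F' ; b = a F + a F' ; one = M.merge-12 (one F) (two F') ; two = M.merge-11-2 (one F) (one F')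
        ; extra = ≤-trans (≤-reflexive (e (a F) (a F') (b F'))) (fin p) }
      where
        open +-*-Solver
        e : ∀ a a' b' → a + b' + (a + a') + 1 ≡ a + a + (a' + b' + 1)
        e = solve 3 (λ a a' b' → a :+ b' :+ (a :+ a') :+ con 1 := a :+ a :+ (a' :+ b' :+ con 1)) refl
        fin : a F ≤ b F → a F + a F + (a F' + b F' + 1) ≤ 2 * (m₁ + m₂)
        fin p = ≤-trans (+-mono-≤ (≤-trans (ℕₚ.+-monoʳ-≤ (a F) p) (≤-trans (m≤m+n _ 1) (extra F))) (extra F')) (≤-reflexive (sym (ℕₚ.*-distribˡ-+ 2 m₁ m₂)))
    ... | no p = record { a = b F + a F' ; b = b F + b F' ; one = M.merge-21 (two F) (one F') ; two = M.merge-22 (two F) (two F')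
        ; extra = ≤-trans (≤-reflexive (e (b F) (a F') (b F'))) (fin (ℕₚ.<⇒≤ (ℕₚ.≰⇒> p))) }
      where
        open +-*-Solver
        e : ∀ b a' b' → b + a' + (b + b') + 1 ≡ b + b + (a' + b' + 1)
        e = solve 3 (λ b a' b' → b :+ a' :+ (b :+ b') :+ con 1 := b :+ b :+ (a' :+ b' :+ con 1)) refl
        fin : b F ≤ a F → b F + b F + (a F' + b F' + 1) ≤ 2 * (m₁ + m₂)
        fin p = ≤-trans (+-mono-≤ (≤-trans (ℕₚ.+-monoˡ-≤ (b F) p) (≤-trans (m≤m+n _ 1) (extra F))) (extra F')) (≤-reflexive (sym (ℕₚ.*-distribˡ-+ 2 m₁ m₂)))

  -- The new token costs at most one crossing of each edge and one unit more, so `cap` and `x` both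
  -- grow by one.
  addToken : ∀ {cap c I Es k x} → Res cap c I Es k x → (ℓ : Tok c) → tcost ℓ ≤ suc (length Es) → NoSep Es → (∀ {A u} → Only A u → u ∉ Es → A (start ℓ) ≡ A c) →
    Res (suc cap) c I Es (suc k) (x + 1)
  addToken {cap} {c} {I} {Es} {k} {x} r ℓ sh ns at = record
    { em = em r ; g = g' ; cov = λ h → case cov r h of λ { (inj₁ p) → inj₁ p ; (inj₂ (j , q)) → inj₂ (suc j , q) }
    ; obl = λ o h → ⊥-elim (ns o h) ; loc = λ { o h zero → at o h ; o h (suc j) → loc r o h j }
    ; cost = ≤-trans (≤-reflexive (e₁ (sum (map size (em r))) (tcost ℓ) (sumF (λ j → tcost (g r j))))) (≤-trans (+-mono-≤ (cost r) sh) (≤-reflexive (e₂ (tokenCost I) cap (length Es) x))) }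
    where
      open +-*-Solver
      g' : Fin (suc k) → Tok c
      g' zero = ℓ
      g' (suc j) = g r j
      e₁ : ∀ s l t → s + (l + t) ≡ s + t + l
      e₁ = solve 3 (λ s l t → s :+ (l :+ t) := s :+ t :+ l) refl
      e₂ : ∀ i c l x → i + c * l + x + suc l ≡ i + suc c * l + (x + 1)
      e₂ = solve 4 (λ i c l x → i :+ c :* l :+ x :+ (con 1 :+ l) := i :+ (con 1 :+ c) :* l :+ (x :+ con 1)) refl

  movePlain : ∀ {v c I Es e} → Plain c I Es → Joins G e v c → e ∉ Es → (∀ {A} → Only A e → ⊥) → Plain v I (e ∷ Es)
  movePlain (none p (r , o)) j e∉ ns = none p (move r j e∉ z≤n (⊥-elim ∘ ns) , move-orig r j e∉ z≤n (⊥-elim ∘ ns) o)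
  movePlain (oddP p (r , o)) j e∉ ns = oddP p (move r j e∉ ≤-refl (⊥-elim ∘ ns) , move-orig r j e∉ ≤-refl (⊥-elim ∘ ns) o)
  movePlain (evenP p (r , o) (r' , o')) j e∉ ns = evenP p (move r j e∉ z≤n (⊥-elim ∘ ns) , move-orig r j e∉ z≤n (⊥-elim ∘ ns) o)
    (move r' j e∉ ≤-refl (⊥-elim ∘ ns) , move-orig r' j e∉ ≤-refl (⊥-elim ∘ ns) o')

  moveFlex : ∀ {v c I Es e m} → Flex c I Es m → Joins G e v c → e ∉ Es → Flex v I (e ∷ Es) m
  moveFlex F j e∉ = record { a = a F ; b = b F ; extra = extra F
    ; one = move (proj₁ (one F)) j e∉ 1≤2 (λ _ → ≤-refl) , move-orig (proj₁ (one F)) j e∉ 1≤2 (λ _ → ≤-refl) (proj₂ (one F))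
    ; two = move (proj₁ (two F)) j e∉ ≤-refl (λ _ → 1≤2) , move-orig (proj₁ (two F)) j e∉ ≤-refl (λ _ → 1≤2) (proj₂ (two F)) }

  -- The alternatives of `Flex` without `Orig`: an added token may share edges with given ones, and
  -- only the crossing of a separator, in `crossLoose`, makes it safe to pair.
  record Loose (v : V) (I : List (Fin n)) (Es : List E) (m : ℕ) : Set where
    field
      la lb : ℕ
      lone : Res 2 v I Es 1 la
      ltwo : Res 2 v I Es 2 lb
      lextra : la + lb + 1 ≤ 2 * m
  open Loose public

  forget : ∀ {v I Es m} → Flex v I Es m → Loose v I Es m
  forget F = record { la = a F ; lb = b F ; lone = proj₁ (one F) ; ltwo = proj₁ (two F) ; lextra = extra F }

  -- The missing alternative is obtained by adding `ℓ`, for one unit of extra. Without any token it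
  -- is added once or twice, with extras 1 and 2, which takes two negative edges. Two copies of `ℓ`
  -- do no harm, since tokens of the same result are never paired.
  loosen : ∀ {c I Es m} → Plain c I Es → NoSep Es → (ℓ : Tok c) → tcost ℓ ≤ suc (length Es) →
    (∀ {A u} → Only A u → u ∉ Es → A (start ℓ) ≡ A c) → 1 ≤ m → (I ≡ [] → 2 ≤ m) → Loose c I Es m
  loosen {c} {I} {Es} {m} P ns ℓ sh at m≥1 m≥2 = from P
    where
      add : ∀ {cap k x} → Res cap c I Es k x → Res (suc cap) c I Es (suc k) (x + 1)
      add r = addToken r ℓ sh ns at
      widen : ∀ {k x} → Res 1 c I Es k x → Res 2 c I Es k x
      widen {k} {x} r = record { em = em r ; g = g r ; cov = cov r ; obl = obl r ; loc = loc r
        ; cost = ≤-trans (cost r) (ℕₚ.+-monoˡ-≤ x (ℕₚ.+-monoʳ-≤ (tokenCost I) (ℕₚ.*-monoˡ-≤ (length Es) 1≤2))) }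
      from : Plain c I Es → Loose c I Es m
      from (none p (r , _)) = record { la = 1 ; lb = 2 ; lone = widen (add r) ; ltwo = add (add r) ; lextra = ℕₚ.*-monoʳ-≤ 2 (m≥2 p) }
      from (oddP p (r , _)) = record { la = 0 ; lb = 1 ; lone = widen r ; ltwo = add r ; lextra = ℕₚ.*-monoʳ-≤ 2 m≥1 }
      from (evenP p (r , _) (r' , _)) = record { la = 1 ; lb = 0 ; lone = add r ; ltwo = r' ; lextra = ℕₚ.*-monoʳ-≤ 2 m≥1 }

  crossLoose : ∀ {v c I Es e m A} → Loose c I Es m → Joins G e v c → e ∉ Es → Only A e → Flex v I (e ∷ Es) m
  crossLoose F j e∉ on = record { a = la F ; b = lb F ; extra = lextra F
    ; one = move (lone F) j e∉ 1≤2 (λ _ → ≤-refl) , cross-orig (lone F) j e∉ 1≤2 (λ _ → ≤-refl) on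
    ; two = move (ltwo F) j e∉ ≤-refl (λ _ → 1≤2) , cross-orig (ltwo F) j e∉ ≤-refl (λ _ → 1≤2) on }

  tokensAt : V → List (Fin n)
  tokensAt v = filter (λ i → ca (D i) ≟ v) (allFin n)

  at-here : ∀ {v i} → i ∈ tokensAt v → ca (D i) ≡ v
  at-here {v} h = proj₂ (∈-filter⁻ (λ i → ca (D i) ≟ v) {xs = allFin n} h)

  here-at : ∀ i → i ∈ tokensAt (ca (D i))
  here-at i = ∈-filter⁺ (λ i' → ca (D i') ≟ ca (D i)) (∈-allFin i) refl

  toks : ∀ {v} → Tree v → List (Fin n)
  toks (leaf v) = tokensAt v
  toks (graft t e p j t') = toks t ++ toks t'

  -- The edges of `tedges`, in the order in which merging concatenates them.
  Es : ∀ {v} → Tree v → List E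
  Es (leaf v) = []
  Es (graft t e p j t') = Es t ++ (e ∷ Es t')

  Es⇒ : ∀ {v} (t : Tree v) {e} → e ∈ Es t → e ∈ tedges t
  Es⇒ (graft t e p j t') h with ∈-++⁻ (Es t) h
  ... | inj₁ q = there (∈-++⁺ˡ (Es⇒ t q))
  ... | inj₂ (here q) = here q
  ... | inj₂ (there q) = there (∈-++⁺ʳ (tedges t) (Es⇒ t' q))

  ⇒Es : ∀ {v} (t : Tree v) {e} → e ∈ tedges t → e ∈ Es t
  ⇒Es (graft t e p j t') (here q) = ∈-++⁺ʳ (Es t) (here q)
  ⇒Es (graft t e p j t') (there h) with ∈-++⁻ (tedges t) h
  ... | inj₁ q = ∈-++⁺ˡ (⇒Es t q)
  ... | inj₂ q = ∈-++⁺ʳ (Es t) (there (⇒Es t' q))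

  Es-length : ∀ {v} (t : Tree v) → length (Es t) ≡ length (tedges t)
  Es-length (leaf v) = refl
  Es-length (graft t e p j t') = trans (length-++ (Es t)) (trans (cong₂ _+_ (Es-length t) (cong suc (Es-length t'))) (trans (+-suc _ _) (cong suc (sym (length-++ (tedges t))))))

  toks-at : ∀ {v} (t : Tree v) {i} → i ∈ toks t → ca (D i) ∈ tverts t
  toks-at (leaf v) h = here (at-here h)
  toks-at (graft t e p j t') h with ∈-++⁻ (toks t) h
  ... | inj₁ q = ∈-++⁺ˡ (toks-at t q)
  ... | inj₂ q = ∈-++⁺ʳ (tverts t) (toks-at t' q)

  at-toks : ∀ {v} (t : Tree v) {i} → ca (D i) ∈ tverts t → i ∈ toks t
  at-toks (leaf v) {i} (here refl) = here-at i
  at-toks (graft t e p j t') h with ∈-++⁻ (tverts t) h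
  ... | inj₁ q = ∈-++⁺ˡ (at-toks t q)
  ... | inj₂ q = ∈-++⁺ʳ (toks t) (at-toks t' q)

  negs : ∀ {v} → Tree v → ℕ
  negs t = count (λ f → σ f ∧ mem (tverts t) (src f))

  negs-graft : ∀ {v} {c} (t : Tree v) e p (j : Joins G e v c) t' → Unique (tverts (graft t e p j t')) → negs t + negs t' ≤ negs (graft t e p j t')
  negs-graft t e p j t' u = ≤-trans (≤-reflexive (sym (count-∨-disjoint (λ f → σ f ∧ mem (tverts t) (src f)) (λ f → σ f ∧ mem (tverts t') (src f))
      λ f h → ∧-falseʳ {σ f} (∉-mem (tverts t') (unique-++-disjoint (tverts t) u (mem-∈ (tverts t) (∧-right {σ f} h)))))))
    (count-mono λ f h → case ∨-split {σ f ∧ mem (tverts t) (src f)} h of λ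
      { (inj₁ q) → ∧-intro (∧-left q) (∈-mem (tverts t ++ tverts t') (∈-++⁺ˡ (mem-∈ (tverts t) (∧-right {σ f} q))))
      ; (inj₂ q) → ∧-intro (∧-left q) (∈-mem (tverts t ++ tverts t') (∈-++⁺ʳ (tverts t) (mem-∈ (tverts t') (∧-right {σ f} q)))) })

  atLeaf : ∀ {v} l → Unique l → (∀ {i} → i ∈ l → ca (D i) ≡ v) → Plain v l []
  atLeaf [] u h = none refl (emptyRes 0 _)
  atLeaf {v} (i ∷ l) u h with h (here refl)
  ... | refl = MergeTrees.plain-plain {v} {i ∷ []} {l} {[]} {[]} (λ { (here refl) q → unique-head u q }) (λ ()) (oddP refl (singleRes 1 i)) (atLeaf l (unique-tail u) (h ∘ there))

-- The recursion over a spanning tree whose component has separators, and its end.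

module RunTree (G : SignedGraph) {ε : ℕ} (S : Setup G ε) {n : ℕ} (D : Fin n → Cycles.Cyc G)
  (odd : ∀ i → Walks.par G (neg G) (Cycles.cedges (D i)) ≡ true) (compatible : ∀ {i j} → i ≢ j → Cycles.Compat G (D i) (D j))
  (W : Fin (nV G) → Bool) where
  open Walks G
  open Cycles G
  open Setup S
  open Separators G
  open Joining G D odd compatible
  open Run G S D odd compatible

  SideNeg : VS → V → E → Set
  SideNeg A c f = σ f ≡ true × (W (src f) ≡ true × W (tgt f) ≡ true) × (A (src f) ≡ A c × A (tgt f) ≡ A c)

  -- What `loosen` consumes beyond a separator: a negative edge for the added token, and a second
  -- negative edge unless some token lies on that side.
  Supply : Set
  Supply = ∀ {A u v c} → Only A u → Joins G u v c → W v ≡ true → W c ≡ true →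
    Σ E λ f → SideNeg A c f × ((Σ (Fin n) λ i → W (ca (D i)) ≡ true × A (ca (D i)) ≡ A c) ⊎ Σ E λ f' → f' ≢ f × SideNeg A c f')

  -- It identifies the far side of a separator, within `W`, with the vertices of the subtree grafted
  -- by it. The negative edges supplied for that side then have both ends in the subtree.
  Ctx : ∀ {v} → Tree v → Set
  Ctx {v} t = ∀ {x} → W x ≡ true → x ∉ tverts t → ∀ {A u} → Only A u → u ∈ tedges t → A x ≡ A v

  Outcome : ∀ {v} → Tree v → Set
  Outcome {v} t = (NoSep (Es t) × Plain v (toks t) (Es t)) ⊎ Flex v (toks t) (Es t) (negs t)

  inTree-same : ∀ {v} (t : Tree v) {x A u} → x ∈ tverts t → Only A u → u ∉ tedges t → A x ≡ A v
  inTree-same t x∈ o u∉ = only-walk o (toRoot t x∈) (u∉ ∘ edges-P (toRoot t x∈))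

  module _ (supply : Supply) where

    sideLoose : ∀ {v c A e} (t : Tree c) → Only A e → Joins G e v c → W v ≡ true → W c ≡ true → (∀ {x} → W x ≡ true → A x ≡ A c → x ∈ tverts t) →
      Outcome t → Loose c (toks t) (Es t) (negs t)
    sideLoose t o j v∈ c∈ side (inj₂ F) = forget F
    sideLoose {v} {c} {A} {e} t o j v∈ c∈ side (inj₁ (ns , P)) = from (supply o j v∈ c∈)
      where
        from : (Σ E λ f → SideNeg A c f × ((Σ (Fin n) λ i → W (ca (D i)) ≡ true × A (ca (D i)) ≡ A c) ⊎ Σ E λ f' → f' ≢ f × SideNeg A c f')) → Loose c (toks t) (Es t) (negs t)
        from (f , (σf , (s∈ , t∈) , (s≡ , t≡)) , more) = loosen P ns (Lollipop.tok ℓ) (≤-trans (Lollipop.tokShort ℓ) (s≤s (≤-reflexive (sym (Es-length t)))))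
            (λ o' u∉ → only-walk o' (trail (Lollipop.tok ℓ)) λ h → u∉ (⇒Es t (Lollipop.inTree ℓ h))) (count-pos counted f∈) (two≤ more)
          where
            ℓ : Lollipop t
            ℓ = lollipop t σf (side s∈ s≡) (side t∈ t≡)
            counted : ES
            counted f = σ f ∧ mem (tverts t) (src f)
            f∈ : counted f ≡ true
            f∈ = ∧-intro σf (∈-mem (tverts t) (side s∈ s≡))
            two≤ : ((Σ (Fin n) λ i → W (ca (D i)) ≡ true × A (ca (D i)) ≡ A c) ⊎ Σ E λ f' → f' ≢ f × SideNeg A c f') → toks t ≡ [] → 2 ≤ negs t
            two≤ (inj₁ (i , w , q)) nil with subst (i ∈_) nil (at-toks t (side w q))
            ... | ()
            two≤ (inj₂ (f' , ne , (σf' , (s∈' , _) , (s≡' , _)))) nil = count-two counted ne (∧-intro σf' (∈-mem (tverts t) (side s∈' s≡'))) f∈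

    -- A grafted subtree crosses its edge as `Flex` if this edge is a separator or the subtree
    -- contains one, and as `Plain` otherwise.
    run : ∀ {v} (t : Tree v) → Unique (tverts t) → (∀ {x} → x ∈ tverts t → W x ≡ true) → Ctx t → Outcome t
    run (leaf v) u inW ctx = inj₁ ((λ _ ()) , atLeaf (tokensAt v) (Uniqueₚ.filter⁺ (λ i → ca (D i) ≟ v) (Uniqueₚ.allFin⁺ n)) at-here)
    run {v} (graft {c = c} t e p j t') u inW ctx = decide (separator? e)
      where
        u₁ : Unique (tverts t)
        u₁ = unique-++ˡ (tverts t) u
        u₂ : Unique (tverts t')
        u₂ = unique-++ʳ (tverts t) u
        dV : ∀ {x} → x ∈ tverts t → x ∈ tverts t' → ⊥
        dV = unique-++-disjoint (tverts t) u
        ut : Unique (e ∷ tedges t ++ tedges t')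
        ut = unique-tedges (graft t e p j t') u
        e∉t : e ∉ tedges t
        e∉t h = unique-head ut (∈-++⁺ˡ h)
        e∉t' : e ∉ tedges t'
        e∉t' h = unique-head ut (∈-++⁺ʳ (tedges t) h)
        dT : ∀ {x} → x ∈ tedges t → x ∈ tedges t' → ⊥
        dT = unique-++-disjoint (tedges t) (unique-tail ut)
        v∈ : W v ≡ true
        v∈ = inW (∈-++⁺ˡ (root∈ t))
        c∈ : W c ≡ true
        c∈ = inW (∈-++⁺ʳ (tverts t) (root∈ t'))
        outside : ∀ {x} → x ∉ tverts t → x ∉ tverts t' → x ∉ tverts t ++ tverts t'
        outside a b h = case ∈-++⁻ (tverts t) h of λ { (inj₁ q) → a q ; (inj₂ q) → b q }
        ctx₁ : Ctx t
        ctx₁ {x} w x∉ {A} {u'} o h with x ∈?ₗ tverts t'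
        ... | inj₁ q = trans (inTree-same t' q o (dT h)) (sym (only-same o (λ { refl → e∉t h }) j))
        ... | inj₂ q = ctx w (outside x∉ q) o (there (∈-++⁺ˡ h))
        ctx₂ : Ctx t'
        ctx₂ {x} w x∉ {A} {u'} o h with x ∈?ₗ tverts t
        ... | inj₁ q = trans (inTree-same t q o (λ k → dT k h)) (only-same o (λ { refl → e∉t' h }) j)
        ... | inj₂ q = trans (ctx w (outside q x∉) o (there (∈-++⁺ʳ (tedges t) h))) (only-same o (λ { refl → e∉t' h }) j)
        side : ∀ {A x} → Only A e → W x ≡ true → A x ≡ A c → x ∈ tverts t'
        side {A} {x} o w q with x ∈?ₗ tverts t'
        ... | inj₁ h = h
        ... | inj₂ h with x ∈?ₗ tverts t
        ...   | inj₁ k = ⊥-elim (only-≢ o j (trans (sym (inTree-same t k o e∉t)) q))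
        ...   | inj₂ k = ⊥-elim (only-≢ o j (trans (sym (ctx w (outside k h) o (here refl))) q))
        left : Outcome t
        left = run t u₁ (inW ∘ ∈-++⁺ˡ) ctx₁
        right : Outcome t'
        right = run t' u₂ (inW ∘ ∈-++⁺ʳ (tverts t)) ctx₂
        e∉Es : e ∉ Es t'
        e∉Es h = e∉t' (Es⇒ t' h)
        dI : Disjoint (toks t) (toks t')
        dI h k = dV (toks-at t h) (toks-at t' k)
        dE : Disjoint (Es t) (e ∷ Es t')
        dE h (here refl) = e∉t (Es⇒ t h)
        dE h (there k) = dT (Es⇒ t h) (Es⇒ t' k)
        module MT = MergeTrees {v} {toks t} {toks t'} {Es t} {e ∷ Es t'} dI dE
        enlarge : ∀ {I L m m'} → m ≤ m' → Flex v I L m → Flex v I L m'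
        enlarge h F = record { a = Flex.a F ; b = Flex.b F ; one = Flex.one F ; two = Flex.two F ; extra = ≤-trans (Flex.extra F) (ℕₚ.*-monoʳ-≤ 2 h) }
        more : negs t + negs t' ≤ negs (graft t e p j t')
        more = negs-graft t e p j t' u
        withRight : Flex v (toks t') (e ∷ Es t') (negs t') → Outcome (graft t e p j t')
        withRight F = inj₂ (enlarge more (case left of λ { (inj₁ (_ , P)) → MT.plain-flex P F ; (inj₂ F') → MT.flex-flex F' F }))
        noSep : NoSep (Es t) → (∀ {A} → Only A e → ⊥) → NoSep (Es t') → NoSep (Es t ++ (e ∷ Es t'))
        noSep a b c o h = case ∈-++⁻ (Es t) h of λ { (inj₁ q) → a o q ; (inj₂ (here refl)) → b o ; (inj₂ (there q)) → c o q }
        decide : (Σ VS λ A → Only A e) ⊎ (∀ {A} → Only A e → ⊥) → Outcome (graft t e p j t')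
        decide (inj₁ (A , o)) = withRight (crossLoose (sideLoose t' o j v∈ c∈ (side o) right) j e∉Es o)
        decide (inj₂ ns) = case right of λ
          { (inj₂ F) → withRight (moveFlex F j e∉Es)
          ; (inj₁ (ns' , P)) → case left of λ
              { (inj₁ (ns'' , P')) → inj₁ ((λ {_} {_} → noSep ns'' ns ns') , MT.plain-plain P' (movePlain P j e∉Es ns))
              ; (inj₂ F) → inj₂ (enlarge more (MT.flex-plain F (movePlain P j e∉Es ns))) } }

  record Closed (I : List (Fin n)) (L : List E) (cap x : ℕ) : Set where
    field
      em : List (SignedCircuit G)
      cost : sum (map size em) ≤ tokenCost I + cap * length L + x
      cov : ∀ {i} → i ∈ I → ∀ e → e ∈ cedges (D i) → Covers em e
      sep : ∀ {A u} → Only A u → u ∈ L → Covers em u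

  closed : ∀ {cap v I L x} → Res cap v I L 0 x → Closed I L cap x
  closed {x = x} r = record { em = Joining.em r ; cost = ≤-trans (m≤m+n _ _) (Joining.cost r)
    ; cov = λ h → case Joining.cov r h of λ { (inj₁ p) → p ; (inj₂ (() , _)) }
    ; sep = λ o h → case Joining.obl r o h of λ { (inj₁ p) → p ; (inj₂ (() , _)) } }

  closePlain : ∀ {v I L} → Plain v I L → oddLen I ≡ false → Closed I L 1 0
  closePlain (none _ r) h = closed (proj₁ (raise z≤n r))
  closePlain (oddP p r) h = absurd p h
  closePlain (evenP _ r _) h = closed (proj₁ r)

  -- Opposite sides of a separator exchange one token each or two tokens each, whichever is cheaper.
  closeSides : ∀ {v c A e I₁ I₂ L₁ L₂ m₁ m₂} → Loose c I₁ L₁ m₁ → Loose v I₂ L₂ m₂ → Joins G e v c → Only A e → e ∉ L₁ → e ∉ L₂ → Disjoint (e ∷ L₁) L₂ →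
    Σ ℕ λ x → Closed (I₁ ++ I₂) ((e ∷ L₁) ++ L₂) 2 x × suc x ≤ m₁ + m₂ × 2 ≤ m₁ + m₂
  closeSides {v} {c} {A} {e} {I₁} {I₂} {L₁} {L₂} {m₁} {m₂} F F' j o e∉ e∉' dE = pick (la F + la F' ≤? lb F + lb F')
    where
      open +-*-Solver
      r₁ : Res 2 v I₁ (e ∷ L₁) 1 (la F)
      r₁ = move (lone F) j e∉ 1≤2 (λ _ → ≤-refl)
      s₁ : Res 2 v I₁ (e ∷ L₁) 2 (lb F)
      s₁ = move (ltwo F) j e∉ ≤-refl (λ _ → 1≤2)
      r₂ : Res 2 v I₂ L₂ 1 (la F')
      r₂ = lone F'
      s₂ : Res 2 v I₂ L₂ 2 (lb F')
      s₂ = ltwo F'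
      apart : ∀ {k x y} (r : Res 2 c I₁ L₁ k x) (s : Res 2 v I₂ L₂ k y) j₁ j₂ → A (start (g r j₁)) ≢ A (start (g s j₂))
      apart r s j₁ j₂ q = only-≢ o j (trans (sym (loc s o e∉' j₂)) (trans (sym q) (loc r o e∉ j₁)))
      stop : ∀ {k l} → Fin 0 → Fin k ⊎ Fin l
      stop ()
      pairs₁ : List (Fin 1 × Fin 1)
      pairs₁ = (zero , zero) ∷ []
      pairs₂ : List (Fin 2 × Fin 2)
      pairs₂ = (zero , zero) ∷ (suc zero , suc zero) ∷ []
      fateˡ₁ : ∀ j → (Σ (Fin 1) λ j' → (j , j') ∈ pairs₁) ⊎ (Σ (Fin 0) λ l → stop {1} {1} l ≡ inj₁ j)
      fateˡ₁ zero = inj₁ (zero , here refl)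
      fateʳ₁ : ∀ j → (Σ (Fin 1) λ j' → (j' , j) ∈ pairs₁) ⊎ (Σ (Fin 0) λ l → stop {1} {1} l ≡ inj₂ j)
      fateʳ₁ zero = inj₁ (zero , here refl)
      fateˡ₂ : ∀ j → (Σ (Fin 2) λ j' → (j , j') ∈ pairs₂) ⊎ (Σ (Fin 0) λ l → stop {2} {2} l ≡ inj₁ j)
      fateˡ₂ zero = inj₁ (zero , here refl)
      fateˡ₂ (suc zero) = inj₁ (suc zero , there (here refl))
      fateʳ₂ : ∀ j → (Σ (Fin 2) λ j' → (j' , j) ∈ pairs₂) ⊎ (Σ (Fin 0) λ l → stop {2} {2} l ≡ inj₂ j)
      fateʳ₂ zero = inj₁ (zero , here refl)
      fateʳ₂ (suc zero) = inj₁ (suc zero , there (here refl))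
      module C₁ = Combine r₁ r₂ (λ j₁ j₂ → apart-compat (g r₁ j₁) (g r₂ j₂) o (apart (lone F) r₂ j₁ j₂)) dE pairs₁ stop fateˡ₁ fateʳ₁
      module C₂ = Combine s₁ s₂ (λ j₁ j₂ → apart-compat (g s₁ j₁) (g s₂ j₂) o (apart (ltwo F) s₂ j₁ j₂)) dE pairs₂ stop fateˡ₂ fateʳ₂
      balance₁ : C₁.pairsCost ((zero , zero) ∷ []) + 0 ≤ sumF (λ j → tcost (g r₁ j)) + sumF (λ j → tcost (g r₂ j))
      balance₁ = ≤-reflexive (solve 2 (λ a b → (a :+ b :+ con 0) :+ con 0 := (a :+ con 0) :+ (b :+ con 0)) refl (tcost (g r₁ zero)) (tcost (g r₂ zero)))
      balance₂ : C₂.pairsCost ((zero , zero) ∷ (suc zero , suc zero) ∷ []) + 0 ≤ sumF (λ j → tcost (g s₁ j)) + sumF (λ j → tcost (g s₂ j))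
      balance₂ = ≤-reflexive (solve 4 (λ a b c d → (a :+ c :+ (b :+ d :+ con 0)) :+ con 0 := (a :+ (b :+ con 0)) :+ (c :+ (d :+ con 0))) refl
        (tcost (g s₁ zero)) (tcost (g s₁ (suc zero))) (tcost (g s₂ zero)) (tcost (g s₂ (suc zero))))
      all : la F + lb F + 1 + (la F' + lb F' + 1) ≤ 2 * (m₁ + m₂)
      all = ≤-trans (+-mono-≤ (lextra F) (lextra F')) (≤-reflexive (sym (ℕₚ.*-distribˡ-+ 2 m₁ m₂)))
      regroup : ∀ a b a' b' → a + b + 1 + (a' + b' + 1) ≡ (a + a' + 1) + (b + b' + 1)
      regroup = solve 4 (λ a b a' b' → a :+ b :+ con 1 :+ (a' :+ b' :+ con 1) := (a :+ a' :+ con 1) :+ (b :+ b' :+ con 1)) refl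
      -- The extras of the two ways to finish add up to at most 2m - 2, so the cheaper one is at
      -- most m - 1.
      half : ∀ x y m → x ≤ y → x + 1 + (y + 1) ≤ 2 * m → suc x ≤ m
      half x y m h k = ℕₚ.*-cancelˡ-≤ 2 (≤-trans (≤-reflexive (dup x)) (≤-trans (ℕₚ.+-monoʳ-≤ (x + 1) (ℕₚ.+-monoˡ-≤ 1 h)) k))
        where
          dup : ∀ x → 2 * suc x ≡ x + 1 + (x + 1)
          dup = solve 1 (λ x → con 2 :* (con 1 :+ x) := x :+ con 1 :+ (x :+ con 1)) refl
      sums : (la F + la F' + 1) + (lb F + lb F' + 1) ≤ 2 * (m₁ + m₂)
      sums = ≤-trans (≤-reflexive (sym (regroup (la F) (lb F) (la F') (lb F')))) all
      some : ∀ m {x y} → x + y + 1 ≤ 2 * m → 1 ≤ m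
      some (suc m) _ = s≤s z≤n
      some zero {x} {y} h = ⊥-elim (ℕₚ.<⇒≱ (s≤s z≤n) (≤-trans (m≤n+m 1 (x + y)) h))
      pick : Dec (la F + la F' ≤ lb F + lb F') → Σ ℕ λ x → Closed (I₁ ++ I₂) ((e ∷ L₁) ++ L₂) 2 x × suc x ≤ m₁ + m₂ × 2 ≤ m₁ + m₂
      pick (yes p) = la F + la F' , closed (C₁.combine balance₁) , half _ _ (m₁ + m₂) p sums , +-mono-≤ (some m₁ {la F} {lb F} (lextra F)) (some m₂ {la F'} {lb F'} (lextra F'))
      pick (no p) = lb F + lb F' , closed (C₂.combine balance₂) , half _ _ (m₁ + m₂) (ℕₚ.<⇒≤ (ℕₚ.≰⇒> p)) (≤-trans (≤-reflexive (+-comm (lb F + lb F' + 1) _)) sums) , +-mono-≤ (some m₁ {la F} {lb F} (lextra F)) (some m₂ {la F'} {lb F'} (lextra F'))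

-- Reading given circuits and paths as closed paths and walks.

module FromCircuit (G : SignedGraph) where
  open Walks G
  open Cycles G
  open Decompose G using (Free)

  seqWalk : ∀ L (vs : Fin (suc L) → V) (es : Fin L → E) → (∀ i → Joins G (es i) (vs (inject₁ i)) (vs (suc i))) → Walk G Free (vs zero) (vs (fromℕ L))
  seqWalk zero vs es st = here
  seqWalk (suc L) vs es st = wstep (es zero) tt (st zero) (seqWalk L (vs ∘ suc) (es ∘ suc) (st ∘ suc))

  seq-edges : ∀ L vs es st → edges (seqWalk L vs es st) ≡ tabulate es
  seq-edges zero vs es st = refl
  seq-edges (suc L) vs es st = cong (es zero ∷_) (seq-edges L (vs ∘ suc) (es ∘ suc) (st ∘ suc))

  seq-verts : ∀ L vs es st → verts (seqWalk L vs es st) ≡ tabulate vs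
  seq-verts zero vs es st = refl
  seq-verts (suc L) vs es st = cong (vs zero ∷_) (seq-verts L (vs ∘ suc) (es ∘ suc) (st ∘ suc))

  open import Data.Fin.Properties using (fromℕ≢inject₁)

  last-or : ∀ {L} (i : Fin (suc L)) → (i ≡ fromℕ L) ⊎ (Σ (Fin L) λ j → i ≡ inject₁ j)
  last-or {zero} zero = inj₁ refl
  last-or {suc L} zero = inj₂ (zero , refl)
  last-or {suc L} (suc i) = case last-or i of λ { (inj₁ q) → inj₁ (cong suc q) ; (inj₂ (j , q)) → inj₂ (suc j , cong suc q) }

  ⨁-last : ∀ {L} (f : Fin (suc L) → Bool) → ⨁ f ≡ f (fromℕ L) xor ⨁ (f ∘ inject₁)
  ⨁-last {zero} f = refl
  ⨁-last {suc L} f = trans (cong (f zero xor_) (⨁-last (f ∘ suc))) (trans (sym (xor-assoc (f zero) (f (fromℕ (suc L))) _))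
    (trans (cong (_xor ⨁ (f ∘ suc ∘ inject₁)) (xor-comm (f zero) (f (fromℕ (suc L))))) (xor-assoc (f (fromℕ (suc L))) (f zero) _)))

  par-tabulate : ∀ (w : ES) {L} (es : Fin L → E) → par w (tabulate es) ≡ ⨁ (w ∘ es)
  par-tabulate w {zero} es = refl
  par-tabulate w {suc L} es = cong (w (es zero) xor_) (par-tabulate w (es ∘ suc))

  fromCircuit : Circuit G → Cyc
  fromCircuit C = record
    { cpath = w ; cuniq = subst Unique (sym (seq-verts (len C) (vs C) _ (step C))) (Uniqueₚ.tabulate⁺ (vs-inj C))
    ; ce = es C (fromℕ (len C)) ; cj = close C
    ; ce∉ = λ h → let (i , q) = ∈-tabulate⁻ (subst (_ ∈_) (seq-edges (len C) (vs C) _ (step C)) h) in fromℕ≢inject₁ (es-inj C q) }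
    where
      w : Walk G Free (vs C zero) (vs C (fromℕ (len C)))
      w = seqWalk (len C) (vs C) (es C ∘ inject₁) (step C)

  es-∈ : ∀ C i → es C i ∈ cedges (fromCircuit C)
  es-∈ C i with last-or i
  ... | inj₁ refl = here refl
  ... | inj₂ (j , refl) = there (subst (es C (inject₁ j) ∈_) (sym (seq-edges (len C) (vs C) _ (step C))) (∈-tabulate⁺ j))

  ∈-es : ∀ C {e} → e ∈ cedges (fromCircuit C) → Σ (Fin (suc (len C))) λ i → e ≡ es C i
  ∈-es C (here q) = fromℕ (len C) , q
  ∈-es C (there h) = let (j , q) = ∈-tabulate⁻ (subst (_ ∈_) (seq-edges (len C) (vs C) _ (step C)) h) in inject₁ j , q

  vs-∈ : ∀ C i → vs C i ∈ cverts (fromCircuit C)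
  vs-∈ C i = subst (vs C i ∈_) (sym (seq-verts (len C) (vs C) _ (step C))) (∈-tabulate⁺ {f = vs C} i)

  par-circuit : ∀ w C → par w (cedges (fromCircuit C)) ≡ ⨁ (λ i → w (es C i))
  par-circuit w C = trans (cong (w (es C (fromℕ (len C))) xor_) (trans (cong (par w) (seq-edges (len C) (vs C) _ (step C))) (par-tabulate w (es C ∘ inject₁)))) (sym (⨁-last (w ∘ es C)))

  bN-inj : ∀ {a b} → bN a ≡ bN b → a ≡ b
  bN-inj {true} {true} _ = refl
  bN-inj {false} {false} _ = refl

  balanced-par : ∀ C → Balanced C → par (neg G) (cedges (fromCircuit C)) ≡ false
  balanced-par C h = trans (par-circuit (neg G) C) (bN-inj (trans (sym (count-%2 (λ i → neg G (es C i)))) h))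

  unbalanced-par : ∀ C → Unbalanced C → par (neg G) (cedges (fromCircuit C)) ≡ true
  unbalanced-par C h = trans (par-circuit (neg G) C) (bN-inj (trans (sym (count-%2 (λ i → neg G (es C i)))) h))

  pathWalk : (P : Path G) → Walk G Free (pv P zero) (pv P (fromℕ (plen P)))
  pathWalk P = seqWalk (plen P) (pv P) (pe P) (pstep P)

  par-∈ : ∀ (w : ES) l → par w l ≡ true → Σ E λ e → e ∈ l × w e ≡ true
  par-∈ w (x ∷ l) h with bool-cases (w x)
  ... | inj₁ p = x , here refl , p
  ... | inj₂ p = let (e , q , r) = par-∈ w l (trans (sym (cong (_xor par w l) p)) h) in e , there q , r

  par-other : ∀ (w : ES) l {e} → par w l ≡ false → e ∈ l → w e ≡ true → Unique l → Σ E λ e' → e' ∈ l × e' ≢ e × w e' ≡ true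
  par-other w (x ∷ l) h (here refl) k u = let (e' , p , q) = par-∈ w l (trans (sym (xor-false h)) k) in e' , there p , (λ r → unique-head u (subst (_∈ l) r p)) , q
  par-other w (x ∷ l) h (there q) k u with bool-cases (w x)
  ... | inj₁ p = x , here refl , (λ { refl → unique-head u q }) , p
  ... | inj₂ p = let (e' , r , s , t) = par-other w l (trans (sym (cong (_xor par w l) p)) h) q k (unique-tail u) in e' , there r , s , t

-- Negative edges forced by the existence of signed circuits through every edge.

module Bridgeless (G : SignedGraph) {ε : ℕ} (S : Setup G ε) (sb : SBridgeless G) where
  open Walks G
  open Cycles G
  open FromCircuit G
  open Setup S
  open Decompose G using (Free)

  ClosedSet : VS → Set
  ClosedSet W = ∀ e → cut W e ≡ false

  closed-cyc : ∀ W → ClosedSet W → ∀ C {x y} → x ∈ cverts C → y ∈ cverts C → W x ≡ W y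
  closed-cyc W cl C = cyc-inside W C λ {e} _ → cl e

  closed-walk : ∀ W → ClosedSet W → ∀ {P : E → Set} {u v} (w : Walk G P u v) → W u ≡ W v
  closed-walk W cl w = xor-false (trans (sym (par-cut W w)) (par-false (edges w) λ e _ → cl e))

  edge-in : ∀ W → ClosedSet W → ∀ C {e} → e ∈ cedges C → ∀ {x} → x ∈ cverts C → W (src e) ≡ W x
  edge-in W cl C h x∈ = closed-cyc W cl C (proj₁ (cedge-ends C h (joins-self _))) x∈

  par-σ' : ∀ C → par (neg G) (cedges C) ≡ true → Σ E λ e → e ∈ cedges C × σ e ≡ true
  par-σ' C h = par-∈ σ (cedges C) (trans (par-σ C) h)

  record TwoNegs (W : VS) (b : Bool) : Set where
    field
      f f' : E
      f≢f' : f ≢ f'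
      σf : σ f ≡ true
      σf' : σ f' ≡ true
      f∈ : W (src f) ≡ b
      f'∈ : W (src f') ≡ b

  -- A balanced circuit through `e` has an even number of negative edges. A barbell has two
  -- edge-disjoint unbalanced circuits with a negative edge in each, and one of these differs from
  -- `e`. Signed circuits are connected, so `W` takes one value on them.
  mate : ∀ {W} → ClosedSet W → ∀ {e} → σ e ≡ true → Σ E λ f → f ≢ e × σ f ≡ true × W (src f) ≡ W (src e)
  mate {W} cl {e} σe = go (sb e)
    where
      choose : TwoNegs W (W (src e)) → Σ E λ f → f ≢ e × σ f ≡ true × W (src f) ≡ W (src e)
      choose T with TwoNegs.f T ≟ e
      ... | no q = TwoNegs.f T , q , TwoNegs.σf T , TwoNegs.f∈ T
      ... | yes q = TwoNegs.f' T , (λ r → TwoNegs.f≢f' T (trans q (sym r))) , TwoNegs.σf' T , TwoNegs.f'∈ T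
      both : ∀ C₁ C₂ → Unbalanced C₁ → Unbalanced C₂ → (∀ i j → ¬ (es C₁ i ≡ es C₂ j)) →
        (∀ {x} → x ∈ cverts (fromCircuit C₁) → W x ≡ W (src e)) → (∀ {x} → x ∈ cverts (fromCircuit C₂) → W x ≡ W (src e)) → TwoNegs W (W (src e))
      both C₁ C₂ u₁ u₂ dj in₁ in₂ = let (f , f∈ , σf) = par-σ' (fromCircuit C₁) (unbalanced-par C₁ u₁) ; (f' , f'∈ , σf') = par-σ' (fromCircuit C₂) (unbalanced-par C₂ u₂) in
        record { f = f ; f' = f' ; σf = σf ; σf' = σf'
               ; f≢f' = λ r → let (i , p) = ∈-es C₁ f∈ ; (j , q) = ∈-es C₂ f'∈ in dj i j (trans (sym p) (trans r q))
               ; f∈ = in₁ (proj₁ (cedge-ends (fromCircuit C₁) f∈ (joins-self f))) ; f'∈ = in₂ (proj₁ (cedge-ends (fromCircuit C₂) f'∈ (joins-self f'))) }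
      all : ∀ C {x} → x ∈ cverts (fromCircuit C) → W x ≡ W (src e) → ∀ {y} → y ∈ cverts (fromCircuit C) → W y ≡ W (src e)
      all C x∈ q y∈ = trans (closed-cyc W cl (fromCircuit C) y∈ x∈) q
      own : ∀ C → EdgeOfC C e → ∀ {y} → y ∈ cverts (fromCircuit C) → W y ≡ W (src e)
      own C (i , refl) y∈ = sym (edge-in W cl (fromCircuit C) (es-∈ C i) y∈)
      go : (Σ (SignedCircuit G) λ s → e ∈SC s) → Σ E λ f → f ≢ e × σ f ≡ true × W (src f) ≡ W (src e)
      go (balanced C h , i , refl) = let C' = fromCircuit C ; (f , f∈ , f≢ , σf) = par-other σ (cedges C') (trans (par-σ C') (balanced-par C h)) (es-∈ C i) σe (cedges-unique C') in
        f , f≢ , σf , trans (edge-in W cl C' f∈ (start∈ (cpath C'))) (sym (edge-in W cl C' (es-∈ C i) (start∈ (cpath C'))))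
      go (short C₁ C₂ u₁ u₂ (v , (i₁ , p₁) , (i₂ , p₂) , _) dj , inj₁ h) = choose (both C₁ C₂ u₁ u₂ dj (own C₁ h)
        (all C₂ (subst (_∈ cverts (fromCircuit C₂)) p₂ (vs-∈ C₂ i₂)) (own C₁ h (subst (_∈ cverts (fromCircuit C₁)) p₁ (vs-∈ C₁ i₁)))))
      go (short C₁ C₂ u₁ u₂ (v , (i₁ , p₁) , (i₂ , p₂) , _) dj , inj₂ h) = choose (both C₁ C₂ u₁ u₂ dj
        (all C₁ (subst (_∈ cverts (fromCircuit C₁)) p₁ (vs-∈ C₁ i₁)) (own C₂ h (subst (_∈ cverts (fromCircuit C₂)) p₂ (vs-∈ C₂ i₂)))) (own C₂ h))
      go (long C₁ C₂ P u₁ u₂ dj (i₁ , p₁) (i₂ , p₂) _ , h) = choose (both C₁ C₂ u₁ u₂ edj (at-start value) (at-end value))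
        where
          edj : ∀ i j → ¬ (es C₁ i ≡ es C₂ j)
          edj i j q = let a∈ = proj₁ (cedge-ends (fromCircuit C₁) (es-∈ C₁ i) (joins-self _))
                          b∈ = proj₁ (cedge-ends (fromCircuit C₂) (subst (_∈ cedges (fromCircuit C₂)) (sym q) (es-∈ C₂ j)) (joins-self _))
                          (k , r) = ∈-vs C₁ a∈ ; (l , s) = ∈-vs C₂ b∈ in dj _ (k , r) (l , s)
            where
              ∈-vs : ∀ C {x} → x ∈ cverts (fromCircuit C) → Σ (Fin (suc (len C))) λ k → vs C k ≡ x
              ∈-vs C x∈ = let (k , r) = ∈-tabulate⁻ {f = vs C} (subst (_ ∈_) (seq-verts (len C) (vs C) _ (step C)) x∈) in k , sym r
          first∈ : pv P zero ∈ cverts (fromCircuit C₁)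
          first∈ = subst (_∈ cverts (fromCircuit C₁)) p₁ (vs-∈ C₁ i₁)
          last∈ : pv P (fromℕ (plen P)) ∈ cverts (fromCircuit C₂)
          last∈ = subst (_∈ cverts (fromCircuit C₂)) p₂ (vs-∈ C₂ i₂)
          sameP : W (pv P zero) ≡ W (pv P (fromℕ (plen P)))
          sameP = closed-walk W cl (pathWalk P)
          onPath : ∀ {x} → x ∈ verts (pathWalk P) → W x ≡ W (pv P zero)
          onPath x∈ = sym (closed-walk W cl (Walks.walk (prefix (pathWalk P) x∈)))
          value : W (pv P zero) ≡ W (src e)
          value = at h
            where
              at : EdgeOfC C₁ e ⊎ EdgeOfC C₂ e ⊎ EdgeOfP P e → W (pv P zero) ≡ W (src e)
              at (inj₁ h₁) = own C₁ h₁ first∈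
              at (inj₂ (inj₁ h₂)) = trans sameP (own C₂ h₂ last∈)
              at (inj₂ (inj₂ (i , refl))) = sym (onPath (proj₁ (edge-ends (pathWalk P) (subst (pe P i ∈_) (sym (seq-edges (plen P) (pv P) (pe P) (pstep P))) (∈-tabulate⁺ i)) (joins-self _))))
          at-start : W (pv P zero) ≡ W (src e) → ∀ {y} → y ∈ cverts (fromCircuit C₁) → W y ≡ W (src e)
          at-start q = all C₁ first∈ q
          at-end : W (pv P zero) ≡ W (src e) → ∀ {y} → y ∈ cverts (fromCircuit C₂) → W y ≡ W (src e)
          at-end q = all C₂ last∈ (trans (sym sameP) q)

  -- A bridge lies on the path of a long barbell, whose circuits lie on its two sides.
  both-sides : ∀ {W} → ClosedSet W → ∀ {A u} → cut A u ≡ true → (∀ {e} → cut A e ≡ true → e ≡ u) → ∀ b →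
    Σ E λ f → σ f ≡ true × W (src f) ≡ W (src u) × A (src f) ≡ b
  both-sides {W} cl {A} {u} c sole b = go (sb u)
    where
      not-on : ∀ C → EdgeOfC C u → ⊥
      not-on C (i , q) = let C' = fromCircuit C ; (e' , ne , _ , c') = even-second {χ (cedges C')} (even-cyc C') A (χ-unique (cedges C') (cedges-unique C') (subst (_∈ cedges C') q (es-∈ C i))) c in ne (sole c')
      side : ∀ C → ¬ EdgeOfC C u → ∀ {x y} → x ∈ cverts (fromCircuit C) → y ∈ cverts (fromCircuit C) → A x ≡ A y
      side C off = cyc-inside A (fromCircuit C) λ {e} h → ≢true⇒false λ k → let (i , q) = ∈-es C h in off (i , trans (sym q) (sole k))
      go : (Σ (SignedCircuit G) λ s → u ∈SC s) → Σ E λ f → σ f ≡ true × W (src f) ≡ W (src u) × A (src f) ≡ b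
      go (balanced C _ , h) = ⊥-elim (not-on C h)
      go (short C₁ C₂ _ _ _ _ , inj₁ h) = ⊥-elim (not-on C₁ h)
      go (short C₁ C₂ _ _ _ _ , inj₂ h) = ⊥-elim (not-on C₂ h)
      go (long C₁ C₂ P _ _ _ _ _ _ , inj₁ h) = ⊥-elim (not-on C₁ h)
      go (long C₁ C₂ P _ _ _ _ _ _ , inj₂ (inj₁ h)) = ⊥-elim (not-on C₂ h)
      go (long C₁ C₂ P u₁ u₂ dj (i₁ , p₁) (i₂ , p₂) _ , inj₂ (inj₂ (i , q))) with bool-cases (A (pv P zero) xor b)
      ... | inj₂ r = let (f , f∈ , σf) = par-σ' (fromCircuit C₁) (unbalanced-par C₁ u₁) in
          f , σf , trans (edge-in W cl (fromCircuit C₁) f∈ first∈) start-W , trans (side C₁ (not-on C₁) (proj₁ (cedge-ends (fromCircuit C₁) f∈ (joins-self f))) first∈) (xor-false r)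
        where
          first∈ : pv P zero ∈ cverts (fromCircuit C₁)
          first∈ = subst (_∈ cverts (fromCircuit C₁)) p₁ (vs-∈ C₁ i₁)
          start-W : W (pv P zero) ≡ W (src u)
          start-W = closed-walk W cl (Walks.walk (prefix (pathWalk P) (proj₁ (edge-ends (pathWalk P) (subst (u ∈_) (sym (seq-edges (plen P) (pv P) (pe P) (pstep P))) (subst (_∈ tabulate (pe P)) q (∈-tabulate⁺ i))) (joins-self u)))))
      ... | inj₁ r = let (f , f∈ , σf) = par-σ' (fromCircuit C₂) (unbalanced-par C₂ u₂) in
          f , σf , trans (edge-in W cl (fromCircuit C₂) f∈ last∈) (trans (sym (closed-walk W cl (pathWalk P))) start-W) ,
          trans (side C₂ (not-on C₂) (proj₁ (cedge-ends (fromCircuit C₂) f∈ (joins-self f))) last∈) (xor-flip (A (pv P zero)) _ b r crossed)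
        where
          u∈ : u ∈ edges (pathWalk P)
          u∈ = subst (u ∈_) (sym (seq-edges (plen P) (pv P) (pe P) (pstep P))) (subst (_∈ tabulate (pe P)) q (∈-tabulate⁺ i))
          last∈ : pv P (fromℕ (plen P)) ∈ cverts (fromCircuit C₂)
          last∈ = subst (_∈ cverts (fromCircuit C₂)) p₂ (vs-∈ C₂ i₂)
          start-W : W (pv P zero) ≡ W (src u)
          start-W = closed-walk W cl (Walks.walk (prefix (pathWalk P) (proj₁ (edge-ends (pathWalk P) u∈ (joins-self u)))))
          par-once : ∀ l → Unique l → u ∈ l → par (cut A) l ≡ true
          par-once (x ∷ l) uq (here refl) = xor-trueˡ c (par-false l λ e e∈ → ≢true⇒false λ k → unique-head uq (subst (_∈ l) (sole k) e∈))
          par-once (x ∷ l) uq (there h) = xor-trueʳ (≢true⇒false λ k → unique-head uq (subst (_∈ l) (sym (sole k)) h)) (par-once l (unique-tail uq) h)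
          crossed : A (pv P zero) xor A (pv P (fromℕ (plen P))) ≡ true
          crossed = trans (sym (par-cut A (pathWalk P))) (par-once (edges (pathWalk P)) (subst Unique (sym (seq-edges (plen P) (pv P) (pe P) (pstep P))) (Uniqueₚ.tabulate⁺ (pe-inj P))) u∈)

-- Components, their kinds, and the distribution of counts over them.

module Components (G : SignedGraph) {ε : ℕ} (S : Setup G ε) where
  open Walks G
  open Cycles G
  open Separators G
  open Setup S

  tree : ∀ r → RT (In pos) r
  tree r = Reach.tree (reach pos r)

  tree-unique : ∀ r → Unique (tverts (tree r))
  tree-unique r = Reach.uniq (reach pos r)

  comp : V → VS
  comp r = mem (tverts (tree r))

  comp-pos : ∀ r {e} → pos e ≡ true → cut (comp r) e ≡ false
  comp-pos r = Reach.set-uncut (reach pos r)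

  comp-walk : ∀ r {u v} → Walk G (In pos) u v → comp r u ≡ comp r v
  comp-walk r w = xor-false (trans (sym (par-cut (comp r) w)) (par-false (edges w) λ e h → comp-pos r (edges-P w h)))

  comp-closed : ∀ r e → cut (comp r) e ≡ false
  comp-closed r e with bool-cases (σ e)
  ... | inj₁ p = xor-≡ (sym (comp-walk r (neg-connected p)))
  ... | inj₂ p = comp-pos r (not-intro p)

  comp-tgt : ∀ r {e} → comp r (src e) ≡ true → comp r (tgt e) ≡ true
  comp-tgt r {e} h = trans (sym (xor-false (comp-closed r e))) h

  comp-self : ∀ r → comp r r ≡ true
  comp-self r = ∈-mem (tverts (tree r)) (root∈ (tree r))

  toComp : ∀ r {x} → comp r x ≡ true → Walk G (In pos) x r
  toComp r h = Reach.fromSet (reach pos r) h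

  sep-pos : ∀ {A u} → Only A u → pos u ≡ true
  sep-pos {A} {u} o with bool-cases (σ u)
  ... | inj₂ p = not-intro p
  ... | inj₁ p = ⊥-elim (only-≢ o (joins-self u) (sym (only-walk o (neg-connected p) λ h → neg-pos p (edges-P (neg-connected p) h))))

  isSep : ∀ {e} → (Σ VS λ A → Only A e) ⊎ (∀ {A} → Only A e → ⊥) → Bool
  isSep (inj₁ _) = true
  isSep (inj₂ _) = false

  U : ES
  U e = isSep (separator? e)

  U-only : ∀ {e} → U e ≡ true → Σ VS λ A → Only A e
  U-only {e} h with separator? e
  ... | inj₁ p = p

  U-false : ∀ {e} → U e ≡ false → ∀ {A} → Only A e → ⊥
  U-false {e} h with separator? e
  ... | inj₂ p = p

  only-U : ∀ {A e} → Only A e → U e ≡ true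
  only-U o = ≢false⇒true λ h → U-false h o

  Unsep : V → Set
  Unsep r = ∀ {A u} → Only A u → comp r (src u) ≡ true → ⊥

  -- Parity is an obstacle only without separators. In a component with a separator the two
  -- alternatives of `Flex` absorb it, so `split` does not ask for it.
  data Kind (r : V) : Set where
    plain : Unsep r → ⨁ (λ e → σ e ∧ comp r (src e)) ≡ false → Kind r
    odd : Unsep r → ⨁ (λ e → σ e ∧ comp r (src e)) ≡ true → ∀ e → σ e ≡ true → comp r (src e) ≡ true → Kind r
    split : ∀ {A u} → Only A u → comp r (src u) ≡ true → Kind r

  kind-raw : ∀ r → Kind r
  kind-raw r = by (search (λ e → U e ∧ comp r (src e)))
    where
      by-parity : Unsep r → (⨁ (λ e → σ e ∧ comp r (src e)) ≡ true) ⊎ (⨁ (λ e → σ e ∧ comp r (src e)) ≡ false) → Kind r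
      by-parity ns (inj₂ p) = plain ns p
      by-parity ns (inj₁ p) = let (e , h) = ⨁-true (λ e → σ e ∧ comp r (src e)) p in odd ns p e (∧-left h) (∧-right {σ e} h)
      by : (∃ λ e → U e ∧ comp r (src e) ≡ true) ⊎ (∀ e → U e ∧ comp r (src e) ≡ false) → Kind r
      by (inj₁ (e , h)) = split (proj₂ (U-only (∧-left h))) (∧-right {U e} h)
      by (inj₂ h) = by-parity (λ {A} {u} o k → absurd (∧-intro (only-U o) k) (h u)) (bool-cases _)

  abstract
    kind : ∀ r → Kind r
    kind = kind-raw

  removedOf : ∀ {r} → Kind r → List E
  removedOf (plain _ _) = []
  removedOf (odd _ _ e _ _) = e ∷ []
  removedOf (split _ _) = []

  removed-σ : ∀ {r} (k : Kind r) {e} → e ∈ removedOf k → σ e ≡ true × comp r (src e) ≡ true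
  removed-σ (odd _ _ e p q) (here refl) = p , q

  vertsOf : List V → List V
  vertsOf [] = []
  vertsOf (r ∷ rs) = tverts (tree r) ++ vertsOf rs

  vertsOf⁻ : ∀ rs {x} → x ∈ vertsOf rs → Σ V λ r → r ∈ rs × x ∈ tverts (tree r)
  vertsOf⁻ (r ∷ rs) h with ∈-++⁻ (tverts (tree r)) h
  ... | inj₁ p = r , here refl , p
  ... | inj₂ p = let (r' , q , s) = vertsOf⁻ rs p in r' , there q , s

  vertsOf⁺ : ∀ {rs r x} → r ∈ rs → x ∈ tverts (tree r) → x ∈ vertsOf rs
  vertsOf⁺ (here refl) p = ∈-++⁺ˡ p
  vertsOf⁺ {r' ∷ rs} (there h) p = ∈-++⁺ʳ (tverts (tree r')) (vertsOf⁺ h p)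

  same-root : ∀ rs → Unique (vertsOf rs) → ∀ {r r' x} → r ∈ rs → r' ∈ rs → x ∈ tverts (tree r) → x ∈ tverts (tree r') → r ≡ r'
  same-root (r ∷ rs) u (here refl) (here refl) p q = refl
  same-root (r ∷ rs) u (here refl) (there h) p q = ⊥-elim (unique-++-disjoint (tverts (tree r)) u p (vertsOf⁺ h q))
  same-root (r ∷ rs) u (there h) (here refl) p q = ⊥-elim (unique-++-disjoint (tverts (tree r)) u q (vertsOf⁺ h p))
  same-root (r ∷ rs) u (there h) (there k) p q = same-root rs (unique-++ʳ (tverts (tree r)) u) h k p q

  record Roots (l : List V) : Set where
    field
      roots : List V
      rootOf : ∀ {x} → x ∈ l → Σ V λ r → r ∈ roots × x ∈ tverts (tree r)
      apart : Unique (vertsOf roots)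

  rootsOf-raw : ∀ l → Roots l
  rootsOf-raw [] = record { roots = [] ; rootOf = λ () ; apart = [] }
  rootsOf-raw (x ∷ l) = add-root (rootsOf-raw l)
    where
      add-root : Roots l → Roots (x ∷ l)
      add-root R = by (x ∈?ₗ vertsOf (Roots.roots R))
        where
          by : (x ∈ vertsOf (Roots.roots R)) ⊎ (x ∉ vertsOf (Roots.roots R)) → Roots (x ∷ l)
          by (inj₁ h) = record { roots = Roots.roots R ; rootOf = λ { (here refl) → vertsOf⁻ (Roots.roots R) h ; (there p) → Roots.rootOf R p } ; apart = Roots.apart R }
          by (inj₂ h) = record { roots = x ∷ Roots.roots R
            ; rootOf = λ { (here refl) → x , here refl , root∈ (tree x) ; (there p) → let (r , q , s) = Roots.rootOf R p in r , there q , s }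
            ; apart = unique-++ (tree-unique x) (Roots.apart R) λ {y} p q → let (r , r∈ , s) = vertsOf⁻ (Roots.roots R) q in
                h (vertsOf⁺ r∈ (mem-∈ (tverts (tree r)) (trans (sym (comp-walk r (toComp x (∈-mem (tverts (tree x)) p)))) (∈-mem (tverts (tree r)) s)))) }

  abstract
    rootsOf : ∀ l → Roots l
    rootsOf = rootsOf-raw

  roots : List V
  roots = Roots.roots (rootsOf (allFin (nV G)))

  roots-apart : Unique (vertsOf roots)
  roots-apart = Roots.apart (rootsOf (allFin (nV G)))

  rootOf : ∀ x → Σ V λ r → r ∈ roots × comp r x ≡ true
  rootOf x = let (r , p , q) = Roots.rootOf (rootsOf (allFin (nV G))) (∈-allFin x) in r , p , ∈-mem (tverts (tree r)) q

  root-same : ∀ {r r' x} → r ∈ roots → r' ∈ roots → comp r x ≡ true → comp r' x ≡ true → r ≡ r'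
  root-same {r} {r'} p q h k = same-root roots roots-apart p q (mem-∈ (tverts (tree r)) h) (mem-∈ (tverts (tree r')) k)

  -- The part of `f` located in one component. Components are disjoint, so the bounds proved for
  -- each of them may be added up.
  share : V → ∀ {m} → (Fin m → V) → (Fin m → ℕ) → ℕ
  share r loc f = sumF (λ i → bN (comp r (loc i)) * f i)

  share-sum : ∀ {m} (loc : Fin m → V) (f : Fin m → ℕ) → sum (map (λ r → share r loc f) roots) ≤ sumF f
  share-sum loc f = ≤-trans (go roots roots-apart) (sumF-mono λ i → ≤-trans (ℕₚ.*-monoˡ-≤ (f i) (bN≤1 (mem (vertsOf roots) (loc i)))) (≤-reflexive (ℕₚ.*-identityˡ (f i))))
    where
      go : ∀ rs → Unique (vertsOf rs) → sum (map (λ r → share r loc f) rs) ≤ sumF (λ i → bN (mem (vertsOf rs) (loc i)) * f i)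
      go [] u = z≤n
      go (r ∷ rs) u = ≤-trans (ℕₚ.+-monoʳ-≤ (share r loc f) (go rs (unique-++ʳ (tverts (tree r)) u)))
          (≤-trans (≤-reflexive (sym (sumF-+ (λ i → bN (comp r (loc i)) * f i) (λ i → bN (mem (vertsOf rs) (loc i)) * f i)))) (sumF-mono λ i →
            ≤-trans (≤-reflexive (sym (ℕₚ.*-distribʳ-+ (f i) (bN (comp r (loc i))) (bN (mem (vertsOf rs) (loc i)))))) (ℕₚ.*-monoˡ-≤ (f i) (pt (loc i)))))
        where
          pt : ∀ x → bN (comp r x) + bN (mem (vertsOf rs) x) ≤ bN (mem (tverts (tree r) ++ vertsOf rs) x)
          pt x with bool-cases (comp r x) | bool-cases (mem (vertsOf rs) x)
          ... | inj₁ p | inj₁ q = ⊥-elim (unique-++-disjoint (tverts (tree r)) u (mem-∈ (tverts (tree r)) p) (mem-∈ (vertsOf rs) q))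
          ... | inj₁ p | inj₂ q rewrite p | q | ∈-mem (tverts (tree r) ++ vertsOf rs) (∈-++⁺ˡ (mem-∈ (tverts (tree r)) p)) = ≤-refl
          ... | inj₂ p | inj₁ q rewrite p | q | ∈-mem (tverts (tree r) ++ vertsOf rs) (∈-++⁺ʳ (tverts (tree r)) (mem-∈ (vertsOf rs) q)) = ≤-refl
          ... | inj₂ p | inj₂ q rewrite p | q = z≤n

  share-count : ∀ r {m} (loc : Fin m → V) (X : Fin m → Bool) → share r loc (bN ∘ X) ≡ count (λ i → X i ∧ comp r (loc i))
  share-count r loc X = sym (trans (count-sumF (λ i → X i ∧ comp r (loc i))) (sumF-cong λ i → tab (X i) (comp r (loc i))))
    where
      tab : ∀ a b → bN (a ∧ b) ≡ bN b * bN a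
      tab true true = refl
      tab true false = refl
      tab false true = refl
      tab false false = refl

  negsIn sepsIn : V → ℕ
  negsIn r = count (λ e → σ e ∧ comp r (src e))
  sepsIn r = count (λ e → U e ∧ comp r (src e))

  order : V → ℕ
  order r = length (tverts (tree r))

  count-share-sum : ∀ {m} (loc : Fin m → V) (X : Fin m → Bool) → sum (map (λ r → count (λ i → X i ∧ comp r (loc i))) roots) ≤ count X
  count-share-sum loc X = ≤-trans (≤-reflexive (cong sum (map-cong roots))) (≤-trans (share-sum loc (bN ∘ X)) (≤-reflexive (sym (count-sumF X))))
    where
      map-cong : ∀ l → map (λ r → count (λ i → X i ∧ comp r (loc i))) l ≡ map (λ r → share r loc (bN ∘ X)) l
      map-cong [] = refl
      map-cong (r ∷ l) = cong₂ _∷_ (sym (share-count r loc X)) (map-cong l)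

  order-sum : sum (map order roots) ≤ nV G
  order-sum = ≤-trans (≤-reflexive (cong sum (map-cong roots))) (≤-trans (count-share-sum id (λ _ → true)) (count≤n {nV G} (λ _ → true)))
    where
      map-cong : ∀ l → map order l ≡ map (λ r → count (λ x → true ∧ comp r x)) l
      map-cong [] = refl
      map-cong (r ∷ l) = cong₂ _∷_ (sym (count-mem-unique (tverts (tree r)) (tree-unique r))) (map-cong l)

-- The signed circuit for a negative edge that is set aside.

module Odd (G : SignedGraph) {ε : ℕ} (S : Setup G ε) (sb : SBridgeless G) where
  open Walks G
  open Cycles G
  open Decompose G
  open Setup S
  open Components G S
  open Bridgeless G S sb

  record Patch (r : V) (e : E) : Set where
    field
      sc : SignedCircuit G
      size≤ : size sc ≤ suc (order r)
      e∈ : e ∈SC sc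
      -- Once `e` is set aside, parity no longer forces the even set of the remaining negative edges
      -- and their join to contain a positive bridge crossed by `e`. This signed circuit has to take
      -- it over.
      bridges∈ : ∀ {A g} → cut A e ≡ true → (∀ {e'} → pos e' ≡ true → cut A e' ≡ true → e' ≡ g) → g ∈SC sc

  fundamental : ∀ {e} → σ e ≡ true → Σ Cyc λ C → (∀ {e'} → e' ∈ cedges C → pos e' ≡ true ⊎ e' ≡ e) × e ∈ cedges C
  fundamental {e} σe = let (C , C⊆ , e∈) = closeWalk {S = λ e' → pos e' ∨ isV e e'} (joins-self e) (∨-right {pos e} (isV-refl e))
                                (weaken (λ {e'} p → delete-in {λ e' → pos e' ∨ isV e e'} (∨-left p) λ { refl → neg-pos σe p }) (neg-connected σe)) in
    C , (λ {e'} h → case ∨-split {pos e'} (C⊆ h) of λ { (inj₁ p) → inj₁ p ; (inj₂ p) → inj₂ (sym (isV-true p)) }) , e∈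

  par-one : ∀ l {f} → Unique l → f ∈ l → σ f ≡ true → (∀ {e} → e ∈ l → pos e ≡ true ⊎ e ≡ f) → par σ l ≡ true
  par-one (x ∷ l) {f} u (here refl) σf only = xor-trueˡ σf (par-false l λ e e∈ → case only (there e∈) of λ { (inj₁ p) → not-true p ; (inj₂ q) → ⊥-elim (unique-head u (subst (_∈ l) q e∈)) })
  par-one (x ∷ l) {f} u (there h) σf only = xor-trueʳ (case only (here refl) of λ { (inj₁ p) → not-true p ; (inj₂ q) → ⊥-elim (unique-head u (subst (_∈ l) (sym q) h)) }) (par-one l (unique-tail u) h σf (only ∘ there))

  -- Since the signs add up to `false`, a single unbalanced circuit is impossible.
  partner : ∀ ds → AllPairs Compat ds → (∀ {C} → C ∈ ds → par σ (cedges C) ≡ true) → parL σ ds ≡ false → ∀ {C} → C ∈ ds → Σ Cyc λ C' → C' ∈ ds × Compat C C'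
  partner (C ∷ []) _ unb h (here refl) = absurd (unb (here refl)) (trans (sym (xor-identityʳ _)) h)
  partner (C ∷ C' ∷ ds) ((c ∷ _) ∷ _) unb h (here refl) = C' , there (here refl) , c
  partner (C ∷ ds) (a ∷ _) unb h (there p) = C , here refl , compat-sym (All.lookup a p)

  -- The fundamental circuits of e and of a second negative edge differ by an even set with two negative edges. In its decomposition
  -- e lies in a balanced circuit, or in one of two unbalanced ones, and a bridge crossed by e lies in the circuit of e by parity.
  patch-raw : ∀ r {e} → σ e ≡ true → comp r (src e) ≡ true → Patch r e
  patch-raw r {e} σe e∈r = from (mate {comp r} (comp-closed r) σe)
    where
      from : (Σ E λ f → f ≢ e × σ f ≡ true × comp r (src f) ≡ comp r (src e)) → Patch r e
      from (f , f≢e , σf , same) = finish (Tokens.cover T {e} e∈S)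
        where
          Ce Cf : Cyc
          Ce = proj₁ (fundamental σe)
          Cf = proj₁ (fundamental σf)
          Ce⊆ : ∀ {e'} → e' ∈ cedges Ce → pos e' ≡ true ⊎ e' ≡ e
          Ce⊆ = proj₁ (proj₂ (fundamental σe))
          Cf⊆ : ∀ {e'} → e' ∈ cedges Cf → pos e' ≡ true ⊎ e' ≡ f
          Cf⊆ = proj₁ (proj₂ (fundamental σf))
          e∈Ce : e ∈ cedges Ce
          e∈Ce = proj₂ (proj₂ (fundamental σe))
          f∈Cf : f ∈ cedges Cf
          f∈Cf = proj₂ (proj₂ (fundamental σf))
          Q : ES
          Q = χ (cedges Ce) ⊕ χ (cedges Cf)
          e∈S : Q e ≡ true
          e∈S = xor-trueˡ (χ-unique (cedges Ce) (cedges-unique Ce) e∈Ce) (χ-∉ (cedges Cf) λ h → case Cf⊆ h of λ { (inj₁ p) → neg-pos σe p ; (inj₂ q) → f≢e (sym q) })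
          Q-even : Even Q
          Q-even = even-⊕ {χ (cedges Ce)} {χ (cedges Cf)} (even-cyc Ce) (even-cyc Cf)
          T : Tokens σ Q
          T = tokens σ Q Q-even
          par-Q : ⨁ (λ g → Q g ∧ σ g) ≡ false
          par-Q = trans (⨁-cong λ g → ∧-distribʳ-xor (σ g) (χ (cedges Ce) g) (χ (cedges Cf) g)) (trans (⨁-⊕ (λ g → χ (cedges Ce) g ∧ σ g) (λ g → χ (cedges Cf) g ∧ σ g))
            (cong₂ _xor_ (trans (χ-par σ (cedges Ce)) (par-one (cedges Ce) (cedges-unique Ce) e∈Ce σe Ce⊆)) (trans (χ-par σ (cedges Cf)) (par-one (cedges Cf) (cedges-unique Cf) f∈Cf σf Cf⊆))))
          parL-false : ∀ cs → (∀ {C} → C ∈ cs → par σ (cedges C) ≡ false) → parL σ cs ≡ false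
          parL-false [] h = refl
          parL-false (C ∷ cs) h = cong₂ _xor_ (h (here refl)) (parL-false cs (h ∘ there))
          par-ds : parL σ (Tokens.ds T) ≡ false
          par-ds = trans (sym (trans (Tokens.parity T σ) (cong (_xor parL σ (Tokens.ds T)) (parL-false (Tokens.bs T) (Tokens.bal T))))) par-Q
          edge-in-r : ∀ {g} → Q g ≡ true → comp r (src g) ≡ true
          edge-in-r {g} h = case xor-split {χ (cedges Ce) g} h of λ
            { (inj₁ (p , _)) → trans (trans (edge-in (comp r) (comp-closed r) Ce (χ-∈ (cedges Ce) p) (start∈ (cpath Ce))) (sym (edge-in (comp r) (comp-closed r) Ce e∈Ce (start∈ (cpath Ce))))) e∈r
            ; (inj₂ (_ , p)) → trans (trans (edge-in (comp r) (comp-closed r) Cf (χ-∈ (cedges Cf) p) (start∈ (cpath Cf))) (sym (edge-in (comp r) (comp-closed r) Cf f∈Cf (start∈ (cpath Cf))))) (trans same e∈r) }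
          verts-in-r : ∀ {C} → (∀ {g} → g ∈ cedges C → Q g ≡ true) → ∀ {x} → x ∈ cverts C → x ∈ tverts (tree r)
          verts-in-r {C} h x∈ = mem-∈ (tverts (tree r)) (trans (sym (edge-in (comp r) (comp-closed r) C (here refl) x∈)) (edge-in-r (h (here refl))))
          crossed : ∀ {C} → e ∈ cedges C → (∀ {g} → g ∈ cedges C → Q g ≡ true) → ∀ {A g} → cut A e ≡ true → (∀ {e'} → pos e' ≡ true → cut A e' ≡ true → e' ≡ g) → g ∈ cedges C
          crossed {C} e∈C _ {A} {g} c sole' = by (even-second {χ (cedges C)} (even-cyc C) A (χ-unique (cedges C) (cedges-unique C) e∈C) c)
            where
              by : (∃ λ e' → e' ≢ e × χ (cedges C) e' ≡ true × cut A e' ≡ true) → g ∈ cedges C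
              by (e' , ne , h , c') with bool-cases (σ e')
              ... | inj₁ p = ⊥-elim (ne (one-neg {A} {g} sole' p c' σe c))
              ... | inj₂ p = subst (_∈ cedges C) (sole' (not-intro p) c') (χ-∈ (cedges C) h)
          neg-par : ∀ C {b} → par σ (cedges C) ≡ b → par (neg G) (cedges C) ≡ b
          neg-par C h = trans (sym (par-σ C)) h
          finish : (Σ Cyc λ C → (C ∈ Tokens.bs T ⊎ C ∈ Tokens.ds T) × e ∈ cedges C) → Patch r e
          finish (C , inj₁ h , e∈C) = record
            { sc = balancedSC C (neg-par C (Tokens.bal T h))
            ; size≤ = ≤-trans (≤-reflexive (sym (clen-verts C))) (≤-trans (unique-⊆-length (cverts C) (tverts (tree r)) (cuniq C) (verts-in-r {C} (Tokens.inS T (inj₁ h)))) (ℕₚ.n≤1+n _))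
            ; e∈ = ∈-edgeOfC C e∈C
            ; bridges∈ = λ {A} {g} c o → ∈-edgeOfC C (crossed {C} e∈C (Tokens.inS T (inj₁ h)) {A} {g} c o) }
          finish (C , inj₂ h , e∈C) = pair (partner (Tokens.ds T) (Tokens.compats T) (Tokens.unb T) par-ds h)
            where
              pair : (Σ Cyc λ C' → C' ∈ Tokens.ds T × Compat C C') → Patch r e
              pair (C' , h' , cp) = record
                { sc = Barbell.sc B ; size≤ = Barbell.size≤verts B (tverts (tree r)) (λ
                    { (inj₁ p) → verts-in-r {C} (Tokens.inS T (inj₂ h)) p
                    ; (inj₂ (inj₁ p)) → verts-in-r {C'} (Tokens.inS T (inj₂ h')) p
                    ; (inj₂ (inj₂ p)) → inside w start-in p })
                ; e∈ = Barbell.cov B (inj₁ e∈C)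
                ; bridges∈ = λ {A} {g} c o → Barbell.cov B (inj₁ (crossed {C} e∈C (Tokens.inS T (inj₂ h)) {A} {g} c o)) }
                where
                  start-in : ca C ∈ tverts (tree r)
                  start-in = verts-in-r {C} (Tokens.inS T (inj₂ h)) (start∈ (cpath C))
                  w : Walk G (_∈ tedges (tree r)) (ca C) (ca C')
                  w = toRoot (tree r) start-in ⟫ rev (toRoot (tree r) (verts-in-r {C'} (Tokens.inS T (inj₂ h')) (start∈ (cpath C'))))
                  inside : ∀ {a b} (w : Walk G (_∈ tedges (tree r)) a b) → a ∈ tverts (tree r) → ∀ {x} → x ∈ verts w → x ∈ tverts (tree r)
                  inside here a∈ (here refl) = a∈
                  inside (wstep g p j w) a∈ (here refl) = a∈
                  inside (wstep g p j w) a∈ (there q) = inside w (proj₂ (tedge-ends (tree r) p j)) q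
                  B : Barbell C C' w
                  B = barbell C C' w cp (neg-par C (Tokens.unb T h)) (neg-par C' (Tokens.unb T h')) (start∈ (cpath C)) (start∈ (cpath C'))

  abstract
    patch : ∀ r {e} → σ e ≡ true → comp r (src e) ≡ true → Patch r e
    patch = patch-raw

-- The cover of one component and its joining cost.

module CompCovers (G : SignedGraph) {ε : ℕ} (S : Setup G ε) (sb : SBridgeless G) (v₀ : Fin (nV G)) where
  open Walks G
  open Cycles G
  open Decompose G
  open Setup S
  open Components G S
  open Bridgeless G S sb
  open Odd G S sb
  open Base G S

  removedIn : List V → List E
  removedIn [] = []
  removedIn (r ∷ rs) = removedOf (kind r) ++ removedIn rs

  removedIn⁻ : ∀ rs {e} → e ∈ removedIn rs → Σ V λ r → r ∈ rs × e ∈ removedOf (kind r)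
  removedIn⁻ (r ∷ rs) h with ∈-++⁻ (removedOf (kind r)) h
  ... | inj₁ p = r , here refl , p
  ... | inj₂ p = let (r' , q , s) = removedIn⁻ rs p in r' , there q , s

  removedIn⁺ : ∀ {rs r e} → r ∈ rs → e ∈ removedOf (kind r) → e ∈ removedIn rs
  removedIn⁺ (here refl) p = ∈-++⁺ˡ p
  removedIn⁺ {r' ∷ rs} (there h) p = ∈-++⁺ʳ (removedOf (kind r')) (removedIn⁺ h p)

  removed N : ES
  removed = mem (removedIn roots)
  N e = σ e ∧ not (removed e)

  removed-root : ∀ {e} → removed e ≡ true → Σ V λ r → r ∈ roots × e ∈ removedOf (kind r)
  removed-root h = removedIn⁻ roots (mem-∈ (removedIn roots) h)

  removed-at : ∀ {r e} → r ∈ roots → comp r (src e) ≡ true → removed e ≡ true → e ∈ removedOf (kind r)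
  removed-at {r} {e} r∈ c h = let (r' , r'∈ , p) = removed-root h in subst (λ r → e ∈ removedOf (kind r)) (root-same r'∈ r∈ (proj₂ (removed-σ (kind r') p)) c) p

  removed⊆σ : ∀ {e} → removed e ≡ true → σ e ≡ true
  removed⊆σ h = let (r , _ , p) = removed-root h in proj₁ (removed-σ (kind r) p)

  abstract
    base : BaseCover N U
    base = baseCover N U (λ {e} → ∧-left) (λ {e} h → sep-pos (proj₂ (U-only {e} h))) (λ {e} h → let (A , o) = U-only {e} h in A , Only.cuts o , λ {e'} → Only.sole o {e'}) v₀
      where open Separators G
  open BaseCover base

  S₁ : ES
  S₁ = N ⊕ J

  abstract
    toks₁ : Tokens (neg G) S₁
    toks₁ = tokens (neg G) S₁ J-even
  module T₁ = Tokens toks₁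

  D : Fin (length T₁.ds) → Cyc
  D = Data.List.lookup T₁.ds

  D∈ : ∀ i → D i ∈ T₁.ds
  D∈ i = ∈-lookup i

  D-odd : ∀ i → par (neg G) (cedges (D i)) ≡ true
  D-odd i = T₁.unb (D∈ i)

  D-compat : ∀ {i j} → i ≢ j → Compat (D i) (D j)
  D-compat = pairwise T₁.compats
    where
      pairwise : ∀ {l} → AllPairs Compat l → ∀ {i j} → i ≢ j → Compat (Data.List.lookup l i) (Data.List.lookup l j)
      pairwise (a ∷ p) {zero} {zero} ne = ⊥-elim (ne refl)
      pairwise (a ∷ p) {zero} {suc j} ne = All.lookup a (∈-lookup j)
      pairwise (a ∷ p) {suc i} {zero} ne = compat-sym (All.lookup a (∈-lookup i))
      pairwise (a ∷ p) {suc i} {suc j} ne = pairwise p λ q → ne (cong suc q)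

  open Separators G
  open Joining G D D-odd D-compat
  open Run G S D D-odd D-compat
  module Side (r : V) = RunTree G S D D-odd D-compat (comp r)

  -- Without separators no token has to be added, so this recursion runs without `Supply`.
  plainRun : ∀ {v} (t : Tree v) → Unique (tverts t) → NoSep (tedges t) → Plain v (toks t) (Es t)
  plainRun (leaf v) u ns = atLeaf (tokensAt v) (Uniqueₚ.filter⁺ (λ i → ca (D i) ≟ v) (Uniqueₚ.allFin⁺ _)) at-here
  plainRun {v} (graft t e p j t') u ns = MergeTrees.plain-plain {v} {toks t} {toks t'} {Es t} {e ∷ Es t'}
      (λ h k → unique-++-disjoint (tverts t) u (toks-at t h) (toks-at t' k))
      (λ { h (here refl) → unique-head ut (∈-++⁺ˡ (Es⇒ t h)) ; h (there k) → unique-++-disjoint (tedges t) (unique-tail ut) (Es⇒ t h) (Es⇒ t' k) })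
      (plainRun t (unique-++ˡ (tverts t) u) (λ o h → ns o (there (∈-++⁺ˡ h))))
      (movePlain (plainRun t' (unique-++ʳ (tverts t) u) (λ o h → ns o (there (∈-++⁺ʳ (tedges t) h)))) j (λ h → unique-head ut (∈-++⁺ʳ (tedges t) (Es⇒ t' h))) (λ o → ns o (here refl)))
    where
      ut : Unique (e ∷ tedges t ++ tedges t')
      ut = unique-tedges (graft t e p j t') u

  unique-toks : ∀ {v} (t : Tree v) → Unique (tverts t) → Unique (toks t)
  unique-toks (leaf v) u = Uniqueₚ.filter⁺ (λ i → ca (D i) ≟ v) (Uniqueₚ.allFin⁺ _)
  unique-toks (graft t e p j t') u = unique-++ (unique-toks t (unique-++ˡ (tverts t) u)) (unique-toks t' (unique-++ʳ (tverts t) u))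
    λ h k → unique-++-disjoint (tverts t) u (toks-at t h) (toks-at t' k)

  oddLen-⨁ : ∀ {m} (l : List (Fin m)) → oddLen l ≡ ⨁ (χ l)
  oddLen-⨁ {m} [] = sym (⨁-false {m} λ _ → refl)
  oddLen-⨁ (x ∷ l) = trans (cong not (oddLen-⨁ l)) (sym (trans (⨁-⊕ (isV x) (χ l)) (cong (_xor ⨁ (χ l)) (trans (⨁-cong λ i → sym (∧-identityʳ (isV x i))) (⨁-at x (λ _ → true))))))

  toks-χ : ∀ r i → χ (toks (tree r)) i ≡ comp r (ca (D i))
  toks-χ r i with bool-cases (comp r (ca (D i)))
  ... | inj₁ p = trans (χ-unique (toks (tree r)) (unique-toks (tree r) (tree-unique r)) (at-toks (tree r) (mem-∈ (tverts (tree r)) p))) (sym p)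
  ... | inj₂ p = trans (χ-∉ (toks (tree r)) λ h → absurd (∈-mem (tverts (tree r)) (toks-at (tree r) h)) p) (sym p)

  par-located : ∀ r C → par (λ e → σ e ∧ comp r (src e)) (cedges C) ≡ par σ (cedges C) ∧ comp r (ca C)
  par-located r C with bool-cases (comp r (ca C))
  ... | inj₁ p = trans (par-cong (cedges C) λ e h → trans (cong (σ e ∧_) (trans (edge-in (comp r) (comp-closed r) C h (start∈ (cpath C))) p)) (∧-identityʳ (σ e)))
      (sym (trans (cong (par σ (cedges C) ∧_) p) (∧-identityʳ _)))
  ... | inj₂ p = trans (par-false (cedges C) λ e h → ∧-falseʳ {σ e} (trans (edge-in (comp r) (comp-closed r) C h (start∈ (cpath C))) p)) (sym (∧-falseʳ {par σ (cedges C)} p))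

  parL-lookup : ∀ w (f : Cyc → Bool) cs → (∀ {C} → C ∈ cs → par w (cedges C) ≡ f C) → parL w cs ≡ ⨁ (λ i → f (Data.List.lookup cs i))
  parL-lookup w f [] h = refl
  parL-lookup w f (C ∷ cs) h = cong₂ _xor_ (h (here refl)) (parL-lookup w f cs (h ∘ there))

  -- The weight is σ within the component. On `S₁` it counts the edges of `N` there, because `J` is
  -- positive; on the decomposition it counts the unbalanced circuits there.
  toks-even : ∀ r → ⨁ (λ e → N e ∧ comp r (src e)) ≡ false → oddLen (toks (tree r)) ≡ false
  toks-even r h = trans (oddLen-⨁ (toks (tree r))) (trans (⨁-cong (toks-χ r)) (trans (sym inD) (trans (sym (trans (T₁.parity w) (cong (_xor parL w T₁.ds) inB))) (trans (⨁-cong pt) h))))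
    where
      w : ES
      w e = σ e ∧ comp r (src e)
      inD : parL w T₁.ds ≡ ⨁ (λ i → comp r (ca (D i)))
      inD = parL-lookup w (λ C → comp r (ca C)) T₁.ds λ {C} q → trans (par-located r C) (cong (_∧ comp r (ca C)) (trans (par-σ C) (T₁.unb q)))
      inB : parL w T₁.bs ≡ false
      inB = trans (parL-lookup w (λ _ → false) T₁.bs λ {C} q → trans (par-located r C) (cong (_∧ comp r (ca C)) (trans (par-σ C) (T₁.bal q)))) (⨁-false {length T₁.bs} λ _ → refl)
      tab : ∀ s n j c → (s ≡ true → j ≡ false) → (s ≡ false → n ≡ false) → (n xor j) ∧ (s ∧ c) ≡ n ∧ c
      tab true n j c p q rewrite p refl = cong (_∧ c) (xor-identityʳ n)
      tab false n j c p q rewrite q refl = ∧-zeroʳ j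
      pt : ∀ e → S₁ e ∧ w e ≡ N e ∧ comp r (src e)
      pt e = tab (σ e) (N e) (J e) (comp r (src e)) (λ s → ≢true⇒false λ j → neg-pos s (J⊆ j)) ∧-falseˡ

  tokenShare : V → ℕ
  tokenShare r = share r (ca ∘ D) (clen ∘ D)

  tokenCost-share : ∀ r I → Unique I → (∀ {i} → i ∈ I → comp r (ca (D i)) ≡ true) → tokenCost I ≤ tokenShare r
  tokenCost-share r I u h = ≤-trans (≤-reflexive (sum-mult (clen ∘ D) I)) (sumF-mono λ i → ℕₚ.*-monoˡ-≤ (clen (D i)) (pt i (i ∈?ₗ I)))
    where
      pt : ∀ i → (i ∈ I) ⊎ (i ∉ I) → mult I i ≤ bN (comp r (ca (D i)))
      pt i (inj₁ p) = ≤-trans (mult-unique I i u) (≤-reflexive (cong bN (sym (h p))))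
      pt i (inj₂ p) = ≤-trans (≤-reflexive (mult-∉ I p)) z≤n

  isPlain : ∀ {r} → Kind r → Bool
  isPlain (plain _ _) = true
  isPlain (odd _ _ _ _ _) = false
  isPlain (split _ _) = false

  -- `β` is the cost beyond the tokens themselves and one unit per edge set aside. The saving of 6
  -- is used for one component with a negative edge, `β≤` for all others, and `β-plain` in the
  -- two-edge-connected case.
  record CompCover (r : V) (k : Kind r) : Set where
    field
      parts : List (SignedCircuit G)
      β : ℕ
      parts-size : sum (map size parts) ≤ tokenShare r + β + length (removedOf k)
      tok∈ : ∀ {i} → comp r (ca (D i)) ≡ true → ∀ e → e ∈ cedges (D i) → Covers parts e
      removed∈ : ∀ {e} → e ∈ removedOf k → Covers parts e
      crossed∈ : ∀ {e} → e ∈ removedOf k → ∀ {A g} → cut A e ≡ true → (∀ {e'} → pos e' ≡ true → cut A e' ≡ true → e' ≡ g) → Covers parts g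
      sep∈ : ∀ {A u} → Only A u → comp r (src u) ≡ true → Covers parts u
      β≤ : β ≤ 2 * order r + 2 * negsIn r + sepsIn r
      β+6≤ : 1 ≤ negsIn r → β + 6 ≤ 2 * order r + 2 * negsIn r + sepsIn r
      β-plain : isPlain k ≡ true → suc β ≤ order r

  module _ (r : V) (r∈ : r ∈ roots) where
    open Side r
    open +-*-Solver

    t : Tree r
    t = tree r

    E# : ℕ
    E# = length (tedges t)

    order-E : order r ≡ suc E#
    order-E = length-tverts t

    unsepClosed : Unsep r → ⨁ (λ e → N e ∧ comp r (src e)) ≡ false → Closed (toks t) (Es t) 1 0
    unsepClosed ns h = closePlain (plainRun t (tree-unique r) λ {A} {u} o u∈ → ns o (∈-mem (tverts t) (proj₁ (tedge-ends t u∈ (joins-self u))))) (toks-even r h)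

    closed-size : (C : Closed (toks t) (Es t) 1 0) → sum (map size (Closed.em C)) ≤ tokenShare r + E#
    closed-size C = ≤-trans (Closed.cost C) (≤-trans (≤-reflexive (trans (ℕₚ.+-identityʳ _) (cong (tokenCost (toks t) +_) (trans (ℕₚ.+-identityʳ _) (Es-length t)))))
      (ℕₚ.+-monoˡ-≤ E# (tokenCost-share r (toks t) (unique-toks t (tree-unique r)) λ h → ∈-mem (tverts t) (toks-at t h))))

    closed-tok : (C : Closed (toks t) (Es t) 1 0) → ∀ {i} → comp r (ca (D i)) ≡ true → ∀ e → e ∈ cedges (D i) → Covers (Closed.em C) e
    closed-tok C h = Closed.cov C (at-toks t (mem-∈ (tverts t) h))

    not-removed : removedOf (kind r) ≡ [] → ∀ {e} → comp r (src e) ≡ true → removed e ≡ false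
    not-removed nil c = ≢true⇒false λ h → case subst (_ ∈_) nil (removed-at r∈ c h) of λ ()

    N-plain : removedOf (kind r) ≡ [] → ∀ e → N e ∧ comp r (src e) ≡ σ e ∧ comp r (src e)
    N-plain nil e with bool-cases (comp r (src e))
    ... | inj₁ p = cong (_∧ comp r (src e)) (trans (cong (σ e ∧_) (cong not (not-removed nil p))) (∧-identityʳ (σ e)))
    ... | inj₂ p = trans (∧-falseʳ {N e} p) (sym (∧-falseʳ {σ e} p))

    N-odd : ∀ {e₀} → removedOf (kind r) ≡ e₀ ∷ [] → σ e₀ ≡ true → comp r (src e₀) ≡ true → ∀ e → N e ∧ comp r (src e) ≡ (σ e ∧ comp r (src e)) xor (isV e₀ e ∧ true)
    N-odd {e₀} one σe₀ c₀ e with bool-cases (isV e₀ e)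
    ... | inj₁ p with isV-true p
    ...   | refl = trans (∧-falseˡ (∧-falseʳ {σ e₀} (cong not (∈-mem (removedIn roots) (removedIn⁺ r∈ (subst (e₀ ∈_) (sym one) (here refl)))))))
                     (sym (trans (cong (_xor (isV e₀ e₀ ∧ true)) (∧-intro σe₀ c₀)) (cong not (∧-intro p refl))))
    N-odd {e₀} one σe₀ c₀ e | inj₂ p = trans (same (bool-cases (comp r (src e)))) (sym (trans (cong ((σ e ∧ comp r (src e)) xor_) (∧-falseˡ p)) (xor-identityʳ _)))
      where
        keep : comp r (src e) ≡ true → removed e ≡ false
        keep c = ≢true⇒false λ h → case subst (e ∈_) one (removed-at r∈ c h) of λ { (here q) → isV-≢ p (sym q) }
        same : (comp r (src e) ≡ true) ⊎ (comp r (src e) ≡ false) → N e ∧ comp r (src e) ≡ σ e ∧ comp r (src e)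
        same (inj₁ q) = cong (_∧ comp r (src e)) (trans (cong (σ e ∧_) (cong not (keep q))) (∧-identityʳ (σ e)))
        same (inj₂ q) = trans (∧-falseʳ {N e} q) (sym (∧-falseʳ {σ e} q))

    weaken-bound : ∀ {x y} s → x ≤ y → x ≤ y + s
    weaken-bound s h = ≤-trans h (m≤m+n _ s)

    plainCover : (ns : Unsep r) (even : ⨁ (λ e → σ e ∧ comp r (src e)) ≡ false) → removedOf (kind r) ≡ [] → CompCover r (plain ns even)
    plainCover ns even nil = record
      { parts = Closed.em C ; β = E# ; parts-size = ≤-trans (closed-size C) (m≤m+n _ 0)
      ; tok∈ = closed-tok C ; removed∈ = λ () ; crossed∈ = λ () ; sep∈ = λ o h → ⊥-elim (ns o h)
      ; β≤ = weaken-bound (sepsIn r) (≤-trans (≤-trans (ℕₚ.n≤1+n E#) (≤-trans (≤-reflexive (sym order-E)) (m≤m+n (order r) _))) (m≤m+n (2 * order r) _))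
      -- A positive even number of negative edges is at least two, which provides four of the six
      -- units; the tree provides the other two.
      ; β+6≤ = λ h → weaken-bound (sepsIn r) (≤-trans (many E# (negsIn r) (two≤ (negsIn r) h (trans (count-%2 (λ e → σ e ∧ comp r (src e))) (cong bN even)))) (≤-reflexive (cong (λ z → 2 * z + 2 * negsIn r) (sym order-E))))
      ; β-plain = λ _ → ≤-reflexive (sym order-E) }
      where
        C : Closed (toks t) (Es t) 1 0
        C = unsepClosed ns (trans (⨁-cong (N-plain nil)) even)
        two≤ : ∀ m → 1 ≤ m → m % 2 ≡ 0 → 2 ≤ m
        two≤ (suc (suc m)) _ _ = s≤s (s≤s z≤n)
        many : ∀ a m → 2 ≤ m → a + 6 ≤ 2 * suc a + 2 * m
        many a m h = ≤-trans (≤-trans (m≤m+n (a + 6) a) (≤-reflexive (eq a))) (ℕₚ.+-monoʳ-≤ (2 * suc a) (ℕₚ.*-monoʳ-≤ 2 h))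
          where
            eq : ∀ a → a + 6 + a ≡ 2 * suc a + 2 * 2
            eq = solve 1 (λ a → a :+ con 6 :+ a := con 2 :* (con 1 :+ a) :+ con 4) refl

    -- The signed circuit of the edge set aside has at most `E# + 2` edges, one of which is charged
    -- to that edge. The saving of 6 needs three negative edges: this edge, its mate, and a third by
    -- parity.
    oddCover : (ns : Unsep r) (p : ⨁ (λ e → σ e ∧ comp r (src e)) ≡ true) → ∀ e (σe : σ e ≡ true) (c : comp r (src e) ≡ true) → removedOf (kind r) ≡ e ∷ [] → CompCover r (odd ns p e σe c)
    oddCover ns p e σe c one = record
      { parts = Patch.sc P ∷ Closed.em C ; β = suc (E# + E#)
      ; parts-size = ≤-trans (+-mono-≤ (Patch.size≤ P) (closed-size C)) (≤-reflexive (trans (cong (λ z → suc z + (tokenShare r + E#)) order-E) (regroup (tokenShare r) E#)))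
      ; tok∈ = λ h e' e'∈ → there (closed-tok C h e' e'∈) ; removed∈ = λ { (here refl) → here (Patch.e∈ P) }
      ; crossed∈ = λ { (here refl) {A} {g} x o → here (Patch.bridges∈ P {A} {g} x o) } ; sep∈ = λ o h → ⊥-elim (ns o h)
      ; β≤ = weaken-bound (sepsIn r) (≤-trans (≤-trans (ℕₚ.n≤1+n _) (≤-reflexive (trans (double E#) (cong (2 *_) (sym order-E))))) (m≤m+n (2 * order r) _))
      ; β+6≤ = λ _ → weaken-bound (sepsIn r) (≤-trans (many E# (negsIn r) three) (≤-reflexive (cong (λ z → 2 * z + 2 * negsIn r) (sym order-E))))
      ; β-plain = λ () }
      where
        P : Patch r e
        P = patch r σe c
        C : Closed (toks t) (Es t) 1 0
        C = unsepClosed ns (trans (⨁-cong (N-odd one σe c)) (trans (⨁-⊕ (λ e → σ e ∧ comp r (src e)) (λ g → isV e g ∧ true)) (cong₂ _xor_ p (⨁-at e (λ _ → true)))))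
        regroup : ∀ a b → suc (suc b) + (a + b) ≡ a + suc (b + b) + 1
        regroup = solve 2 (λ a b → con 2 :+ b :+ (a :+ b) := a :+ (con 1 :+ (b :+ b)) :+ con 1) refl
        double : ∀ a → suc (suc (a + a)) ≡ 2 * suc a
        double = solve 1 (λ a → con 2 :+ (a :+ a) := con 2 :* (con 1 :+ a)) refl
        three≤ : ∀ m → 2 ≤ m → m % 2 ≡ 1 → 3 ≤ m
        three≤ (suc (suc zero)) _ ()
        three≤ (suc (suc (suc m))) _ _ = s≤s (s≤s (s≤s z≤n))
        three≤ (suc zero) (s≤s ()) _
        three : 3 ≤ negsIn r
        three = let (f , f≢e , σf , same) = mate {comp r} (comp-closed r) σe in
          three≤ (negsIn r) (count-two (λ e → σ e ∧ comp r (src e)) f≢e (∧-intro σf (trans same c)) (∧-intro σe c)) (trans (count-%2 (λ e → σ e ∧ comp r (src e))) (cong bN p))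
        many : ∀ a m → 3 ≤ m → suc (a + a) + 6 ≤ 2 * suc a + 2 * m
        many a m h = ≤-trans (≤-trans (ℕₚ.n≤1+n _) (≤-reflexive (eq a))) (ℕₚ.+-monoʳ-≤ (2 * suc a) (ℕₚ.*-monoʳ-≤ 2 h))
          where
            eq : ∀ a → suc (suc (a + a) + 6) ≡ 2 * suc a + 2 * 3
            eq = solve 1 (λ a → con 1 :+ (con 1 :+ (a :+ a) :+ con 6) := con 2 :* (con 1 :+ a) :+ con 6) refl

    -- A signed circuit through the separator forces a negative edge on the given side. Nothing is
    -- set aside in this component, so this edge lies in `S₁`: either in a token on that side, or in
    -- a balanced circuit, which has a second negative edge there.
    supply : removedOf (kind r) ≡ [] → Supply
    supply nil {A} {u} {v} {c} o j v∈ c∈ = from (both-sides {comp r} (comp-closed r) {A} {u} (Only.cuts o) (λ {e'} → Only.sole o {e'}) (A c))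
      where
        u∈ : comp r (src u) ≡ true
        u∈ = case joins-ends j (joins-self u) of λ { (inj₁ (p , _)) → subst (λ x → comp r x ≡ true) (sym p) v∈ ; (inj₂ (p , _)) → subst (λ x → comp r x ≡ true) (sym p) c∈ }
        side : ∀ {f} → σ f ≡ true → comp r (src f) ≡ true → A (src f) ≡ A c → SideNeg A c f
        side {f} σf cf af = σf , (cf , comp-tgt r cf) , (af , trans (sym (only-same o (λ { refl → neg-pos σf (sep-pos o) }) (joins-self f))) af)
        from : (Σ E λ f → σ f ≡ true × comp r (src f) ≡ comp r (src u) × A (src f) ≡ A c) →
          Σ E λ f → SideNeg A c f × ((Σ (Fin (length T₁.ds)) λ i → comp r (ca (D i)) ≡ true × A (ca (D i)) ≡ A c) ⊎ Σ E λ f' → f' ≢ f × SideNeg A c f')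
        from (f , σf , same , af) = f , side σf cf af , by (T₁.cover f∈)
          where
            cf : comp r (src f) ≡ true
            cf = trans same u∈
            f∈ : S₁ f ≡ true
            f∈ = xor-trueˡ (∧-intro σf (not-intro (not-removed nil cf))) (≢true⇒false λ h → neg-pos σf (J⊆ h))
            inC : ∀ {C x} → f ∈ cedges C → x ∈ cverts C → comp r x ≡ true × A x ≡ A c
            inC {C} f∈C x∈ = trans (sym (edge-in (comp r) (comp-closed r) C f∈C x∈)) cf , trans (only-cyc C o x∈ (proj₁ (cedge-ends C f∈C (joins-self f)))) af
            by : (Σ Cyc λ C → (C ∈ T₁.bs ⊎ C ∈ T₁.ds) × f ∈ cedges C) →
              (Σ (Fin (length T₁.ds)) λ i → comp r (ca (D i)) ≡ true × A (ca (D i)) ≡ A c) ⊎ Σ E λ f' → f' ≢ f × SideNeg A c f'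
            by (C , inj₁ C∈ , f∈C) = let (f' , f'∈ , ne , σf') = par-other σ (cedges C) (trans (par-σ C) (T₁.bal C∈)) f∈C σf (cedges-unique C)
                                         (cf' , af') = inC {C} f∈C (proj₁ (cedge-ends C f'∈ (joins-self f'))) in inj₂ (f' , ne , side σf' cf' af')
              where open FromCircuit G
            by (C , inj₂ C∈ , f∈C) = inj₁ (index C∈ , subst (λ C → comp r (ca C) ≡ true × A (ca C) ≡ A c) (lookup-index C∈) (inC {C} f∈C (start∈ (cpath C))))

-- Components with a separator.

module SplitCover (G : SignedGraph) {ε : ℕ} (S : Setup G ε) (sb : SBridgeless G) (v₀ : Fin (nV G)) where
  open Walks G
  open Cycles G
  open Decompose G
  open Setup S
  open Components G S
  open CompCovers G S sb v₀
  open Separators G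
  open Joining G D D-odd D-compat
  open Run G S D D-odd D-compat

  mapRT : ∀ {P Q : E → Set} → (∀ {e} → P e → Q e) → ∀ {v} → RT P v → RT Q v
  mapRT h (leaf v) = leaf v
  mapRT h (graft t e p j t') = graft (mapRT h t) e (h p) j (mapRT h t')

  mapRT-verts : ∀ {P Q : E → Set} (h : ∀ {e} → P e → Q e) {v} (t : RT P v) → tverts (mapRT {P} {Q} h t) ≡ tverts t
  mapRT-verts h (leaf v) = refl
  mapRT-verts h (graft t e p j t') = cong₂ _++_ (mapRT-verts h t) (mapRT-verts h t')

  mapRT-edges : ∀ {P Q : E → Set} (h : ∀ {e} → P e → Q e) {v} (t : RT P v) → tedges (mapRT {P} {Q} h t) ≡ tedges t
  mapRT-edges h (leaf v) = refl
  mapRT-edges h (graft t e p j t') = cong (e ∷_) (cong₂ _++_ (mapRT-edges h t) (mapRT-edges h t'))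

  -- The component is spanned anew by two trees rooted at the ends of a separator. The joining then
  -- finishes across that separator, where every two tokens from opposite sides are compatible.
  half : ∀ u x → Tree x
  half u x = mapRT (λ {e} → delete-⊆ {pos} {u} {e}) (Reach.tree (reach (delete pos u) x))

  half-unique : ∀ u x → Unique (tverts (half u x))
  half-unique u x = subst Unique (sym (mapRT-verts _ (Reach.tree (reach (delete pos u) x)))) (Reach.uniq (reach (delete pos u) x))

  half-avoids : ∀ u x → u ∉ tedges (half u x)
  half-avoids u x h = delete-≢ {pos} (tedges-P (Reach.tree (reach (delete pos u) x)) (subst (u ∈_) (mapRT-edges _ (Reach.tree (reach (delete pos u) x))) h)) refl

  half-closed : ∀ u x {e a b} → pos e ≡ true → e ≢ u → Joins G e a b → a ∈ tverts (half u x) → b ∈ tverts (half u x)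
  half-closed u x p ne j h = subst (_ ∈_) (sym eq) (Reach.closed R (delete-in {pos} p ne) j (subst (_ ∈_) eq h))
    where
      R : Reach (delete pos u) x
      R = reach (delete pos u) x
      eq : tverts (half u x) ≡ tverts (Reach.tree R)
      eq = mapRT-verts _ (Reach.tree R)

  halves : ∀ {u v c} → Joins G u v c → ∀ {a b} → Walk G (In pos) a b → (a ∈ tverts (half u v)) ⊎ (a ∈ tverts (half u c)) → (b ∈ tverts (half u v)) ⊎ (b ∈ tverts (half u c))
  halves j here h = h
  halves {u} {v} {c} j (wstep {a} {b} e p k w) h with e ≟ u
  ... | no ne = halves j w (case h of λ { (inj₁ q) → inj₁ (half-closed u v p ne k q) ; (inj₂ q) → inj₂ (half-closed u c p ne k q) })
  ... | yes refl = halves j w (case joins-ends j k of λ { (inj₁ (_ , q)) → inj₂ (subst (_∈ tverts (half u c)) (sym q) (root∈ (half u c))) ; (inj₂ (_ , q)) → inj₁ (subst (_∈ tverts (half u v)) (sym q) (root∈ (half u v))) })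

  module _ (r : V) (r∈ : r ∈ roots) {A : VS} {u : E} (o : Only A u) (u∈ : comp r (src u) ≡ true) (nil : removedOf (kind r) ≡ []) where
    open Side r

    module Half {v c : V} (j : Joins G u v c) (v∈ : comp r v ≡ true) (c∈ : comp r c ≡ true) where
      same-v : ∀ {x} → x ∈ tverts (half u v) → A x ≡ A v
      same-v h = inTree-same (half u v) h o (half-avoids u v)
      same-c : ∀ {x} → x ∈ tverts (half u c) → A x ≡ A c
      same-c h = inTree-same (half u c) h o (half-avoids u c)

      apart : ∀ {x} → x ∈ tverts (half u v) → x ∈ tverts (half u c) → ⊥
      apart h k = only-≢ o j (trans (sym (same-v h)) (same-c k))

      located : ∀ {x} → comp r x ≡ true → (x ∈ tverts (half u v)) ⊎ (x ∈ tverts (half u c))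
      located h = halves j (toComp r v∈ ⟫ rev (toComp r h)) (inj₁ (root∈ (half u v)))

      inside-c : ∀ {x} → x ∈ tverts (half u c) → comp r x ≡ true
      inside-c h = trans (comp-walk r (weaken (tedges-P (half u c)) (toRoot (half u c) h))) c∈

      ctx : Ctx (half u c)
      ctx {x} w x∉ {A'} {u'} o' h = case located w of λ
        { (inj₂ q) → ⊥-elim (x∉ q)
        ; (inj₁ q) → trans (inTree-same (half u v) q o' λ k → apart (proj₁ (tedge-ends (half u v) k (joins-self u'))) (proj₁ (tedge-ends (half u c) h (joins-self u'))))
            (only-same o' (λ { refl → half-avoids u c h }) j) }

      loose : Loose c (toks (half u c)) (Es (half u c)) (negs (half u c))
      loose = sideLoose (supply r r∈ nil) (half u c) o j v∈ c∈
        (λ w q → case located w of λ { (inj₂ h) → h ; (inj₁ h) → ⊥-elim (only-≢ o j (trans (sym (same-v h)) q)) })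
        (run (supply r r∈ nil) (half u c) (half-unique u c) inside-c ctx)

    v₁ v₂ : V
    v₁ = src u
    v₂ = tgt u
    v₂∈ : comp r v₂ ≡ true
    v₂∈ = comp-tgt r u∈
    module Far = Half {v₁} {v₂} (joins-self u) u∈ v₂∈
    module Near = Half {v₂} {v₁} (joins-sym (joins-self u)) v₂∈ u∈

    joined : Tree v₁
    joined = graft (half u v₁) u (sep-pos o) (joins-self u) (half u v₂)

    joined-unique : Unique (tverts joined)
    joined-unique = unique-++ (half-unique u v₁) (half-unique u v₂) Far.apart

    joined-in : ∀ {x} → x ∈ tverts joined → comp r x ≡ true
    joined-in h = case ∈-++⁻ (tverts (half u v₁)) h of λ { (inj₁ q) → Near.inside-c q ; (inj₂ q) → Far.inside-c q }

    joined-order : suc (length (tedges joined)) ≤ order r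
    joined-order = ≤-trans (≤-reflexive (sym (length-tverts joined))) (unique-⊆-length (tverts joined) (tverts (tree r)) joined-unique λ h → mem-∈ (tverts (tree r)) (joined-in h))

    negs-total : negs (half u v₂) + negs (half u v₁) ≤ negsIn r
    negs-total = ≤-trans (≤-reflexive (+-comm (negs (half u v₂)) _)) (≤-trans (negs-graft (half u v₁) u (sep-pos o) (joins-self u) (half u v₂) joined-unique)
      (count-mono λ f h → ∧-intro (∧-left h) (joined-in (mem-∈ (tverts joined) (∧-right {σ f} h)))))

    crossing-edges : Disjoint (u ∷ Es (half u v₂)) (Es (half u v₁))
    crossing-edges (here refl) k = half-avoids u v₁ (Es⇒ (half u v₁) k)
    crossing-edges {e} (there h) k = Far.apart (proj₁ (tedge-ends (half u v₁) (Es⇒ (half u v₁) k) (joins-self e))) (proj₁ (tedge-ends (half u v₂) (Es⇒ (half u v₂) h) (joins-self e)))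

    I : List (Fin _)
    I = toks (half u v₂) ++ toks (half u v₁)

    L : List E
    L = (u ∷ Es (half u v₂)) ++ Es (half u v₁)

    I-unique : Unique I
    I-unique = unique-++ (unique-toks (half u v₂) (half-unique u v₂)) (unique-toks (half u v₁) (half-unique u v₁)) λ h k → Far.apart (toks-at (half u v₁) k) (toks-at (half u v₂) h)

    I-in : ∀ {i} → i ∈ I → comp r (ca (D i)) ≡ true
    I-in h = case ∈-++⁻ (toks (half u v₂)) h of λ { (inj₁ q) → Far.inside-c (toks-at (half u v₂) q) ; (inj₂ q) → Near.inside-c (toks-at (half u v₁) q) }

    in-I : ∀ {i} → comp r (ca (D i)) ≡ true → i ∈ I
    in-I c = case Far.located c of λ { (inj₁ q) → ∈-++⁺ʳ (toks (half u v₂)) (at-toks (half u v₁) q) ; (inj₂ q) → ∈-++⁺ˡ (at-toks (half u v₂) q) }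

    L-order : suc (length L) ≤ order r
    L-order = ≤-trans (s≤s (≤-reflexive (cong suc (trans (length-++ (Es (half u v₂))) (trans (cong₂ _+_ (Es-length (half u v₂)) (Es-length (half u v₁))) (trans (+-comm (length (tedges (half u v₂))) _) (sym (length-++ (tedges (half u v₁))))))))))
      joined-order

    in-L : ∀ {A' u'} → Only A' u' → comp r (src u') ≡ true → u' ∈ L
    in-L {A'} {u'} o' c = by (u' ∈?ₗ L)
      where
        by : (u' ∈ L) ⊎ (u' ∉ L) → u' ∈ L
        by (inj₁ h) = h
        by (inj₂ h) = ⊥-elim (only-≢ o' (joins-self u') (trans (near c) (sym (near (comp-tgt r c)))))
          where
            near : ∀ {x} → comp r x ≡ true → A' x ≡ A' v₁
            near w = case Far.located w of λ
              { (inj₁ q) → inTree-same (half u v₁) q o' λ k → h (∈-++⁺ʳ (u ∷ Es (half u v₂)) (⇒Es (half u v₁) k))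
              ; (inj₂ q) → trans (inTree-same (half u v₂) q o' λ k → h (there (∈-++⁺ˡ (⇒Es (half u v₂) k)))) (sym (only-same o' (λ { refl → h (here refl) }) (joins-self u))) }

    splitCover : CompCover r (split o u∈)
    splitCover = from (closeSides Far.loose Near.loose (joins-self u) o (λ h → half-avoids u v₂ (Es⇒ (half u v₂) h)) (λ h → half-avoids u v₁ (Es⇒ (half u v₁) h)) crossing-edges)
      where
        seps≥1 : 1 ≤ sepsIn r
        seps≥1 = count-pos (λ e → U e ∧ comp r (src e)) {u} (∧-intro (only-U o) u∈)
        from : (Σ ℕ λ x → Closed I L 2 x × suc x ≤ negs (half u v₂) + negs (half u v₁) × 2 ≤ negs (half u v₂) + negs (half u v₁)) → CompCover r (split o u∈)
        from (x , C , x≤ , m≥2) = record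
          { parts = Closed.em C ; β = 2 * length L + x
          ; parts-size = ≤-trans (Closed.cost C) (≤-trans (≤-reflexive (+-assoc (tokenCost I) (2 * length L) x)) (≤-trans (ℕₚ.+-monoˡ-≤ (2 * length L + x) (tokenCost-share r I I-unique I-in)) (m≤m+n _ 0)))
          ; tok∈ = λ h → Closed.cov C (in-I h) ; removed∈ = λ () ; crossed∈ = λ ()
          ; sep∈ = λ o' h → Closed.sep C o' (in-L o' h)
          ; β≤ = ≤-trans (m≤m+n _ 6) big ; β+6≤ = λ _ → big ; β-plain = λ () }
          where
            -- The six units: two from the tree having one edge fewer than vertices, one from the
            -- extra staying below the number of negative edges, two from the second copy of that
            -- number, and one from the separator.
            arith : ∀ l x v m s → suc l ≤ v → suc x ≤ m → 2 ≤ m → 1 ≤ s → 2 * l + x + 6 ≤ 2 * v + 2 * m + s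
            arith l x v m s p q h k = ≤-trans (≤-reflexive (eq₁ l x)) (≤-trans (+-mono-≤ (+-mono-≤ (ℕₚ.*-monoʳ-≤ 2 p) (+-mono-≤ q h)) k) (≤-reflexive (cong (λ z → 2 * v + z + s) (eq₂ m))))
              where
                open +-*-Solver
                eq₁ : ∀ l x → 2 * l + x + 6 ≡ 2 * suc l + (suc x + 2) + 1
                eq₁ = solve 2 (λ l x → con 2 :* l :+ x :+ con 6 := con 2 :* (con 1 :+ l) :+ ((con 1 :+ x) :+ con 2) :+ con 1) refl
                eq₂ : ∀ m → m + m ≡ 2 * m
                eq₂ = solve 1 (λ m → m :+ m := con 2 :* m) refl
            big : 2 * length L + x + 6 ≤ 2 * order r + 2 * negsIn r + sepsIn r
            big = arith (length L) x (order r) (negsIn r) (sepsIn r) L-order (≤-trans x≤ negs-total) (≤-trans m≥2 negs-total) seps≥1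

  cover-raw : ∀ r → r ∈ roots → CompCover r (kind r)
  cover-raw r r∈ = by (kind r) refl
    where
      by : ∀ k → kind r ≡ k → CompCover r k
      by (plain ns p) q = plainCover r r∈ ns p (cong removedOf q)
      by (odd ns p e σe c) q = oddCover r r∈ ns p e σe c (cong removedOf q)
      by (split o c) q = splitCover r r∈ o c (cong removedOf q)

  abstract
    compCover : ∀ r → r ∈ roots → CompCover r (kind r)
    compCover = cover-raw

-- The whole cover: every edge is covered, and the total length.

module Assembly (G : SignedGraph) {ε : ℕ} (S : Setup G ε) (sb : SBridgeless G) (v₀ : Fin (nV G)) where
  open Walks G
  open Cycles G
  open Decompose G
  open Setup S
  open Components G S
  open Base G S using (module BaseCover)
  open CompCovers G S sb v₀
  open BaseCover base
  open SplitCover G S sb v₀ using (compCover)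
  open Separators G
  open Joining G D D-odd D-compat using (Covers)

  AllBalanced : List Cyc → Set
  AllBalanced cs = ∀ {C} → C ∈ cs → par (neg G) (cedges C) ≡ false

  balancedAll : ∀ cs → AllBalanced cs → List (SignedCircuit G)
  balancedAll [] h = []
  balancedAll (C ∷ cs) h = balancedSC C (h (here refl)) ∷ balancedAll cs (h ∘ there)

  balancedAll-size : ∀ cs (h : AllBalanced cs) → sum (map size (balancedAll cs h)) ≡ sum (map clen cs)
  balancedAll-size [] h = refl
  balancedAll-size (C ∷ cs) h = cong (clen C +_) (balancedAll-size cs (h ∘ there))

  balancedAll-covers : ∀ cs (h : AllBalanced cs) {C e} → C ∈ cs → e ∈ cedges C → Covers (balancedAll cs h) e
  balancedAll-covers (C ∷ cs) h (here refl) q = here (∈-edgeOfC C q)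
  balancedAll-covers (C ∷ cs) h (there p) q = there (balancedAll-covers cs (h ∘ there) p q)

  module Positive (K : ES) (K-even : Even K) (K⊆ : ∀ {e} → K e ≡ true → E₀ e ≡ true) where
    d : Decomp K
    d = decompose K K-even

    bal : ∀ {C} → C ∈ Decomp.cs d → par (neg G) (cedges C) ≡ false
    bal {C} h = trans (sym (par-σ C)) (par-false (cedges C) λ e q → not-true (E₀-pos (K⊆ (Decomp.inS d h q))))

    circuits : List (SignedCircuit G)
    circuits = balancedAll (Decomp.cs d) bal

    circuits-size : sum (map size circuits) ≡ count K
    circuits-size = trans (balancedAll-size (Decomp.cs d) bal) (Decomp.total d)

    circuits-cover : ∀ {e} → K e ≡ true → Covers circuits e
    circuits-cover k = let (C , p , q) = Decomp.cover d k in balancedAll-covers (Decomp.cs d) bal p q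

  module P₁ = Positive K₁ even₁ in₁
  module P₂ = Positive K₂ even₂ in₂
  module P₃ = Positive K₃ even₃ in₃

  AllRoots : List V → Set
  AllRoots rs = ∀ {r} → r ∈ rs → r ∈ roots

  compParts : ∀ rs → AllRoots rs → List (SignedCircuit G)
  compParts [] h = []
  compParts (r ∷ rs) h = CompCover.parts (compCover r (h (here refl))) ++ compParts rs (h ∘ there)

  βs : ∀ rs → AllRoots rs → ℕ
  βs [] h = 0
  βs (r ∷ rs) h = CompCover.β (compCover r (h (here refl))) + βs rs (h ∘ there)

  removed# : V → ℕ
  removed# r = length (removedOf (kind r))

  compParts-size : ∀ rs (h : AllRoots rs) → sum (map size (compParts rs h)) ≤ sum (map tokenShare rs) + βs rs h + sum (map removed# rs)
  compParts-size [] h = z≤n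
  compParts-size (r ∷ rs) h = ≤-trans (≤-reflexive (trans (cong sum (map-++ size (CompCover.parts c) _)) (sum-++ (map size (CompCover.parts c)) _)))
      (≤-trans (+-mono-≤ (CompCover.parts-size c) (compParts-size rs (h ∘ there))) (≤-reflexive (regroup (tokenShare r) (CompCover.β c) (removed# r) (sum (map tokenShare rs)) (βs rs (h ∘ there)) (sum (map removed# rs)))))
    where
      open +-*-Solver
      c : CompCover r (kind r)
      c = compCover r (h (here refl))
      regroup : ∀ a b c a' b' c' → a + b + c + (a' + b' + c') ≡ a + a' + (b + b') + (c + c')
      regroup = solve 6 (λ a b c a' b' c' → a :+ b :+ c :+ (a' :+ b' :+ c') := a :+ a' :+ (b :+ b') :+ (c :+ c')) refl

  weight : List V → ℕ
  weight rs = 2 * sum (map order rs) + 2 * sum (map negsIn rs) + sum (map sepsIn rs)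

  weight-∷ : ∀ r rs → 2 * order r + 2 * negsIn r + sepsIn r + weight rs ≡ weight (r ∷ rs)
  weight-∷ r rs = solve 6 (λ a b c a' b' c' → con 2 :* a :+ con 2 :* b :+ c :+ (con 2 :* a' :+ con 2 :* b' :+ c') := con 2 :* (a :+ a') :+ con 2 :* (b :+ b') :+ (c :+ c')) refl
      (order r) (negsIn r) (sepsIn r) (sum (map order rs)) (sum (map negsIn rs)) (sum (map sepsIn rs))
    where open +-*-Solver

  βs-≤ : ∀ rs (h : AllRoots rs) → βs rs h ≤ weight rs
  βs-≤ [] h = z≤n
  βs-≤ (r ∷ rs) h = ≤-trans (+-mono-≤ (CompCover.β≤ (compCover r (h (here refl)))) (βs-≤ rs (h ∘ there))) (≤-reflexive (weight-∷ r rs))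

  βs+6≤ : ∀ rs (h : AllRoots rs) {r} → r ∈ rs → 1 ≤ negsIn r → βs rs h + 6 ≤ weight rs
  βs+6≤ (r ∷ rs) h (here refl) m = ≤-trans (≤-reflexive (swap (CompCover.β c) (βs rs (h ∘ there)))) (≤-trans (+-mono-≤ (CompCover.β+6≤ c m) (βs-≤ rs (h ∘ there))) (≤-reflexive (weight-∷ r rs)))
    where
      open +-*-Solver
      c : CompCover r (kind r)
      c = compCover r (h (here refl))
      swap : ∀ a b → a + b + 6 ≡ a + 6 + b
      swap = solve 2 (λ a b → a :+ b :+ con 6 := a :+ con 6 :+ b) refl
  βs+6≤ (r ∷ rs) h (there p) m = ≤-trans (≤-reflexive (+-assoc (CompCover.β c) _ 6)) (≤-trans (+-mono-≤ (CompCover.β≤ c) (βs+6≤ rs (h ∘ there) p m)) (≤-reflexive (weight-∷ r rs)))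
    where
      c : CompCover r (kind r)
      c = compCover r (h (here refl))

  βs-plain : (∀ r → isPlain (kind r) ≡ true) → ∀ rs (h : AllRoots rs) → βs rs h + length rs ≤ sum (map order rs)
  βs-plain pl [] h = z≤n
  βs-plain pl (r ∷ rs) h = ≤-trans (≤-reflexive (swap (CompCover.β c) (βs rs (h ∘ there)) (length rs))) (+-mono-≤ (CompCover.β-plain c (pl r)) (βs-plain pl rs (h ∘ there)))
    where
      open +-*-Solver
      c : CompCover r (kind r)
      c = compCover r (h (here refl))
      swap : ∀ a b l → a + b + suc l ≡ suc a + (b + l)
      swap = solve 3 (λ a b l → a :+ b :+ (con 1 :+ l) := con 1 :+ a :+ (b :+ l)) refl

  compParts-∈ : ∀ rs (h : AllRoots rs) {r} → (p : r ∈ rs) → ∀ {e} → (∀ r∈ → Covers (CompCover.parts (compCover r r∈)) e) → Covers (compParts rs h) e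
  compParts-∈ (r ∷ rs) h (here refl) c = ++⁺ˡ (c (h (here refl)))
  compParts-∈ (r ∷ rs) h (there p) c = ++⁺ʳ (CompCover.parts (compCover r (h (here refl)))) (compParts-∈ rs (h ∘ there) p c)

  β : ℕ
  β = βs roots id

  comps balancedTokens : List (SignedCircuit G)
  comps = compParts roots id
  balancedTokens = balancedAll T₁.bs T₁.bal

  all : List (SignedCircuit G)
  all = balancedTokens ++ (P₁.circuits ++ (P₂.circuits ++ P₃.circuits)) ++ comps

  comps∈ : ∀ {e} → Covers comps e → Covers all e
  comps∈ c = ++⁺ʳ balancedTokens (++⁺ʳ (P₁.circuits ++ (P₂.circuits ++ P₃.circuits)) c)

  covered-S₁ : ∀ {e} → S₁ e ≡ true → Covers all e
  covered-S₁ {e} h = by (T₁.cover h)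
    where
      by : (Σ Cyc λ C → (C ∈ T₁.bs ⊎ C ∈ T₁.ds) × e ∈ cedges C) → Covers all e
      by (C , inj₁ p , q) = ++⁺ˡ (balancedAll-covers T₁.bs T₁.bal p q)
      by (C , inj₂ p , q) = let (r , r∈ , c) = rootOf (ca (D (index p))) in
        comps∈ (compParts-∈ roots id r∈ λ r∈' → CompCover.tok∈ (compCover r r∈') c e (subst (λ C → e ∈ cedges C) (lookup-index p) q))

  covered-removed : ∀ {e} → removed e ≡ true → Covers all e
  covered-removed h = let (r , r∈ , p) = removed-root h in comps∈ (compParts-∈ roots id r∈ λ r∈' → CompCover.removed∈ (compCover r r∈') p)

  covered-neg : ∀ {e} → σ e ≡ true → Covers all e
  covered-neg {e} s with bool-cases (removed e)
  ... | inj₁ h = covered-removed h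
  ... | inj₂ h = covered-S₁ (xor-trueˡ (∧-intro s (not-intro h)) (≢true⇒false λ j → neg-pos s (J⊆ j)))

  N-pos : ∀ {e} → pos e ≡ true → N e ≡ false
  N-pos p = ∧-falseˡ (not-true p)

  covered-E₀ : ∀ {e} → E₀ e ≡ true → Covers all e
  covered-E₀ {e} h = by (∨-split {J e} (cover h))
    where
      K∈ : Covers (P₁.circuits ++ (P₂.circuits ++ P₃.circuits)) e → Covers all e
      K∈ c = ++⁺ʳ balancedTokens (++⁺ˡ c)
      by : (J e ≡ true) ⊎ (K₁ e ∨ (K₂ e ∨ K₃ e) ≡ true) → Covers all e
      by (inj₁ j) = covered-S₁ (xor-trueʳ (N-pos (E₀-pos h)) j)
      by (inj₂ k) = case ∨-split {K₁ e} k of λ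
        { (inj₁ p) → K∈ (++⁺ˡ (P₁.circuits-cover p))
        ; (inj₂ k') → case ∨-split {K₂ e} k' of λ
            { (inj₁ p) → K∈ (++⁺ʳ P₁.circuits (++⁺ˡ (P₂.circuits-cover p))) ; (inj₂ p) → K∈ (++⁺ʳ P₁.circuits (++⁺ʳ P₂.circuits (P₃.circuits-cover p))) } }

  -- If a negative edge crosses the cut of the bridge and was set aside, its own signed circuit
  -- contains `g`. If it was not, the even set `S₁` meets the cut a second time, and this can only
  -- be at `g`, since one negative edge at most crosses. If no negative edge crosses, `g` is a
  -- separator.
  covered-bridge : ∀ {g A} → pos g ≡ true → cut A g ≡ true → (∀ {e'} → pos e' ≡ true → cut A e' ≡ true → e' ≡ g) → Covers all g
  covered-bridge {g} {A} p c sole' = by (search (λ h → σ h ∧ cut A h))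
    where
      partner : ∀ {h} → σ h ≡ true → cut A h ≡ true → (∃ λ e' → e' ≢ h × S₁ e' ≡ true × cut A e' ≡ true) → Covers all g
      partner {h} σh ch (e' , ne , s , c') = from (bool-cases (σ e'))
        where
          from : (σ e' ≡ true) ⊎ (σ e' ≡ false) → Covers all g
          from (inj₁ q) = ⊥-elim (ne (one-neg {A} {g} sole' q c' σh ch))
          from (inj₂ q) = covered-S₁ (subst (λ z → S₁ z ≡ true) (sole' (not-intro q) c') s)
      by : (∃ λ h → σ h ∧ cut A h ≡ true) ⊎ (∀ h → σ h ∧ cut A h ≡ false) → Covers all g
      by (inj₁ (h , q)) = from (bool-cases (removed h))
        where
          from : (removed h ≡ true) ⊎ (removed h ≡ false) → Covers all g
          from (inj₁ k) = let (r , r∈ , p) = removed-root k in comps∈ (compParts-∈ roots id r∈ λ r∈' → CompCover.crossed∈ (compCover r r∈') p {A} {g} (∧-right {σ h} q) sole')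
          from (inj₂ k) = partner {h} (∧-left q) (∧-right {σ h} q)
            (even-second {S₁} J-even A (xor-trueˡ (∧-intro (∧-left {σ h} q) (not-intro k)) (≢true⇒false λ j → neg-pos {h} (∧-left {σ h} q) (J⊆ j))) (∧-right {σ h} q))
      by (inj₂ none) = let (r , r∈ , k) = rootOf (src g) in comps∈ (compParts-∈ roots id r∈ λ r∈' → CompCover.sep∈ (compCover r r∈') {A} only k)
        where
          only : Only A g
          only = mkOnly c λ {e'} c' → sole' (not-intro (≢true⇒false λ s → absurd (∧-intro s c') (none e'))) c'

  covered : ∀ g → Covers all g
  covered g with bool-cases (σ g)
  ... | inj₁ s = covered-neg s
  ... | inj₂ s with bool-cases (E₀ g)
  ...   | inj₁ h = covered-E₀ h
  ...   | inj₂ h = let (A , c , o) = bridge (not-intro s) h in covered-bridge {g} {A} (not-intro s) c o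

  scCover : SCCover G
  scCover = record { members = all ; covers = covered }

  sumF-lookup : ∀ {X : Set} (f : X → ℕ) l → sumF (λ i → f (Data.List.lookup l i)) ≡ sum (map f l)
  sumF-lookup f [] = refl
  sumF-lookup f (x ∷ l) = cong (f x +_) (sumF-lookup f l)

  sum-map-mono : ∀ {f g : V → ℕ} → (∀ r → f r ≤ g r) → ∀ l → sum (map f l) ≤ sum (map g l)
  sum-map-mono h [] = z≤n
  sum-map-mono h (r ∷ l) = +-mono-≤ (h r) (sum-map-mono h l)

  removed-total : sum (map removed# roots) ≤ count removed
  removed-total = ≤-trans (go roots id) (count-share-sum src removed)
    where
      one : ∀ {r} → r ∈ roots → (k : Kind r) → kind r ≡ k → length (removedOf k) ≤ count (λ e → removed e ∧ comp r (src e))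
      one r∈ (plain _ _) q = z≤n
      one r∈ (split _ _) q = z≤n
      one {r} r∈ (odd _ _ e σe c) q = count-pos (λ e → removed e ∧ comp r (src e)) {e} (∧-intro (∈-mem (removedIn roots) (removedIn⁺ r∈ (subst (λ k → e ∈ removedOf k) (sym q) (here refl)))) c)
      go : ∀ rs → AllRoots rs → sum (map removed# rs) ≤ sum (map (λ r → count (λ e → removed e ∧ comp r (src e))) rs)
      go [] h = z≤n
      go (r ∷ rs) h = +-mono-≤ (one (h (here refl)) (kind r) refl) (go rs (h ∘ there))

  N+removed : count N + count removed ≤ ε
  N+removed = ≤-trans (≤-reflexive (sym (count-∨-disjoint N removed λ e h → not-true (∧-right {σ e} h))))
    (≤-trans (count-mono {f = λ e → N e ∨ removed e} {σ} λ e h → case ∨-split {N e} h of λ { (inj₁ p) → ∧-left p ; (inj₂ p) → removed⊆σ p }) (≤-reflexive σ-count))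

  tokens-total : sum (map clen T₁.bs) + sum (map tokenShare roots) ≤ count N + count J
  tokens-total = ≤-trans (ℕₚ.+-monoʳ-≤ (sum (map clen T₁.bs)) (≤-trans (share-sum (ca ∘ D) (clen ∘ D)) (≤-reflexive (sumF-lookup clen T₁.ds))))
    (≤-trans (≤-reflexive T₁.total) (≤-trans (count-mono {f = S₁} {λ e → N e ∨ J e} λ e h → case xor-split {N e} h of λ { (inj₁ (p , _)) → ∨-left p ; (inj₂ (_ , p)) → ∨-right {N e} p }) (count-∨ N J)))

  -- The circuits of `N ⊕ J` have at most `count N + count J` edges, and the edges set aside
  -- contribute the units that complete `count N` to at most `ε`.
  total-length : coverLength scCover ≤ cost + ε + β
  total-length = ≤-trans (≤-reflexive split-sum) (≤-trans (ℕₚ.+-monoʳ-≤ (sum (map clen T₁.bs) + (count K₁ + (count K₂ + count K₃))) (compParts-size roots id))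
      (arith (sum (map clen T₁.bs)) (count K₁) (count K₂ + count K₃) (sum (map tokenShare roots)) β (sum (map removed# roots)) (count N) (count J) ε tokens-total
        (≤-trans (ℕₚ.+-monoʳ-≤ (count N) removed-total) N+removed)))
    where
      s++ : ∀ k l → sum (map size (k ++ l)) ≡ sum (map (size {G}) k) + sum (map size l)
      s++ k l = trans (cong sum (map-++ size k l)) (sum-++ (map size k) (map size l))
      split-sum : sum (map size all) ≡ sum (map clen T₁.bs) + (count K₁ + (count K₂ + count K₃)) + sum (map size comps)
      split-sum = trans (s++ balancedTokens _) (trans (cong₂ _+_ (balancedAll-size T₁.bs T₁.bal) (trans (s++ (P₁.circuits ++ (P₂.circuits ++ P₃.circuits)) comps) (cong (_+ sum (map size comps))
        (trans (s++ P₁.circuits _) (cong₂ _+_ P₁.circuits-size (trans (s++ P₂.circuits P₃.circuits) (cong₂ _+_ P₂.circuits-size P₃.circuits-size)))))))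
        (sym (+-assoc (sum (map clen T₁.bs)) _ _)))
      arith : ∀ b k₁ k tk β rm n j ε → b + tk ≤ n + j → n + rm ≤ ε → b + (k₁ + k) + (tk + β + rm) ≤ j + k₁ + k + ε + β
      arith b k₁ k tk β rm n j ε p q = ≤-trans (≤-reflexive (e₁ b k₁ k tk β rm)) (≤-trans (ℕₚ.+-monoˡ-≤ (k₁ + k + β + rm) p) (≤-trans (≤-reflexive (e₂ n j k₁ k β rm)) (≤-trans (ℕₚ.+-monoˡ-≤ (j + k₁ + k + β) q) (≤-reflexive (e₃ ε j k₁ k β)))))
        where
          open +-*-Solver
          e₁ : ∀ b k₁ k tk β rm → b + (k₁ + k) + (tk + β + rm) ≡ b + tk + (k₁ + k + β + rm)
          e₁ = solve 6 (λ b k₁ k tk β rm → b :+ (k₁ :+ k) :+ (tk :+ β :+ rm) := b :+ tk :+ (k₁ :+ k :+ β :+ rm)) refl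
          e₂ : ∀ n j k₁ k β rm → n + j + (k₁ + k + β + rm) ≡ n + rm + (j + k₁ + k + β)
          e₂ = solve 6 (λ n j k₁ k β rm → n :+ j :+ (k₁ :+ k :+ β :+ rm) := n :+ rm :+ (j :+ k₁ :+ k :+ β)) refl
          e₃ : ∀ ε j k₁ k β → ε + (j + k₁ + k + β) ≡ j + k₁ + k + ε + β
          e₃ = solve 5 (λ ε j k₁ k β → ε :+ (j :+ k₁ :+ k :+ β) := j :+ k₁ :+ k :+ ε :+ β) refl

  weight-≤ : weight roots ≤ 2 * nV G + 2 * ε + count U
  weight-≤ = +-mono-≤ (+-mono-≤ (ℕₚ.*-monoʳ-≤ 2 order-sum) (ℕₚ.*-monoʳ-≤ 2 (≤-trans (count-share-sum src σ) (≤-reflexive σ-count)))) (count-share-sum src U)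

  β-general : ∀ {e} → σ e ≡ true → β + 6 ≤ 2 * nV G + 2 * ε + count U
  β-general {e} s = let (r , r∈ , c) = rootOf (src e) in ≤-trans (βs+6≤ roots id r∈ (count-pos (λ e → σ e ∧ comp r (src e)) {e} (∧-intro s c))) weight-≤

  module Connectivity (tec : TwoEdgeConnected G) (ε-even : ε % 2 ≡ 0) where
    no-separator : ∀ {A u} → Only A u → ⊥
    no-separator {A} {u} o = only-≢ o (joins-self u) (only-walk o (proj₂ tec u (src u) (tgt u)) λ h → edges-P (proj₂ tec u (src u) (tgt u)) h refl)

    everything : ∀ r x → comp r x ≡ true
    everything r x = trans (sym (xor-false (trans (sym (par-cut (comp r) w)) (par-false (edges w) λ e _ → comp-closed r e)))) (comp-self r)
      where
        w : Walk G (λ _ → E) r x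
        w = proj₁ tec r x

    all-plain : ∀ r → isPlain (kind r) ≡ true
    all-plain r = by (kind r)
      where
        σ-even : ⨁ σ ≡ false
        σ-even with ⨁ σ in q
        ... | false = refl
        ... | true with trans (sym (cong bN q)) (trans (sym (count-%2 σ)) (trans (cong (_% 2) σ-count) ε-even))
        ...   | ()
        by : (k : Kind r) → isPlain k ≡ true
        by (plain _ _) = refl
        by (split o _) = ⊥-elim (no-separator o)
        by (odd _ p _ _ _) = absurd (trans (⨁-cong λ e → sym (trans (cong (σ e ∧_) (everything r (src e))) (∧-identityʳ (σ e)))) p) σ-even

    β-connected : β + 1 ≤ nV G
    β-connected = ≤-trans (ℕₚ.+-monoʳ-≤ β (nonempty (proj₁ (proj₂ (rootOf v₀))))) (≤-trans (βs-plain all-plain roots id) order-sum)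
      where
        nonempty : ∀ {r} {l : List V} → r ∈ l → 1 ≤ length l
        nonempty (here _) = s≤s z≤n
        nonempty (there _) = s≤s z≤n

-- With p the number of positive and ε of negative edges, c the base cover, b the joining cost and T the total.
private
  module Arithmetic where
    open +-*-Solver

    triple : ∀ c ε b → 3 * (c + ε + b) ≡ 3 * c + 3 * ε + 3 * b
    triple = solve 3 (λ c ε b → con 3 :* (c :+ ε :+ b) := con 3 :* c :+ con 3 :* ε :+ con 3 :* b) refl

    -- The constant 18 is three times the saving of 6. The terms in u cancel: the room left by the
    -- base cover equals the charge for the separators in the joining cost.
    general : ∀ T c ε b u R k K V → T ≤ c + ε + b → 3 * c + 3 * u + k ≤ R → b + 6 ≤ 2 * V + 2 * ε + u → K ≡ k + 18 → 3 * T + K ≤ R + 3 * ε + 3 * (2 * V + 2 * ε)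
    general T c ε b u R k K V t r h refl = ℕₚ.+-cancelʳ-≤ (3 * u) _ _ (≤-trans (ℕₚ.+-monoˡ-≤ (3 * u) (ℕₚ.+-monoˡ-≤ (k + 18) (≤-trans (ℕₚ.*-monoʳ-≤ 3 t) (≤-reflexive (triple c ε b)))))
        (≤-trans (≤-reflexive (e₁ (3 * c) (3 * ε) b (3 * u) k)) (≤-trans (+-mono-≤ (ℕₚ.+-monoˡ-≤ (3 * ε) r) (ℕₚ.*-monoʳ-≤ 3 h)) (≤-reflexive (e₂ (R + 3 * ε) (2 * V + 2 * ε) u)))))
      where
        e₁ : ∀ c ε b u k → c + ε + 3 * b + (k + 18) + u ≡ c + u + k + ε + 3 * (b + 6)
        e₁ = solve 5 (λ c ε b u k → c :+ ε :+ con 3 :* b :+ (k :+ con 18) :+ u := c :+ u :+ k :+ ε :+ con 3 :* (b :+ con 6)) refl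
        e₂ : ∀ x y u → x + 3 * (y + u) ≡ x + 3 * y + 3 * u
        e₂ = solve 3 (λ x y u → x :+ con 3 :* (y :+ u) := x :+ con 3 :* y :+ con 3 :* u) refl

    -- The constant 9 is 3 from the saving of one vertex in the joining cost and 6 from ε ≥ 2.
    connected : ∀ T c ε b R k K V → T ≤ c + ε + b → 3 * c + k ≤ R → b + 1 ≤ V → 2 ≤ ε → K ≡ k + 9 → 3 * T + K ≤ R + 3 * ε + 3 * V + 3 * ε
    connected T c ε b R k K V t r h e refl = ≤-trans (ℕₚ.+-monoˡ-≤ (k + 9) (≤-trans (ℕₚ.*-monoʳ-≤ 3 t) (≤-reflexive (triple c ε b))))
        (≤-trans (≤-reflexive (e₁ (3 * c) (3 * ε) b k)) (+-mono-≤ (+-mono-≤ (ℕₚ.+-monoˡ-≤ (3 * ε) r) (ℕₚ.*-monoʳ-≤ 3 h)) (ℕₚ.*-monoʳ-≤ 3 e)))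
      where
        e₁ : ∀ c ε b k → c + ε + 3 * b + (k + 9) ≡ c + k + ε + 3 * (b + 1) + 6
        e₁ = solve 4 (λ c ε b k → c :+ ε :+ con 3 :* b :+ (k :+ con 9) := c :+ k :+ ε :+ con 3 :* (b :+ con 1) :+ con 6) refl

    target₁ : ∀ p ε V → 5 * p + 3 * V + 3 * ε + 3 * (2 * V + 2 * ε) ≡ 3 * (p + ε) + 9 * V + (2 * (p + ε) + 4 * ε)
    target₁ = solve 3 (λ p ε V → con 5 :* p :+ con 3 :* V :+ con 3 :* ε :+ con 3 :* (con 2 :* V :+ con 2 :* ε) := con 3 :* (p :+ ε) :+ con 9 :* V :+ (con 2 :* (p :+ ε) :+ con 4 :* ε)) refl

    target₂ : ∀ p ε V → 3 * p + 6 * V + 3 * ε + 3 * (2 * V + 2 * ε) ≡ 3 * (p + ε) + 9 * V + (3 * V + 6 * ε)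
    target₂ = solve 3 (λ p ε V → con 3 :* p :+ con 6 :* V :+ con 3 :* ε :+ con 3 :* (con 2 :* V :+ con 2 :* ε) := con 3 :* (p :+ ε) :+ con 9 :* V :+ (con 3 :* V :+ con 6 :* ε)) refl

    target₃ : ∀ p ε V → 5 * p + 3 * V + 3 * ε + 3 * V + 3 * ε ≡ 3 * (p + ε) + 6 * V + (2 * (p + ε) + ε)
    target₃ = solve 3 (λ p ε V → con 5 :* p :+ con 3 :* V :+ con 3 :* ε :+ con 3 :* V :+ con 3 :* ε := con 3 :* (p :+ ε) :+ con 6 :* V :+ (con 2 :* (p :+ ε) :+ ε)) refl

    target₄ : ∀ p ε V → 3 * p + 6 * V + 3 * ε + 3 * V + 3 * ε ≡ 3 * (p + ε) + 6 * V + (3 * V + 3 * ε)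
    target₄ = solve 3 (λ p ε V → con 3 :* p :+ con 6 :* V :+ con 3 :* ε :+ con 3 :* V :+ con 3 :* ε := con 3 :* (p :+ ε) :+ con 6 :* V :+ (con 3 :* V :+ con 3 :* ε)) refl

-- The four inequalities, multiplied by three, and the passage to integers.

module Bounds (G : SignedGraph) {ε : ℕ} (S : Setup G ε) (sb : SBridgeless G) {e : Fin (nE G)} (σe : Setup.σ S e ≡ true) where
  open Setup S
  open Components G S using (U)
  open Assembly G S sb (proj₁ (ends G e)) public
  open CompCovers G S sb (proj₁ (ends G e)) using (base)
  open Base.BaseCover base
  open Arithmetic

  p : ℕ
  p = count pos

  edges-total : p + ε ≡ nE G
  edges-total = trans (cong (p +_) (sym σ-count)) (trans (sym (count-∨-disjoint pos σ λ _ → not-true)) (trans (count-cong (λ f → tab (σ f))) (count-true (nE G))))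
    where
      tab : ∀ b → not b ∨ b ≡ true
      tab true = refl
      tab false = refl
      count-true : ∀ n → count {n} (λ _ → true) ≡ n
      count-true zero = refl
      count-true (suc n) = cong suc (count-true n)

  general₁ : 3 * coverLength scCover + 21 ≤ 3 * nE G + 9 * nV G + (2 * nE G + 4 * ε)
  general₁ = ≤-trans (general (coverLength scCover) cost ε β (count U) (5 * p + 3 * nV G) 3 21 (nV G) total-length bound₂ (β-general σe) refl)
    (≤-reflexive (trans (target₁ p ε (nV G)) (cong (λ m → 3 * m + 9 * nV G + (2 * m + 4 * ε)) edges-total)))

  general₂ : 3 * coverLength scCover + 24 ≤ 3 * nE G + 9 * nV G + (3 * nV G + 6 * ε)
  general₂ = ≤-trans (general (coverLength scCover) cost ε β (count U) (3 * p + 6 * nV G) 6 24 (nV G) total-length bound₁ (β-general σe) refl)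
    (≤-reflexive (trans (target₂ p ε (nV G)) (cong (λ m → 3 * m + 9 * nV G + (3 * nV G + 6 * ε)) edges-total)))

  module _ (tec : TwoEdgeConnected G) (ε-even : ε % 2 ≡ 0) where
    open Connectivity tec ε-even

    two≤ε : 2 ≤ ε
    two≤ε = from ε (≤-trans (count-pos σ σe) (≤-reflexive σ-count)) ε-even
      where
        from : ∀ m → 1 ≤ m → m % 2 ≡ 0 → 2 ≤ m
        from (suc (suc m)) _ _ = s≤s (s≤s z≤n)

    drop-U : ∀ {k R} → 3 * cost + 3 * count U + k ≤ R → 3 * cost + k ≤ R
    drop-U {k} h = ≤-trans (ℕₚ.+-monoˡ-≤ k (m≤m+n (3 * cost) (3 * count U))) h

    connected₁ : 3 * coverLength scCover + 12 ≤ 3 * nE G + 6 * nV G + (2 * nE G + ε)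
    connected₁ = ≤-trans (connected (coverLength scCover) cost ε β (5 * p + 3 * nV G) 3 12 (nV G) total-length (drop-U bound₂) β-connected two≤ε refl)
      (≤-reflexive (trans (target₃ p ε (nV G)) (cong (λ m → 3 * m + 6 * nV G + (2 * m + ε)) edges-total)))

    connected₂ : 3 * coverLength scCover + 15 ≤ 3 * nE G + 6 * nV G + (3 * nV G + 3 * ε)
    connected₂ = ≤-trans (connected (coverLength scCover) cost ε β (3 * p + 6 * nV G) 6 15 (nV G) total-length (drop-U bound₁) β-connected two≤ε refl)
      (≤-reflexive (trans (target₄ p ε (nV G)) (cong (λ m → 3 * m + 6 * nV G + (3 * nV G + 3 * ε)) edges-total)))

open import Data.Integer using (ℤ; +_; _-_; _⊓_)
open import Data.Integer as ℤ using ()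
open import Data.Integer.Properties as ℤₚ using ()

-- Up to here every negative constant stands on the left side as an addition; it moves to the right
-- only in the integers, where the terms of the minimum may be negative.
ℕ-to-ℤ : ∀ T x y c → 3 * T + c ≤ x + y → (+ 3) ℤ.* (+ T) ℤ.≤ + x ℤ.+ (+ y - + c)
ℕ-to-ℤ T x y c h = subst₂ ℤ._≤_ left right (ℤₚ.+-monoˡ-≤ (ℤ.- (+ c)) (ℤ.+≤+ h))
  where
    left : + (3 * T + c) ℤ.+ ℤ.- (+ c) ≡ (+ 3) ℤ.* (+ T)
    left = trans (cong (ℤ._+ ℤ.- (+ c)) (ℤₚ.pos-+ (3 * T) c)) (trans (ℤₚ.+-assoc (+ (3 * T)) (+ c) (ℤ.- (+ c))) (trans (cong (λ z → (+ (3 * T)) ℤ.+ z) (ℤₚ.+-inverseʳ (+ c))) (trans (ℤₚ.+-identityʳ (+ (3 * T))) (ℤₚ.pos-* 3 T))))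
    right : + (x + y) ℤ.+ ℤ.- (+ c) ≡ + x ℤ.+ (+ y - + c)
    right = trans (cong (ℤ._+ ℤ.- (+ c)) (ℤₚ.pos-+ x y)) (ℤₚ.+-assoc (+ x) (+ y) (ℤ.- (+ c)))

≤-+-⊓ : ∀ {i j k l} → i ℤ.≤ j ℤ.+ k → i ℤ.≤ j ℤ.+ l → i ℤ.≤ j ℤ.+ (k ⊓ l)
≤-+-⊓ {i} {j} {k} {l} p q with ℤₚ.⊓-sel k l
... | inj₁ r = subst (λ z → i ℤ.≤ j ℤ.+ z) (sym r) p
... | inj₂ r = subst (λ z → i ℤ.≤ j ℤ.+ z) (sym r) q

theorem1p2 : (G : SignedGraph) (ε : ℕ) → IsNegativeness G ε → 0 < ε → SBridgeless G →
    (Σ (SCCover G) λ c →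
    (+ 3) ℤ.* (+ coverLength c) ℤ.≤
    + (3 ℕ.* nE G ℕ.+ 9 ℕ.* nV G) ℤ.+
    ((+ (2 ℕ.* nE G ℕ.+ 4 ℕ.* ε) - + 21) ⊓ (+ (3 ℕ.* nV G ℕ.+ 6 ℕ.* ε) - + 24)))
    ×
    (TwoEdgeConnected G → ε % 2 ≡ 0 →
    Σ (SCCover G) λ c →
    (+ 3) ℤ.* (+ coverLength c) ℤ.≤
    + (3 ℕ.* nE G ℕ.+ 6 ℕ.* nV G) ℤ.+
    ((+ (2 ℕ.* nE G ℕ.+ ε) - + 12) ⊓ (+ (3 ℕ.* nV G ℕ.+ 3 ℕ.* ε) - + 15)))
theorem1p2 G ε isNeg ε>0 sb = from (search σ)
  where
    S : Setup G ε
    S = setup G isNeg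
    open Setup S
    none-absurd : (∀ e → σ e ≡ false) → ⊥
    none-absurd none = ℕₚ.<-irrefl (trans (sym (trans (count-cong none) (count-false {nE G}))) σ-count) ε>0
    from : (∃ λ e → σ e ≡ true) ⊎ (∀ e → σ e ≡ false) → _
    from (inj₂ none) = ⊥-elim (none-absurd none)
    from (inj₁ (e , σe)) = (scCover , ≤-+-⊓ {j = + (3 * nE G + 9 * nV G)} {k = + (2 * nE G + 4 * ε) - + 21} {+ (3 * nV G + 6 * ε) - + 24}
          (ℕ-to-ℤ T (3 * nE G + 9 * nV G) (2 * nE G + 4 * ε) 21 general₁) (ℕ-to-ℤ T (3 * nE G + 9 * nV G) (3 * nV G + 6 * ε) 24 general₂)) ,
        λ tec even → scCover , ≤-+-⊓ {j = + (3 * nE G + 6 * nV G)} {k = + (2 * nE G + ε) - + 12} {+ (3 * nV G + 3 * ε) - + 15}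
          (ℕ-to-ℤ T (3 * nE G + 6 * nV G) (2 * nE G + ε) 12 (connected₁ tec even)) (ℕ-to-ℤ T (3 * nE G + 6 * nV G) (3 * nV G + 3 * ε) 15 (connected₂ tec even))
      where
        open Bounds G S sb σe
        T : ℕ
        T = coverLength scCover
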